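{- Let $G_1$ be a $(q_1,q_2)$-semi-regular bipartite graph with bipartition $V_1,V_2$, $|V_1|=n_1\le n_2=|V_2|$; let $G_2$ be a $(q_3,q_4)$-semi-regular bipartite graph with bipartition $V_3,V_4$, $|V_3|=n_3\le n_4=|V_4|$; and let $G_2'$ be a $(q_3',q_4')$-semi-regular bipartite graph with bipartition $V_3',V_4'$, $|V_3'|=n_3'\le n_4'=|V_4'|$. Let $G=G_1\vee G_2$ and $G'=G_1\vee G_2'$. Then $Z_G(u)=Z_{G'}(u)$ if and only if $spec(G)=spec(G')$.
   Context: A bipartite graph with bipartition $(V_1,V_2)$ is $(q_1,q_2)$-semi-regular if every vertex of $V_1$ has degree $q_1$ and every vertex of $V_2$ has degree $q_2$ ($q_1,q_2\ge1$). The join $G_1\vee G_2$ has vertex set $V(G_1)\sqcup V(G_2)$ and edge set $E(G_1)\cup E(G_2)\cup\{uv:u\in V(G_1),v\in V(G_2)\}$. $spec(G)$ is the multiset of eigenvalues of the adjacency matrix of $G$. For a finite connected graph $G$ with no degree-1 vertices, the Ihara zeta function is $Z_G(u)=\prod_{[C]}(1-u^{|C|})^{ -1}$ for $|u|$ small, the product over equivalence classes of primitive, backtrackless, tailless closed paths $C$ of length $|C|$; equivalently (Bass) $Z_G(u)^{ -1}=(1-u^2)^{m-n}\det(I_n-uA(G)+u^2(D(G)-I_n))$, with $n,m$ the numbers of vertices and edges, $A(G)$ the adjacency matrix and $D(G)$ the degree matrix. -}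

module Defs where

open import Level using (Level; _⊔_)
open import Algebra.Bundles using (CommutativeRing; Semiring)
open import Algebra.Apartness.Bundles using (HeytingField)
import Algebra.Apartness.Bundles as Apartness
import Algebra.Definitions.RawSemiring as RawSemiringDefs
import Data.List.Relation.Binary.Permutation.Setoid as Permutation
open import Data.Bool.Base using (Bool; true; false; T; if_then_else_)
open import Data.Bool.Properties using (T?)
open import Data.Fin.Base using (Fin; zero; suc; toℕ; punchIn; splitAt)
import Data.Fin.Properties as Fin
open import Data.Fin.Subset using (Subset; _∈_; _∉_; ∣_∣)
open import Data.List.Base as List
  using (List; []; _∷_; [_]; _++_; map; concat; concatMap; replicate; foldr;
         filter; deduplicate; allFin; upTo; cartesianProduct;
         cartesianProductWith; head; last; length; take; drop)
import Data.List.Properties as List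
open import Data.List.Relation.Unary.Any using (Any; any?)
open import Data.List.Relation.Unary.Linked using (Linked; linked?)
open import Data.Maybe.Relation.Binary.Connected using (Connected; connected?)
open import Data.Nat.Base as ℕ using (ℕ; zero; suc; _≤_; _<_; _∸_; z≤n; s≤s)
open import Data.Nat.Divisibility using (_∣?_)
import Data.Nat.ListAction as ℕList
import Data.Nat.Properties as ℕ
open import Data.Product.Base
  using (_×_; _,_; proj₁; proj₂; swap; ∃-syntax)
import Data.Product.Properties as Product
open import Data.Sum.Base using (_⊎_; inj₁; inj₂)
open import Data.Vec.Base using (tabulate)
open import Function.Base using (_∘_)
open import Relation.Binary.Definitions using (DecidableEquality)
import Relation.Binary.Definitions as B
open import Relation.Binary.PropositionalEquality
  using (_≡_; _≢_; refl; sym; trans; cong)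
open import Relation.Nullary using (Dec; yes; no; ¬_; does)
open import Relation.Nullary.Decidable using (¬?; _×-dec_; map′)
import Relation.Unary as U

-- Finite simple graphs.  An empty vertex set is excluded: joining with an empty
-- graph could produce a disconnected graph or one with vertices of degree 1, for
-- which the zeta function is not considered.
record Graph : Set where
  field
    order       : ℕ
    nonempty    : 0 < order
    adj         : Fin order → Fin order → Bool
    symmetric   : ∀ u v → adj u v ≡ adj v u
    irreflexive : ∀ v → adj v v ≡ false

  Vertex : Set
  Vertex = Fin order

  neighbours : Vertex → Subset order
  neighbours v = tabulate (adj v)

  degree : Vertex → ℕ
  degree v = ∣ neighbours v ∣

open Graph public using (order)

record IsBipartition (G : Graph) (V₁ V₂ : Subset (order G)) : Set where
  open Graph G using (Vertex; adj)
  field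
    covers   : ∀ v → v ∈ V₁ ⊎ v ∈ V₂
    disjoint : ∀ v → v ∈ V₁ → v ∉ V₂
    crossing : ∀ u v → T (adj u v) →
               (u ∈ V₁ × v ∈ V₂) ⊎ (u ∈ V₂ × v ∈ V₁)

record IsSemiRegular (G : Graph) (V₁ V₂ : Subset (order G))
                     (q₁ q₂ : ℕ) : Set where
  open Graph G using (degree)
  field
    bipartition : IsBipartition G V₁ V₂
    degree₁     : ∀ v → v ∈ V₁ → degree v ≡ q₁
    degree₂     : ∀ v → v ∈ V₂ → degree v ≡ q₂
    q₁≥1        : 1 ≤ q₁
    q₂≥1        : 1 ≤ q₂

module _ (G₁ G₂ : Graph) where
  private
    module G₁ = Graph G₁
    module G₂ = Graph G₂

  ⊎-adj : G₁.Vertex ⊎ G₂.Vertex → G₁.Vertex ⊎ G₂.Vertex → Bool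
  ⊎-adj (inj₁ u) (inj₁ v) = G₁.adj u v
  ⊎-adj (inj₁ u) (inj₂ v) = true
  ⊎-adj (inj₂ u) (inj₁ v) = true
  ⊎-adj (inj₂ u) (inj₂ v) = G₂.adj u v

  ⊎-adj-symmetric : ∀ x y → ⊎-adj x y ≡ ⊎-adj y x
  ⊎-adj-symmetric (inj₁ u) (inj₁ v) = G₁.symmetric u v
  ⊎-adj-symmetric (inj₁ u) (inj₂ v) = refl
  ⊎-adj-symmetric (inj₂ u) (inj₁ v) = refl
  ⊎-adj-symmetric (inj₂ u) (inj₂ v) = G₂.symmetric u v

  ⊎-adj-irreflexive : ∀ x → ⊎-adj x x ≡ false
  ⊎-adj-irreflexive (inj₁ v) = G₁.irreflexive v
  ⊎-adj-irreflexive (inj₂ v) = G₂.irreflexive v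

infixr 6 _∨_

-- The join; Fin (m + n) stands for the disjoint union Fin m ⊎ Fin n.
_∨_ : Graph → Graph → Graph
G₁ ∨ G₂ = record
  { order       = order G₁ ℕ.+ order G₂
  ; nonempty    = ℕ.≤-trans (Graph.nonempty G₁) (ℕ.m≤m+n _ _)
  ; adj         = λ u v → ⊎-adj G₁ G₂ (split u) (split v)
  ; symmetric   = λ u v → ⊎-adj-symmetric G₁ G₂ (split u) (split v)
  ; irreflexive = λ v → ⊎-adj-irreflexive G₁ G₂ (split v)
  }
  where split = splitAt (order G₁)

module Matrices {c ℓ} (R : CommutativeRing c ℓ) where
  open CommutativeRing R using (Carrier; _*_; _-_; -_; 0#; 1#; semiring)
  open RawSemiringDefs (Semiring.rawSemiring semiring) using (sum; _^_)

  Matrix : ℕ → Set c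
  Matrix n = Fin n → Fin n → Carrier

  -- Laplace expansion along the first row.
  det : ∀ {n} → Matrix n → Carrier
  det {zero}  M = 1#
  det {suc n} M = sum λ j →
    (- 1#) ^ toℕ j * M zero j * det (λ i k → M (suc i) (punchIn j k))

  identity : ∀ {n} → Matrix n
  identity i j = if does (i Fin.≟ j) then 1# else 0#

  charPoly : ∀ {n} → Matrix n → Carrier → Carrier
  charPoly M x = det (λ i j → x * identity i j - M i j)

  adjacency : (G : Graph) → Matrix (order G)
  adjacency G u v = if Graph.adj G u v then 1# else 0#

module Spectra {c ℓ₁ ℓ₂} (K : HeytingField c ℓ₁ ℓ₂) where
  open HeytingField K using (Carrier; _≈_; _*_; _-_; 0#; 1#; heytingCommutativeRing)
  private
    R : CommutativeRing c ℓ₁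
    R = Apartness.HeytingCommutativeRing.commutativeRing heytingCommutativeRing

  open Matrices R public
  open RawSemiringDefs (Semiring.rawSemiring (CommutativeRing.semiring R)) using () renaming (_×_ to _·_)
  open Permutation (CommutativeRing.setoid R) public using (_↭_)

  CharacteristicZero : Set ℓ₁
  CharacteristicZero = ∀ n → n · 1# ≈ 0# → n ≡ 0

  -- λs lists the eigenvalues of A(G) in K with multiplicity, as the roots of its
  -- characteristic polynomial.  Polynomials are compared as functions on K; for K
  -- of characteristic zero, hence infinite, this is the same as comparing
  -- coefficients.  Lists are compared as multisets by _↭_.
  IsSpectrum : Graph → List Carrier → Set (c ⊔ ℓ₁)
  IsSpectrum G λs =
    ∀ x → charPoly (adjacency G) x ≈ foldr (λ α p → (x - α) * p) 1# λs

power : ∀ {a} {A : Set a} → ℕ → List A → List A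
power r xs = concat (replicate r xs)

words : ∀ {a} {A : Set a} → List A → ℕ → List (List A)
words as zero    = [ [] ]
words as (suc k) = cartesianProductWith _∷_ as (words as k)

Primitive : ∀ {a} {A : Set a} → List A → Set a
Primitive C = ∀ D r → 2 ≤ r → C ≢ power r D

rotations : ∀ {a} {A : Set a} → List A → List (List A)
rotations C = map (λ i → drop i C ++ take i C) (upTo (length C))

infix 4 _∼_

_∼_ : ∀ {a} {A : Set a} → List A → List A → Set a
C ∼ C′ = Any (C′ ≡_) (rotations C)

module _ {a} {A : Set a} (_≟_ : DecidableEquality A) where
  private
    _≟*_ : DecidableEquality (List A)
    _≟*_ = List.≡-dec _≟_

    -- If C = D^(2+r) then D is a prefix of C and r ≤ length C.
    ProperPower : List A → Set a
    ProperPower C = ∃[ d ] d < suc (length C) ×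
                    (∃[ r ] r < suc (length C) × C ≡ power (2 ℕ.+ r) (take d C))

    properPower? : U.Decidable ProperPower
    properPower? C = ℕ.anyUpTo? (λ d → ℕ.anyUpTo? (λ r → C ≟* _) _) _

    take-length : ∀ (xs ys : List A) → take (length xs) (xs ++ ys) ≡ xs
    take-length []       ys = refl
    take-length (x ∷ xs) ys = cong (x ∷_) (take-length xs ys)

    power-[] : ∀ r → power r [] ≡ ([] {A = A})
    power-[] zero    = refl
    power-[] (suc r) = power-[] r

    r≤length : ∀ r x (xs : List A) → r ≤ length (power r (x ∷ xs))
    r≤length zero    x xs = z≤n
    r≤length (suc r) x xs = s≤s (ℕ.≤-trans (r≤length r x xs)
      (ℕ.≤-trans (ℕ.m≤n+m _ (length xs)) (ℕ.≤-reflexive (sym (List.length-++ xs)))))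

    bounded : ∀ C D r → C ≡ power (2 ℕ.+ r) D → ProperPower C
    bounded C [] r C≡ with refl ← trans C≡ (power-[] r) =
      0 , s≤s z≤n , 0 , s≤s z≤n , refl
    bounded C D@(x ∷ xs) r refl =
      length D ,
      s≤s (ℕ.≤-trans (ℕ.m≤m+n _ _) (ℕ.≤-reflexive (sym (List.length-++ D)))) ,
      r ,
      s≤s (ℕ.≤-trans (ℕ.m≤n+m r 2) (r≤length (2 ℕ.+ r) x xs)) ,
      cong (power (2 ℕ.+ r)) (sym (take-length D (power (suc r) D)))

  primitive? : U.Decidable (Primitive {A = A})
  primitive? C = map′
    (λ { ¬p D _ (s≤s (s≤s {n = r} _)) C≡ → ¬p (bounded C D r C≡) })
    (λ { prim (d , _ , r , _ , C≡) → prim (take d C) (2 ℕ.+ r) (s≤s (s≤s z≤n)) C≡ })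
    (¬? (properPower? C))

  ∼? : B.Decidable (_∼_ {A = A})
  ∼? C C′ = any? (C′ ≟*_) (rotations C)

module Cycles (G : Graph) where
  open Graph G using (Vertex; adj)

  Arc : Set
  Arc = Vertex × Vertex

  origin terminus : Arc → Vertex
  origin   = proj₁
  terminus = proj₂

  inverse : Arc → Arc
  inverse = swap

  _≟_ : DecidableEquality Arc
  _≟_ = Product.≡-dec Fin._≟_ Fin._≟_

  arcs : List Arc
  arcs = filter (λ (u , v) → T? (adj u v))
                (cartesianProduct (allFin (order G)) (allFin (order G)))

  Composable NotInverse : Arc → Arc → Set
  Composable e f = terminus e ≡ origin f
  NotInverse e f = f ≢ inverse e

  -- Conditions on a sequence of arcs; the Connected clauses relate the last
  -- arc to the first.
  ClosedPath Backtrackless Tailless : List Arc → Set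
  ClosedPath C    = Linked Composable C × Connected Composable (last C) (head C)
  Backtrackless C = Linked NotInverse C
  Tailless C      = Connected NotInverse (last C) (head C)

  Prime : List Arc → Set
  Prime C = ClosedPath C × Backtrackless C × Tailless C × Primitive C

  composable? : B.Decidable Composable
  composable? e f = terminus e Fin.≟ origin f

  notInverse? : B.Decidable NotInverse
  notInverse? e f = ¬? (f ≟ inverse e)

  prime? : U.Decidable Prime
  prime? C = (linked? composable? C ×-dec connected? composable? (last C) (head C))
       ×-dec linked? notInverse? C
       ×-dec connected? notInverse? (last C) (head C)
       ×-dec primitive? _≟_ C

  -- One representative of each class of primes of length k under cyclic
  -- rotation.
  primeClasses : ℕ → List (List Arc)
  primeClasses k = deduplicate (∼? _≟_) (filter prime? (words arcs k))

-- Formal power series in u, given by their coefficients.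
Series : Set
Series = ℕ → ℕ

one : Series
one zero    = 1
one (suc n) = 0

infixl 7 _⊛_

_⊛_ : Series → Series → Series
(f ⊛ g) n = ℕList.sum (map (λ i → f i ℕ.* g (n ∸ i)) (upTo (suc n)))

-- (1 - u^k)⁻¹ = 1 + u^k + u^(2k) + ⋯, for k ≥ 1.
geometric : ℕ → Series
geometric k n = if does (k ∣? n) then 1 else 0

-- The part of the Euler product coming from primes of length 1, …, m.
partialZeta : Graph → ℕ → Series
partialZeta G m =
  foldr (λ C Z → geometric (length C) ⊛ Z) one
        (concatMap (λ i → primeClasses (suc i)) (upTo m))
  where open Cycles G

-- The Ihara zeta function as a formal power series: primes longer than n do not
-- contribute to the coefficient of u^n.  Holomorphic functions near 0 agree for
-- small |u| exactly when these coefficients do.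
zeta : Graph → Series
zeta G n = partialZeta G n n

{-# OPTIONS --safe #-}

-- Let A and D be the adjacency and degree matrices of the join G, and n, m its
-- numbers of vertices and edges.  Counting closed backtrackless tailless walks,
-- Nₖ = ∑_{d∣k} d π(d), turns the zeta function into the numbers Nₖ, and Bass's
-- formula (via Jacobi's formula for the derivative of a determinant) turns these
-- into f(u) = (1 − u²)^(m−n) det (I − uA + u²(D − I)).  Both f and the reversed
-- characteristic polynomial det (I − uA) are governed by determinants
--   J(u) = det (I + u²P − uA),  P diagonal and constant on V₁, V₂, V₃, V₄,
-- with P = D − I and P = 0 respectively.  As the blocks joining G₁ to G₂ have rank
-- one, J = (F₁F₂ / Δ) (Y − 2u³X), where Fᵢ is the determinant J of Gᵢ alone, Δ, X, Y
-- are explicit polynomials and all of these are even in u because G₁ and G₂ are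
-- bipartite.  Hence J determines X / Y, the quotient of its odd and even parts, in
-- which the unknown Fᵢ no longer occur; together with the number of vertices
-- (characteristic polynomial) or of edges (the degree of f is 2m) this gives
-- |V₃|, |V₄|, q₃, q₄, and then F₂.  Finally F₂ is, up to explicit factors, the value
-- of det ((y , −B) , (−Bᵀ , 1)), B the biadjacency matrix of G₂, at
-- y = (1 + u²p₃)(1 + u²p₄) / u², so F₂ for one P determines F₂ for every other P.

module Submission where

open import Level using (_⊔_)
open import Algebra.Apartness.Bundles using (HeytingField)
import Algebra.Apartness.Bundles as Apartness
open import Algebra.Bundles using (CommutativeRing; Semiring)
import Algebra.Construct.Pointwise as Pointwise
import Algebra.Definitions.RawSemiring as RawSemiringDefs
import Algebra.Properties.CommutativeMonoid.Sum as MonoidSum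
import Algebra.Properties.Group
import Algebra.Properties.Semiring.Sum as SemiringSum
open import Algebra.Solver.Ring.AlmostCommutativeRing
  using (_-Raw-AlmostCommutative⟶_; fromCommutativeRing)
open import Data.Bool.Base as Bool using (Bool; true; false; not; if_then_else_)
open import Data.Bool.Properties using (T?)
open import Data.Empty using (⊥; ⊥-elim)
open import Data.Fin.Base using (Fin; zero; suc; toℕ; fromℕ<; punchIn; splitAt; _↑ˡ_; _↑ʳ_)
import Data.Fin.Properties as Fin
open import Data.Fin.Subset as Subset using (Subset; ∣_∣)
import Data.Fin.Subset.Properties as Subset
open import Data.Integer.Base as ℤ using (ℤ; +_; -[1+_])
import Data.Integer.Properties as ℤ
open import Data.List.Base as List
  using (List; []; _∷_; [_]; _++_; take; drop; length; map; concat; concatMap; filter;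
         deduplicate; upTo; applyUpTo; cartesianProductWith; cartesianProduct; allFin;
         replicate; foldr)
open import Data.List.Membership.Propositional using (_∈_)
import Data.List.Membership.Propositional.Properties as ∈
open import Data.List.Membership.Propositional.Properties.WithK using (unique∧set⇒bag)
import Data.List.Properties as List
open import Data.List.Relation.Binary.BagAndSetEquality using (∼bag⇒↭)
open import Data.List.Relation.Binary.Disjoint.Propositional using (Disjoint)
import Data.List.Relation.Binary.Permutation.Homogeneous as Homogeneous
import Data.List.Relation.Binary.Permutation.Propositional.Properties as ↭
import Data.List.Relation.Binary.Permutation.Setoid as Permutation
import Data.List.Relation.Binary.Permutation.Setoid.Properties as PermutationProperties
import Data.List.Relation.Binary.Pointwise as Pointwiseᴸ
open import Data.List.Relation.Unary.All as All using (All; []; _∷_)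
import Data.List.Relation.Unary.All.Properties as All
open import Data.List.Relation.Unary.AllPairs as AllPairs using (AllPairs; []; _∷_)
import Data.List.Relation.Unary.AllPairs.Properties as AllPairs
open import Data.List.Relation.Unary.Any as Any using (here; there)
open import Data.List.Relation.Unary.Linked using (Linked; [-]; _∷_)
open import Data.List.Relation.Unary.Unique.Propositional using (Unique)
import Data.List.Relation.Unary.Unique.Propositional.Properties as Unique
open import Data.Maybe.Base as Maybe using (Maybe; just; nothing)
open import Data.Maybe.Relation.Binary.Connected as Connected using (Connected)
open import Data.Nat.Base as ℕ using (ℕ; zero; suc; _≤_; _<_; z≤n; s≤s)
open import Data.Nat.Divisibility as ℕ using (_∣_; _∣?_; divides)
import Data.Nat.DivMod as ℕ
open import Data.Nat.GCD as ℕ using (gcd; module Bézout)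
open import Data.Nat.Induction using (<-rec)
import Data.Nat.ListAction as ℕList
import Data.Nat.Properties as ℕ
open import Data.Product.Base using (_×_; _,_; proj₁; proj₂; ∃-syntax)
import Data.Sign.Base as Sign
open import Data.Sum.Base using (inj₁; inj₂; [_,_]′)
open import Data.Vec.Base as Vec using (Vec; []; _∷_)
import Data.Vec.Functional as Vector
import Data.Vec.Functional.Properties as Vector
import Data.Vec.Properties as Vec
open import Function.Base using (_∘_; id)
open import Function.Bundles using (_⇔_; mk⇔; Equivalence)
open import Relation.Binary.Definitions using (Decidable; DecidableEquality)
open import Relation.Binary.PropositionalEquality as ≡ using (_≡_; _≢_; _≗_)
open import Relation.Nullary using (Dec; yes; no; ¬_; does)
open import Relation.Nullary.Decidable using (dec-true; dec-false; _×-dec_; ¬?)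
import Relation.Unary as U
open import Defs

-- Two obstacles shape the proof. The zeta function fixes f but neither of its two factors: m - n is
-- unknown, and the entries of D - I involve the unknown order of G₂. So integers must be extracted
-- before anything can be cancelled: the degree of f and the constant term τ of X are two linear
-- equations for the order and the number of edges of G₂. After that the u² coefficient of X Y′ = X′
-- Y gives only (q₃q₄ - q₃′q₄′) · e · (kν - τ) = 0, where k and ν are the orders of G₁ and G₂ and e
-- is the number of edges of G₂. The last factor can vanish, but only if G₂ is a perfect matching,
-- which ν and e alone then reveal. Otherwise |V₃| + |V₄| and |V₃| |V₄| are known, and |V₃| ≤ |V₄|
-- tells the two apart. Quotients such as F₁F₂ / Δ are never formed: identities are
-- cross-multiplied, and what has to be cancelled is a power of u or a polynomial that is nonzero at
-- u = 0. Determinants are compared as functions, since substitutions like u = 1/v are pointwise,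
-- whereas Bass's formula lives in power series; `Represents` links the two.

-- A ring solver with integer coefficients

module IntegerSolver {c ℓ} (R : CommutativeRing c ℓ) where
  open CommutativeRing R
  open import Algebra.Properties.Ring ring
  open import Algebra.Properties.AbelianGroup +-abelianGroup using (⁻¹-∙-comm)
  open import Algebra.Properties.Semiring.Mult.TCOptimised semiring using (×-homo-+; ×1-homo-*; 1+×)
    renaming (_×_ to _·_)
  open import Relation.Binary.Reasoning.Setoid setoid

  ⟦_⟧ℤ : ℤ → Carrier
  ⟦ + n ⟧ℤ      = n · 1#
  ⟦ -[1+ n ] ⟧ℤ = - (suc n · 1#)

  ⟦-⟧ : ∀ i → ⟦ ℤ.- i ⟧ℤ ≈ - ⟦ i ⟧ℤ
  ⟦-⟧ (+ zero)   = sym -0#≈0#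
  ⟦-⟧ (+ suc n)  = refl
  ⟦-⟧ -[1+ n ]   = sym (-‿involutive _)

  ⟦⊖⟧ : ∀ m n → ⟦ m ℤ.⊖ n ⟧ℤ ≈ m · 1# - n · 1#
  ⟦⊖⟧ zero    zero    = sym (-‿inverseʳ _)
  ⟦⊖⟧ zero    (suc n) = sym (+-identityˡ _)
  ⟦⊖⟧ (suc m) zero    = sym (trans (+-congˡ -0#≈0#) (+-identityʳ _))
  ⟦⊖⟧ (suc m) (suc n) = begin
    ⟦ suc m ℤ.⊖ suc n ⟧ℤ                ≡⟨ ≡.cong ⟦_⟧ℤ (ℤ.[1+m]⊖[1+n]≡m⊖n m n) ⟩
    ⟦ m ℤ.⊖ n ⟧ℤ                        ≈⟨ ⟦⊖⟧ m n ⟩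
    m · 1# - n · 1#                     ≈⟨ +-congʳ (trans (sym (+-identityʳ _)) (+-congˡ (sym (-‿inverseʳ 1#)))) ⟩
    (m · 1# + (1# - 1#)) - n · 1#       ≈⟨ +-congʳ (sym (+-assoc _ _ _)) ⟩
    (m · 1# + 1# - 1#) - n · 1#         ≈⟨ +-assoc _ _ _ ⟩
    (m · 1# + 1#) + (- 1# - n · 1#)     ≈⟨ +-cong (trans (+-comm _ _) (sym (1+× m 1#)))
        (trans (⁻¹-∙-comm _ _) (-‿cong (sym (1+× n 1#)))) ⟩
    suc m · 1# - suc n · 1#             ∎

  ⟦+⟧ : ∀ i j → ⟦ i ℤ.+ j ⟧ℤ ≈ ⟦ i ⟧ℤ + ⟦ j ⟧ℤ
  ⟦+⟧ (+ m)    (+ n)    = ×-homo-+ 1# m n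
  ⟦+⟧ (+ m)    -[1+ n ] = ⟦⊖⟧ m (suc n)
  ⟦+⟧ -[1+ m ] (+ n)    = trans (⟦⊖⟧ n (suc m)) (+-comm _ _)
  ⟦+⟧ -[1+ m ] -[1+ n ] = begin
    - (suc (suc (m ℕ.+ n)) · 1#)      ≡⟨ ≡.cong (λ k → - (k · 1#)) (≡.sym (ℕ.+-suc (suc m) n)) ⟩
    - ((suc m ℕ.+ suc n) · 1#)        ≈⟨ -‿cong (×-homo-+ 1# (suc m) (suc n)) ⟩
    - (suc m · 1# + suc n · 1#)       ≈⟨ sym (⁻¹-∙-comm _ _) ⟩
    - (suc m · 1#) - (suc n · 1#)     ∎

  ⟦*⟧ : ∀ i j → ⟦ i ℤ.* j ⟧ℤ ≈ ⟦ i ⟧ℤ * ⟦ j ⟧ℤ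
  ⟦*⟧ (+ m)    (+ n)    = trans (reflexive (≡.cong ⟦_⟧ℤ (ℤ.+◃n≡+n (m ℕ.* n)))) (×1-homo-* m n)
  ⟦*⟧ (+ m)    -[1+ n ] = begin
    ⟦ Sign.- ℤ.◃ m ℕ.* suc n ⟧ℤ   ≡⟨ ≡.cong ⟦_⟧ℤ (ℤ.-◃n≡-n (m ℕ.* suc n)) ⟩
    ⟦ ℤ.- (+ (m ℕ.* suc n)) ⟧ℤ    ≈⟨ ⟦-⟧ (+ (m ℕ.* suc n)) ⟩
    - ((m ℕ.* suc n) · 1#)        ≈⟨ -‿cong (×1-homo-* m (suc n)) ⟩
    - (m · 1# * (suc n · 1#))     ≈⟨ -‿distribʳ-* _ _ ⟩
    m · 1# * - (suc n · 1#)       ∎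
  ⟦*⟧ -[1+ m ] (+ n)    = begin
    ⟦ Sign.- ℤ.◃ suc m ℕ.* n ⟧ℤ   ≡⟨ ≡.cong ⟦_⟧ℤ (ℤ.-◃n≡-n (suc m ℕ.* n)) ⟩
    ⟦ ℤ.- (+ (suc m ℕ.* n)) ⟧ℤ    ≈⟨ ⟦-⟧ (+ (suc m ℕ.* n)) ⟩
    - ((suc m ℕ.* n) · 1#)        ≈⟨ -‿cong (×1-homo-* (suc m) n) ⟩
    - (suc m · 1# * (n · 1#))     ≈⟨ -‿distribˡ-* _ _ ⟩
    - (suc m · 1#) * (n · 1#)     ∎
  ⟦*⟧ -[1+ m ] -[1+ n ] = begin
    ((suc m ℕ.* suc n) · 1#)          ≈⟨ ×1-homo-* (suc m) (suc n) ⟩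
    suc m · 1# * (suc n · 1#)         ≈⟨ sym (-‿involutive _) ⟩
    - - (suc m · 1# * (suc n · 1#))   ≈⟨ -‿cong (-‿distribʳ-* _ _) ⟩
    - (suc m · 1# * - (suc n · 1#))   ≈⟨ -‿distribˡ-* _ _ ⟩
    - (suc m · 1#) * - (suc n · 1#)   ∎

  homomorphism : ℤ.+-*-rawRing -Raw-AlmostCommutative⟶ fromCommutativeRing R
  homomorphism = record
    { ⟦_⟧    = ⟦_⟧ℤ
    ; +-homo = ⟦+⟧
    ; *-homo = ⟦*⟧
    ; -‿homo = ⟦-⟧
    ; 0-homo = refl
    ; 1-homo = refl
    }

  -- Coefficients are compared in ℤ, where equality is decidable. A positive answer is sound in
  -- every `R`, including rings of power series, whose own equality is not decidable.
  coefficient≟ : ∀ i j → Maybe (⟦ i ⟧ℤ ≈ ⟦ j ⟧ℤ)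
  coefficient≟ i j with i ℤ.≟ j
  ... | yes i≡j = just (reflexive (≡.cong ⟦_⟧ℤ i≡j))
  ... | no  _   = nothing

  open import Algebra.Solver.Ring ℤ.+-*-rawRing (fromCommutativeRing R) homomorphism coefficient≟ public
    using (solve; con; _:+_; _:*_; _:-_; :-_; _:=_)

-- Determinants through the exterior algebra

module Determinants {c ℓ} (R : CommutativeRing c ℓ) where
  open CommutativeRing R hiding (zero)
  open Matrices R
  open IntegerSolver R
  open import Algebra.Properties.Ring ring using (-0#≈0#)
  open import Algebra.Properties.Semiring.Sum semiring
  import Algebra.Properties.CommutativeMonoid.Sum *-commutativeMonoid as Product
  open import Algebra.Definitions.RawSemiring (Semiring.rawSemiring semiring) using (product; _^_)
  open import Relation.Binary.Reasoning.Setoid setoid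

  sum-zero : ∀ {n} {f : Fin n → Carrier} → (∀ i → f i ≈ 0#) → sum f ≈ 0#
  sum-zero {n} f≈0 = trans (sum-cong-≋ f≈0) (sum-replicate-zero n)

  sum-only : ∀ {n} {f : Fin n → Carrier} i → (∀ k → k ≢ i → f k ≈ 0#) → sum f ≈ f i
  sum-only {suc n} zero    f≈0 = trans (+-congˡ (sum-zero λ k → f≈0 (suc k) λ ())) (+-identityʳ _)
  sum-only {suc n} (suc i) f≈0 = trans (+-congʳ (f≈0 zero λ ()))
    (trans (+-identityˡ _) (sum-only i λ k k≢i → f≈0 (suc k) (k≢i ∘ Fin.suc-injective)))

  sum-split : ∀ m {n} (f : Fin (m ℕ.+ n) → Carrier) →
              sum f ≈ sum (λ i → f (i ↑ˡ n)) + sum (λ j → f (m ↑ʳ j))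
  sum-split zero    f = sym (+-identityˡ _)
  sum-split (suc m) f = trans (+-congˡ (sum-split m (f ∘ suc))) (sym (+-assoc _ _ _))

  -- The exterior algebra on n generators: a set s of generators indexes the
  -- coefficient of their increasing wedge product.
  Exterior : ℕ → Set c
  Exterior n = Vec Bool n → Carrier

  infixr 7 _⋀_

  -- Write x = x₀ + e ∧ x₁ with e the first generator and v = v₀ e + v′. Then v ∧ x = v′ ∧ x₀ + e ∧
  -- (v₀ x₀ - v′ ∧ x₁); the sign comes from moving v′ past e.
  _⋀_ : ∀ {n} → (Fin n → Carrier) → Exterior n → Exterior n
  (v ⋀ x) []          = 0#
  (v ⋀ x) (false ∷ s) = ((v ∘ suc) ⋀ (x ∘ (false ∷_))) s
  (v ⋀ x) (true ∷ s)  = v zero * x (false ∷ s) - ((v ∘ suc) ⋀ (x ∘ (true ∷_))) s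

  unit : ∀ {n} → Exterior n
  unit []          = 1#
  unit (false ∷ s) = unit s
  unit (true ∷ s)  = 0#

  ⋀rows : ∀ {m n} → (Fin m → Fin n → Carrier) → Exterior n
  ⋀rows {zero}  M = unit
  ⋀rows {suc m} M = M zero ⋀ ⋀rows (M ∘ suc)

  top : ∀ n → Vec Bool n
  top n = Vec.replicate n true

  ⋀-cong : ∀ {n} {v w : Fin n → Carrier} {x y : Exterior n} →
           (∀ i → v i ≈ w i) → (∀ s → x s ≈ y s) → ∀ s → (v ⋀ x) s ≈ (w ⋀ y) s
  ⋀-cong v≈w x≈y []          = refl
  ⋀-cong v≈w x≈y (false ∷ s) = ⋀-cong (v≈w ∘ suc) (x≈y ∘ (false ∷_)) s
  ⋀-cong v≈w x≈y (true ∷ s)  =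
    +-cong (*-cong (v≈w zero) (x≈y _)) (-‿cong (⋀-cong (v≈w ∘ suc) (x≈y ∘ (true ∷_)) s))

  ⋀-linearˡ : ∀ {n} a (v w : Fin n → Carrier) x s →
              ((λ i → a * v i + w i) ⋀ x) s ≈ a * (v ⋀ x) s + (w ⋀ x) s
  ⋀-linearˡ a v w x []          = sym (trans (+-identityʳ _) (zeroʳ a))
  ⋀-linearˡ a v w x (false ∷ s) = ⋀-linearˡ a (v ∘ suc) (w ∘ suc) _ s
  ⋀-linearˡ a v w x (true ∷ s)  = trans (+-congˡ (-‿cong (⋀-linearˡ a (v ∘ suc) (w ∘ suc) _ s)))
    (solve 6 (λ a v w x p q → (a :* v :+ w) :* x :- (a :* p :+ q) := a :* (v :* x :- p) :+ (w :* x :- q))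
      refl a _ _ _ _ _)

  ⋀-linearʳ : ∀ {n} a (v : Fin n → Carrier) x y s →
              (v ⋀ (λ t → a * x t + y t)) s ≈ a * (v ⋀ x) s + (v ⋀ y) s
  ⋀-linearʳ a v x y []          = sym (trans (+-identityʳ _) (zeroʳ a))
  ⋀-linearʳ a v x y (false ∷ s) = ⋀-linearʳ a (v ∘ suc) _ _ s
  ⋀-linearʳ a v x y (true ∷ s)  = trans (+-congˡ (-‿cong (⋀-linearʳ a (v ∘ suc) _ _ s)))
    (solve 6 (λ a v x y p q → v :* (a :* x :+ y) :- (a :* p :+ q) := a :* (v :* x :- p) :+ (v :* y :- q))
      refl a _ _ _ _ _)

  ⋀-zeroʳ : ∀ {n} (v : Fin n → Carrier) {x} → (∀ s → x s ≈ 0#) → ∀ s → (v ⋀ x) s ≈ 0#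
  ⋀-zeroʳ v x≈0 []          = refl
  ⋀-zeroʳ v x≈0 (false ∷ s) = ⋀-zeroʳ (v ∘ suc) (x≈0 ∘ (false ∷_)) s
  ⋀-zeroʳ v x≈0 (true ∷ s)  =
    trans (+-cong (trans (*-congˡ (x≈0 _)) (zeroʳ _))
                  (trans (-‿cong (⋀-zeroʳ (v ∘ suc) (x≈0 ∘ (true ∷_)) s)) -0#≈0#))
          (+-identityˡ _)

  ⋀-zeroˡ : ∀ {n} {v : Fin n → Carrier} → (∀ i → v i ≈ 0#) → ∀ x s → (v ⋀ x) s ≈ 0#
  ⋀-zeroˡ v≈0 x []          = refl
  ⋀-zeroˡ v≈0 x (false ∷ s) = ⋀-zeroˡ (v≈0 ∘ suc) _ s
  ⋀-zeroˡ v≈0 x (true ∷ s)  =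
    trans (+-cong (trans (*-congʳ (v≈0 zero)) (zeroˡ _))
                  (trans (-‿cong (⋀-zeroˡ (v≈0 ∘ suc) _ s)) -0#≈0#))
          (+-identityˡ _)

  ⋀-sumʳ : ∀ {m n} (v : Fin n → Carrier) (a : Fin m → Carrier) (y : Fin m → Exterior n) s →
           (v ⋀ (λ t → sum (λ i → a i * y i t))) s ≈ sum (λ i → a i * (v ⋀ y i) s)
  ⋀-sumʳ {zero}  v a y s = ⋀-zeroʳ v (λ _ → refl) s
  ⋀-sumʳ {suc m} v a y s =
    trans (⋀-linearʳ (a zero) v (y zero) _ s) (+-congˡ (⋀-sumʳ v (a ∘ suc) (y ∘ suc) s))

  ⋀-anticomm : ∀ {n} (v w : Fin n → Carrier) x s → (v ⋀ w ⋀ x) s ≈ - (w ⋀ v ⋀ x) s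
  ⋀-anticomm v w x []          = sym -0#≈0#
  ⋀-anticomm v w x (false ∷ s) = ⋀-anticomm (v ∘ suc) (w ∘ suc) _ s
  ⋀-anticomm v w x (true ∷ s)  = begin
    v zero * p - (v′ ⋀ (λ t → w zero * xf t - (w′ ⋀ xt) t)) s
      ≈⟨ +-congˡ (-‿cong (trans (sub v′ (w zero) xf (w′ ⋀ xt)) (+-congˡ (-‿cong (⋀-anticomm v′ w′ xt s))))) ⟩
    v zero * p - (w zero * q - - r)
      ≈⟨ solve 5 (λ v w p q r → v :* p :- (w :* q :- :- r) := :- (w :* q :- (v :* p :- r))) refl (v zero) (w zero) p q r ⟩
    - (w zero * q - (v zero * p - r))
      ≈⟨ -‿cong (+-congˡ (-‿cong (sym (sub w′ (v zero) xf (v′ ⋀ xt))))) ⟩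
    - (w zero * q - (w′ ⋀ (λ t → v zero * xf t - (v′ ⋀ xt) t)) s) ∎
    where
    v′ = v ∘ suc
    w′ = w ∘ suc
    xf = x ∘ (false ∷_)
    xt = x ∘ (true ∷_)
    p = (w′ ⋀ xf) s
    q = (v′ ⋀ xf) s
    r = (w′ ⋀ v′ ⋀ xt) s
    sub : ∀ (u : Fin _ → Carrier) b (y z : Exterior _) →
          (u ⋀ (λ t → b * y t - z t)) s ≈ b * (u ⋀ y) s - (u ⋀ z) s
    sub u b y z = begin
      (u ⋀ (λ t → b * y t - z t)) s                  ≈⟨ ⋀-cong (λ _ → refl)
          (λ t → solve 2 (λ m z → m :- z := con (+ 1) :* m :+ con -[1+ 0 ] :* z) refl (b * y t) (z t)) s ⟩
      (u ⋀ (λ t → 1# * (b * y t) + (- 1#) * z t)) s    ≈⟨ ⋀-linearʳ 1# u _ _ s ⟩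
      1# * (u ⋀ (λ t → b * y t)) s + (u ⋀ (λ t → (- 1#) * z t)) s
        ≈⟨ +-cong (*-congˡ (scale b y)) (scale (- 1#) z) ⟩
      1# * (b * (u ⋀ y) s) + (- 1#) * (u ⋀ z) s      ≈⟨ solve 2
          (λ m z → con (+ 1) :* m :+ con -[1+ 0 ] :* z := m :- z) refl _ _ ⟩
      b * (u ⋀ y) s - (u ⋀ z) s                      ∎
      where
      scale : ∀ d (k : Exterior _) → (u ⋀ (λ t → d * k t)) s ≈ d * (u ⋀ k) s
      scale d k = begin
        (u ⋀ (λ t → d * k t)) s             ≈⟨ ⋀-cong (λ _ → refl) (λ t → sym (+-identityʳ _)) s ⟩
        (u ⋀ (λ t → d * k t + 0#)) s        ≈⟨ ⋀-linearʳ d u k _ s ⟩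
        d * (u ⋀ k) s + (u ⋀ (λ _ → 0#)) s  ≈⟨ +-congˡ (⋀-zeroʳ u (λ _ → refl) s) ⟩
        d * (u ⋀ k) s + 0#                  ≈⟨ +-identityʳ _ ⟩
        d * (u ⋀ k) s                       ∎

  -- Anticommutativity says only that twice this element vanishes, and 2 may be a zero divisor in
  -- `R`. Directly: the two cross terms `v zero * p` cancel, and the remaining term contains `v′`
  -- twice.
  ⋀-alternating : ∀ {n} (v : Fin n → Carrier) x s → (v ⋀ v ⋀ x) s ≈ 0#
  ⋀-alternating v x []          = refl
  ⋀-alternating v x (false ∷ s) = ⋀-alternating (v ∘ suc) _ s
  ⋀-alternating v x (true ∷ s)  = begin
    v zero * p - (v′ ⋀ (λ t → v zero * xf t - (v′ ⋀ xt) t)) s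
      ≈⟨ +-congˡ (-‿cong (⋀-cong (λ _ → refl)
          (λ t → solve 2 (λ m z → m :- z := con -[1+ 0 ] :* z :+ m) refl (v zero * xf t) _) s)) ⟩
    v zero * p - (v′ ⋀ (λ t → (- 1#) * (v′ ⋀ xt) t + v zero * xf t)) s
      ≈⟨ +-congˡ (-‿cong (⋀-linearʳ (- 1#) v′ (v′ ⋀ xt) _ s)) ⟩
    v zero * p - ((- 1#) * (v′ ⋀ v′ ⋀ xt) s + (v′ ⋀ (λ t → v zero * xf t)) s)
      ≈⟨ +-congˡ (-‿cong (+-cong (trans (*-congˡ (⋀-alternating v′ xt s)) (zeroʳ _))
           (trans (⋀-cong (λ _ → refl) (λ t → sym (+-identityʳ _)) s)
             (trans (⋀-linearʳ (v zero) v′ xf (λ _ → 0#) s) (+-congˡ (⋀-zeroʳ v′ (λ _ → refl) s)))))) ⟩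
    v zero * p - (0# + (v zero * p + 0#))
      ≈⟨ solve 1 (λ m → m :- (con (+ 0) :+ (m :+ con (+ 0))) := con (+ 0)) refl (v zero * p) ⟩
    0# ∎
    where
    v′ = v ∘ suc
    xf = x ∘ (false ∷_)
    xt = x ∘ (true ∷_)
    p = (v′ ⋀ xf) s

  ⋀rows-cong : ∀ {m n} {M N : Fin m → Fin n → Carrier} →
               (∀ i j → M i j ≈ N i j) → ∀ s → ⋀rows M s ≈ ⋀rows N s
  ⋀rows-cong {zero}  M≈N s = refl
  ⋀rows-cong {suc m} M≈N s = ⋀-cong (M≈N zero) (⋀rows-cong (M≈N ∘ suc)) s

  -- Deletion of the j-th generator is an algebra homomorphism; it turns the
  -- expansion of the top coefficient of M₀ ∧ ⋯ along M₀ into Laplace's.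
  delete : ∀ {n} → Fin (suc n) → Exterior (suc n) → Exterior n
  delete j x s = x (Vec.insertAt s j false)

  delete-⋀ : ∀ {n} (j : Fin (suc n)) v x s → delete j (v ⋀ x) s ≈ ((v ∘ punchIn j) ⋀ delete j x) s
  delete-⋀ zero    v x s           = refl
  delete-⋀ (suc j) v x (false ∷ s) = delete-⋀ j (v ∘ suc) _ s
  delete-⋀ (suc j) v x (true ∷ s)  = +-congˡ (-‿cong (delete-⋀ j (v ∘ suc) _ s))

  delete-unit : ∀ {n} (j : Fin (suc n)) s → delete j unit s ≈ unit s
  delete-unit zero    s           = refl
  delete-unit (suc j) (false ∷ s) = delete-unit j s
  delete-unit (suc j) (true ∷ s)  = refl

  delete-⋀rows : ∀ {m n} (j : Fin (suc n)) (M : Fin m → Fin (suc n) → Carrier) s →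
                 delete j (⋀rows M) s ≈ ⋀rows (λ i k → M i (punchIn j k)) s
  delete-⋀rows {zero}  j M s = delete-unit j s
  delete-⋀rows {suc m} j M s = trans (delete-⋀ j (M zero) _ s) (⋀-cong (λ _ → refl) (delete-⋀rows j (M ∘ suc)) s)

  top-⋀ : ∀ {n} (v : Fin (suc n) → Carrier) x →
          (v ⋀ x) (top (suc n)) ≈ sum (λ j → (- 1#) ^ toℕ j * v j * delete j x (top n))
  top-⋀ {zero}  v x = solve 2 (λ v x → v :* x :- con (+ 0) := con (+ 1) :* v :* x :+ con (+ 0)) refl _ _
  top-⋀ {suc n} v x = +-cong (*-congʳ (sym (*-identityˡ _))) (begin
    - ((v ∘ suc) ⋀ (x ∘ (true ∷_))) (top (suc n))
      ≈⟨ -‿cong (top-⋀ (v ∘ suc) (x ∘ (true ∷_))) ⟩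
    - sum f                  ≈⟨ solve 1 (λ a → :- a := con -[1+ 0 ] :* a) refl _ ⟩
    (- 1#) * sum f             ≈⟨ *-distribˡ-sum (- 1#) f ⟩
    sum (λ j → (- 1#) * f j)   ≈⟨ sum-cong-≋ {suc n}
        (λ j → solve 3 (λ p q r → con -[1+ 0 ] :* (p :* q :* r) := con -[1+ 0 ] :* p :* q :* r) refl
        ((- 1#) ^ toℕ j) (v (suc j)) (delete j (x ∘ (true ∷_)) (top n))) ⟩
    _ ∎)
    where f = λ j → (- 1#) ^ toℕ j * v (suc j) * delete j (x ∘ (true ∷_)) (top n)

  -- The bridge from Laplace's recursion to the wedge of the rows, where multilinearity and
  -- alternation in any row need no bookkeeping of signs.
  det≈⋀rows : ∀ {n} (M : Matrix n) → det M ≈ ⋀rows M (top n)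
  det≈⋀rows {zero}  M = refl
  det≈⋀rows {suc n} M = sym (trans (top-⋀ (M zero) (⋀rows (M ∘ suc)))
    (sum-cong-≋ {suc n} λ j → *-congˡ {(- 1#) ^ toℕ j * M zero j}
        (trans (delete-⋀rows j (M ∘ suc) (top n)) (sym (det≈⋀rows {n} _)))))

  det-cong : ∀ {n} {M N : Matrix n} → (∀ i j → M i j ≈ N i j) → det M ≈ det N
  det-cong {n} M≈N = trans (det≈⋀rows {n} _) (trans (⋀rows-cong M≈N (top n)) (sym (det≈⋀rows {n} _)))

  infixl 9 _[_≔_]

  _[_≔_] : ∀ {m n} → (Fin m → Fin n → Carrier) → Fin m → (Fin n → Carrier) → Fin m → Fin n → Carrier
  M [ i ≔ r ] = Vector.updateAt M i (λ _ → r)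

  update-cong : ∀ {m n} (M : Fin m → Fin n → Carrier) i {v w} → (∀ j → v j ≈ w j) →
                ∀ k j → (M [ i ≔ v ]) k j ≈ (M [ i ≔ w ]) k j
  update-cong {suc m} M zero    v≈w zero    j = v≈w j
  update-cong {suc m} M zero    v≈w (suc k) j = refl
  update-cong {suc m} M (suc i) v≈w zero    j = refl
  update-cong {suc m} M (suc i) v≈w (suc k) j = update-cong (M ∘ suc) i v≈w k j

  ⋀rows-linear : ∀ {m n} (M : Fin m → Fin n → Carrier) i a v w s →
                 ⋀rows (M [ i ≔ (λ j → a * v j + w j) ]) s ≈ a * ⋀rows (M [ i ≔ v ]) s + ⋀rows (M [ i ≔ w ]) s
  ⋀rows-linear {suc m} M zero    a v w s = ⋀-linearˡ a v w (⋀rows (M ∘ suc)) s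
  ⋀rows-linear {suc m} M (suc i) a v w s =
    trans (⋀-cong (λ _ → refl) (⋀rows-linear (M ∘ suc) i a v w) s)
          (⋀-linearʳ a (M zero) _ _ s)

  ⋀rows-zero : ∀ {m n} (M : Fin m → Fin n → Carrier) i s → ⋀rows (M [ i ≔ (λ _ → 0#) ]) s ≈ 0#
  ⋀rows-zero {suc m} M zero    s = ⋀-zeroˡ (λ _ → refl) _ s
  ⋀rows-zero {suc m} M (suc i) s = ⋀-zeroʳ (M zero) (⋀rows-zero (M ∘ suc) i) s

  ⋀rows-sum : ∀ {m n k} (M : Fin m → Fin n → Carrier) i (a : Fin k → Carrier) (r : Fin k → Fin n → Carrier) s →
              ⋀rows (M [ i ≔ (λ j → sum (λ l → a l * r l j)) ]) s ≈ sum (λ l → a l * ⋀rows (M [ i ≔ r l ]) s)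
  ⋀rows-sum {k = zero}  M i a r s = ⋀rows-zero M i s
  ⋀rows-sum {k = suc k} M i a r s =
    trans (⋀rows-linear M i (a zero) (r zero) _ s) (+-congˡ (⋀rows-sum M i (a ∘ suc) (r ∘ suc) s))

  -- Anticommutativity moves `v` past the rows above row `k`, until it meets its own copy.
  ⋀-absorbs : ∀ {m n} (v : Fin n → Carrier) (M : Fin m → Fin n → Carrier) k →
              (∀ j → v j ≈ M k j) → ∀ s → (v ⋀ ⋀rows M) s ≈ 0#
  ⋀-absorbs v M zero    v≈ s = trans (⋀-cong v≈ (λ _ → refl) s) (⋀-alternating (M zero) _ s)
  ⋀-absorbs v M (suc k) v≈ s = trans (⋀-anticomm v (M zero) _ s)
    (trans (-‿cong (⋀-zeroʳ (M zero) (⋀-absorbs v (M ∘ suc) k v≈) s)) -0#≈0#)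

  ⋀rows-repeated : ∀ {m n} (M : Fin m → Fin n → Carrier) i k → k ≢ i → ∀ s → ⋀rows (M [ i ≔ M k ]) s ≈ 0#
  ⋀rows-repeated M zero    zero    k≢i s = ⊥-elim (k≢i ≡.refl)
  ⋀rows-repeated M zero    (suc k) k≢i s = ⋀-absorbs (M (suc k)) (M ∘ suc) k (λ _ → refl) s
  ⋀rows-repeated M (suc i) zero    k≢i s =
    ⋀-absorbs (M zero) _ i (λ j → reflexive (≡.cong (λ r → r j) (≡.sym (Vector.updateAt-updates i (M ∘ suc))))) s
  ⋀rows-repeated M (suc i) (suc k) k≢i s =
    ⋀-zeroʳ (M zero) (⋀rows-repeated (M ∘ suc) i k (k≢i ∘ ≡.cong suc)) s

  -- Cramer's rule without division: after expanding row `i`, every summand with k ≠ i has a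
  -- repeated row, so only the multiple `a i` of the old row survives. Both the rank-one update and
  -- Jacobi's formula rest on this.
  ⋀rows-combination : ∀ {n} (M : Matrix n) i (a : Fin n → Carrier) s →
                      ⋀rows (M [ i ≔ (λ j → sum (λ k → a k * M k j)) ]) s ≈ a i * ⋀rows M s
  ⋀rows-combination {n} M i a s = begin
    ⋀rows (M [ i ≔ (λ j → sum (λ k → a k * M k j)) ]) s   ≈⟨ ⋀rows-sum M i a M s ⟩
    sum (λ k → a k * ⋀rows (M [ i ≔ M k ]) s)
      ≈⟨ sum-only {n} i (λ k k≢i → trans (*-congˡ (⋀rows-repeated M i k k≢i s)) (zeroʳ _)) ⟩
    a i * ⋀rows (M [ i ≔ M i ]) s
      ≈⟨ *-congˡ (⋀rows-cong (λ k j → reflexive (≡.cong (λ r → r j) (Vector.updateAt-id-local i M ≡.refl k))) s) ⟩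
    a i * ⋀rows M s                                       ∎

  -- In the multilinear expansion a term that takes `v` in two rows vanishes by alternation, so the
  -- expansion stops at the terms linear in `a`.
  ⋀rows-rank1 : ∀ {m n} (N : Fin m → Fin n → Carrier) (a : Fin m → Carrier) v s →
                ⋀rows (λ i j → N i j + a i * v j) s ≈ ⋀rows N s + sum (λ i → a i * ⋀rows (N [ i ≔ v ]) s)
  ⋀rows-rank1 {zero}  N a v s = sym (+-identityʳ _)
  ⋀rows-rank1 {suc m} {n} N a v s = begin
    ((λ j → N zero j + a zero * v j) ⋀ ⋀rows (λ i j → N (suc i) j + a (suc i) * v j)) s
      ≈⟨ ⋀-cong (λ j → +-comm _ _) (λ t → trans (⋀rows-rank1 N′ a′ v t)
          (trans (+-comm _ _) (+-congʳ (sym (*-identityˡ _))))) s ⟩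
    ((λ j → a zero * v j + N zero j) ⋀ z) s
      ≈⟨ ⋀-linearˡ (a zero) v (N zero) z s ⟩
    a zero * (v ⋀ z) s + (N zero ⋀ z) s
      ≈⟨ +-cong (*-congˡ (expand v)) (expand (N zero)) ⟩
    a zero * (1# * sum (λ i → a′ i * (v ⋀ y i) s) + (v ⋀ ⋀rows N′) s)
      + (1# * sum (λ i → a′ i * (N zero ⋀ y i) s) + (N zero ⋀ ⋀rows N′) s)
      -- Row zero is already `v` here, so every term with a second `v` drops out.
      ≈⟨ +-congʳ (*-congˡ (+-congʳ (*-congˡ (sum-zero {m} λ i → trans (*-congˡ (⋀-absorbs v (N′ [ i ≔ v ]) i
           (λ j → reflexive (≡.cong (λ r → r j) (≡.sym (Vector.updateAt-updates i N′)))) s)) (zeroʳ _))))) ⟩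
    a zero * (1# * 0# + (v ⋀ ⋀rows N′) s)
      + (1# * sum (λ i → a′ i * (N zero ⋀ y i) s) + (N zero ⋀ ⋀rows N′) s)
      ≈⟨ solve 4 (λ a p q r → a :* (con (+ 1) :* con (+ 0) :+ p) :+ (con (+ 1) :* q :+ r) := r :+ (a :* p :+ q))
          refl _ _ _ _ ⟩
    _ ∎
    where
    N′ = N ∘ suc
    a′ = a ∘ suc
    y  = λ i → ⋀rows (N′ [ i ≔ v ])
    z : Exterior n
    z t = 1# * sum (λ i → a′ i * y i t) + ⋀rows N′ t
    expand : ∀ w → (w ⋀ z) s ≈ 1# * sum (λ i → a′ i * (w ⋀ y i) s) + (w ⋀ ⋀rows N′) s
    expand w = trans (⋀-linearʳ 1# w (λ t → sum (λ i → a′ i * y i t)) (⋀rows N′) s) (+-congʳ (*-congˡ (⋀-sumʳ w a′ y s)))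

  -- The matrix determinant lemma det (N + a vᵀ) = (1 + vᵀ N⁻¹ a) det N with vᵀ N⁻¹ written as z / Δ
  -- and everything multiplied by Δ, so that it makes sense in a ring.
  det-rank1 : ∀ {n} (N : Matrix n) (a v z : Fin n → Carrier) Δ →
              (∀ j → Δ * v j ≈ sum (λ i → z i * N i j)) →
              Δ * det (λ i j → N i j + a i * v j) ≈ (Δ + sum (λ i → a i * z i)) * det N
  det-rank1 {n} N a v z Δ Δv≈ = begin
    Δ * det (λ i j → N i j + a i * v j)
      ≈⟨ *-congˡ (trans (det≈⋀rows {n} _) (⋀rows-rank1 N a v (top n))) ⟩
    Δ * (W + sum (λ i → a i * ⋀rows (N [ i ≔ v ]) (top n)))
      ≈⟨ trans (distribˡ _ _ _) (+-congˡ (*-distribˡ-sum Δ (λ i → a i * ⋀rows (N [ i ≔ v ]) (top n)))) ⟩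
    Δ * W + sum (λ i → Δ * (a i * ⋀rows (N [ i ≔ v ]) (top n)))
      ≈⟨ +-congˡ (sum-cong-≋ {n} λ i → trans (solve 3 (λ d a w → d :* (a :* w) := a :* (d :* w)) refl Δ (a i) _)
           (trans (*-congˡ (replaced i)) (sym (*-assoc _ _ _)))) ⟩
    Δ * W + sum (λ i → a i * z i * W)
      ≈⟨ +-congˡ (sym (*-distribʳ-sum W (λ i → a i * z i))) ⟩
    Δ * W + sum (λ i → a i * z i) * W
      ≈⟨ sym (distribʳ _ _ _) ⟩
    (Δ + sum (λ i → a i * z i)) * W
      ≈⟨ *-congˡ (sym (det≈⋀rows N)) ⟩
    (Δ + sum (λ i → a i * z i)) * det N ∎
    where
    W = ⋀rows N (top n)
    replaced : ∀ i → Δ * ⋀rows (N [ i ≔ v ]) (top n) ≈ z i * W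
    replaced i = begin
      Δ * ⋀rows (N [ i ≔ v ]) (top n)                        ≈⟨ sym (+-identityʳ _) ⟩
      Δ * ⋀rows (N [ i ≔ v ]) (top n) + 0#                   ≈⟨ +-congˡ (sym (⋀rows-zero N i (top n))) ⟩
      Δ * ⋀rows (N [ i ≔ v ]) (top n) + ⋀rows (N [ i ≔ (λ _ → 0#) ]) (top n)
        ≈⟨ sym (⋀rows-linear N i Δ v (λ _ → 0#) (top n)) ⟩
      ⋀rows (N [ i ≔ (λ j → Δ * v j + 0#) ]) (top n)
        ≈⟨ ⋀rows-cong (update-cong N i (λ j → trans (+-identityʳ _) (Δv≈ j))) (top n) ⟩
      ⋀rows (N [ i ≔ (λ j → sum (λ k → z k * N k j)) ]) (top n)
        ≈⟨ ⋀rows-combination N i z (top n) ⟩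
      z i * W                                                ∎

  det-identity : ∀ n → det {n} identity ≈ 1#
  det-identity zero    = refl
  det-identity (suc n) = trans
    (sum-only {suc n} {λ j → (- 1#) ^ toℕ j * identity {suc n} zero j * det
        (λ i k → identity {suc n} (suc i) (punchIn j k))} zero
        (λ { zero 0≢0 → ⊥-elim (0≢0 ≡.refl) ; (suc k) _ → trans (*-congʳ (zeroʳ _)) (zeroˡ _) }))
    (trans (*-cong (*-identityˡ 1#) (det-identity n)) (*-identityˡ 1#))

  det-scale : ∀ {n} (a b : Fin n → Carrier) (M : Matrix n) →
              det (λ i j → a i * M i j * b j) ≈ product a * product b * det M
  det-scale {zero}  a b M = sym (trans (*-identityʳ _) (*-identityˡ _))
  det-scale {suc n} a b M = trans (sum-cong-≋ {suc n} term)
    (sym (*-distribˡ-sum (product a * product b) (λ j → (- 1#) ^ toℕ j * M zero j * minor j)))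
    where
    minor : Fin (suc n) → Carrier
    minor j = det (λ i k → M (suc i) (punchIn j k))
    term : ∀ j → (- 1#) ^ toℕ j * (a zero * M zero j * b j) * det
        (λ i k → a (suc i) * M (suc i) (punchIn j k) * b (punchIn j k))
                 ≈ product a * product b * ((- 1#) ^ toℕ j * M zero j * minor j)
    term j = begin
      _ ≈⟨ *-congˡ (det-scale (a ∘ suc) (b ∘ punchIn j) (λ i k → M (suc i) (punchIn j k))) ⟩
      (- 1#) ^ toℕ j * (a zero * M zero j * b j) * (product (a ∘ suc) * product (b ∘ punchIn j) * minor j)
        ≈⟨ solve 7 (λ s a m b p q d → s :* (a :* m :* b) :* (p :* q :* d) := a :* p :* (b :* q) :*
            (s :* m :* d)) refl _ _ _ _ _ _ _ ⟩
      product a * (b j * product (b ∘ punchIn j)) * ((- 1#) ^ toℕ j * M zero j * minor j)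
        ≈⟨ *-congʳ (*-congˡ (sym (Product.sum-remove {i = j} b))) ⟩
      _ ∎

  det-diagonal : ∀ {n} (a : Fin n → Carrier) → det (λ i j → a i * identity i j) ≈ product a
  det-diagonal {n} a = begin
    det (λ i j → a i * identity i j)        ≈⟨ det-cong {n} (λ i j → sym (*-identityʳ _)) ⟩
    det (λ i j → a i * identity i j * 1#)   ≈⟨ det-scale a (λ _ → 1#) identity ⟩
    product a * product (λ (_ : Fin n) → 1#) * det {n} identity
      ≈⟨ *-cong (*-congˡ (Product.sum-replicate-zero n)) (det-identity n) ⟩
    product a * 1# * 1#                     ≈⟨ trans (*-identityʳ _) (*-identityʳ _) ⟩
    product a                               ∎

  punchIn-↑ˡ : ∀ {n} n′ (j : Fin (suc n)) (k : Fin n) → punchIn (j ↑ˡ n′) (k ↑ˡ n′) ≡ punchIn j k ↑ˡ n′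
  punchIn-↑ˡ n′ zero    k       = ≡.refl
  punchIn-↑ˡ n′ (suc j) zero    = ≡.refl
  punchIn-↑ˡ n′ (suc j) (suc k) = ≡.cong suc (punchIn-↑ˡ n′ j k)

  punchIn-↑ʳ : ∀ n {n′} (j : Fin (suc n)) (k : Fin n′) → punchIn (j ↑ˡ n′) (n ↑ʳ k) ≡ suc n ↑ʳ k
  punchIn-↑ʳ n       zero    k = ≡.refl
  punchIn-↑ʳ (suc n) (suc j) k = ≡.cong suc (punchIn-↑ʳ n j k)

  -- In the expansion along the first row only columns of the left block contribute, and their
  -- minors are block triangular again with the same lower right block.
  det-blockTriangular : ∀ n {n′} (M : Matrix (n ℕ.+ n′)) →
    (∀ i j → M (i ↑ˡ n′) (n ↑ʳ j) ≈ 0#) →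
    det M ≈ det (λ i j → M (i ↑ˡ n′) (j ↑ˡ n′)) * det (λ i j → M (n ↑ʳ i) (n ↑ʳ j))
  det-blockTriangular zero         M M≈0 = sym (*-identityˡ _)
  det-blockTriangular (suc n) {n′} M M≈0 = begin
    det M
      ≈⟨ sum-split (suc n) (λ j → (- 1#) ^ toℕ j * M zero j * minor j) ⟩
    sum (λ j → (- 1#) ^ toℕ (j ↑ˡ n′) * M zero (j ↑ˡ n′) * minor (j ↑ˡ n′)) + sum
        (λ j → (- 1#) ^ toℕ (suc n ↑ʳ j) * M zero (suc n ↑ʳ j) * minor (suc n ↑ʳ j))
      ≈⟨ +-cong (sum-cong-≋ {suc n} term)
          (sum-zero {n′} λ j → trans (*-congʳ (trans (*-congˡ (M≈0 zero j)) (zeroʳ _))) (zeroˡ _)) ⟩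
    sum (λ j → (- 1#) ^ toℕ j * M zero (j ↑ˡ n′) * det (λ i k → M (suc i ↑ˡ n′) (punchIn j k ↑ˡ n′)) * D) + 0#
      ≈⟨ trans (+-identityʳ _) (sym (*-distribʳ-sum D
          (λ j → (- 1#) ^ toℕ j * M zero (j ↑ˡ n′) * det (λ i k → M (suc i ↑ˡ n′) (punchIn j k ↑ˡ n′))))) ⟩
    _ ∎
    where
    minor : Fin (suc n ℕ.+ n′) → Carrier
    minor j = det (λ i k → M (suc i) (punchIn j k))
    D = det (λ i j → M (suc n ↑ʳ i) (suc n ↑ʳ j))
    term : ∀ (j : Fin (suc n)) → (- 1#) ^ toℕ (j ↑ˡ n′) * M zero (j ↑ˡ n′) * minor (j ↑ˡ n′) ≈
      (- 1#) ^ toℕ j * M zero (j ↑ˡ n′) * det (λ i k → M (suc i ↑ˡ n′) (punchIn j k ↑ˡ n′)) * D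
    term j = trans
      (*-cong (*-congʳ (reflexive (≡.cong ((- 1#) ^_) (Fin.toℕ-↑ˡ j n′))))
        (trans (det-blockTriangular n (λ i k → M (suc i) (punchIn (j ↑ˡ n′) k))
                  (λ i k → trans (reflexive (≡.cong (M (suc (i ↑ˡ n′))) (punchIn-↑ʳ n j k))) (M≈0 (suc i) k)))
          (*-cong (det-cong (λ i k → reflexive (≡.cong (M (suc (i ↑ˡ n′))) (punchIn-↑ˡ n′ j k))))
                  (det-cong (λ i k → reflexive (≡.cong (M (suc (n ↑ʳ i))) (punchIn-↑ʳ n j k)))))))
      (sym (*-assoc _ _ _))

  module Derivation (δ : Carrier → Carrier)
    (δ-cong : ∀ {x y} → x ≈ y → δ x ≈ δ y)
    (δ-+ : ∀ x y → δ (x + y) ≈ δ x + δ y)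
    (δ-* : ∀ x y → δ (x * y) ≈ δ x * y + x * δ y) where

    δ0 : δ 0# ≈ 0#
    δ0 = begin
      δ 0#                        ≈⟨ solve 1 (λ a → a := a :+ a :- a) refl (δ 0#) ⟩
      δ 0# + δ 0# - δ 0#          ≈⟨ +-congʳ (trans (sym (δ-+ 0# 0#)) (δ-cong (+-identityʳ 0#))) ⟩
      δ 0# - δ 0#                 ≈⟨ -‿inverseʳ _ ⟩
      0#                          ∎

    δ1 : δ 1# ≈ 0#
    δ1 = begin
      δ 1#                        ≈⟨ solve 1 (λ a → a := a :* con (+ 1) :+ con (+ 1) :* a :- a) refl (δ 1#) ⟩
      δ 1# * 1# + 1# * δ 1# - δ 1#  ≈⟨ +-congʳ (trans (sym (δ-* 1# 1#)) (δ-cong (*-identityʳ 1#))) ⟩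
      δ 1# - δ 1#                 ≈⟨ -‿inverseʳ _ ⟩
      0#                          ∎

    δ-neg : ∀ x → δ (- x) ≈ - δ x
    δ-neg x = begin
      δ (- x)                     ≈⟨ solve 2 (λ a b → a := (a :+ b) :- b) refl (δ (- x)) (δ x) ⟩
      δ (- x) + δ x - δ x         ≈⟨ +-congʳ (trans (sym (δ-+ (- x) x)) (trans (δ-cong (-‿inverseˡ x)) δ0)) ⟩
      0# - δ x                    ≈⟨ +-identityˡ _ ⟩
      - δ x                       ∎

    δ-⋀ : ∀ {n} (v : Fin n → Carrier) x s → δ ((v ⋀ x) s) ≈ ((δ ∘ v) ⋀ x) s + (v ⋀ (δ ∘ x)) s
    δ-⋀ v x []          = trans δ0 (sym (+-identityʳ _))
    δ-⋀ v x (false ∷ s) = δ-⋀ (v ∘ suc) _ s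
    δ-⋀ v x (true ∷ s)  = begin
      δ (v zero * x (false ∷ s) - p)             ≈⟨ trans (δ-+ _ _)
          (+-cong (δ-* _ _) (trans (δ-neg _) (-‿cong (δ-⋀ (v ∘ suc) _ s)))) ⟩
      δ (v zero) * x (false ∷ s) + v zero * δ (x (false ∷ s)) - (q + r)
        ≈⟨ solve 4 (λ a b c d → a :+ b :- (c :+ d) := (a :- c) :+ (b :- d)) refl _ _ _ _ ⟩
      (δ (v zero) * x (false ∷ s) - q) + (v zero * δ (x (false ∷ s)) - r) ∎
      where
      p = ((v ∘ suc) ⋀ (x ∘ (true ∷_))) s
      q = ((δ ∘ v ∘ suc) ⋀ (x ∘ (true ∷_))) s
      r = ((v ∘ suc) ⋀ (δ ∘ x ∘ (true ∷_))) s

    δ-unit : ∀ {n} (s : Vec Bool n) → δ (unit s) ≈ 0#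
    δ-unit []          = δ1
    δ-unit (false ∷ s) = δ-unit s
    δ-unit (true ∷ s)  = δ0

    δ-⋀rows : ∀ {m n} (M : Fin m → Fin n → Carrier) s →
              δ (⋀rows M s) ≈ sum (λ i → ⋀rows (M [ i ≔ δ ∘ M i ]) s)
    δ-⋀rows {zero}  M s = δ-unit s
    δ-⋀rows {suc m} M s = trans (δ-⋀ (M zero) _ s) (+-congˡ (begin
      (M zero ⋀ (δ ∘ ⋀rows (M ∘ suc))) s
        ≈⟨ ⋀-cong (λ _ → refl) (λ t → trans (δ-⋀rows (M ∘ suc) t) (sum-cong-≋ {m} λ i → sym (*-identityˡ _))) s ⟩
      (M zero ⋀ (λ t → sum (λ i → 1# * ⋀rows ((M ∘ suc) [ i ≔ δ ∘ M (suc i) ]) t))) s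
        ≈⟨ ⋀-sumʳ (M zero) (λ _ → 1#) (λ i → ⋀rows ((M ∘ suc) [ i ≔ δ ∘ M (suc i) ])) s ⟩
      sum (λ i → 1# * (M zero ⋀ ⋀rows ((M ∘ suc) [ i ≔ δ ∘ M (suc i) ])) s)
        ≈⟨ sum-cong-≋ {m} (λ i → *-identityˡ _) ⟩
      _ ∎))

    -- By the product rule, δ of the determinant is the sum over `i` of the determinants with row
    -- `i` differentiated. If δ M = C M, that row is a combination of the rows of `M`, and replacing
    -- it multiplies the determinant by `C i i`.
    jacobi : ∀ {n} (M C : Matrix n) → (∀ i j → δ (M i j) ≈ sum (λ k → C i k * M k j)) →
            δ (det M) ≈ sum (λ i → C i i) * det M
    jacobi {n} M C δM≈CM = begin
      δ (det M)              ≈⟨ trans (δ-cong (det≈⋀rows M)) (δ-⋀rows M (top n)) ⟩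
      sum (λ i → ⋀rows (M [ i ≔ δ ∘ M i ]) (top n))
        ≈⟨ sum-cong-≋ {n} (λ i → trans (⋀rows-cong (update-cong M i (δM≈CM i)) (top n))
            (⋀rows-combination M i (C i) (top n))) ⟩
      sum (λ i → C i i * ⋀rows M (top n))    ≈⟨ sym (*-distribʳ-sum (⋀rows M (top n)) (λ i → C i i)) ⟩
      sum (λ i → C i i) * ⋀rows M (top n)    ≈⟨ *-congˡ (sym (det≈⋀rows M)) ⟩
      sum (λ i → C i i) * det M              ∎

-- Formal power series and the Euler operator

module PowerSeries {c ℓ} (R : CommutativeRing c ℓ) where
  open CommutativeRing R hiding (zero)
  open IntegerSolver R
  open import Algebra.Properties.Semiring.Mult semiring using (×-comm-*; ×-congʳ)
  open import Algebra.Definitions.RawSemiring (Semiring.rawSemiring semiring) using () renaming (_×_ to _·_)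
  open import Relation.Binary.Reasoning.Setoid setoid

  infixl 7 _⊠_

  -- The Cauchy product, peeled from the left: s = s₀ + u s′ gives s t = s₀ t + u (s′ t). This
  -- recursion replaces sums over an index range in all ring laws.
  _⊠_ : (ℕ → Carrier) → (ℕ → Carrier) → ℕ → Carrier
  (s ⊠ t) zero    = s 0 * t 0
  (s ⊠ t) (suc n) = s 0 * t (suc n) + ((s ∘ suc) ⊠ t) n

  constant : Carrier → ℕ → Carrier
  constant a zero    = a
  constant a (suc n) = 0#

  X : ℕ → Carrier
  X zero    = 0#
  X (suc n) = constant 1# n

  ⊠-cong : ∀ {s s′ t t′} → (∀ n → s n ≈ s′ n) → (∀ n → t n ≈ t′ n) → ∀ n → (s ⊠ t) n ≈ (s′ ⊠ t′) n
  ⊠-cong s≈ t≈ zero    = *-cong (s≈ 0) (t≈ 0)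
  ⊠-cong s≈ t≈ (suc n) = +-cong (*-cong (s≈ 0) (t≈ (suc n))) (⊠-cong (s≈ ∘ suc) t≈ n)

  ⊠-zeroˡ : ∀ {s} t → (∀ n → s n ≈ 0#) → ∀ n → (s ⊠ t) n ≈ 0#
  ⊠-zeroˡ t s≈0 zero    = trans (*-congʳ (s≈0 0)) (zeroˡ _)
  ⊠-zeroˡ t s≈0 (suc n) = trans (+-cong (trans (*-congʳ (s≈0 0)) (zeroˡ _)) (⊠-zeroˡ t (s≈0 ∘ suc) n)) (+-identityʳ _)

  ⊠-linearˡ : ∀ a s t r n → ((λ k → a * s k + t k) ⊠ r) n ≈ a * (s ⊠ r) n + (t ⊠ r) n
  ⊠-linearˡ a s t r zero    =
    solve 4 (λ a s t r → (a :* s :+ t) :* r := a :* (s :* r) :+ t :* r) refl a (s 0) (t 0) (r 0)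
  ⊠-linearˡ a s t r (suc n) = trans (+-congˡ (⊠-linearˡ a (s ∘ suc) (t ∘ suc) r n))
    (solve 6 (λ a s t r p q → (a :* s :+ t) :* r :+ (a :* p :+ q) := a :* (s :* r :+ p) :+ (t :* r :+ q))
      refl a (s 0) (t 0) (r (suc n)) _ _)

  ⊠-sucʳ : ∀ s t n → (s ⊠ t) (suc n) ≈ s (suc n) * t 0 + (s ⊠ (t ∘ suc)) n
  ⊠-sucʳ s t zero    = +-comm _ _
  ⊠-sucʳ s t (suc n) = trans (+-congˡ (⊠-sucʳ (s ∘ suc) t n))
    (solve 3 (λ a b p → a :+ (b :+ p) := b :+ (a :+ p)) refl _ _ _)

  ⊠-comm : ∀ s t n → (s ⊠ t) n ≈ (t ⊠ s) n
  ⊠-comm s t zero    = *-comm _ _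
  ⊠-comm s t (suc n) = trans (+-cong (*-comm _ _) (⊠-comm (s ∘ suc) t n)) (sym (⊠-sucʳ t s n))

  ⊠-distribʳ : ∀ r s t n → ((λ k → s k + t k) ⊠ r) n ≈ (s ⊠ r) n + (t ⊠ r) n
  ⊠-distribʳ r s t n = trans (⊠-cong {t = r} (λ k → +-congʳ (sym (*-identityˡ _))) (λ _ → refl) n)
    (trans (⊠-linearˡ 1# s t r n) (+-congʳ (*-identityˡ _)))

  ⊠-assoc : ∀ s t r n → ((s ⊠ t) ⊠ r) n ≈ (s ⊠ (t ⊠ r)) n
  ⊠-assoc s t r zero    = *-assoc _ _ _
  ⊠-assoc s t r (suc n) = trans (+-congˡ
      (trans (⊠-linearˡ (s 0) (t ∘ suc) ((s ∘ suc) ⊠ t) r n) (+-congˡ (⊠-assoc (s ∘ suc) t r n))))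
    (solve 5 (λ a b c p q → a :* b :* c :+ (a :* p :+ q) := a :* (b :* c :+ p) :+ q) refl (s 0) (t 0) (r (suc n)) _ _)

  constant-⊠ : ∀ a t n → (constant a ⊠ t) n ≈ a * t n
  constant-⊠ a t zero    = refl
  constant-⊠ a t (suc n) = trans (+-congˡ (⊠-zeroˡ t (λ _ → refl) n)) (+-identityʳ _)

  ⊠-identityˡ : ∀ t n → (constant 1# ⊠ t) n ≈ t n
  ⊠-identityˡ t n = trans (constant-⊠ 1# t n) (*-identityˡ _)

  X-⊠-zero : ∀ t → (X ⊠ t) 0 ≈ 0#
  X-⊠-zero t = zeroˡ _

  X-⊠-suc : ∀ t n → (X ⊠ t) (suc n) ≈ t n
  X-⊠-suc t n = trans (+-cong (zeroˡ _) (⊠-identityˡ t n)) (+-identityˡ _)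

  seriesRing : CommutativeRing c ℓ
  seriesRing = record
    { Carrier = ℕ → Carrier
    ; _≈_ = λ s t → ∀ n → s n ≈ t n
    ; _+_ = λ s t n → s n + t n
    ; _*_ = _⊠_
    ; -_ = λ s n → - s n
    ; 0# = λ _ → 0#
    ; 1# = constant 1#
    ; isCommutativeRing = record
      { isRing = record
        { +-isAbelianGroup = Pointwise.isAbelianGroup ℕ +-isAbelianGroup
        ; *-cong     = ⊠-cong
        ; *-assoc    = ⊠-assoc
        ; *-identity = ⊠-identityˡ , λ t n → trans (⊠-comm t (constant 1#) n) (⊠-identityˡ t n)
        ; distrib    = (λ r s t n → trans (⊠-comm r (λ k → s k + t k) n)
                         (trans (⊠-distribʳ r s t n) (+-cong (⊠-comm s r n) (⊠-comm t r n))))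
                     , ⊠-distribʳ
        }
      ; *-comm = ⊠-comm
      }
    }

  -- The operator u d/du. Unlike d/du it does not shift indices, and it is the form in which the
  -- logarithm of an Euler product becomes a generating series of walks.
  θ : (ℕ → Carrier) → ℕ → Carrier
  θ s n = n · s n

  ·-zeroʳ : ∀ n → n · 0# ≈ 0#
  ·-zeroʳ zero    = refl
  ·-zeroʳ (suc n) = trans (+-identityˡ _) (·-zeroʳ n)

  θ-cong : ∀ {s t} → (∀ n → s n ≈ t n) → ∀ n → θ s n ≈ θ t n
  θ-cong s≈t n = ×-congʳ n (s≈t n)

  ·-distrib-+ : ∀ n x y → n · (x + y) ≈ n · x + n · y
  ·-distrib-+ zero    x y = sym (+-identityˡ _)
  ·-distrib-+ (suc n) x y = trans (+-congˡ (·-distrib-+ n x y))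
    (solve 4 (λ x y p q → (x :+ y) :+ (p :+ q) := (x :+ p) :+ (y :+ q)) refl _ _ _ _)

  θ-+ : ∀ s t n → θ (λ k → s k + t k) n ≈ θ s n + θ t n
  θ-+ s t n = ·-distrib-+ n (s n) (t n)

  θ-* : ∀ s t n → θ (s ⊠ t) n ≈ (θ s ⊠ t) n + (s ⊠ θ t) n
  θ-* s t zero    = sym (trans (+-cong (zeroˡ _) (zeroʳ _)) (+-identityʳ _))
  θ-* s t (suc n) = begin
    suc n · (s 0 * t (suc n) + p)
      ≈⟨ ·-distrib-+ (suc n) _ _ ⟩
    suc n · (s 0 * t (suc n)) + (p + n · p)
      ≈⟨ +-cong (sym (×-comm-* (suc n) _ _)) (+-congˡ (θ-* s′ t n)) ⟩
    s 0 * (suc n · t (suc n)) + (p + ((θ s′ ⊠ t) n + (s′ ⊠ θ t) n))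
      ≈⟨ solve 5 (λ z a p q r → a :+ (p :+ (q :+ r)) := (con (+ 0) :* z :+ (con (+ 1) :* p :+ q)) :+ (a :+ r))
          refl (t (suc n)) _ _ _ _ ⟩
    (0# * t (suc n) + (1# * p + (θ s′ ⊠ t) n)) + (s 0 * (suc n · t (suc n)) + (s′ ⊠ θ t) n)
      ≈⟨ +-congʳ (+-congˡ (trans (sym (⊠-linearˡ 1# s′ (θ s′) t n))
           (⊠-cong {t = t} (λ k → +-congʳ (*-identityˡ (s′ k))) (λ _ → refl) n))) ⟩
    _ ∎
    where
    s′ = s ∘ suc
    p = (s′ ⊠ t) n

-- Polynomial functions on a field of characteristic zero

record IsFieldOfCharacteristicZero {c ℓ} (R : CommutativeRing c ℓ) : Set (c ⊔ ℓ) where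
  open CommutativeRing R using (_≈_; _*_; 0#; 1#; semiring)
  field
    inverse            : ∀ x → ¬ x ≈ 0# → ∃[ y ] x * y ≈ 1#
    0#?                : ∀ x → Dec (x ≈ 0#)
    characteristicZero : ∀ n → RawSemiringDefs._×_ (Semiring.rawSemiring semiring) n 1# ≈ 0# → n ≡ 0

module PolynomialFunctions {c ℓ} (R : CommutativeRing c ℓ) (isField : IsFieldOfCharacteristicZero R) where
  open CommutativeRing R hiding (zero)
  open IsFieldOfCharacteristicZero isField public
  open IntegerSolver R
  open PowerSeries R
  open Matrices R using (det)
  open import Algebra.Properties.AbelianGroup +-abelianGroup using (x∙y⁻¹≈ε⇒x≈y; x≈y⇒x∙y⁻¹≈ε)
  open import Algebra.Properties.Semiring.Mult semiring using (×-homo-+; ×1-homo-*)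
  open import Algebra.Definitions.RawSemiring (Semiring.rawSemiring semiring) using (sum; _^_) renaming (_×_ to _·_)
  open import Relation.Binary.Reasoning.Setoid setoid

  private
    module S = CommutativeRing seriesRing
    module SM = Matrices seriesRing
    module SD = RawSemiringDefs (Semiring.rawSemiring S.semiring)

  x-y≈0⇒x≈y : ∀ {x y} → x - y ≈ 0# → x ≈ y
  x-y≈0⇒x≈y = x∙y⁻¹≈ε⇒x≈y _ _

  x≈y⇒x-y≈0 : ∀ {x y} → x ≈ y → x - y ≈ 0#
  x≈y⇒x-y≈0 = x≈y⇒x∙y⁻¹≈ε

  *-cancelˡ-nonzero : ∀ {x y z} → ¬ x ≈ 0# → x * y ≈ x * z → y ≈ z
  *-cancelˡ-nonzero {x} {y} {z} x≉0 xy≈xz with w , xw≈1 ← inverse x x≉0 = begin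
    y             ≈⟨ *-identityˡ y ⟨
    1# * y        ≈⟨ *-congʳ xw≈1 ⟨
    x * w * y     ≈⟨ solve 3 (λ x w y → x :* w :* y := w :* (x :* y)) refl x w y ⟩
    w * (x * y)   ≈⟨ *-congˡ xy≈xz ⟩
    w * (x * z)   ≈⟨ solve 3 (λ x w y → w :* (x :* y) := x :* w :* y) refl x w z ⟩
    x * w * z     ≈⟨ *-congʳ xw≈1 ⟩
    1# * z        ≈⟨ *-identityˡ z ⟩
    z             ∎

  xy≈0⇒y≈0 : ∀ {x y} → ¬ x ≈ 0# → x * y ≈ 0# → y ≈ 0#
  xy≈0⇒y≈0 x≉0 xy≈0 = *-cancelˡ-nonzero x≉0 (trans xy≈0 (sym (zeroʳ _)))

  xy≉0 : ∀ {x y} → ¬ x ≈ 0# → ¬ y ≈ 0# → ¬ x * y ≈ 0#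
  xy≉0 x≉0 y≉0 xy≈0 = y≉0 (xy≈0⇒y≈0 x≉0 xy≈0)

  1≉0 : ¬ 1# ≈ 0#
  1≉0 1≈0 with () ← characteristicZero 1 (trans (+-identityʳ 1#) 1≈0)

  1^ : ∀ n → 1# ^ n ≈ 1#
  1^ zero    = refl
  1^ (suc n) = trans (*-identityˡ _) (1^ n)

  ^≉0 : ∀ {x} n → ¬ x ≈ 0# → ¬ x ^ n ≈ 0#
  ^≉0 zero    x≉0 = 1≉0
  ^≉0 (suc n) x≉0 = xy≉0 x≉0 (^≉0 n x≉0)

  ι : ℕ → Carrier
  ι n = n · 1#

  ι-+ : ∀ m n → ι (m ℕ.+ n) ≈ ι m + ι n
  ι-+ = ×-homo-+ 1#

  ι-* : ∀ m n → ι (m ℕ.* n) ≈ ι m * ι n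
  ι-* = ×1-homo-*

  ι-injective : ∀ m n → ι m ≈ ι n → m ≡ n
  ι-injective zero    zero    _ = ≡.refl
  ι-injective zero    (suc n) e = ≡.sym (characteristicZero (suc n) (sym e))
  ι-injective (suc m) zero    e = characteristicZero (suc m) e
  ι-injective (suc m) (suc n) e = ≡.cong suc (ι-injective m n (begin
    ι m               ≈⟨ solve 1 (λ a → a := con (+ 1) :+ a :- con (+ 1)) refl (ι m) ⟩
    1# + ι m - 1#     ≈⟨ +-congʳ e ⟩
    1# + ι n - 1#     ≈⟨ solve 1 (λ a → a := con (+ 1) :+ a :- con (+ 1)) refl (ι n) ⟨
    ι n               ∎))

  ιsuc≉0 : ∀ n → ¬ ι (suc n) ≈ 0#
  ιsuc≉0 n e with () ← characteristicZero (suc n) e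

  -- Ties a function on the field to its coefficient sequence by a finite Horner scheme, whose depth
  -- bounds the degree. Equations are required only up to `_≈_`, pointwise, so functions need never
  -- be equal intensionally.
  data Represents : (Carrier → Carrier) → (ℕ → Carrier) → Set (c ⊔ ℓ) where
    vanishing : ∀ {f s} → (∀ x → f x ≈ 0#) → (∀ n → s n ≈ 0#) → Represents f s
    horner    : ∀ {f s g t} → Represents g t →
                (∀ x → f x ≈ s 0 + x * g x) → (∀ n → s (suc n) ≈ t n) → Represents f s

  represents-cong : ∀ {f g s t} → (∀ x → f x ≈ g x) → (∀ n → s n ≈ t n) → Represents f s → Represents g t
  represents-cong f≈g s≈t (vanishing f≈0 s≈0) =
    vanishing (λ x → trans (sym (f≈g x)) (f≈0 x)) (λ n → trans (sym (s≈t n)) (s≈0 n))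
  represents-cong f≈g s≈t (horner r f≈ s≈) =
    horner r (λ x → trans (sym (f≈g x)) (trans (f≈ x) (+-congʳ (s≈t 0)))) (λ n → trans (sym (s≈t (suc n))) (s≈ n))

  represents-constant : ∀ a → Represents (λ _ → a) (constant a)
  represents-constant a = horner (vanishing {λ _ → 0#} (λ _ → refl) (λ _ → refl))
    (λ x → sym (trans (+-congˡ (zeroʳ x)) (+-identityʳ a))) (λ _ → refl)

  represents-X : Represents (λ x → x) X
  represents-X = horner (represents-constant 1#)
    (λ x → sym (trans (+-identityˡ _) (*-identityʳ x))) (λ _ → refl)

  represents-+ : ∀ {f g s t} → Represents f s → Represents g t →
                 Represents (λ x → f x + g x) (λ n → s n + t n)
  represents-+ (vanishing f≈0 s≈0) r =
    represents-cong (λ x → sym (trans (+-congʳ (f≈0 x)) (+-identityˡ _)))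
                    (λ n → sym (trans (+-congʳ (s≈0 n)) (+-identityˡ _))) r
  represents-+ r@(horner _ _ _) (vanishing g≈0 t≈0) =
    represents-cong (λ x → sym (trans (+-congˡ (g≈0 x)) (+-identityʳ _)))
                    (λ n → sym (trans (+-congˡ (t≈0 n)) (+-identityʳ _))) r
  represents-+ {s = s} {t} (horner {g = g} r f≈ s≈) (horner {g = h} r′ g≈ t≈) = horner (represents-+ r r′)
    (λ x → trans (+-cong (f≈ x) (g≈ x))
      (solve 5 (λ a b x p q → (a :+ x :* p) :+ (b :+ x :* q) := (a :+ b) :+ x :* (p :+ q)) refl (s 0) (t 0) x (g x) (h x)))
    (λ n → +-cong (s≈ n) (t≈ n))

  represents-scale : ∀ a {f s} → Represents f s → Represents (λ x → a * f x) (λ n → a * s n)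
  represents-scale a (vanishing f≈0 s≈0) =
    vanishing (λ x → trans (*-congˡ (f≈0 x)) (zeroʳ a)) (λ n → trans (*-congˡ (s≈0 n)) (zeroʳ a))
  represents-scale a {s = s} (horner {g = g} r f≈ s≈) = horner (represents-scale a r)
    (λ x → trans (*-congˡ (f≈ x)) (solve 4 (λ a s x g → a :* (s :+ x :* g) := a :* s :+ x :* (a :* g)) refl a (s 0) x (g x)))
    (λ n → *-congˡ (s≈ n))

  represents-* : ∀ {f g s t} → Represents f s → Represents g t → Represents (λ x → f x * g x) (s ⊠ t)
  represents-* {t = t} (vanishing f≈0 s≈0) r =
    vanishing (λ x → trans (*-congʳ (f≈0 x)) (zeroˡ _)) (⊠-zeroˡ t s≈0)
  represents-* {f} {g} {s} {t} (horner {g = f′} {t = s′} r f≈ s≈) r′ =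
    represents-cong
      (λ x → trans (solve 4 (λ a x p q → a :* q :+ (con (+ 0) :+ x :* (p :* q)) := (a :+ x :* p) :* q) refl
          (s 0) x (f′ x) (g x))
                   (*-congʳ (sym (f≈ x))))
      (λ { zero → +-identityʳ _ ; (suc n) → +-congˡ (⊠-cong {t = t} (λ k → sym (s≈ k)) (λ _ → refl) n) })
      (represents-+ (represents-scale (s 0) r′)
        (horner {s = λ { zero → 0# ; (suc n) → (s′ ⊠ t) n }} (represents-* r r′) (λ x → refl) (λ n → refl)))

  represents-neg : ∀ {f s} → Represents f s → Represents (λ x → - f x) (λ n → - s n)
  represents-neg r = represents-cong (λ x → solve 1 (λ a → con -[1+ 0 ] :* a := :- a) refl _)
                                     (λ n → solve 1 (λ a → con -[1+ 0 ] :* a := :- a) refl _) (represents-scale (- 1#) r)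

  represents-sum : ∀ {n} {f : Fin n → Carrier → Carrier} {s : Fin n → ℕ → Carrier} →
                   (∀ i → Represents (f i) (s i)) → Represents (λ x → sum (λ i → f i x)) (SD.sum s)
  represents-sum {zero}  r = vanishing (λ _ → refl) (λ _ → refl)
  represents-sum {suc n} r = represents-+ (r zero) (represents-sum (r ∘ suc))

  represents-^ : ∀ {f s} n → Represents f s → Represents (λ x → f x ^ n) (s SD.^ n)
  represents-^ zero    r = represents-constant 1#
  represents-^ (suc n) r = represents-* r (represents-^ n r)

  -- One Laplace expansion is read twice, in the field at each `x` and in the ring of series. This
  -- is how a determinant of series is recognised as the coefficients of a determinant of functions.
  represents-det : ∀ {n} {M : Carrier → Fin n → Fin n → Carrier} {N : Fin n → Fin n → ℕ → Carrier} →
                   (∀ i j → Represents (λ x → M x i j) (N i j)) → Represents (λ x → det (M x)) (SM.det N)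
  represents-det {zero}  r = represents-constant 1#
  represents-det {suc n} r = represents-sum λ j →
    represents-* (represents-* (represents-^ (toℕ j) (represents-neg (represents-constant 1#))) (r zero j))
                 (represents-det (λ i k → r (suc i) (punchIn j k)))

  -- The number counts coefficients, so the degree is strictly smaller. Coefficients are existential
  -- here, because division by x - p keeps producing new ones.
  BoundedDegree : ℕ → (Carrier → Carrier) → Set (c ⊔ ℓ)
  BoundedDegree zero    f = Level.Lift c (∀ x → f x ≈ 0#)
  BoundedDegree (suc d) f = ∃[ a ] ∃[ g ] BoundedDegree d g × (∀ x → f x ≈ a + x * g x)

  bounded-weaken : ∀ d {f} → BoundedDegree d f → BoundedDegree (suc d) f
  bounded-weaken zero    (Level.lift f≈0)  = 0# , (λ _ → 0#) , Level.lift (λ _ → refl) ,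
    λ x → trans (f≈0 x) (sym (trans (+-identityˡ _) (zeroʳ x)))
  bounded-weaken (suc d) (a , g , b , f≈) = a , g , bounded-weaken d b , f≈

  bounded-combine : ∀ d a {f g} → BoundedDegree d f → BoundedDegree d g → BoundedDegree d (λ x → f x + a * g x)
  bounded-combine zero    a (Level.lift f≈0) (Level.lift g≈0) =
    Level.lift λ x → trans (+-cong (f≈0 x) (trans (*-congˡ (g≈0 x)) (zeroʳ a))) (+-identityʳ 0#)
  bounded-combine (suc d) a (f₀ , f′ , b , f≈) (g₀ , g′ , b′ , g≈) =
    f₀ + a * g₀ , _ , bounded-combine d a b b′ ,
    λ x → trans (+-cong (f≈ x) (*-congˡ (g≈ x)))
      (solve 6 (λ a p q x f g → (p :+ x :* f) :+ a :* (q :+ x :* g) := (p :+ a :* q) :+ x :* (f :+ a :* g)) refl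
          a f₀ g₀ x (f′ x) (g′ x))

  bounded : ∀ {f s} → Represents f s → ∃[ d ] BoundedDegree d f
  bounded (vanishing f≈0 _) = 0 , Level.lift f≈0
  bounded (horner {s = s} {g = g} r f≈ _) = suc (proj₁ (bounded r)) , s 0 , g , proj₂ (bounded r) , f≈

  bounded-divide : ∀ d {f} p → BoundedDegree (suc d) f →
                   ∃[ h ] BoundedDegree d h × (∀ x → f x ≈ f p + (x - p) * h x)
  bounded-divide zero    p (a , g , b , f≈) = (λ _ → 0#) , Level.lift (λ _ → refl) , λ x → begin
    _                       ≈⟨ trans (f≈ x) (+-congˡ (trans (*-congˡ (Level.lower b x)) (zeroʳ x))) ⟩
    a + 0#                  ≈⟨ solve 3 (λ a p x → a :+ con (+ 0) := (a :+ p :* con (+ 0)) :+ (x :- p) :* con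
        (+ 0)) refl a p x ⟩
    (a + p * 0#) + (x - p) * 0#  ≈⟨ +-congʳ (sym (trans (f≈ p) (+-congˡ (*-congˡ (Level.lower b p))))) ⟩
    _                       ∎
  bounded-divide (suc d) {f} p (a , g , b , f≈) with k , b′ , g≈ ← bounded-divide d p b =
    -- From f = a + x g and g = g(p) + (x - p) k follows f - f(p) = (x - p)(g + p k).
    (λ x → g x + p * k x) , bounded-combine (suc d) p b (bounded-weaken d b′) , λ x → begin
    f x                                      ≈⟨ f≈ x ⟩
    a + x * g x                              ≈⟨ solve 4
        (λ a x p g → a :+ x :* g := a :+ (x :- p) :* g :+ p :* g) refl a x p (g x) ⟩
    a + (x - p) * g x + p * g x              ≈⟨ +-congˡ (*-congˡ (g≈ x)) ⟩
    a + (x - p) * g x + p * (g p + (x - p) * k x)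
      ≈⟨ solve 6 (λ a x p gx gp k → a :+ (x :- p) :* gx :+ p :* (gp :+ (x :- p) :* k)
            := (a :+ p :* gp) :+ (x :- p) :* (gx :+ p :* k)) refl a x p (g x) (g p) (k x) ⟩
    (a + p * g p) + (x - p) * (g x + p * k x)   ≈⟨ +-congʳ (sym (f≈ p)) ⟩
    f p + (x - p) * (g x + p * k x)             ∎

  -- Splitting off x - p₀ leaves a quotient of smaller degree that vanishes at the remaining points.
  -- An infinite family of points is used, so that its tail serves the quotient without counting
  -- zeros.
  bounded-vanish : ∀ d {f} (p : ℕ → Carrier) → (∀ i j → p i ≈ p j → i ≡ j) →
                   BoundedDegree d f → (∀ i → f (p i) ≈ 0#) → ∀ x → f x ≈ 0#
  bounded-vanish zero    p p-inj b f≈0 = Level.lower b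
  bounded-vanish (suc d) {f} p p-inj b f≈0 x with h , b′ , f≈ ← bounded-divide d (p 0) b =
    trans (f≈ x) (trans (+-cong (f≈0 0) (trans (*-congˡ (bounded-vanish d (p ∘ suc)
      (λ i j e → ℕ.suc-injective (p-inj (suc i) (suc j) e)) b′ h≈0 x)) (zeroʳ _))) (+-identityʳ 0#))
    where
    h≈0 : ∀ i → h (p (suc i)) ≈ 0#
    h≈0 i = xy≈0⇒y≈0 {p (suc i) - p 0} (λ e → ⊥-elim (1+n≢0 (p-inj (suc i) 0 (x-y≈0⇒x≈y e))))
      (begin
        (p (suc i) - p 0) * h (p (suc i))             ≈⟨ trans (+-congʳ (f≈0 0)) (+-identityˡ _) ⟨
        f (p 0) + (p (suc i) - p 0) * h (p (suc i))   ≈⟨ f≈ (p (suc i)) ⟨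
        f (p (suc i))                                 ≈⟨ f≈0 (suc i) ⟩
        0#                                            ∎)
      where
      1+n≢0 : ∀ {n} → suc n ≢ 0
      1+n≢0 ()

  record Polynomial (f : Carrier → Carrier) : Set (c ⊔ ℓ) where
    constructor polynomial
    field
      {series}   : ℕ → Carrier
      represents : Represents f series

  open Polynomial public

  infixl 6 _+ᴾ_
  infixl 7 _*ᴾ_
  infixr 8 _^ᴾ_
  infix  8 -ᴾ_

  constᴾ : ∀ {a} → Polynomial (λ _ → a)
  constᴾ {a} = polynomial (represents-constant a)

  idᴾ : Polynomial (λ x → x)
  idᴾ = polynomial represents-X

  _+ᴾ_ : ∀ {f g} → Polynomial f → Polynomial g → Polynomial (λ x → f x + g x)
  polynomial r +ᴾ polynomial r′ = polynomial (represents-+ r r′)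

  _*ᴾ_ : ∀ {f g} → Polynomial f → Polynomial g → Polynomial (λ x → f x * g x)
  polynomial r *ᴾ polynomial r′ = polynomial (represents-* r r′)

  -ᴾ_ : ∀ {f} → Polynomial f → Polynomial (λ x → - f x)
  -ᴾ polynomial r = polynomial (represents-neg r)

  _^ᴾ_ : ∀ {f} → Polynomial f → ∀ n → Polynomial (λ x → f x ^ n)
  polynomial r ^ᴾ n = polynomial (represents-^ n r)

  detᴾ : ∀ {n} {M : Carrier → Fin n → Fin n → Carrier} → (∀ i j → Polynomial (λ x → M x i j)) →
         Polynomial (λ x → det (M x))
  detᴾ r = polynomial (represents-det (λ i j → represents (r i j)))

  polynomial-vanish : ∀ {f} → Polynomial f → (p : ℕ → Carrier) → (∀ i j → p i ≈ p j → i ≡ j) →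
                      (∀ i → f (p i) ≈ 0#) → ∀ x → f x ≈ 0#
  polynomial-vanish P p p-inj = bounded-vanish _ p p-inj (proj₂ (bounded (represents P)))

  -- The points a + 1, a + 2, ... are distinct in characteristic zero and avoid `a`. With a = 0 this
  -- extends identities obtained by dividing by u, or by substituting 1/u, to u = 0.
  vanish-except : ∀ {f} → Polynomial f → ∀ a → (∀ x → ¬ x ≈ a → f x ≈ 0#) → ∀ x → f x ≈ 0#
  vanish-except P a f≈0 = polynomial-vanish P (λ n → a + ι (suc n))
    (λ i j e → ℕ.suc-injective (ι-injective (suc i) (suc j) (+-cancelˡ a e)))
    (λ i → f≈0 _ λ e → ιsuc≉0 i (+-cancelˡ a (trans e (sym (+-identityʳ a)))))
    where
    +-cancelˡ : ∀ a {x y} → a + x ≈ a + y → x ≈ y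
    +-cancelˡ a {x} {y} e = begin
      x               ≈⟨ solve 2 (λ a x → x := a :+ x :- a) refl a x ⟩
      a + x - a       ≈⟨ +-congʳ e ⟩
      a + y - a       ≈⟨ solve 2 (λ a x → x := a :+ x :- a) refl a y ⟨
      y               ∎

  ≈-except : ∀ {f g} → Polynomial f → Polynomial g → ∀ a → (∀ x → ¬ x ≈ a → f x ≈ g x) → ∀ x → f x ≈ g x
  ≈-except P Q a f≈g x = x-y≈0⇒x≈y (vanish-except (P +ᴾ (-ᴾ Q)) a (λ y y≉a → x≈y⇒x-y≈0 (f≈g y y≉a)) x)

  -- s₀ is the value at 0, hence 0. What remains is x g(x) = 0; away from 0 the factor x cancels,
  -- and `vanish-except` supplies g(0) = 0.
  represents-zero : ∀ {f s} → Represents f s → (∀ x → f x ≈ 0#) → ∀ n → s n ≈ 0#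
  represents-zero (vanishing _ s≈0)   f≈0 n = s≈0 n
  represents-zero {f} {s} (horner {g = g} r f≈ s≈) f≈0 = λ
    { zero    → s₀≈0
    ; (suc n) → trans (s≈ n) (represents-zero r g≈0 n) }
    where
    s₀≈0 : s 0 ≈ 0#
    s₀≈0 = begin
      s 0              ≈⟨ solve 2 (λ s g → s := s :+ con (+ 0) :* g) refl (s 0) (g 0#) ⟩
      s 0 + 0# * g 0#  ≈⟨ f≈ 0# ⟨
      f 0#             ≈⟨ f≈0 0# ⟩
      0#               ∎
    g≈0 : ∀ x → g x ≈ 0#
    g≈0 = vanish-except (polynomial r) 0# λ x x≉0 → xy≈0⇒y≈0 x≉0 (begin
      x * g x          ≈⟨ +-identityˡ _ ⟨
      0# + x * g x     ≈⟨ +-congʳ s₀≈0 ⟨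
      s 0 + x * g x    ≈⟨ f≈ x ⟨
      f x              ≈⟨ f≈0 x ⟩
      0#               ∎)

  zero-represents : ∀ {f s} → Represents f s → (∀ n → s n ≈ 0#) → ∀ x → f x ≈ 0#
  zero-represents (vanishing f≈0 _)   s≈0 x = f≈0 x
  zero-represents (horner r f≈ s≈) s≈0 x =
    trans (f≈ x) (trans (+-cong (s≈0 0)
        (trans (*-congˡ (zero-represents r (λ n → trans (sym (s≈ n)) (s≈0 (suc n))) x)) (zeroʳ x))) (+-identityʳ 0#))

  represents-injective : ∀ {f g s t} → Represents f s → Represents g t → (∀ x → f x ≈ g x) → ∀ n → s n ≈ t n
  represents-injective r r′ f≈g n =
    x-y≈0⇒x≈y (represents-zero (represents-+ r (represents-neg r′)) (λ x → x≈y⇒x-y≈0 (f≈g x)) n)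

  represents-functional : ∀ {f g s t} → Represents f s → Represents g t → (∀ n → s n ≈ t n) → ∀ x → f x ≈ g x
  represents-functional r r′ s≈t x =
    x-y≈0⇒x≈y (zero-represents (represents-+ r (represents-neg r′)) (λ n → x≈y⇒x-y≈0 (s≈t n)) x)

  -- Evaluation at 0 kills the constant coefficient of f because g(0) ≠ 0. Then f = x h with h g =
  -- 0, and the induction continues on the shorter Horner scheme of h.
  product-vanish : ∀ {f g} → Polynomial f → Polynomial g → ¬ g 0# ≈ 0# → (∀ x → f x * g x ≈ 0#) → ∀ x → f x ≈ 0#
  product-vanish {f} {g} (polynomial r) Q g₀≉0 = go r
    where
    go : ∀ {f s} → Represents f s → (∀ x → f x * g x ≈ 0#) → ∀ x → f x ≈ 0#
    go (vanishing f≈0 _) fg≈0 = f≈0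
    go {f} {s} (horner {g = h} r f≈ _) fg≈0 x = trans (f≈xh x) (trans (*-congˡ (go r hg≈0 x)) (zeroʳ x))
      where
      s₀≈0 : s 0 ≈ 0#
      s₀≈0 = begin
        s 0              ≈⟨ solve 2 (λ s g → s := s :+ con (+ 0) :* g) refl (s 0) (h 0#) ⟩
        s 0 + 0# * h 0#  ≈⟨ f≈ 0# ⟨
        f 0#             ≈⟨ xy≈0⇒y≈0 g₀≉0 (trans (*-comm _ _) (fg≈0 0#)) ⟩
        0#               ∎
      f≈xh : ∀ x → f x ≈ x * h x
      f≈xh x = trans (f≈ x) (trans (+-congʳ s₀≈0) (+-identityˡ _))
      hg≈0 : ∀ x → h x * g x ≈ 0#
      hg≈0 = vanish-except (polynomial r *ᴾ Q) 0# λ x x≉0 →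
        xy≈0⇒y≈0 x≉0 (trans (sym (*-assoc _ _ _)) (trans (*-congʳ (sym (f≈xh x))) (fg≈0 x)))

  product-cancelʳ : ∀ {f f′ g} → Polynomial f → Polynomial f′ → Polynomial g → ¬ g 0# ≈ 0# →
                    (∀ x → f x * g x ≈ f′ x * g x) → ∀ x → f x ≈ f′ x
  product-cancelʳ {f} {f′} {g} P P′ Q g₀≉0 e x = x-y≈0⇒x≈y (product-vanish (P +ᴾ (-ᴾ P′)) Q g₀≉0
    (λ y → trans (solve 3 (λ a b c → (a :- b) :* c := a :* c :- b :* c) refl (f y) (f′ y) (g y)) (x≈y⇒x-y≈0 (e y))) x)

  -- Cancel x from both sides until one exponent is 0; if the other were not, evaluation at 0 would
  -- contradict f(0) ≠ 0 or g(0) ≠ 0. Applied after u = 1/v, this reads off degrees.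
  order-unique : ∀ {f g} → Polynomial f → Polynomial g → ¬ f 0# ≈ 0# → ¬ g 0# ≈ 0# → ∀ a b →
                 (∀ x → ¬ x ≈ 0# → x ^ a * f x ≈ x ^ b * g x) → a ≡ b × (∀ x → f x ≈ g x)
  order-unique {f} {g} P Q f₀≉0 g₀≉0 zero zero e = ≡.refl , ≈-except P Q 0# λ x x≉0 →
    trans (sym (*-identityˡ _)) (trans (e x x≉0) (*-identityˡ _))
  order-unique {f} {g} P Q f₀≉0 g₀≉0 zero (suc b) e = ⊥-elim (f₀≉0 (trans (sym (*-identityˡ _))
    (trans (≈-except (constᴾ *ᴾ P) ((idᴾ ^ᴾ suc b) *ᴾ Q) 0# e 0#) (trans (*-congʳ (zeroˡ _)) (zeroˡ _)))))
  order-unique {f} {g} P Q f₀≉0 g₀≉0 (suc a) zero e = ⊥-elim (g₀≉0 (trans (sym (*-identityˡ _))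
    (trans (≈-except (constᴾ *ᴾ Q) ((idᴾ ^ᴾ suc a) *ᴾ P) 0# (λ x x≉0 → sym (e x x≉0)) 0#)
        (trans (*-congʳ (zeroˡ _)) (zeroˡ _)))))
  order-unique {f} {g} P Q f₀≉0 g₀≉0 (suc a) (suc b) e
    with a≡b , f≈g ← order-unique P Q f₀≉0 g₀≉0 a b (λ x x≉0 → *-cancelˡ-nonzero x≉0
           (trans (sym (*-assoc _ _ _)) (trans (e x x≉0) (*-assoc _ _ _))))
    = ≡.cong suc a≡b , f≈g

-- Matrices of a graph and sums over its vertices

module GraphMatrices {c ℓ} (R : CommutativeRing c ℓ) where
  open CommutativeRing R hiding (zero)
  open Determinants R
  open Matrices R
  open import Algebra.Properties.Semiring.Sum semiring

  identity-diagonal : ∀ {n} (i : Fin n) → identity i i ≡ 1#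
  identity-diagonal i = ≡.cong (λ b → if b then 1# else 0#) (dec-true (i Fin.≟ i) ≡.refl)

  identity-offDiagonal : ∀ {n} {i j : Fin n} → i ≢ j → identity i j ≡ 0#
  identity-offDiagonal {i = i} {j} i≢j = ≡.cong (λ b → if b then 1# else 0#) (dec-false (i Fin.≟ j) i≢j)

  sum-identityʳ : ∀ {n} (f : Fin n → Carrier) k → sum (λ j → f j * identity j k) ≈ f k
  sum-identityʳ f k = trans
    (sum-only k λ j j≢k → trans (*-congˡ (reflexive (identity-offDiagonal j≢k))) (zeroʳ _))
    (trans (*-congˡ (reflexive (identity-diagonal k))) (*-identityʳ _))

  sum-identityˡ : ∀ {n} (f : Fin n → Carrier) k → sum (λ j → identity k j * f j) ≈ f k
  sum-identityˡ f k = trans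
    (sum-only k λ j j≢k → trans (*-congʳ (reflexive (identity-offDiagonal (j≢k ∘ ≡.sym)))) (zeroˡ _))
    (trans (*-congʳ (reflexive (identity-diagonal k))) (*-identityˡ _))

  sum-linear : ∀ {n} a (f g : Fin n → Carrier) → sum (λ i → a * f i + g i) ≈ a * sum f + sum g
  sum-linear a f g = trans (∑-distrib-+ (λ i → a * f i) g) (+-congʳ (sym (*-distribˡ-sum a f)))

  sum² : ∀ {m n} → (Fin m → Fin n → Carrier) → Carrier
  sum² f = sum (λ i → sum (f i))

  sum²-cong : ∀ {m n} {f g : Fin m → Fin n → Carrier} → (∀ i j → f i j ≈ g i j) → sum² f ≈ sum² g
  sum²-cong {m} {n} f≈g = sum-cong-≋ {m} (λ i → sum-cong-≋ {n} (f≈g i))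

  sum²-linear : ∀ {m n} a (f g : Fin m → Fin n → Carrier) →
                sum² (λ i j → a * f i j + g i j) ≈ a * sum² f + sum² g
  sum²-linear {m} a f g = trans (sum-cong-≋ {m} (λ i → sum-linear a (f i) (g i)))
      (sum-linear a (λ i → sum (f i)) (λ i → sum (g i)))

  module _ (G : Graph) where
    open Graph G using (adj; symmetric)

    valency : Fin (order G) → Carrier
    valency i = sum (adjacency G i)

    adjacency-true : ∀ {i j} → adj i j ≡ true → adjacency G i j ≡ 1#
    adjacency-true e = ≡.cong (λ b → if b then 1# else 0#) e

    adjacency-symmetric : ∀ i j → adjacency G i j ≡ adjacency G j i
    adjacency-symmetric i j = ≡.cong (λ b → if b then 1# else 0#) (symmetric i j)

    -- Recursions for walks hold only along arcs; the factor `adjacency G i j` removes all other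
    -- pairs from the sums.
    adjacency-*-cong : ∀ i j {x y} → (adj i j ≡ true → x ≈ y) → adjacency G i j * x ≈ adjacency G i j * y
    adjacency-*-cong i j x≈y with adj i j
    ... | true  = *-congˡ (x≈y ≡.refl)
    ... | false = trans (zeroˡ _) (sym (zeroˡ _))

    -- det (bass u (valency − 1)) is the determinant in Bass's formula, and
    -- bass u 0 = I − uA.
    bass : Carrier → (Fin (order G) → Carrier) → Matrix (order G)
    bass u p i j = (1# + u * u * p i) * identity i j - u * adjacency G i j

-- Bass's formula as an identity of power series

module BassFormula {c ℓ} (R : CommutativeRing c ℓ) (G : Graph) where
  open PowerSeries R
  open CommutativeRing seriesRing hiding (zero)
  open IntegerSolver seriesRing
  open Determinants seriesRing
  open GraphMatrices seriesRing
  open Matrices seriesRing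
  open import Algebra.Properties.Semiring.Sum semiring
  open import Algebra.Definitions.RawSemiring (Semiring.rawSemiring semiring) using (_^_) renaming (_×_ to _·_)
  open import Relation.Binary.Reasoning.Setoid setoid
  open Derivation θ θ-cong θ-+ θ-*
  open Graph G using (adj; symmetric; irreflexive)
  private module K = CommutativeRing R

  A : Matrix (order G)
  A = adjacency G

  q : Fin (order G) → Carrier
  q i = valency G i - 1#

  M : Matrix (order G)
  M = bass G X q

  M-apply : ∀ (z : Fin (order G) → Carrier) a →
            sum (λ b → M a b * z b) ≈ (1# - X * X) * z a + X * X * (valency G a * z a) - X * sum (λ b → A a b * z b)
  M-apply z a = begin
    sum (λ b → M a b * z b)
      ≈⟨ sum-cong-≋ {order G} (λ b → solve 5
          (λ e i x α z → (e :* i :- x :* α) :* z := e :* (i :* z) :+ (:- x) :* (α :* z)) refl (1# + X * X * q a)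
          (identity a b) X (A a b) (z b)) ⟩
    sum (λ b → e * (identity a b * z b) + (- X) * (A a b * z b))
      ≈⟨ trans (sum-linear e (λ b → identity a b * z b) _)
          (+-cong (*-congˡ (sum-identityˡ z a)) (sym (*-distribˡ-sum (- X) (λ b → A a b * z b)))) ⟩
    e * z a + (- X) * s
      ≈⟨ solve 4 (λ x v z s → (con (+ 1) :+ x :* x :* (v :- con (+ 1))) :* z :+ (:- x) :* s
           := (con (+ 1) :- x :* x) :* z :+ x :* x :* (v :* z) :- x :* s) refl X (valency G a) (z a) s ⟩
    _ ∎
    where
    e = 1# + X * X * q a
    s = sum (λ b → A a b * z b)

  module _ (V : Matrix (order G)) (VM≈I : ∀ i j → sum (λ k → V i k * M k j) ≈ identity i j) where

    invert : ∀ (z y : Fin (order G) → Carrier) → (∀ a → sum (λ b → M a b * z b) ≈ y a) →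
             ∀ a → z a ≈ sum (λ j → V a j * y j)
    invert z y Mz≈y a = begin
      z a                                                ≈⟨ sum-identityˡ z a ⟨
      sum (λ k → identity a k * z k)                     ≈⟨ sum-cong-≋ {n} (λ k → *-congʳ {z k} (VM≈I a k)) ⟨
      sum (λ k → sum (λ j → V a j * M j k) * z k)        ≈⟨ sum-cong-≋ {n}
          (λ k → *-distribʳ-sum (z k) (λ j → V a j * M j k)) ⟩
      sum (λ k → sum (λ j → V a j * M j k * z k))        ≈⟨ ∑-comm {n} {n} (λ k j → V a j * M j k * z k) ⟩
      sum (λ j → sum (λ k → V a j * M j k * z k))        ≈⟨ sum²-cong {n} {n} (λ j k → *-assoc (V a j) (M j k) (z k)) ⟩
      sum (λ j → sum (λ k → V a j * (M j k * z k)))      ≈⟨ sum-cong-≋ {n}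
          (λ j → trans (sym (*-distribˡ-sum (V a j) (λ k → M j k * z k))) (*-congˡ {V a j} (Mz≈y j))) ⟩
      sum (λ j → V a j * y j)                            ∎
      where n = order G

    -- Y is the series of backtrackless walks from the arc (a , b) to the arc (c , d).
    module _ {c d} (A-cd : adj c d ≡ true) (Y : Matrix (order G))
      (Y-step : ∀ a b → adj a b ≡ true →
                Y a b ≈ identity a c * identity b d + X * (sum (λ x → A b x * Y b x) - Y b a)) where

      -- Walks starting at the vertex `a`, whatever their first arc. Passing to them brings in the
      -- matrix `M` indexed by vertices in place of one indexed by arcs.
      Z : Fin (order G) → Carrier
      Z a = sum (λ x → A a x * Y a x)

      -- The recursion at (a , b) subtracts the backtracking term `Y b a`; the recursion at (b , a)
      -- leads back to `Y a b` with factor u². Solving for it expresses arcs through the vertex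
      -- series `Z` alone.
      Y-twice : ∀ a b → adj a b ≡ true → (1# - X * X) * Y a b ≈
                identity a c * identity b d - X * (identity b c * identity a d) + X * Z b - X * X * Z a
      Y-twice a b A-ab = begin
        (1# - X * X) * Y a b
          ≈⟨ solve 2 (λ x y → (con (+ 1) :- x :* x) :* y := y :- x :* x :* y) refl X (Y a b) ⟩
        Y a b - X * X * Y a b
          ≈⟨ +-congʳ (Y-step a b A-ab) ⟩
        (i + X * (Z b - Y b a)) - X * X * Y a b
          ≈⟨ +-congʳ (+-congˡ (*-congˡ {X} (+-congˡ (-‿cong (Y-step b a (≡.trans (symmetric b a) A-ab)))))) ⟩
        (i + X * (Z b - (j + X * (Z a - Y a b)))) - X * X * Y a b
          ≈⟨ solve 6 (λ i j x zb za y → (i :+ x :* (zb :- (j :+ x :* (za :- y)))) :- x :* x :* y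
               := i :- x :* j :+ x :* zb :- x :* x :* za) refl i j X (Z b) (Z a) (Y a b) ⟩
        i - X * j + X * Z b - X * X * Z a ∎
        where
        i = identity a c * identity b d
        j = identity b c * identity a d

      A-identity : ∀ {c d} → adj c d ≡ true → ∀ a → A a d * identity a c ≈ identity a c
      A-identity {c} {d} A-cd a with a Fin.≟ c
      ... | yes ≡.refl = trans (*-congʳ {1#} (reflexive (adjacency-true G A-cd))) (*-identityˡ _)
      ... | no  _      = zeroʳ (A a d)

      -- Sum `Y-twice` over the neighbours `b` of `a`. The term with `Z a` picks up the valency of
      -- `a`, and collecting all occurrences of `Z` gives row `a` of `M`.
      MZ : ∀ a → sum (λ b → M a b * Z b) ≈ identity a c - X * identity a d
      MZ a = begin
        sum (λ b → M a b * Z b)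
          ≈⟨ M-apply Z a ⟩
        (1# - X * X) * Z a + X * X * (valency G a * Z a) - X * s
          ≈⟨ +-congʳ (+-congʳ summed) ⟩
        (identity a c - X * identity a d + X * s - X * X * (valency G a * Z a)) + X * X * (valency G a * Z a) - X * s
          ≈⟨ solve 4 (λ i j s v → (i :- j :+ s :- v) :+ v :- s := i :- j) refl (identity a c) (X * identity a d)
              (X * s) (X * X * (valency G a * Z a)) ⟩
        identity a c - X * identity a d ∎
        where
        n = order G
        s = sum (λ b → A a b * Z b)
        i j : Fin n → Carrier
        i b = A a b * identity a c * identity b d
        j b = A a b * identity a d * identity b c
        summed : (1# - X * X) * Z a ≈ identity a c - X * identity a d + X * s - X * X * (valency G a * Z a)
        summed = begin
          (1# - X * X) * Z a
            ≈⟨ *-distribˡ-sum (1# - X * X) (λ b → A a b * Y a b) ⟩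
          sum (λ b → (1# - X * X) * (A a b * Y a b))
            ≈⟨ sum-cong-≋ {n} (λ b → trans (solve 3 (λ e α y → e :* (α :* y) := α :* (e :* y)) refl (1# - X * X)
                (A a b) (Y a b))
                 (trans (adjacency-*-cong G a b (Y-twice a b))
                   (solve 8 (λ α ac bd bc ad x zb za → α :* (ac :* bd :- x :* (bc :* ad) :+ x :* zb :- x :* x :* za)
                       := (:- x) :* (α :* ad :* bc) :+ (x :* (α :* zb) :+ ((:- x :* x) :* (α :* za) :+ α :* ac :* bd)))
                     refl (A a b) (identity a c) (identity b d) (identity b c) (identity a d) X (Z b) (Z a)))) ⟩
          sum (λ b → (- X) * j b + (X * (A a b * Z b) + ((- X * X) * (A a b * Z a) + i b)))
            ≈⟨ trans (sum-linear (- X) j (λ b → X * (A a b * Z b) + ((- X * X) * (A a b * Z a) + i b)))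
                 (+-congˡ (trans (sum-linear X (λ b → A a b * Z b) (λ b → (- X * X) * (A a b * Z a) + i b))
                   (+-congˡ (sum-linear (- X * X) (λ b → A a b * Z a) i)))) ⟩
          (- X) * sum j + (X * s + ((- X * X) * sum (λ b → A a b * Z a) + sum i))
            ≈⟨ +-cong (*-congˡ {(- X)} (trans (sum-identityʳ (λ b → A a b * identity a d) c)
                   (A-identity (≡.trans (symmetric d c) A-cd) a)))
                 (+-congˡ {X * s} (+-cong (*-congˡ {(- X * X)} (sym (*-distribʳ-sum (Z a) (A a))))
                   (trans (sum-identityʳ (λ b → A a b * identity a c) d) (A-identity A-cd a)))) ⟩
          (- X) * identity a d + (X * s + ((- X * X) * (valency G a * Z a) + identity a c))
            ≈⟨ solve 5 (λ x ad s v ac → (:- x) :* ad :+ (x :* s :+ ((:- x :* x) :* v :+ ac)) := ac :- x :* ad :+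
                x :* s :- x :* x :* v)
                 refl X (identity a d) s (valency G a * Z a) (identity a c) ⟩
          _ ∎

      Z-closed : ∀ a → Z a ≈ V a c - X * V a d
      Z-closed a = begin
        Z a                                                           ≈⟨ invert Z
            (λ j → identity j c - X * identity j d) MZ a ⟩
        sum (λ j → V a j * (identity j c - X * identity j d))
          ≈⟨ sum-cong-≋ {order G} (λ j → solve 4
              (λ v x c d → v :* (c :- x :* d) := (:- x) :* (v :* d) :+ v :* c) refl (V a j) X (identity j c)
              (identity j d)) ⟩
        sum (λ j → (- X) * (V a j * identity j d) + V a j * identity j c)
          ≈⟨ sum-linear (- X) (λ j → V a j * identity j d) _ ⟩
        (- X) * sum (λ j → V a j * identity j d) + sum (λ j → V a j * identity j c)
          ≈⟨ +-cong (*-congˡ { - X} (sum-identityʳ (V a) d)) (sum-identityʳ (V a) c) ⟩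
        (- X) * V a d + V a c
          ≈⟨ solve 3 (λ x d c → (:- x) :* d :+ c := c :- x :* d) refl X (V a d) (V a c) ⟩
        V a c - X * V a d                                             ∎

      Y-closed : (1# - X * X) * Y c d ≈ 1# + X * (V d c - X * V d d) - X * X * (V c c - X * V c d)
      Y-closed = trans (Y-twice c d A-cd)
        (+-cong (+-cong one-term (*-congˡ {X} (Z-closed d))) (-‿cong (*-congˡ {X * X} (Z-closed c))))
        where
        c≢d : c ≢ d
        c≢d c≡d with () ← ≡.trans (≡.sym A-cd) (≡.trans (≡.cong (adj c) (≡.sym c≡d)) (irreflexive c))
        -- The second product vanishes because an arc is not a loop.
        one-term : identity c c * identity d d - X * (identity d c * identity c d) ≈ 1#
        one-term = trans (+-cong (trans (*-cong (reflexive (identity-diagonal c))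
            (reflexive (identity-diagonal d))) (*-identityˡ _))
            (-‿cong (*-congˡ {X} (*-congˡ {identity d c} (reflexive (identity-offDiagonal c≢d))))))
          (solve 2 (λ x y → con (+ 1) :- x :* (y :* con (+ 0)) := con (+ 1)) refl X (identity d c))

    module _ (Y : Fin (order G) → Fin (order G) → Matrix (order G))
      (Y-step : ∀ c d → adj c d ≡ true → ∀ a b → adj a b ≡ true →
                Y c d a b ≈ identity a c * identity b d + X * (sum (λ x → A b x * Y c d b x) - Y c d b a)) where

      arcs# walks# trAV trQV trV : Carrier
      arcs#  = sum² A
      walks# = sum² (λ c d → A c d * Y c d c d)
      trAV   = sum² (λ i j → A i j * V j i)
      trQV   = sum (λ i → q i * V i i)
      trV    = sum (λ i → V i i)

      -- `Y-closed` summed over all arcs (c , d). By symmetry of `A` the two mixed sums are both tr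
      -- A V, and the two diagonal sums are both tr D V = tr Q V + tr V.
      trace-walks : (1# - X * X) * walks# ≈ arcs# + X * (1# + X * X) * trAV - (1# + 1#) * (X * X) * (trQV + trV)
      trace-walks = begin
        (1# - X * X) * walks#
          ≈⟨ trans (*-distribˡ-sum (1# - X * X) (λ c → sum (λ d → A c d * Y c d c d)))
               (sum-cong-≋ {n} (λ c → *-distribˡ-sum (1# - X * X) (λ d → A c d * Y c d c d))) ⟩
        sum² (λ c d → (1# - X * X) * (A c d * Y c d c d))
          ≈⟨ sum²-cong {n} {n} (λ c d → trans
              (solve 3 (λ e α y → e :* (α :* y) := α :* (e :* y)) refl (1# - X * X) (A c d) (Y c d c d))
               (trans (adjacency-*-cong G c d (λ A-cd → Y-closed A-cd (Y c d) (Y-step c d A-cd)))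
                 (solve 6 (λ α x dc dd cc cd → α :* (con (+ 1) :+ x :* (dc :- x :* dd) :- x :* x :* (cc :- x :* cd))
                     := x :* (α :* dc) :+ (x :* x :* x :* (α :* cd) :+
                         ((:- (x :* x)) :* (α :* dd) :+ ((:- (x :* x)) :* (α :* cc) :+ α))))
                   refl (A c d) X (V d c) (V d d) (V c c) (V c d)))) ⟩
        sum² (λ c d → X * (A c d * V d c) +
            (X * X * X * (A c d * V c d) + ((- (X * X)) * (A c d * V d d) + ((- (X * X)) * (A c d * V c c) + A c d))))
          ≈⟨ trans (sum²-linear {n} {n} X (λ c d → A c d * V d c) _) (+-congˡ {X * trAV}
               (trans (sum²-linear {n} {n} (X * X * X) (λ c d → A c d * V c d) _) (+-cong (*-congˡ {X * X * X} transpose)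
                 (trans (sum²-linear {n} {n} (- (X * X)) (λ c d → A c d * V d d) _) (+-cong (*-congˡ { - (X * X)} columns)
                   (trans (sum²-linear {n} {n} (- (X * X)) (λ c d → A c d * V c c) _)
                       (+-congʳ {arcs#} (*-congˡ { - (X * X)} rows)))))))) ⟩
        X * trAV + (X * X * X * trAV + ((- (X * X)) * (trQV + trV) + ((- (X * X)) * (trQV + trV) + arcs#)))
          ≈⟨ solve 4 (λ x a t e → x :* a :+ (x :* x :* x :* a :+ ((:- (x :* x)) :* t :+ ((:- (x :* x)) :* t :+ e)))
               := e :+ x :* (con (+ 1) :+ x :* x) :* a :- (con (+ 1) :+ con (+ 1)) :* (x :* x) :* t) refl X trAV
                   (trQV + trV) arcs# ⟩
        _ ∎
        where
        n = order G
        transpose : sum² (λ c d → A c d * V c d) ≈ trAV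
        transpose = trans (∑-comm {n} {n} (λ c d → A c d * V c d))
          (sum²-cong {n} {n} (λ d c → *-congʳ {V c d} (reflexive (adjacency-symmetric G c d))))
        rows : sum² (λ c d → A c d * V c c) ≈ trQV + trV
        rows = trans (sum-cong-≋ {n} (λ c → trans (sym (*-distribʳ-sum (V c c) (A c)))
            (solve 2 (λ v w → v :* w := (v :- con (+ 1)) :* w :+ w) refl (valency G c) (V c c))))
          (∑-distrib-+ {n} (λ i → q i * V i i) (λ i → V i i))
        columns : sum² (λ c d → A c d * V d d) ≈ trQV + trV
        columns = trans (∑-comm {n} {n} (λ c d → A c d * V d d))
          (trans (sum²-cong {n} {n} (λ d c → *-congʳ {V d d} (reflexive (adjacency-symmetric G c d)))) rows)

      -- The trace of V M = I. It eliminates tr V, leaving exactly the two traces that occur in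
      -- `logDerivative-det`.
      trace-VM : trV - X * trAV + X * X * trQV ≈ order G · 1#
      trace-VM = sym (begin
        n · 1#                                        ≈⟨ sum-replicate n ⟨
        sum (λ (i : Fin n) → 1#)                      ≈⟨ sum-cong-≋ {n}
            (λ i → trans (VM≈I i i) (reflexive (identity-diagonal i))) ⟨
        sum² (λ i k → V i k * M k i)
          ≈⟨ sum²-cong {n} {n} (λ i k → solve 5 (λ v x q e α → v :* ((con (+ 1) :+ x :* x :* q) :* e :- x :* α)
               := x :* x :* (v :* q :* e) :+ ((:- x) :* (α :* v) :+ v :* e)) refl (V i k) X (q k) (identity k i) (A k i)) ⟩
        sum² (λ i k → X * X * (V i k * q k * identity k i) + ((- X) * (A k i * V i k) + V i k * identity k i))
          ≈⟨ trans (sum²-linear {n} {n} (X * X) (λ i k → V i k * q k * identity k i) _)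
              (+-congˡ (sum²-linear {n} {n} (- X) (λ i k → A k i * V i k) _)) ⟩
        X * X * sum² (λ i k → V i k * q k * identity k i) +
            ((- X) * sum² (λ i k → A k i * V i k) + sum² (λ i k → V i k * identity k i))
          ≈⟨ +-cong (*-congˡ {X * X} (sum-cong-≋ {n}
              (λ i → trans (sum-identityʳ (λ k → V i k * q k) i) (*-comm (V i i) (q i)))))
               (+-cong (*-congˡ { - X} (∑-comm {n} {n} (λ i k → A k i * V i k)))
                   (sum-cong-≋ {n} (λ i → sum-identityʳ (V i) i))) ⟩
        X * X * trQV + ((- X) * trAV + trV)
          ≈⟨ solve 4 (λ x q a t → x :* x :* q :+ ((:- x) :* a :+ t) := t :- x :* a :+ x :* x :* q) refl X trQV trAV trV ⟩
        trV - X * trAV + X * X * trQV ∎)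
        where n = order G

  private module Σᴷ = SemiringSum K.semiring

  IsConstant : Carrier → Set ℓ
  IsConstant s = ∀ n → s (suc n) K.≈ K.0#

  if-constant : ∀ b → IsConstant (if b then 1# else 0#)
  if-constant true  n = K.refl
  if-constant false n = K.refl

  sum-constant : ∀ {n} {f : Fin n → Carrier} → (∀ i → IsConstant (f i)) → IsConstant (sum f)
  sum-constant {zero}  f-const n = K.refl
  sum-constant {suc _} f-const n = K.trans (K.+-cong (f-const zero n) (sum-constant (f-const ∘ suc) n)) (K.+-identityʳ _)

  q-constant : ∀ i → IsConstant (q i)
  q-constant i n = K.trans (K.+-cong (sum-constant (λ j → if-constant (adj i j)) n) -0#≈0#) (K.+-identityʳ _)
    where open import Algebra.Properties.Ring K.ring using (-0#≈0#)

  *-constant : ∀ {s} t → IsConstant s → ∀ n → (t * s) n K.≈ t n K.* s 0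
  *-constant {s} t s-const n = K.trans (*-comm t s n)
    (K.trans (*-cong {s} {constant (s 0)} {t} {t} (λ { zero → K.refl ; (suc k) → s-const k }) (λ _ → K.refl) n)
      (K.trans (constant-⊠ (s 0) t n) (K.*-comm _ _)))

  θ-constant : ∀ {s} → IsConstant s → θ s ≈ 0#
  θ-constant         s-const zero    = K.refl
  θ-constant {s}     s-const (suc n) = K.trans (×-congʳ (suc n) (s-const n)) (·-zeroʳ (suc n))
    where open import Algebra.Properties.Semiring.Mult K.semiring using (×-congʳ)

  sum-coefficient : ∀ {n} (f : Fin n → Carrier) k → sum f k ≡ Σᴷ.sum (λ i → f i k)
  sum-coefficient {zero}  f k = ≡.refl
  sum-coefficient {suc n} f k = ≡.cong (f zero k K.+_) (sum-coefficient (f ∘ suc) k)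

  -- The inverse of M = I - uA + u²Q as a geometric series: V = I + u V A - u² V Q, read coefficient
  -- by coefficient. The subscript 0 extracts the scalar from a constant series.
  inverseCoefficient : ℕ → Fin (order G) → Fin (order G) → K.Carrier
  inverseCoefficient zero          i j = identity i j 0
  inverseCoefficient (suc zero)    i j = Σᴷ.sum (λ k → inverseCoefficient 0 i k K.* A k j 0)
  inverseCoefficient (suc (suc n)) i j =
    Σᴷ.sum (λ k → inverseCoefficient (suc n) i k K.* A k j 0) K.- inverseCoefficient n i j K.* q j 0

  V : Matrix (order G)
  V i j n = inverseCoefficient n i j

  V-step : ∀ i j → V i j ≈ identity i j + X * (sum (λ k → V i k * A k j) - X * (V i j * q j))
  V-step i j = λ
    { zero          → K.sym (K.trans (K.+-congˡ (X-⊠-zero (w - X * v))) (K.+-identityʳ _))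
    ; (suc zero)    → K.sym (K.trans (K.+-cong (identity-constant 0) (X-⊠-suc (w - X * v) 0)) (K.trans (K.+-identityˡ _)
        (K.trans (K.+-cong (w-coefficient 0) (K.trans (K.-‿cong (X-⊠-zero v)) -0#≈0#)) (K.+-identityʳ _))))
    ; (suc (suc n)) → K.sym (K.trans (K.+-cong (identity-constant (suc n)) (X-⊠-suc (w - X * v) (suc n)))
        (K.trans (K.+-identityˡ _)
        (K.+-cong (w-coefficient (suc n)) (K.-‿cong (K.trans (X-⊠-suc v n) (*-constant (V i j) (q-constant j) n))))))
    }
    where
    open import Algebra.Properties.Ring K.ring using (-0#≈0#)
    w = sum (λ k → V i k * A k j)
    v = V i j * q j
    identity-constant : IsConstant (identity i j)
    identity-constant = if-constant (does (i Fin.≟ j))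
    w-coefficient : ∀ n → w n K.≈ Σᴷ.sum (λ k → inverseCoefficient n i k K.* A k j 0)
    w-coefficient n = K.trans (K.reflexive (sum-coefficient (λ k → V i k * A k j) n))
      (Σᴷ.sum-cong-≋ {order G} (λ k → *-constant (V i k) (if-constant (adj k j)) n))

  VM≈identity : ∀ i j → sum (λ k → V i k * M k j) ≈ identity i j
  VM≈identity i j = begin
    sum (λ k → V i k * M k j)
      ≈⟨ sum-cong-≋ {n} (λ k → solve 5 (λ v x q e α → v :* ((con (+ 1) :+ x :* x :* q) :* e :- x :* α)
           := (:- x) :* (v :* α) :+ v :* (con (+ 1) :+ x :* x :* q) :* e) refl (V i k) X (q k) (identity k j) (A k j)) ⟩
    sum (λ k → (- X) * (V i k * A k j) + V i k * (1# + X * X * q k) * identity k j)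
      ≈⟨ trans (sum-linear (- X) (λ k → V i k * A k j) (λ k → V i k * (1# + X * X * q k) * identity k j))
           (+-congˡ (sum-identityʳ (λ k → V i k * (1# + X * X * q k)) j)) ⟩
    (- X) * w + V i j * (1# + X * X * q j)
      ≈⟨ solve 4 (λ x w v q → (:- x) :* w :+ v :* (con (+ 1) :+ x :* x :* q) := v :- x :* (w :- x :* (v :* q)))
          refl X w (V i j) (q j) ⟩
    V i j - X * (w - X * (V i j * q j))
      ≈⟨ +-congʳ (V-step i j) ⟩
    identity i j + X * (w - X * (V i j * q j)) - X * (w - X * (V i j * q j))
      ≈⟨ solve 2 (λ e m → e :+ m :- m := e) refl (identity i j) (X * (w - X * (V i j * q j))) ⟩
    identity i j ∎
    where
    n = order G
    w = sum (λ k → V i k * A k j)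

  θ-X : θ X ≈ X
  θ-X zero          = K.refl
  θ-X (suc zero)    = K.+-identityʳ _
  θ-X (suc (suc n)) = ·-zeroʳ (suc (suc n))

  θ-X² : θ (X * X) ≈ (1# + 1#) * (X * X)
  θ-X² = trans (θ-* X X) (trans (+-cong (*-congʳ {X} θ-X) (*-congˡ {X} θ-X))
    (solve 1 (λ a → a :+ a := (con (+ 1) :+ con (+ 1)) :* a) refl (X * X)))

  θ-M : ∀ i j → θ (M i j) ≈ (1# + 1#) * (X * X) * q i * identity i j - X * A i j
  θ-M i j = begin
    θ (M i j)                                        ≈⟨ trans (θ-+ (p * e) (- (X * α))) (+-congˡ (δ-neg (X * α))) ⟩
    θ (p * e) - θ (X * α)
      ≈⟨ +-cong (trans (θ-* p e) (+-congˡ (*-congˡ {p} (θ-constant (if-constant (does (i Fin.≟ j)))))))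
                (-‿cong (trans (θ-* X α) (+-cong (*-congʳ {α} θ-X) (*-congˡ {X} (θ-constant (if-constant (adj i j))))))) ⟩
    θ p * e + p * 0# - (X * α + X * 0#)
      ≈⟨ +-congʳ (+-congʳ (*-congʳ {e} (trans (θ-+ 1# (X * X * q i)) (+-cong δ1
           (trans (θ-* (X * X) (q i)) (+-cong (*-congʳ {q i} θ-X²) (*-congˡ {X * X} (θ-constant (q-constant i))))))))) ⟩
    (0# + ((1# + 1#) * (X * X) * q i + X * X * 0#)) * e + p * 0# - (X * α + X * 0#)
      ≈⟨ solve 5 (λ x q e p α → (con (+ 0) :+
          ((con (+ 1) :+ con (+ 1)) :* (x :* x) :* q :+ x :* x :* con (+ 0))) :* e :+ p :* con (+ 0) :-
          (x :* α :+ x :* con (+ 0))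
           := (con (+ 1) :+ con (+ 1)) :* (x :* x) :* q :* e :- x :* α) refl X (q i) e p α ⟩
    (1# + 1#) * (X * X) * q i * e - X * α            ∎
    where
    p = 1# + X * X * q i
    e = identity i j
    α = A i j

  -- Jacobi's formula for C = θ(M) V, for which C M = θ(M) since V M = I. Its trace follows from
  -- θ(M) = 2u²Q - uA.
  logDerivative-det : θ (det M) ≈ ((1# + 1#) * (X * X) * sum (λ i → q i * V i i) - X * sum² (λ i j → A i j * V j i)) * det M
  logDerivative-det = trans (jacobi M C (λ i j → sym (CM i j))) (*-congʳ {det M} (begin
    sum² (λ i j → θ (M i j) * V j i)
      ≈⟨ sum²-cong {n} {n} (λ i j → trans (*-congʳ {V j i} (θ-M i j))
           (solve 5 (λ x q e α v → ((con (+ 1) :+ con (+ 1)) :* (x :* x) :* q :* e :- x :* α) :* v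
              := (con (+ 1) :+ con (+ 1)) :* (x :* x) :* (e :* (q :* v)) :+ (:- x) :* (α :* v)) refl X (q i)
                  (identity i j) (A i j) (V j i))) ⟩
    sum² (λ i j → (1# + 1#) * (X * X) * (identity i j * (q i * V j i)) + (- X) * (A i j * V j i))
      ≈⟨ trans (sum²-linear {n} {n} ((1# + 1#) * (X * X)) (λ i j → identity i j * (q i * V j i))
          (λ i j → (- X) * (A i j * V j i)))
           (+-cong (*-congˡ {(1# + 1#) * (X * X)} (sum-cong-≋ {n} (λ i → sum-identityˡ (λ j → q i * V j i) i)))
             (trans (sum-cong-≋ {n} (λ i → sym (*-distribˡ-sum (- X) (λ j → A i j * V j i))))
                 (sym (*-distribˡ-sum (- X) (λ i → sum (λ j → A i j * V j i)))))) ⟩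
    (1# + 1#) * (X * X) * sum (λ i → q i * V i i) + (- X) * sum² (λ i j → A i j * V j i)
      ≈⟨ solve 3 (λ a x b → a :+ (:- x) :* b := a :- x :* b) refl
          ((1# + 1#) * (X * X) * sum (λ i → q i * V i i)) X (sum² (λ i j → A i j * V j i)) ⟩
    _ ∎))
    where
    n = order G
    C : Matrix n
    C i k = sum (λ l → θ (M i l) * V l k)
    CM : ∀ i j → sum (λ k → C i k * M k j) ≈ θ (M i j)
    CM i j = begin
      sum (λ k → C i k * M k j)                          ≈⟨ sum-cong-≋ {n}
          (λ k → *-distribʳ-sum (M k j) (λ l → θ (M i l) * V l k)) ⟩
      sum² (λ k l → θ (M i l) * V l k * M k j)           ≈⟨ ∑-comm {n} {n} (λ k l → θ (M i l) * V l k * M k j) ⟩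
      sum² (λ l k → θ (M i l) * V l k * M k j)
        ≈⟨ sum-cong-≋ {n} (λ l → trans (sum-cong-≋ {n} (λ k → *-assoc (θ (M i l)) (V l k) (M k j)))
             (trans (sym (*-distribˡ-sum (θ (M i l)) (λ k → V l k * M k j))) (*-congˡ {θ (M i l)} (VM≈identity l j)))) ⟩
      sum (λ l → θ (M i l) * identity l j)               ≈⟨ sum-identityʳ (λ l → θ (M i l)) j ⟩
      θ (M i j)                                          ∎

  e : Carrier
  e = 1# - X * X

  -- The factor `e` on the left keeps the exponent at `r`, so that no r - 1 appears.
  logDerivative-power : ∀ r → e * θ (e ^ r) ≈ - ((1# + 1#) * (X * X) * (r · 1#) * e ^ r)
  logDerivative-power zero    = trans (*-congˡ {e} δ1)
    (solve 2 (λ e x → e :* con (+ 0) := :- ((con (+ 1) :+ con (+ 1)) :* (x :* x) :* con (+ 0) :* con (+ 1))) refl e X)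
  logDerivative-power (suc r) = begin
    e * θ (e * e ^ r)
      ≈⟨ *-congˡ {e} (trans (θ-* e (e ^ r)) (+-congʳ (*-congʳ {e ^ r} θ-e))) ⟩
    e * ((- ((1# + 1#) * (X * X))) * e ^ r + e * θ (e ^ r))
      ≈⟨ solve 4 (λ e x p t → e :* ((:- ((con (+ 1) :+ con (+ 1)) :* (x :* x))) :* p :+ t)
           := (:- ((con (+ 1) :+ con (+ 1)) :* (x :* x))) :* (e :* p) :+ e :* t) refl e X (e ^ r) (e * θ (e ^ r)) ⟩
    (- ((1# + 1#) * (X * X))) * (e * e ^ r) + e * (e * θ (e ^ r))
      ≈⟨ +-congˡ (*-congˡ {e} (logDerivative-power r)) ⟩
    (- ((1# + 1#) * (X * X))) * (e * e ^ r) + e * - ((1# + 1#) * (X * X) * (r · 1#) * e ^ r)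
      ≈⟨ solve 4 (λ e x p r → (:- ((con (+ 1) :+ con (+ 1)) :* (x :* x))) :* (e :* p) :+ e :*
          (:- ((con (+ 1) :+ con (+ 1)) :* (x :* x) :* r :* p))
           := :- ((con (+ 1) :+ con (+ 1)) :* (x :* x) :* (con (+ 1) :+ r) :* (e :* p))) refl e X (e ^ r) (r · 1#) ⟩
    _ ∎
    where
    θ-e : θ e ≈ - ((1# + 1#) * (X * X))
    θ-e = trans (θ-+ 1# (- (X * X))) (trans (+-cong δ1 (trans (δ-neg (X * X)) (-‿cong θ-X²))) (+-identityˡ _))

  -- The equation reads s = u² s: the first two coefficients are 0 and every other one equals the
  -- coefficient two places below.
  e-cancel : ∀ s → e * s ≈ 0# → s ≈ 0#
  e-cancel s es≈0 = go
    where
    s≈XXs : s ≈ X * (X * s)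
    s≈XXs = trans (solve 2 (λ x s → s := (con (+ 1) :- x :* x) :* s :+ x :* (x :* s)) refl X s)
        (trans (+-congʳ es≈0) (+-identityˡ _))
    go : s ≈ 0#
    go zero          = K.trans (s≈XXs 0) (X-⊠-zero (X * s))
    go (suc zero)    = K.trans (s≈XXs 1) (K.trans (X-⊠-suc (X * s) 0) (X-⊠-zero s))
    go (suc (suc n)) = K.trans (s≈XXs (suc (suc n))) (K.trans (X-⊠-suc (X * s) (suc n)) (K.trans (X-⊠-suc s n) (go n)))

  -- Bass's formula, as the differential equation u f′ = −(∑ₖ Nₖ uᵏ) f for
  -- f = (1 − u²)^(m−n) det (I − uA + u²(D − I)), where Nₖ counts the closed
  -- backtrackless tailless walks of length k ≥ 1.
  bass-formula : (Y : Fin (order G) → Fin (order G) → Matrix (order G)) →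
    (∀ c d → adj c d ≡ true → ∀ a b → adj a b ≡ true →
      Y c d a b ≈ identity a c * identity b d + X * (sum (λ x → A b x * Y c d b x) - Y c d b a)) →
    ∀ r → sum² A ≈ (1# + 1#) * ((order G · 1#) + (r · 1#)) →
    θ (e ^ r * det M) ≈ - ((sum² (λ c d → A c d * Y c d c d) - sum² A) * (e ^ r * det M))
  -- Multiplying by `e` = 1 - u² makes both `trace-walks` and `logDerivative-power` applicable. Once
  -- `t≈` has removed tr V, the claim is a polynomial identity in u, r, n and the two traces `a` and
  -- `g`.
  bass-formula Y Y-step r A≈ = λ n → Kg.inverseˡ-unique _ _ (e-cancel (θ f + N * f) (begin
    e * (θ f + N * f)
      ≈⟨ *-congˡ {e} (+-congʳ {N * f} (trans (θ-* P D) (+-congˡ {θ P * D} (*-congˡ {P} logDerivative-det)))) ⟩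
    e * (θ P * D + P * (T * D) + (w - sum² A) * (P * D))
      ≈⟨ solve 7 (λ e t P D T w a → e :* (t :* D :+ P :* (T :* D) :+ (w :- a) :* (P :* D))
           := (e :* t) :* D :+ P :* D :* (e :* T :+ (e :* w :- e :* a))) refl e (θ P) P D T w (sum² A) ⟩
    (e * θ P) * D + P * D * (e * T + (e * w - e * sum² A))
      ≈⟨ +-cong (*-congʳ {D} (logDerivative-power r))
          (*-congˡ {P * D} (+-congˡ {e * T} (+-cong ew (-‿cong (*-congˡ {e} A≈))))) ⟩
    - (2X² * (r · 1#) * P) * D + P * D *
        (e * T + ((1# + 1#) * (n·1 + (r · 1#)) + X * (1# + X * X) * a - (1# + 1#) * (X * X) *
        (g + (n·1 + X * a - X * X * g)) - e * ((1# + 1#) * (n·1 + (r · 1#)))))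
      ≈⟨ solve 7 (λ x r P D a g n → let one = con (+ 1) ; two = one :+ one ; xx = x :* x ; e = one :- xx in
           :- (two :* xx :* r :* P) :* D :+ P :* D :* (e :* (two :* xx :* g :- x :* a)
             :+ (two :* (n :+ r) :+ x :* (one :+ xx) :* a :- two :* xx :* (g :+ (n :+ x :* a :- xx :* g)) :- e
                 :* (two :* (n :+ r)))) := con (+ 0))
           refl X (r · 1#) P D a g n·1 ⟩
    0# ∎) n)
    where
    module Kg = Algebra.Properties.Group K.+-group
    P = e ^ r
    D = det M
    f = P * D
    w = sum² (λ c d → A c d * Y c d c d)
    N = w - sum² A
    n·1 = order G · 1#
    2X² = (1# + 1#) * (X * X)
    a = sum² (λ i j → A i j * V j i)
    g = sum (λ i → q i * V i i)
    t = sum (λ i → V i i)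
    T = 2X² * g - X * a
    t≈ : t ≈ n·1 + X * a - X * X * g
    t≈ = trans (solve 4 (λ t x a g → t := (t :- x :* a :+ x :* x :* g) :+ x :* a :- x :* x :* g) refl t X a g)
      (+-congʳ (+-congʳ (trace-VM V VM≈identity Y Y-step)))
    ew : e * w ≈ (1# + 1#) * (n·1 + (r · 1#)) + X * (1# + X * X) * a - (1# + 1#) * (X * X) * (g + (n·1 + X * a - X * X * g))
    ew = trans (trace-walks V VM≈identity Y Y-step)
      (+-cong (+-congʳ A≈) (-‿cong (*-congˡ {(1# + 1#) * (X * X)} (+-congˡ {g} t≈))))

-- Words: rotations, powers and primitive roots

module Rotation {a} {A : Set a} where
  open ≡ using (refl; sym; trans; cong; cong₂; subst; module ≡-Reasoning)

  ρ : List A → List A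
  ρ []       = []
  ρ (x ∷ xs) = xs ++ [ x ]

  ρ^ : ℕ → List A → List A
  ρ^ zero    C = C
  ρ^ (suc n) C = ρ^ n (ρ C)

  ρ^-+ : ∀ m n C → ρ^ (m ℕ.+ n) C ≡ ρ^ n (ρ^ m C)
  ρ^-+ zero    n C = refl
  ρ^-+ (suc m) n C = ρ^-+ m n (ρ C)

  ρ^-++ : ∀ xs ys → ρ^ (length xs) (xs ++ ys) ≡ ys ++ xs
  ρ^-++ []       ys = sym (List.++-identityʳ ys)
  ρ^-++ (x ∷ xs) ys = begin
    ρ^ (length xs) ((xs ++ ys) ++ [ x ])   ≡⟨ cong (ρ^ (length xs)) (List.++-assoc xs ys [ x ]) ⟩
    ρ^ (length xs) (xs ++ (ys ++ [ x ]))   ≡⟨ ρ^-++ xs (ys ++ [ x ]) ⟩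
    (ys ++ [ x ]) ++ xs                    ≡⟨ List.++-assoc ys [ x ] xs ⟩
    ys ++ x ∷ xs                           ∎
    where open ≡-Reasoning

  length-take-≤ : ∀ i (C : List A) → i ≤ length C → length (take i C) ≡ i
  length-take-≤ i C i≤ = trans (List.length-take i C) (ℕ.m≤n⇒m⊓n≡m i≤)

  ρ^-drop-take : ∀ i C → i ≤ length C → ρ^ i C ≡ drop i C ++ take i C
  ρ^-drop-take i C i≤ = begin
    ρ^ i C                                         ≡⟨ cong₂ ρ^ (sym (length-take-≤ i C i≤)) (sym (List.take++drop≡id i C)) ⟩
    ρ^ (length (take i C)) (take i C ++ drop i C)  ≡⟨ ρ^-++ (take i C) (drop i C) ⟩
    drop i C ++ take i C                           ∎
    where open ≡-Reasoning

  length-ρ : ∀ C → length (ρ C) ≡ length C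
  length-ρ []       = refl
  length-ρ (x ∷ xs) = trans (List.length-++ xs) (ℕ.+-comm _ 1)

  length-ρ^ : ∀ n C → length (ρ^ n C) ≡ length C
  length-ρ^ zero    C = refl
  length-ρ^ (suc n) C = trans (length-ρ^ n (ρ C)) (length-ρ C)

  ρ^-length : ∀ C → ρ^ (length C) C ≡ C
  ρ^-length C = trans (cong (ρ^ (length C)) (sym (List.++-identityʳ C))) (ρ^-++ C [])

  ρ^-* : ∀ {d C} q → ρ^ d C ≡ C → ρ^ (q ℕ.* d) C ≡ C
  ρ^-*         zero    e = refl
  ρ^-* {d} {C} (suc q) e = trans (ρ^-+ d (q ℕ.* d) C) (trans (cong (ρ^ (q ℕ.* d)) e) (ρ^-* q e))

  ρ^-% : ∀ x xs i → let C = x ∷ xs in ρ^ i C ≡ ρ^ (i ℕ.% length C) C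
  ρ^-% x xs i = begin
    ρ^ i C                                    ≡⟨ cong (λ k → ρ^ k C)
        (trans (ℕ.m≡m%n+[m/n]*n i (length C)) (ℕ.+-comm _ (i ℕ./ length C ℕ.* length C))) ⟩
    ρ^ (i ℕ./ length C ℕ.* length C ℕ.+ i ℕ.% length C) C   ≡⟨ ρ^-+ (i ℕ./ length C ℕ.* length C) (i ℕ.% length C) C ⟩
    ρ^ (i ℕ.% length C) (ρ^ (i ℕ./ length C ℕ.* length C) C)  ≡⟨ cong (ρ^ (i ℕ.% length C))
        (ρ^-* (i ℕ./ length C) (ρ^-length C)) ⟩
    ρ^ (i ℕ.% length C) C                     ∎
    where
    open ≡-Reasoning
    C = x ∷ xs

  -- Bézout: the gcd is x m - y n, or y n - x m. Rotating by the subtracted multiple changes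
  -- nothing, so a rotation by the gcd may be completed to one by a multiple of `m` or `n`.
  ρ^-gcd : ∀ m n C → ρ^ m C ≡ C → ρ^ n C ≡ C → ρ^ (gcd m n) C ≡ C
  ρ^-gcd m n C em en with Bézout.identity (ℕ.gcd-GCD m n)
  ... | Bézout.+- x y eq = begin
    ρ^ (gcd m n) C                      ≡⟨ cong (ρ^ (gcd m n)) (ρ^-* y en) ⟨
    ρ^ (gcd m n) (ρ^ (y ℕ.* n) C)       ≡⟨ ρ^-+ (y ℕ.* n) (gcd m n) C ⟨
    ρ^ (y ℕ.* n ℕ.+ gcd m n) C          ≡⟨ cong (λ k → ρ^ k C) (trans (ℕ.+-comm (y ℕ.* n) _) eq) ⟩
    ρ^ (x ℕ.* m) C                      ≡⟨ ρ^-* x em ⟩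
    C                                   ∎
    where open ≡-Reasoning
  ... | Bézout.-+ x y eq = begin
    ρ^ (gcd m n) C                      ≡⟨ cong (ρ^ (gcd m n)) (ρ^-* x em) ⟨
    ρ^ (gcd m n) (ρ^ (x ℕ.* m) C)       ≡⟨ ρ^-+ (x ℕ.* m) (gcd m n) C ⟨
    ρ^ (x ℕ.* m ℕ.+ gcd m n) C          ≡⟨ cong (λ k → ρ^ k C) (trans (ℕ.+-comm (x ℕ.* m) _) eq) ⟩
    ρ^ (y ℕ.* n) C                      ≡⟨ ρ^-* y en ⟩
    C                                   ∎
    where open ≡-Reasoning

  length-power : ∀ r (D : List A) → length (power r D) ≡ r ℕ.* length D
  length-power zero    D = refl
  length-power (suc r) D = trans (List.length-++ D) (cong (length D ℕ.+_) (length-power r D))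

  power-comm : ∀ r (D : List A) → power r D ++ D ≡ D ++ power r D
  power-comm zero    D = sym (List.++-identityʳ D)
  power-comm (suc r) D = trans (List.++-assoc D (power r D) D) (cong (D ++_) (power-comm r D))

  power-+ : ∀ q r (D : List A) → power (q ℕ.+ r) D ≡ power q D ++ power r D
  power-+ zero    r D = refl
  power-+ (suc q) r D = trans (cong (D ++_) (power-+ q r D)) (sym (List.++-assoc D (power q D) (power r D)))

  power-* : ∀ q r (D : List A) → power (q ℕ.* r) D ≡ power q (power r D)
  power-* zero    r D = refl
  power-* (suc q) r D = trans (power-+ r (q ℕ.* r) D) (cong (power r D ++_) (power-* q r D))

  power-1 : ∀ (D : List A) → power 1 D ≡ D
  power-1 D = List.++-identityʳ D

  ρ^-power : ∀ r D → ρ^ (length D) (power r D) ≡ power r D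
  ρ^-power zero    D = ρ^-[] (length D)
    where
    ρ^-[] : ∀ n → ρ^ n [] ≡ []
    ρ^-[] zero    = refl
    ρ^-[] (suc n) = ρ^-[] n
  ρ^-power (suc r) D = trans (ρ^-++ D (power r D)) (power-comm r D)

  -- Comparing prefixes in D E = E D shows that E starts with D; the rest of E still commutes with D
  -- and is shorter by one copy.
  commute⇒power : ∀ m (D E : List A) → D ++ E ≡ E ++ D → length E ≡ m ℕ.* length D → E ≡ power m D
  commute⇒power zero    D []      e l = refl
  commute⇒power (suc m) D E       e l = trans E≡ (cong (D ++_) (commute⇒power m D E′ commute lengthE′))
    where
    open ≡-Reasoning
    D≤E : length D ≤ length E
    D≤E = ℕ.≤-trans (ℕ.m≤m+n _ _) (ℕ.≤-reflexive (sym l))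
    E′ = drop (length D) E
    prefix : take (length D) E ≡ D
    prefix = begin
      take (length D) E         ≡⟨ cong (λ k → take k E) (ℕ.m≤n⇒m⊓n≡m D≤E) ⟨
      take (length D ℕ.⊓ length E) E    ≡⟨ trans (cong (λ k → take k E) (ℕ.⊓-comm (length D) (length E)))
          (take-++ E D (length D) D≤E) ⟩
      take (length D) (E ++ D)  ≡⟨ cong (take (length D)) e ⟨
      take (length D) (D ++ E)  ≡⟨ take-length D E ⟩
      D                         ∎
      where
      take-length : ∀ (xs ys : List A) → take (length xs) (xs ++ ys) ≡ xs
      take-length []       ys = refl
      take-length (x ∷ xs) ys = cong (x ∷_) (take-length xs ys)
      take-++ : ∀ (xs ys : List A) n → n ≤ length xs → take (length xs ℕ.⊓ n) xs ≡ take n (xs ++ ys)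
      take-++ []       ys zero    n≤ = refl
      take-++ (x ∷ xs) ys zero    n≤ = refl
      take-++ (x ∷ xs) ys (suc n) (s≤s n≤) = cong (x ∷_) (take-++ xs ys n n≤)
    E≡ : E ≡ D ++ E′
    E≡ = trans (sym (List.take++drop≡id (length D) E)) (cong (_++ E′) prefix)
    commute : D ++ E′ ≡ E′ ++ D
    commute = List.++-cancelˡ D _ _ (begin
      D ++ (D ++ E′)    ≡⟨ cong (D ++_) E≡ ⟨
      D ++ E            ≡⟨ e ⟩
      E ++ D            ≡⟨ cong (_++ D) E≡ ⟩
      (D ++ E′) ++ D    ≡⟨ List.++-assoc D E′ D ⟩
      D ++ (E′ ++ D)    ∎)
    lengthE′ : length E′ ≡ m ℕ.* length D
    lengthE′ = trans (List.length-drop (length D) E) (trans (cong (ℕ._∸ length D) l) (ℕ.m+n∸m≡n (length D) _))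

  -- Rotation by `g` exchanges the prefix of length `g` with the rest of the word. If it fixes the
  -- word, the two pieces commute.
  period⇒power : ∀ m g C → length C ≡ m ℕ.* g → g ≤ length C → ρ^ g C ≡ C → C ≡ power m (take g C)
  period⇒power zero    g []      l g≤ e = refl
  period⇒power (suc m) g C       l g≤ e = trans (sym (List.take++drop≡id g C)) (cong (take g C ++_)
    (commute⇒power m (take g C) (drop g C)
      (trans (List.take++drop≡id g C) (trans (sym e) (ρ^-drop-take g C g≤)))
      (trans (List.length-drop g C) (trans (cong (ℕ._∸ g) l)
          (trans (ℕ.m+n∸m≡n g _) (cong (m ℕ.*_) (sym (length-take-≤ g C g≤))))))))

  -- The gcd of `d` and the length is again a period. If it were a proper divisor of the length, the
  -- word would be a proper power.
  primitive-period : ∀ {C} → Primitive C → 0 < length C → ∀ d → ρ^ d C ≡ C → length C ∣ d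
  primitive-period {C} prim C>0 d e with ℕ.gcd[m,n]∣n d (length C)
  ... | divides zero          l = ⊥-elim (ℕ.<-irrefl (sym l) C>0)
  ... | divides (suc (suc m)) l = ⊥-elim (prim (take g C) (suc (suc m)) (s≤s (s≤s z≤n))
      (period⇒power (suc (suc m)) g C l (ℕ.≤-trans (ℕ.m≤m+n g _) (ℕ.≤-reflexive (sym l)))
          (ρ^-gcd d (length C) C e (ρ^-length C))))
    where g = gcd d (length C)
  ... | divides (suc zero)    l = subst (_∣ d) (sym (trans l (ℕ.*-identityˡ _))) (ℕ.gcd[m,n]∣m d (length C))

  ρ-power : ∀ q (D : List A) → ρ (power q D) ≡ power q (ρ D)
  ρ-power zero    D        = refl
  ρ-power (suc q) []       = ρ-power q []
  ρ-power (suc q) (x ∷ xs) = begin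
    (xs ++ power q (x ∷ xs)) ++ [ x ]      ≡⟨ List.++-assoc xs _ _ ⟩
    xs ++ (power q (x ∷ xs) ++ [ x ])      ≡⟨ cong (xs ++_) (shift q) ⟨
    xs ++ x ∷ power q (xs ++ [ x ])        ≡⟨ List.++-assoc xs [ x ] _ ⟨
    (xs ++ [ x ]) ++ power q (xs ++ [ x ]) ∎
    where
    open ≡-Reasoning
    shift : ∀ q → x ∷ power q (xs ++ [ x ]) ≡ power q (x ∷ xs) ++ [ x ]
    shift zero    = refl
    shift (suc q) = cong (x ∷_) (begin
      (xs ++ [ x ]) ++ power q (xs ++ [ x ])   ≡⟨ List.++-assoc xs [ x ] _ ⟩
      xs ++ x ∷ power q (xs ++ [ x ])          ≡⟨ cong (xs ++_) (shift q) ⟩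
      xs ++ (power q (x ∷ xs) ++ [ x ])        ≡⟨ List.++-assoc xs _ _ ⟨
      (xs ++ power q (x ∷ xs)) ++ [ x ]        ∎)

  ρ^-power-comm : ∀ n q D → ρ^ n (power q D) ≡ power q (ρ^ n D)
  ρ^-power-comm zero    q D = refl
  ρ^-power-comm (suc n) q D = trans (cong (ρ^ n) (ρ-power q D)) (ρ^-power-comm n q (ρ D))

  ++-injectiveˡ : ∀ (xs ys : List A) {us vs} → length xs ≡ length ys → xs ++ us ≡ ys ++ vs → xs ≡ ys
  ++-injectiveˡ []       []       l e = refl
  ++-injectiveˡ (x ∷ xs) (y ∷ ys) l e =
    cong₂ _∷_ (List.∷-injectiveˡ e) (++-injectiveˡ xs ys (ℕ.suc-injective l) (List.∷-injectiveʳ e))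

  power-injective : ∀ q {D E : List A} → power (suc q) D ≡ power (suc q) E → D ≡ E
  power-injective q {D} {E} e = ++-injectiveˡ D E
    (ℕ.*-cancelˡ-≡ (length D) (length E) (suc q)
        (trans (sym (length-power (suc q) D)) (trans (cong length e) (length-power (suc q) E)))) e

  -- Rotation by the length of E fixes the common power, hence fixes D, so the length of D divides
  -- that of E; then exchange roles. Equality of lengths already separates the lists of powers
  -- counted in `closedWords-divisorSum`.
  root-unique : ∀ q r {D E : List A} → Primitive D → Primitive E → 0 < length D → 0 < length E →
                power (suc q) D ≡ power (suc r) E → length D ≡ length E
  root-unique q r {D} {E} pD pE D>0 E>0 e = ℕ.∣-antisym (period q r pD D>0 e) (period r q pE E>0 (sym e))
    where
    period : ∀ q r {D E : List A} → Primitive D → 0 < length D → power (suc q) D ≡ power (suc r) E → length D ∣ length E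
    period q r {D} {E} pD D>0 e = primitive-period pD D>0 (length E) (power-injective q (begin
      power (suc q) (ρ^ (length E) D)   ≡⟨ ρ^-power-comm (length E) (suc q) D ⟨
      ρ^ (length E) (power (suc q) D)   ≡⟨ cong (ρ^ (length E)) e ⟩
      ρ^ (length E) (power (suc r) E)   ≡⟨ ρ^-power (suc r) E ⟩
      power (suc r) E                   ≡⟨ e ⟨
      power (suc q) D                   ∎))
      where open ≡-Reasoning

  m*n>0⇒m>0 : ∀ m n → 0 < m ℕ.* n → 0 < m
  m*n>0⇒m>0 (suc m) n _ = s≤s z≤n

  -- Strong induction on the length. If no proper rotation fixes the word, it is its own root;
  -- otherwise the gcd of a period and the length gives a shorter word of which it is a power, and
  -- exponents multiply.
  root : DecidableEquality A → ∀ C → 0 < length C → ∃[ q ] ∃[ D ] C ≡ power (suc q) D × Primitive D × 0 < length D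
  root _≟_ C C>0 = <-rec (λ n → ∀ C → length C ≡ n → 0 < length C → ∃[ q ] ∃[ D ] C ≡ power (suc q) D ×
      Primitive D × 0 < length D)
    step (length C) C refl C>0
    where
    step : ∀ n → (∀ {m} → m < n → ∀ C → length C ≡ m → 0 < length C → ∃[ q ] ∃[ D ] C ≡ power (suc q) D ×
        Primitive D × 0 < length D) →
           ∀ C → length C ≡ n → 0 < length C → ∃[ q ] ∃[ D ] C ≡ power (suc q) D × Primitive D × 0 < length D
    step n rec C C≡n C>0 with ℕ.anyUpTo? (λ d → (0 ℕ.<? d) ×-dec List.≡-dec _≟_ (ρ^ d C) C) (length C)
    ... | no ¬period = 0 , C , sym (power-1 C) , prim , C>0
      where
      prim : Primitive C
      prim D (suc (suc r)) (s≤s (s≤s _)) C≡ = ¬period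
          (length D , D<C , D>0 , trans (cong (ρ^ (length D)) C≡) (trans (ρ^-power (2 ℕ.+ r) D) (sym C≡)))
        where
        l : length C ≡ (2 ℕ.+ r) ℕ.* length D
        l = trans (cong length C≡) (length-power (2 ℕ.+ r) D)
        D>0 : 0 < length D
        D>0 = m*n>0⇒m>0 (length D) (2 ℕ.+ r) (subst (0 <_) (trans l (ℕ.*-comm (2 ℕ.+ r) (length D))) C>0)
        D<C : length D < length C
        D<C = ℕ.≤-trans (ℕ.+-monoˡ-≤ (length D) D>0)
            (ℕ.≤-trans (ℕ.+-monoʳ-≤ (length D) (ℕ.m≤m+n (length D) _)) (ℕ.≤-reflexive (sym l)))
    ... | yes (d , d<C , d>0 , e) with ℕ.gcd[m,n]∣n d (length C)
    ... | divides zero l = ⊥-elim (ℕ.<-irrefl (sym l) C>0)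
    ... | divides (suc m) l with rec (subst (g <_) C≡n g<C) (take g C) lg (ℕ.≤-trans g>0 (ℕ.≤-reflexive (sym lg)))
      where
      g = gcd d (length C)
      g>0 : 0 < g
      g>0 = m*n>0⇒m>0 g (suc m) (subst (0 <_) (trans l (ℕ.*-comm (suc m) g)) C>0)
      g<C : g < length C
      g<C = ℕ.≤-<-trans (ℕ.∣⇒≤ {{ℕ.>-nonZero d>0}} (ℕ.gcd[m,n]∣m d (length C))) d<C
      lg : length (take g C) ≡ g
      lg = length-take-≤ g C (ℕ.<⇒≤ g<C)
    ... | q , D , C′≡ , pD , D>0 = q ℕ.+ m ℕ.* suc q , D , (begin
      C                                       ≡⟨ period⇒power (suc m) g C l g≤ (ρ^-gcd d (length C) C e (ρ^-length C)) ⟩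
      power (suc m) (take g C)                ≡⟨ cong (power (suc m)) C′≡ ⟩
      power (suc m) (power (suc q) D)         ≡⟨ power-* (suc m) (suc q) D ⟨
      power (suc m ℕ.* suc q) D               ∎) , pD , D>0
      where
      open ≡-Reasoning
      g = gcd d (length C)
      g≤ : g ≤ length C
      g≤ = ℕ.≤-trans (ℕ.m≤m+n g _) (ℕ.≤-reflexive (sym l))

  ∼⇒ρ^ : ∀ {C C′ : List A} → C ∼ C′ → ∃[ i ] i < length C × C′ ≡ ρ^ i C
  ∼⇒ρ^ {C} C∼C′ with i , i∈ , e ← ∈.∈-map⁻ _ C∼C′ with i<C ← ∈.∈-upTo⁻ i∈ =
    i , i<C , trans e (sym (ρ^-drop-take i C (ℕ.<⇒≤ i<C)))

  ρ^⇒∼ : ∀ {C} i → i < length C → C ∼ ρ^ i C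
  ρ^⇒∼ {C} i i<C = Any.map (trans (ρ^-drop-take i C (ℕ.<⇒≤ i<C))) (∈.∈-map⁺ (λ i → drop i C ++ take i C) (∈.∈-upTo⁺ i<C))

  ρ^⇒∼′ : ∀ {C} i → 0 < length C → C ∼ ρ^ i C
  ρ^⇒∼′ {x ∷ xs} i C>0 = subst ((x ∷ xs) ∼_) (sym (ρ^-% x xs i)) (ρ^⇒∼ _ (ℕ.m%n<n i (length (x ∷ xs))))

  ∼-nonempty : ∀ {C C′ : List A} → C ∼ C′ → 0 < length C
  ∼-nonempty C∼C′ with i , i<C , _ ← ∼⇒ρ^ C∼C′ = ℕ.≤-<-trans z≤n i<C

  ∼-trans : ∀ {C D E : List A} → C ∼ D → D ∼ E → C ∼ E
  ∼-trans {C} C∼D D∼E with i , _ , refl ← ∼⇒ρ^ C∼D with j , _ , refl ← ∼⇒ρ^ D∼E =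
    subst (C ∼_) (ρ^-+ i j C) (ρ^⇒∼′ (i ℕ.+ j) (∼-nonempty C∼D))

  ∼-sym : ∀ {C D : List A} → C ∼ D → D ∼ C
  ∼-sym {C} C∼D with i , i<C , refl ← ∼⇒ρ^ C∼D = subst (ρ^ i C ∼_)
    (trans (sym (ρ^-+ i (length C ℕ.∸ i) C)) (trans (cong (λ k → ρ^ k C) (ℕ.m+[n∸m]≡n (ℕ.<⇒≤ i<C))) (ρ^-length C)))
    (ρ^⇒∼′ (length C ℕ.∸ i) (subst (0 <_) (sym (length-ρ^ i C)) (∼-nonempty C∼D)))

  -- If rotations by i < j agree, rotating further by |C| - i shows that j - i is a period. A
  -- primitive word has no positive period below its length.
  rotations-unique : ∀ {C} → Primitive C → Unique (rotations C)
  rotations-unique {C} prim = subst Unique (sym (List.map-upTo _ (length C)))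
    (Unique.applyUpTo⁺₁ _ (length C) λ {i} {j} i<j j<C e → not-equal i<j j<C
      (trans (ρ^-drop-take i C (ℕ.<⇒≤ (ℕ.<-trans i<j j<C))) (trans e (sym (ρ^-drop-take j C (ℕ.<⇒≤ j<C))))))
    where
    open ≡-Reasoning
    not-equal : ∀ {i j} → i < j → j < length C → ρ^ i C ≢ ρ^ j C
    not-equal {i} {j} i<j j<C e = ℕ.<⇒≱ (ℕ.≤-<-trans (ℕ.m∸n≤m j i) j<C)
      (ℕ.∣⇒≤ {{ℕ.>-nonZero (ℕ.m<n⇒0<n∸m i<j)}} (primitive-period prim (ℕ.≤-<-trans z≤n j<C) s (begin
        ρ^ s C                       ≡⟨ cong (ρ^ s) (ρ^-length C) ⟨
        ρ^ s (ρ^ (length C) C)       ≡⟨ ρ^-+ (length C) s C ⟨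
        ρ^ (length C ℕ.+ s) C        ≡⟨ cong (λ k → ρ^ k C) arith ⟩
        ρ^ (j ℕ.+ t) C               ≡⟨ ρ^-+ j t C ⟩
        ρ^ t (ρ^ j C)                ≡⟨ cong (ρ^ t) e ⟨
        ρ^ t (ρ^ i C)                ≡⟨ ρ^-+ i t C ⟨
        ρ^ (i ℕ.+ t) C               ≡⟨ cong (λ k → ρ^ k C) i+t ⟩
        ρ^ (length C) C              ≡⟨ ρ^-length C ⟩
        C                            ∎)))
      where
      s = j ℕ.∸ i
      t = length C ℕ.∸ i
      i+t : i ℕ.+ t ≡ length C
      i+t = ℕ.m+[n∸m]≡n (ℕ.<⇒≤ (ℕ.<-trans i<j j<C))
      arith : length C ℕ.+ s ≡ j ℕ.+ t
      arith = begin
        length C ℕ.+ s       ≡⟨ cong (ℕ._+ s) i+t ⟨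
        i ℕ.+ t ℕ.+ s        ≡⟨ ℕ.+-assoc i t s ⟩
        i ℕ.+ (t ℕ.+ s)      ≡⟨ cong (i ℕ.+_) (ℕ.+-comm t s) ⟩
        i ℕ.+ (s ℕ.+ t)      ≡⟨ ℕ.+-assoc i s t ⟨
        i ℕ.+ s ℕ.+ t        ≡⟨ cong (ℕ._+ t) (ℕ.m+[n∸m]≡n (ℕ.<⇒≤ i<j)) ⟩
        j ℕ.+ t              ∎

-- Counting lists and inverting divisor sums

module _ {a} {A : Set a} where
  open ≡ using (refl; trans; cong)

  unique-length : ∀ {xs ys : List A} → Unique xs → Unique ys →
                  (∀ {z} → z ∈ xs → z ∈ ys) → (∀ {z} → z ∈ ys → z ∈ xs) → length xs ≡ length ys
  unique-length u v f g = ↭.↭-length (∼bag⇒↭ (unique∧set⇒bag u v (mk⇔ f g)))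

  length-concat : ∀ (xss : List (List A)) → length (concat xss) ≡ ℕList.sum (map length xss)
  length-concat []         = refl
  length-concat (xs ∷ xss) = trans (List.length-++ xs) (cong (length xs ℕ.+_) (length-concat xss))

sum-applyUpTo-suc : ∀ f n → ℕList.sum (applyUpTo f (suc n)) ≡ ℕList.sum (applyUpTo f n) ℕ.+ f n
sum-applyUpTo-suc f zero    = ℕ.+-comm (f 0) 0
sum-applyUpTo-suc f (suc n) = ≡.trans (≡.cong (f 0 ℕ.+_) (sum-applyUpTo-suc (f ∘ suc) n)) (≡.sym (ℕ.+-assoc (f 0) _ _))

sum-applyUpTo-cong : ∀ {f g} n → (∀ i → i < n → f i ≡ g i) → ℕList.sum (applyUpTo f n) ≡ ℕList.sum (applyUpTo g n)
sum-applyUpTo-cong zero    f≡g = ≡.refl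
sum-applyUpTo-cong (suc n) f≡g = ≡.cong₂ ℕ._+_ (f≡g 0 (s≤s z≤n)) (sum-applyUpTo-cong n (λ i i<n → f≡g (suc i) (s≤s i<n)))

divisorSum : (ℕ → ℕ) → ℕ → ℕ
divisorSum f k = ℕList.sum (applyUpTo (λ i → if does (suc i ∣? k) then f (suc i) else 0) k)

-- Takes the place of Möbius inversion: the divisor k + 1 of itself contributes with coefficient 1,
-- and all smaller divisors are known by strong induction.
divisorSum-injective : ∀ {f g} → (∀ k → divisorSum f (suc k) ≡ divisorSum g (suc k)) → ∀ k → f (suc k) ≡ g (suc k)
divisorSum-injective {f} {g} e = <-rec _ λ k rec → ℕ.+-cancelˡ-≡ (ℕList.sum (applyUpTo (term f k) k)) _ _ (begin
  ℕList.sum (applyUpTo (term f k) k) ℕ.+ f (suc k)  ≡⟨ split f k ⟨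
  divisorSum f (suc k)                       ≡⟨ e k ⟩
  divisorSum g (suc k)                       ≡⟨ split g k ⟩
  ℕList.sum (applyUpTo (term g k) k) ℕ.+ g (suc k)
    ≡⟨ ≡.cong (ℕ._+ g (suc k)) (sum-applyUpTo-cong k
        (λ i i<k → ≡.cong (λ m → if does (suc i ∣? suc k) then m else 0) (rec i<k))) ⟨
  ℕList.sum (applyUpTo (term f k) k) ℕ.+ g (suc k)  ∎)
  where
  open ≡.≡-Reasoning
  term : (ℕ → ℕ) → ℕ → ℕ → ℕ
  term f k i = if does (suc i ∣? suc k) then f (suc i) else 0
  split : ∀ f k → divisorSum f (suc k) ≡ ℕList.sum (applyUpTo (term f k) k) ℕ.+ f (suc k)
  split f k = ≡.trans (sum-applyUpTo-suc (term f k) k)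
    (≡.cong (λ b → ℕList.sum (applyUpTo (term f k) k) ℕ.+ (if b then f (suc k) else 0)) (dec-true (suc k ∣? suc k) ℕ.∣-refl))

-- Cyclic words over an alphabet with a step relation

module ClosedWords {a s} {A : Set a} (_≟_ : DecidableEquality A) {Step : A → A → Set s} (step? : Decidable Step)
                   (as : List A) (as! : Unique as) where
  open ≡ using (refl; sym; trans; cong; cong₂; subst; module ≡-Reasoning)
  open Rotation {A = A}

  -- The endpoint is a separate argument and not a letter of the word, so chains concatenate without
  -- overlap, and a cyclic word is a chain from its first letter to itself.
  Chain : A → List A → A → Set s
  Chain x []       y = Step x y
  Chain x (z ∷ zs) y = Step x z × Chain z zs y

  -- The empty word is excluded: it has no rotations in the sense of `rotations`, and it is a power
  -- of itself.
  Closed : List A → Set s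
  Closed []       = Level.Lift s ⊥
  Closed (x ∷ xs) = Chain x xs x

  chain? : ∀ x xs y → Dec (Chain x xs y)
  chain? x []       y = step? x y
  chain? x (z ∷ zs) y = step? x z ×-dec chain? z zs y

  closed? : U.Decidable Closed
  closed? []       = no λ ()
  closed? (x ∷ xs) = chain? x xs x

  chain-++⁺ : ∀ x xs y ys z → Chain x xs y → Chain y ys z → Chain x (xs ++ y ∷ ys) z
  chain-++⁺ x []       y ys z c         c′ = c , c′
  chain-++⁺ x (w ∷ xs) y ys z (s₁ , c)  c′ = s₁ , chain-++⁺ w xs y ys z c c′

  chain-++⁻ : ∀ x xs y ys z → Chain x (xs ++ y ∷ ys) z → Chain x xs y × Chain y ys z
  chain-++⁻ x []       y ys z c        = c
  chain-++⁻ x (w ∷ xs) y ys z (s₁ , c) with c₁ , c₂ ← chain-++⁻ w xs y ys z c = (s₁ , c₁) , c₂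

  closed-ρ : ∀ C → Closed C → Closed (ρ C)
  closed-ρ (x ∷ [])     c        = c
  closed-ρ (x ∷ y ∷ ys) (s₁ , c) = chain-++⁺ y ys x [] y c s₁

  closed-ρ^ : ∀ n C → Closed C → Closed (ρ^ n C)
  closed-ρ^ zero    C c = c
  closed-ρ^ (suc n) C c = closed-ρ^ n (ρ C) (closed-ρ C c)

  closed-power : ∀ q D → Closed D → Closed (power (suc q) D)
  closed-power zero    (x ∷ xs) c = subst (λ l → Chain x l x) (sym (List.++-identityʳ xs)) c
  closed-power (suc q) (x ∷ xs) c = chain-++⁺ x xs x (xs ++ power q (x ∷ xs)) x c (closed-power q (x ∷ xs) c)

  closed-root : ∀ q D → 0 < length D → Closed (power (suc q) D) → Closed D
  closed-root zero    (x ∷ xs) _ c = subst (λ l → Chain x l x) (List.++-identityʳ xs) c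
  closed-root (suc q) (x ∷ xs) _ c = proj₁ (chain-++⁻ x xs x (xs ++ power q (x ∷ xs)) x c)

  closed-nonempty : ∀ C → Closed C → 0 < length C
  closed-nonempty (x ∷ xs) c = s≤s z≤n

  Letters : List A → Set a
  Letters = All (_∈ as)

  letters-ρ : ∀ C → Letters C → Letters (ρ C)
  letters-ρ []       []       = []
  letters-ρ (x ∷ xs) (p ∷ ps) = All.++⁺ ps (p ∷ [])

  letters-ρ^ : ∀ n C → Letters C → Letters (ρ^ n C)
  letters-ρ^ zero    C l = l
  letters-ρ^ (suc n) C l = letters-ρ^ n (ρ C) (letters-ρ C l)

  letters-power : ∀ q D → Letters D → Letters (power q D)
  letters-power zero    D l = []
  letters-power (suc q) D l = All.++⁺ l (letters-power q D l)

  ∈-words⁺ : ∀ C → Letters C → C ∈ words as (length C)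
  ∈-words⁺ []       []       = here refl
  ∈-words⁺ (x ∷ xs) (p ∷ ps) = ∈.∈-cartesianProductWith⁺ _∷_ p (∈-words⁺ xs ps)

  ∈-words⁻ : ∀ k C → C ∈ words as k → length C ≡ k × Letters C
  ∈-words⁻ zero    C (here refl) = refl , []
  ∈-words⁻ (suc k) C C∈ with x , xs , x∈ , xs∈ , refl ← ∈.∈-cartesianProductWith⁻ _∷_ as (words as k) C∈
    with l , ls ← ∈-words⁻ k xs xs∈ = cong suc l , x∈ ∷ ls

  words! : ∀ k → Unique (words as k)
  words! zero    = [] ∷ []
  words! (suc k) = Unique.cartesianProductWith⁺ _∷_ List.∷-injective as! (words! k)

  closedWords primeWords : ℕ → List (List A)
  closedWords k = filter closed? (words as k)
  primeWords  k = filter (λ C → closed? C ×-dec primitive? _≟_ C) (words as k)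

  classes : ℕ → List (List A)
  classes k = deduplicate (∼? _≟_) (primeWords k)

  ∈-closedWords⁺ : ∀ {k C} → length C ≡ k → Letters C → Closed C → C ∈ closedWords k
  ∈-closedWords⁺ refl l c = ∈.∈-filter⁺ closed? (∈-words⁺ _ l) c

  ∈-closedWords⁻ : ∀ {k C} → C ∈ closedWords k → length C ≡ k × Letters C × Closed C
  ∈-closedWords⁻ {k} {C} C∈ with C∈w , c ← ∈.∈-filter⁻ closed? {xs = words as k} C∈ with l , ls ← ∈-words⁻ k C
      C∈w = l , ls , c

  ∈-primeWords⁺ : ∀ {k C} → length C ≡ k → Letters C → Closed C → Primitive C → C ∈ primeWords k
  ∈-primeWords⁺ refl l c p = ∈.∈-filter⁺ _ (∈-words⁺ _ l) (c , p)

  ∈-primeWords⁻ : ∀ {k C} → C ∈ primeWords k → length C ≡ k × Letters C × Closed C × Primitive C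
  ∈-primeWords⁻ {k} {C} C∈ with C∈w , c , p ← ∈.∈-filter⁻ _ {xs = words as k} C∈ with l , ls ← ∈-words⁻ k C C∈w
      = l , ls , c , p

  primitive-ρ^ : ∀ {C} n → Primitive C → 0 < length C → Primitive (ρ^ n C)
  primitive-ρ^ {C} n prim C>0 D r 2≤r e with m , _ , C≡ ← ∼⇒ρ^ (∼-sym (ρ^⇒∼′ {C} n C>0)) =
    prim (ρ^ m D) r 2≤r (trans C≡ (trans (cong (ρ^ m) e) (ρ^-power-comm m r D)))

  private
    reps-distinct : ∀ L → AllPairs (λ r r′ → ¬ r ∼ r′) (deduplicate (∼? _≟_) L)
    reps-distinct []      = []
    reps-distinct (x ∷ L) = All.all-filter (¬? ∘ ∼? _≟_ x) (deduplicate (∼? _≟_) L) ∷ AllPairs.filter⁺ _ (reps-distinct L)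

    -- A representative is discarded only when an earlier word is equivalent to it; by transitivity
    -- that word takes over its class.
    reps-cover : ∀ L {C} → C ∈ L → 0 < length C → ∃[ r ] r ∈ deduplicate (∼? _≟_) L × r ∼ C
    reps-cover (x ∷ L) (here refl) C>0 = x , here refl , ρ^⇒∼′ 0 C>0
    reps-cover (x ∷ L) (there C∈L) C>0 with r , r∈ , r∼C ← reps-cover L C∈L C>0 with ∼? _≟_ x r
    ... | yes x∼r = x , here refl , ∼-trans x∼r r∼C
    ... | no  x≁r = r , there (∈.∈-filter⁺ _ r∈ x≁r) , r∼C

  -- A primitive word of length `k` has `k` distinct rotations, all of them primitive and closed. So
  -- the rotations of the representatives list every prime word exactly once.
  primeWords-classes : ∀ k → length (primeWords k) ≡ length (classes k) ℕ.* k
  primeWords-classes k = begin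
    length (primeWords k)                                ≡⟨ unique-length (Unique.filter⁺ _ (words! k)) union! to from ⟩
    length (concatMap rotations (classes k))             ≡⟨ length-concat (map rotations (classes k)) ⟩
    ℕList.sum (map length (map rotations (classes k)))   ≡⟨ constant-sum (classes k)
        (λ r∈ → ∈.∈-deduplicate⁻ (∼? _≟_) (primeWords k) r∈) ⟩
    length (classes k) ℕ.* k                             ∎
    where
    open ≡-Reasoning
    member : ∀ {r} → r ∈ classes k → r ∈ primeWords k
    member = ∈.∈-deduplicate⁻ (∼? _≟_) (primeWords k)
    constant-sum : ∀ R → (∀ {r} → r ∈ R → r ∈ primeWords k) → ℕList.sum (map length (map rotations R)) ≡ length R ℕ.* k
    constant-sum []      R⊆ = refl
    constant-sum (r ∷ R) R⊆ = cong₂ ℕ._+_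
      (trans (List.length-map _ (upTo (length r)))
          (trans (List.length-upTo (length r)) (proj₁ (∈-primeWords⁻ {k} (R⊆ (here refl))))))
      (constant-sum R (R⊆ ∘ there))
    union! : Unique (concatMap rotations (classes k))
    union! = Unique.concat⁺
      (All.map⁺ (All.tabulate λ r∈ → rotations-unique (proj₂ (proj₂ (proj₂ (∈-primeWords⁻ {k} (member r∈)))))))
      (AllPairs.map⁺ (AllPairs.map disjoint (reps-distinct (primeWords k))))
      where
      disjoint : ∀ {r r′} → ¬ r ∼ r′ → Disjoint (rotations r) (rotations r′)
      disjoint r≁r′ (z∈r , z∈r′) = r≁r′ (∼-trans z∈r (∼-sym z∈r′))
    to : ∀ {C} → C ∈ primeWords k → C ∈ concatMap rotations (classes k)
    to {C} C∈ with l , _ , c , _ ← ∈-primeWords⁻ {k} C∈ with r , r∈ , r∼C ← reps-cover (primeWords k) C∈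
        (closed-nonempty C c) =
      ∈.∈-concat⁺′ r∼C (∈.∈-map⁺ rotations r∈)
    from : ∀ {C} → C ∈ concatMap rotations (classes k) → C ∈ primeWords k
    from C∈ with xs , C∈xs , xs∈ ← ∈.∈-concat⁻′ (map rotations (classes k)) C∈ with r , r∈ , refl ← ∈.∈-map⁻ rotations xs∈
      with l , ls , c , p ← ∈-primeWords⁻ {k} (member r∈) with i , _ , refl ← ∼⇒ρ^ C∈xs =
      ∈-primeWords⁺ (trans (length-ρ^ i r) l) (letters-ρ^ i r ls) (closed-ρ^ i r c) (primitive-ρ^ i p (closed-nonempty r c))

  -- Each closed word is a power of a primitive closed word whose length divides its own. That
  -- length is unique by `root-unique`, and for fixed length the root is unique because powers are
  -- injective.
  closedWords-divisorSum : ∀ k → length (closedWords (suc k)) ≡ divisorSum (λ d → length (classes d) ℕ.* d) (suc k)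
  closedWords-divisorSum k = begin
    length (closedWords (suc k))                         ≡⟨ unique-length
        (Unique.filter⁺ closed? (words! (suc k))) union! to from ⟩
    length (concat (applyUpTo part (suc k)))             ≡⟨ length-concat (applyUpTo part (suc k)) ⟩
    ℕList.sum (map length (applyUpTo part (suc k)))      ≡⟨ cong ℕList.sum (List.map-applyUpTo part length (suc k)) ⟩
    ℕList.sum (applyUpTo (length ∘ part) (suc k))        ≡⟨ sum-applyUpTo-cong (suc k) (λ i _ → length-part i) ⟩
    divisorSum (λ d → length (classes d) ℕ.* d) (suc k)  ∎
    where
    open ≡-Reasoning
    -- The exponent of the power is the quotient contained in the proof of divisibility.
    powers : ∀ {i} → Dec (suc i ∣ suc k) → List (List A)
    powers {i} (yes (divides q _)) = map (power q) (primeWords (suc i))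
    powers     (no _)              = []
    part : ℕ → List (List A)
    part i = powers (suc i ∣? suc k)
    length-powers : ∀ {i} (d : Dec (suc i ∣ suc k)) → length (powers d) ≡
        (if does d then length (classes (suc i)) ℕ.* suc i else 0)
    length-powers {i} (yes (divides q _)) = trans (List.length-map (power q) (primeWords (suc i)))
        (primeWords-classes (suc i))
    length-powers     (no _)              = refl
    length-part : ∀ i → length (part i) ≡ (if does (suc i ∣? suc k) then length (classes (suc i)) ℕ.* suc i else 0)
    length-part i = length-powers (suc i ∣? suc k)
    part⁻ : ∀ i {C} → C ∈ part i → ∃[ q ] ∃[ D ] suc k ≡ suc q ℕ.* suc i × C ≡ power (suc q) D × D ∈ primeWords (suc i)
    part⁻ i C∈ with suc i ∣? suc k
    ... | yes (divides (suc q) e) with D , D∈ , refl ← ∈.∈-map⁻ (power (suc q)) C∈ = q , D , e , refl , D∈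
    part⁺ : ∀ i q D → suc k ≡ suc q ℕ.* suc i → D ∈ primeWords (suc i) → power (suc q) D ∈ part i
    part⁺ i q D e D∈ with suc i ∣? suc k
    ... | no ∤ = ⊥-elim (∤ (divides (suc q) e))
    ... | yes (divides q′ e′) with refl ← ℕ.*-cancelʳ-≡ (suc q) q′ (suc i) (trans (sym e) e′) = ∈.∈-map⁺ (power (suc q)) D∈
    part! : ∀ i → Unique (part i)
    part! i with suc i ∣? suc k
    ... | yes (divides (suc q) _) = Unique.map⁺ (power-injective q) (Unique.filter⁺ _ (words! (suc i)))
    ... | no _                    = []
    union! : Unique (concat (applyUpTo part (suc k)))
    union! = Unique.concat⁺ (All.applyUpTo⁺₂ part (suc k) part!) (AllPairs.applyUpTo⁺₁ part (suc k) disjoint)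
      where
      disjoint : ∀ {i j} → i < j → j < suc k → Disjoint (part i) (part j)
      disjoint {i} {j} i<j _ (C∈i , C∈j)
        with q , D , _ , refl , D∈ ← part⁻ i C∈i with r , E , _ , e , E∈ ← part⁻ j C∈j
        with lD , _ , cD , pD ← ∈-primeWords⁻ {suc i} D∈ with lE , _ , cE , pE ← ∈-primeWords⁻ {suc j} E∈ =
        ℕ.<-irrefl (ℕ.suc-injective (trans (sym lD)
            (trans (root-unique q r pD pE (closed-nonempty D cD) (closed-nonempty E cE) e) lE))) i<j
    to : ∀ {C} → C ∈ closedWords (suc k) → C ∈ concat (applyUpTo part (suc k))
    to {C} C∈ with l , ls , c ← ∈-closedWords⁻ {suc k} C∈ with root _≟_ C (closed-nonempty C c)
    ... | q , D@(_ ∷ D′) , refl , pD , D>0 = ∈.∈-concat⁺′ (part⁺ (length D′) q D k≡ D∈)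
        (∈.∈-applyUpTo⁺ part (ℕ.≤-trans (ℕ.m≤m+n (length D) _) (ℕ.≤-reflexive (sym k≡))))
      where
      k≡ : suc k ≡ suc q ℕ.* length D
      k≡ = trans (sym l) (length-power (suc q) D)
      D∈ : D ∈ primeWords (length D)
      D∈ = ∈-primeWords⁺ refl (All.++⁻ˡ D ls) (closed-root q D D>0 c) pD
    from : ∀ {C} → C ∈ concat (applyUpTo part (suc k)) → C ∈ closedWords (suc k)
    from C∈ with xs , C∈xs , xs∈ ← ∈.∈-concat⁻′ (applyUpTo part (suc k)) C∈ with i , _ , refl ← ∈.∈-applyUpTo⁻ part xs∈
      with q , D , e , refl , D∈ ← part⁻ i C∈xs with l , ls , c , _ ← ∈-primeWords⁻ {suc i} D∈ =
      ∈-closedWords⁺ (trans (length-power (suc q) D) (trans (cong (suc q ℕ.*_) l) (sym e)))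
          (letters-power (suc q) D ls) (closed-power q D c)

-- Euler products and their exponents

eulerProduct : List ℕ → Series
eulerProduct = foldr (λ d Z → geometric d ⊛ Z) one

module _ where
  open ≡ using (refl; trans; cong; cong₂; module ≡-Reasoning)

  ⊛-expand : ∀ d Z n → (geometric d ⊛ Z) n ≡ Z n ℕ.+ ℕList.sum (applyUpTo (λ i → geometric d (suc i) ℕ.* Z (n ℕ.∸ suc i)) n)
  ⊛-expand d Z n = trans (cong ℕList.sum (List.map-upTo (λ i → geometric d i ℕ.* Z (n ℕ.∸ i)) (suc n)))
    (cong (ℕ._+ ℕList.sum (applyUpTo (λ i → geometric d (suc i) ℕ.* Z (n ℕ.∸ suc i)) n))
        (trans (cong (λ b → (if b then 1 else 0) ℕ.* Z n) (dec-true (d ∣? 0) (d ℕ.∣0))) (ℕ.*-identityˡ (Z n))))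

  -- Congruence Z ≡ Z′ + p uᵐ modulo u^(m+1), phrased without subtraction.
  AgreeBelow : ℕ → ℕ → Series → Series → Set
  AgreeBelow m p Z Z′ = (∀ k → k < m → Z k ≡ Z′ k) × Z m ≡ p ℕ.+ Z′ m

  -- The factor has constant term 1, so the leading term p uᵐ of the difference passes through
  -- unchanged.
  ⊛-agree : ∀ {m p Z Z′} d → AgreeBelow m p Z Z′ → AgreeBelow m p (geometric d ⊛ Z) (geometric d ⊛ Z′)
  ⊛-agree {m} {p} {Z} {Z′} d (below , at) = (λ k k<m → begin
      (geometric d ⊛ Z) k        ≡⟨ ⊛-expand d Z k ⟩
      _                          ≡⟨ cong₂ ℕ._+_ (below k k<m) (lower k (ℕ.<⇒≤ k<m)) ⟩
      _                          ≡⟨ ⊛-expand d Z′ k ⟨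
      (geometric d ⊛ Z′) k       ∎) , (begin
      (geometric d ⊛ Z) m        ≡⟨ ⊛-expand d Z m ⟩
      _                          ≡⟨ cong₂ ℕ._+_ at (lower m ℕ.≤-refl) ⟩
      p ℕ.+ Z′ m ℕ.+ _           ≡⟨ ℕ.+-assoc p (Z′ m) _ ⟩
      p ℕ.+ (Z′ m ℕ.+ _)         ≡⟨ cong (p ℕ.+_) (⊛-expand d Z′ m) ⟨
      p ℕ.+ (geometric d ⊛ Z′) m ∎)
    where
    open ≡-Reasoning
    lower : ∀ k → k ≤ m → ℕList.sum (applyUpTo (λ i → geometric d (suc i) ℕ.* Z (k ℕ.∸ suc i)) k)
                        ≡ ℕList.sum (applyUpTo (λ i → geometric d (suc i) ℕ.* Z′ (k ℕ.∸ suc i)) k)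
    lower k k≤m = sum-applyUpTo-cong k (λ i i<k → cong (geometric d (suc i) ℕ.*_)
      (below _ (ℕ.<-≤-trans (ℕ.∸-monoʳ-< {k} {suc i} {0} (s≤s z≤n) i<k) k≤m)))

  -- This is (1 - u^(m+1))^(-p) = 1 + p u^(m+1) + ⋯, one factor at a time.
  eulerProduct-replicate : ∀ m p → AgreeBelow (suc m) p (eulerProduct (replicate p (suc m))) one
  eulerProduct-replicate m zero    = (λ _ _ → refl) , refl
  eulerProduct-replicate m (suc p) with below , at ← eulerProduct-replicate m p = (λ k k<m → begin
      (geometric (suc m) ⊛ Z) k  ≡⟨ ⊛-expand (suc m) Z k ⟩
      _                          ≡⟨ cong₂ ℕ._+_ (below k k<m) (vanish k k (ℕ.≤-pred k<m)) ⟩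
      one k ℕ.+ 0                ≡⟨ ℕ.+-identityʳ _ ⟩
      one k                      ∎) , (begin
      (geometric (suc m) ⊛ Z) (suc m)   ≡⟨ ⊛-expand (suc m) Z (suc m) ⟩
      Z (suc m) ℕ.+ ℕList.sum (applyUpTo (term (suc m)) (suc m))
        ≡⟨ cong₂ ℕ._+_ at (trans (sum-applyUpTo-suc (term (suc m)) m) (cong₂ ℕ._+_ (vanish (suc m) m ℕ.≤-refl) last-term)) ⟩
      p ℕ.+ 0 ℕ.+ 1              ≡⟨ trans (cong (ℕ._+ 1) (ℕ.+-identityʳ p)) (ℕ.+-comm p 1) ⟩
      suc p                      ≡⟨ ℕ.+-identityʳ (suc p) ⟨
      suc p ℕ.+ 0                ∎)
    where
    open ≡-Reasoning
    Z = eulerProduct (replicate p (suc m))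
    term : ℕ → ℕ → ℕ
    term k i = geometric (suc m) (suc i) ℕ.* Z (k ℕ.∸ suc i)
    vanish : ∀ k n → n ≤ m → ℕList.sum (applyUpTo (term k) n) ≡ 0
    vanish k n n≤m = trans
      (sum-applyUpTo-cong n (λ i i<n → cong (λ b → (if b then 1 else 0) ℕ.* Z (k ℕ.∸ suc i))
        (dec-false (suc m ∣? suc i) λ m∣i → ℕ.<⇒≱ (s≤s (ℕ.<-≤-trans i<n n≤m)) (ℕ.∣⇒≤ m∣i))))
      (zeros n)
      where
      zeros : ∀ n → ℕList.sum (applyUpTo (λ _ → 0) n) ≡ 0
      zeros zero    = refl
      zeros (suc n) = zeros n
    last-term : term (suc m) m ≡ 1
    last-term = trans (cong₂ (λ b k → (if b then 1 else 0) ℕ.* Z k) (dec-true (suc m ∣? suc m) ℕ.∣-refl) (ℕ.n∸n≡0 (suc m)))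
      (trans (ℕ.*-identityˡ (Z 0)) (proj₁ (eulerProduct-replicate m p) 0 (s≤s z≤n)))

  -- Indices are shifted: `π i` is the multiplicity of the length i + 1, since length 0 does not
  -- occur.
  exponents : (ℕ → ℕ) → ℕ → List ℕ
  exponents π m = concat (applyUpTo (λ i → replicate (π i) (suc i)) m)

  exponents-cong : ∀ {π π′} m → (∀ i → i < m → π i ≡ π′ i) → exponents π m ≡ exponents π′ m
  exponents-cong {π} {π′} m e = cong concat (go (λ i → replicate (π i) (suc i)) (λ i → replicate (π′ i) (suc i)) m
      (λ i i<m → cong (λ r → replicate r (suc i)) (e i i<m)))
    where
    go : ∀ (f g : ℕ → List ℕ) m → (∀ i → i < m → f i ≡ g i) → applyUpTo f m ≡ applyUpTo g m
    go f g zero    e = refl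
    go f g (suc m) e = cong₂ _∷_ (e 0 (s≤s z≤n)) (go (f ∘ suc) (g ∘ suc) m (λ i i<m → e (suc i) (s≤s i<m)))

  eulerProduct-top : ∀ π m → eulerProduct (exponents π (suc m)) (suc m) ≡ π m ℕ.+ eulerProduct (exponents π m) (suc m)
  eulerProduct-top π m = trans (cong (λ ns → eulerProduct ns (suc m)) (begin
      exponents π (suc m)                                   ≡⟨ cong concat (List.applyUpTo-∷ʳ f m) ⟨
      concat (applyUpTo f m ++ [ f m ])                     ≡⟨ List.concat-++ (applyUpTo f m) [ f m ] ⟨
      exponents π m ++ (f m ++ [])                          ≡⟨ cong (exponents π m ++_) (List.++-identityʳ (f m)) ⟩
      exponents π m ++ f m                                  ∎))
    (proj₂ (append (exponents π m)))
    where
    open ≡-Reasoning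
    f = λ i → replicate (π i) (suc i)
    append : ∀ ns → AgreeBelow (suc m) (π m) (eulerProduct (ns ++ f m)) (eulerProduct ns)
    append []       = eulerProduct-replicate m (π m)
    append (d ∷ ns) = ⊛-agree d (append ns)

  -- The system is triangular: the coefficient of u^(m+1) is `π m` plus a quantity that depends only
  -- on shorter lengths.
  eulerProduct-injective : ∀ {π π′} → (∀ n → eulerProduct (exponents π n) n ≡ eulerProduct (exponents π′ n) n) →
      ∀ i → π i ≡ π′ i
  eulerProduct-injective {π} {π′} e = <-rec _ λ m rec → ℕ.+-cancelʳ-≡ (eulerProduct (exponents π m) (suc m)) _ _ (begin
    π m ℕ.+ eulerProduct (exponents π m) (suc m)     ≡⟨ eulerProduct-top π m ⟨
    eulerProduct (exponents π (suc m)) (suc m)       ≡⟨ e (suc m) ⟩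
    eulerProduct (exponents π′ (suc m)) (suc m)      ≡⟨ eulerProduct-top π′ m ⟩
    π′ m ℕ.+ eulerProduct (exponents π′ m) (suc m)   ≡⟨ cong (λ ns → π′ m ℕ.+ eulerProduct ns (suc m))
        (exponents-cong m (λ i i<m → rec i<m)) ⟨
    π′ m ℕ.+ eulerProduct (exponents π m) (suc m)    ∎)
    where open ≡-Reasoning

-- Primes of a graph as cyclic words of arcs

module Walks (G : Graph) where
  open Cycles G
  open ≡ using (refl; sym; trans; cong; cong₂; module ≡-Reasoning)

  Step : Arc → Arc → Set
  Step e f = Composable e f × NotInverse e f

  step? : Decidable Step
  step? e f = composable? e f ×-dec notInverse? e f

  arcs! : Unique arcs
  arcs! = Unique.filter⁺ _ (Unique.cartesianProduct⁺ (Unique.allFin⁺ (order G)) (Unique.allFin⁺ (order G)))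

  open ClosedWords _≟_ step? arcs arcs! public

  linked⇒chain : ∀ x xs y → Linked Composable (x ∷ xs) → Connected Composable (List.last (x ∷ xs)) (Maybe.just y) →
                 Linked NotInverse (x ∷ xs) → Connected NotInverse (List.last (x ∷ xs)) (Maybe.just y) → Chain x xs y
  linked⇒chain x []       y _       (Connected.just c) _         (Connected.just n) = c , n
  linked⇒chain x (z ∷ zs) y (c ∷ cs) c′                (n ∷ ns) n′                  = (c , n) , linked⇒chain z
      zs y cs c′ ns n′

  chain⇒linked : ∀ x xs y → Chain x xs y →
    (Linked Composable (x ∷ xs) × Connected Composable (List.last (x ∷ xs)) (Maybe.just y)) ×
    Linked NotInverse (x ∷ xs) × Connected NotInverse (List.last (x ∷ xs)) (Maybe.just y)
  chain⇒linked x []       y (c , n)         = ([-] , Connected.just c) , [-] , Connected.just n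
  chain⇒linked x (z ∷ zs) y ((c , n) , ch) with (cs , c′) , ns , n′ ← chain⇒linked z zs y ch = (c ∷ cs , c′) , n ∷ ns , n′

  prime⇒ : ∀ {C} → Prime C → Closed C × Primitive C
  -- The empty list is its own square, hence not primitive.
  prime⇒ {[]}     (_ , _ , _ , prim) = ⊥-elim (prim [] 2 (s≤s (s≤s z≤n)) refl)
  prime⇒ {x ∷ xs} ((cs , c) , ns , n , prim) = linked⇒chain x xs x cs c ns n , prim

  ⇒prime : ∀ {C} → Closed C × Primitive C → Prime C
  ⇒prime {x ∷ xs} (ch , prim) with (cs , c) , ns , n ← chain⇒linked x xs x ch = (cs , c) , ns , n , prim

  -- Equivalent predicates filter the same list to the same list, in the same order, so the chosen
  -- representatives coincide too.
  primeClasses≡classes : ∀ k → primeClasses k ≡ classes k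
  primeClasses≡classes k = cong (deduplicate (∼? _≟_))
    (List.filter-≐ prime? (λ C → closed? C ×-dec primitive? _≟_ C) (prime⇒ , ⇒prime) (words arcs k))

  zeta≡eulerProduct : ∀ n → zeta G n ≡ eulerProduct (exponents (λ i → length (classes (suc i))) n) n
  zeta≡eulerProduct n = trans (lengths (concatMap (λ i → primeClasses (suc i)) (upTo n)))
      (cong (λ ns → eulerProduct ns n) (begin
    map length (concatMap (λ i → primeClasses (suc i)) (upTo n))
      ≡⟨ List.map-concatMap length (λ i → primeClasses (suc i)) (upTo n) ⟩
    concatMap (λ i → map length (primeClasses (suc i))) (upTo n)
      ≡⟨ List.concatMap-cong (λ i → trans (cong (map length) (primeClasses≡classes (suc i))) (all-length (suc i))) (upTo n) ⟩
    concatMap (λ i → replicate (length (classes (suc i))) (suc i)) (upTo n)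
      ≡⟨ cong concat (List.map-upTo (λ i → replicate (length (classes (suc i))) (suc i)) n) ⟩
    exponents (λ i → length (classes (suc i))) n ∎))
    where
    open ≡-Reasoning
    lengths : ∀ (Cs : List (List Arc)) → foldr (λ C Z → geometric (length C) ⊛ Z) one Cs n ≡ eulerProduct (map length Cs) n
    lengths Cs = cong (λ Z → Z n) (sym (List.foldr-map (λ d Z → geometric d ⊛ Z) length one Cs))
    constant-map : ∀ {k} (Cs : List (List Arc)) → (∀ {C} → C ∈ Cs → length C ≡ k) → map length Cs ≡ replicate (length Cs) k
    constant-map []       e = refl
    constant-map (C ∷ Cs) e = cong₂ _∷_ (e (here refl)) (constant-map Cs (e ∘ there))
    all-length : ∀ k → map length (classes k) ≡ replicate (length (classes k)) k
    all-length k = constant-map (classes k) (λ C∈ → proj₁ (∈-primeWords⁻ {k} (∈.∈-deduplicate⁻ (∼? _≟_) (primeWords k) C∈)))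

  closedWalks : ℕ → ℕ
  closedWalks k = length (closedWords k)

module _ (G G′ : Graph) where
  private
    module W  = Walks G
    module W′ = Walks G′
  open ≡ using (sym; trans; cong)

  -- Two triangular systems over ℕ: the Euler product and the numbers of prime classes determine
  -- each other, and so do these numbers and the counts of closed walks.
  zeta⇔closedWalks : (zeta G ≗ zeta G′) ⇔ (∀ k → W.closedWalks (suc k) ≡ W′.closedWalks (suc k))
  zeta⇔closedWalks = mk⇔
    (λ Z≗Z′ k → trans (W.closedWords-divisorSum k) (trans
      (sum-applyUpTo-cong (suc k) (λ i _ → cong (λ r → if does (suc i ∣? suc k) then r ℕ.* suc i else 0)
        (eulerProduct-injective {λ i → length (W.classes (suc i))} {λ i → length (W′.classes (suc i))}
          (λ n → trans (sym (W.zeta≡eulerProduct n)) (trans (Z≗Z′ n) (W′.zeta≡eulerProduct n))) i)))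
      (sym (W′.closedWords-divisorSum k))))
    (λ N≡N′ n → trans (W.zeta≡eulerProduct n) (trans
      (cong (λ ns → eulerProduct ns n) (exponents-cong n (λ i _ → ℕ.*-cancelʳ-≡ _ _ (suc i)
        (divisorSum-injective {λ d → length (W.classes d) ℕ.* d} {λ d → length (W′.classes d) ℕ.* d}
          (λ k → trans (sym (W.closedWords-divisorSum k)) (trans (N≡N′ k) (W′.closedWords-divisorSum k))) i))))
      (sym (W′.zeta≡eulerProduct n))))

-- Counting walks in the field, and the zeta function through Bass's determinant

module WalkCounting {c ℓ} (R : CommutativeRing c ℓ) (isField : IsFieldOfCharacteristicZero R) where
  open CommutativeRing R hiding (zero)
  open IntegerSolver R
  open PowerSeries R
  open PolynomialFunctions R isField
  open Determinants R using (det-cong; det-identity)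
  open GraphMatrices R
  open Matrices R
  open import Algebra.Properties.Ring ring using (-0#≈0#)
  open import Algebra.Properties.Semiring.Sum semiring
  open import Algebra.Properties.Semiring.Mult semiring using (×-assoc-*; ×-congʳ)
  open import Algebra.Properties.Semiring.Exp semiring using (^-congˡ)
  open import Algebra.Definitions.RawSemiring (Semiring.rawSemiring semiring) using (_^_) renaming (_×_ to _·_)
  open import Relation.Binary.Reasoning.Setoid setoid

  indicator : ∀ {p} {P : Set p} → Dec P → Carrier
  indicator P? = if does P? then 1# else 0#

  listSum : ∀ {a} {A : Set a} → (A → Carrier) → List A → Carrier
  listSum F = foldr (λ x s → F x + s) 0#

  module _ {a} {A : Set a} where
    listSum-cong : ∀ {F F′ : A → Carrier} xs → (∀ x → F x ≈ F′ x) → listSum F xs ≈ listSum F′ xs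
    listSum-cong []       e = refl
    listSum-cong (x ∷ xs) e = +-cong (e x) (listSum-cong xs e)

    listSum-++ : ∀ (F : A → Carrier) xs ys → listSum F (xs ++ ys) ≈ listSum F xs + listSum F ys
    listSum-++ F []       ys = sym (+-identityˡ _)
    listSum-++ F (x ∷ xs) ys = trans (+-congˡ (listSum-++ F xs ys)) (sym (+-assoc _ _ _))

    listSum-*ˡ : ∀ k (F : A → Carrier) xs → listSum (λ x → k * F x) xs ≈ k * listSum F xs
    listSum-*ˡ k F []       = sym (zeroʳ k)
    listSum-*ˡ k F (x ∷ xs) = trans (+-congˡ (listSum-*ˡ k F xs)) (sym (distribˡ k _ _))

    listSum-filter : ∀ {p} {P : U.Pred A p} (P? : U.Decidable P) (F : A → Carrier) xs →
                     listSum F (filter P? xs) ≈ listSum (λ x → indicator (P? x) * F x) xs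
    listSum-filter P? F []       = refl
    listSum-filter P? F (x ∷ xs) with does (P? x)
    ... | true  = +-cong (sym (*-identityˡ _)) (listSum-filter P? F xs)
    ... | false = trans (listSum-filter P? F xs) (trans (sym (+-identityˡ _)) (+-congʳ (sym (zeroˡ _))))

    ι-length : ∀ (xs : List A) → ι (length xs) ≈ listSum (λ _ → 1#) xs
    ι-length []       = refl
    ι-length (x ∷ xs) = +-congˡ (ι-length xs)

    listSum-tabulate : ∀ {n} (f : Fin n → A) (F : A → Carrier) → listSum F (List.tabulate f) ≈ sum (F ∘ f)
    listSum-tabulate {zero}  f F = refl
    listSum-tabulate {suc n} f F = +-congˡ (listSum-tabulate (f ∘ suc) F)

  module _ {a b} {A : Set a} {B : Set b} where
    listSum-map : ∀ (f : A → B) (F : B → Carrier) xs → listSum F (map f xs) ≈ listSum (F ∘ f) xs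
    listSum-map f F []       = refl
    listSum-map f F (x ∷ xs) = +-congˡ (listSum-map f F xs)

  listSum-product : ∀ {a b d} {A : Set a} {B : Set b} {D : Set d} (f : A → B → D) (F : D → Carrier) xs ys →
                    listSum F (cartesianProductWith f xs ys) ≈ listSum (λ x → listSum (λ y → F (f x y)) ys) xs
  listSum-product f F []       ys = refl
  listSum-product f F (x ∷ xs) ys = trans (listSum-++ F (map (f x) ys) _)
    (+-cong (listSum-map (f x) F ys) (listSum-product f F xs ys))

  module _ (G : Graph) where
    open Graph G using (adj)
    open Walks G
    open Cycles G

    private
      n = order G
      A = adjacency G

    listSum-arcs : ∀ (F : Arc → Carrier) → listSum F arcs ≈ sum² (λ a b → A a b * F (a , b))
    listSum-arcs F = begin
      listSum F arcs
        ≈⟨ listSum-filter (λ (u , v) → T? (adj u v)) F (cartesianProduct (allFin n) (allFin n)) ⟩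
      listSum (λ (u , v) → A u v * F (u , v)) (cartesianProduct (allFin n) (allFin n))
        ≈⟨ listSum-product _,_ _ (allFin n) (allFin n) ⟩
      listSum (λ u → listSum (λ v → A u v * F (u , v)) (allFin n)) (allFin n)
        ≈⟨ listSum-tabulate {n = n} id (λ u → listSum (λ v → A u v * F (u , v)) (allFin n)) ⟩
      sum (λ u → listSum (λ v → A u v * F (u , v)) (allFin n))
        ≈⟨ sum-cong-≋ {n} (λ u → listSum-tabulate id (λ v → A u v * F (u , v))) ⟩
      sum² (λ a b → A a b * F (a , b)) ∎

    -- `k` counts the intermediate arcs, so these chains have k + 1 steps.
    chainCount : ℕ → Arc → Arc → Carrier
    chainCount k x y = listSum (λ w → indicator (chain? x w y)) (words arcs k)

    indicator-× : ∀ {p q} {P : Set p} {Q : Set q} (P? : Dec P) (Q? : Dec Q) → indicator (P? ×-dec Q?) ≈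
        indicator P? * indicator Q?
    indicator-× P? Q? with does P?
    ... | true  = sym (*-identityˡ _)
    ... | false = sym (zeroˡ _)

    chainCount-suc : ∀ k x y → chainCount (suc k) x y ≈ listSum (λ z → indicator (step? x z) * chainCount k z y) arcs
    chainCount-suc k x y = trans (listSum-product _∷_ _ arcs (words arcs k))
      (listSum-cong arcs λ z → trans (listSum-cong (words arcs k) λ w → indicator-× (step? x z) (chain? z w y))
        (listSum-*ˡ (indicator (step? x z)) _ (words arcs k)))

    ι-closedWalks : ∀ k → ι (closedWalks (suc k)) ≈ sum² (λ c d → A c d * chainCount k (c , d) (c , d))
    ι-closedWalks k = begin
      ι (length (closedWords (suc k)))                               ≈⟨ ι-length (closedWords (suc k)) ⟩
      listSum (λ _ → 1#) (closedWords (suc k))                       ≈⟨ listSum-filter closed? (λ _ → 1#)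
          (words arcs (suc k)) ⟩
      listSum (λ C → indicator (closed? C) * 1#) (words arcs (suc k))
        ≈⟨ listSum-product _∷_ _ arcs (words arcs k) ⟩
      listSum (λ x → listSum (λ w → indicator (chain? x w x) * 1#) (words arcs k)) arcs
        ≈⟨ listSum-cong arcs (λ x → listSum-cong (words arcs k) (λ w → *-identityʳ _)) ⟩
      listSum (λ x → chainCount k x x) arcs                          ≈⟨ listSum-arcs _ ⟩
      _                                                              ∎

    indicator-step : ∀ a b g h → indicator (step? (a , b) (g , h)) ≈ identity b g * (1# - identity h a)
    indicator-step a b g h with b Fin.≟ g
    ... | no  _ = sym (zeroˡ _)
    ... | yes ≡.refl with h Fin.≟ a
    ...   | yes ≡.refl = trans (reflexive (≡.cong (λ e → if not e then 1# else 0#) (dec-true ((b , h) ≟ (b , h)) ≡.refl)))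
              (solve 0 (con (+ 0) := con (+ 1) :* (con (+ 1) :- con (+ 1))) refl)
    ...   | no  h≢a    = trans (reflexive
        (≡.cong (λ e → if not e then 1# else 0#) (dec-false ((b , h) ≟ (b , a)) (h≢a ∘ ≡.cong proj₂))))
              (solve 0 (con (+ 1) := con (+ 1) :* (con (+ 1) :- con (+ 0))) refl)

    identity-symmetric : ∀ (i j : Fin n) → identity i j ≈ identity j i
    identity-symmetric i j with i Fin.≟ j
    ... | yes ≡.refl = sym (reflexive (identity-diagonal i))
    ... | no  i≢j    = sym (reflexive (identity-offDiagonal (i≢j ∘ ≡.sym)))

    -- Arcs that may follow (a , b) are all arcs leaving `b` except (b , a). Since `a` and `b` are
    -- adjacent, the excluded term really occurs in the full sum and is subtracted exactly once.
    step-sum : ∀ a b → adj a b ≡ true → ∀ (F : Fin n → Fin n → Carrier) →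
               listSum (λ (g , h) → indicator (step? (a , b) (g , h)) * F g h) arcs ≈ sum (λ h → A b h * F b h) - F b a
    step-sum a b A-ab F = begin
      listSum (λ (g , h) → indicator (step? (a , b) (g , h)) * F g h) arcs
        ≈⟨ listSum-arcs _ ⟩
      sum² (λ g h → A g h * (indicator (step? (a , b) (g , h)) * F g h))
        ≈⟨ sum²-cong {n} {n} (λ g h → trans (*-congˡ (*-congʳ (indicator-step a b g h)))
             (solve 4 (λ α i j f → α :* (i :* (con (+ 1) :- j) :* f) := i :* (α :* (con (+ 1) :- j) :* f)) refl
                 (A g h) (identity b g) (identity h a) (F g h))) ⟩
      sum² (λ g h → identity b g * (A g h * (1# - identity h a) * F g h))
        ≈⟨ sum-cong-≋ {n} (λ g → sym (*-distribˡ-sum (identity b g) (λ h → A g h * (1# - identity h a) * F g h))) ⟩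
      sum (λ g → identity b g * sum (λ h → A g h * (1# - identity h a) * F g h))
        ≈⟨ sum-identityˡ (λ g → sum (λ h → A g h * (1# - identity h a) * F g h)) b ⟩
      sum (λ h → A b h * (1# - identity h a) * F b h)
        ≈⟨ sum-cong-≋ {n} (λ h → solve 3 (λ α i f → α :* (con (+ 1) :- i) :* f := con -[1+ 0 ] :* (α :* f :* i)
            :+ α :* f) refl (A b h) (identity h a) (F b h)) ⟩
      sum (λ h → (- 1#) * (A b h * F b h * identity h a) + A b h * F b h)
        ≈⟨ sum-linear (- 1#) (λ h → A b h * F b h * identity h a) (λ h → A b h * F b h) ⟩
      (- 1#) * sum (λ h → A b h * F b h * identity h a) + sum (λ h → A b h * F b h)
        ≈⟨ +-congʳ (*-congˡ (trans (sum-identityʳ (λ h → A b h * F b h) a)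
             (trans (*-congʳ (reflexive (≡.trans (adjacency-symmetric G b a) (adjacency-true G A-ab)))) (*-identityˡ _)))) ⟩
      (- 1#) * F b a + sum (λ h → A b h * F b h)
        ≈⟨ solve 2 (λ f s → con -[1+ 0 ] :* f :+ s := s :- f) refl (F b a) _ ⟩
      sum (λ h → A b h * F b h) - F b a ∎

    -- Coefficients of the series fed to `bass-formula`, indexed by the number of steps; whence the
    -- shift against `chainCount`.
    walks : Fin n → Fin n → Fin n → Fin n → ℕ → Carrier
    walks c d a b zero    = identity a c * identity b d
    walks c d a b (suc k) = chainCount k (a , b) (c , d)

    walks-suc : ∀ {c d} → adj c d ≡ true → ∀ a b → adj a b ≡ true → ∀ k →
                walks c d a b (suc k) ≈ sum (λ x → A b x * walks c d b x k) - walks c d b a k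
    walks-suc {c} {d} A-cd a b A-ab (suc k) =
      trans (chainCount-suc k (a , b) (c , d)) (step-sum a b A-ab (λ g h → chainCount k (g , h) (c , d)))
    walks-suc {c} {d} A-cd a b A-ab zero = begin
      indicator (step? (a , b) (c , d)) + 0#
        ≈⟨ trans (+-identityʳ _) (indicator-step a b c d) ⟩
      identity b c * (1# - identity d a)
        ≈⟨ solve 2 (λ i j → i :* (con (+ 1) :- j) := i :- i :* j) refl _ _ ⟩
      identity b c - identity b c * identity d a
        ≈⟨ +-cong (sym A-bd) (-‿cong (*-congˡ (identity-symmetric d a))) ⟩
      A b d * identity b c - identity b c * identity a d
        ≈⟨ +-congʳ (sym (trans (sum-cong-≋ {n} (λ x → sym (*-assoc _ _ _)))
            (sum-identityʳ (λ x → A b x * identity b c) d))) ⟩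
      sum (λ x → A b x * (identity b c * identity x d)) - identity b c * identity a d ∎
      where
      A-bd : A b d * identity b c ≈ identity b c
      A-bd with b Fin.≟ c
      ... | yes ≡.refl = trans (*-congʳ (reflexive (adjacency-true G A-cd))) (*-identityˡ _)
      ... | no  _      = zeroʳ _

    private
      module BF = BassFormula R G
      module SM = Matrices seriesRing
      module SG = GraphMatrices seriesRing
      module S = CommutativeRing seriesRing
      module SR = RawSemiringDefs (Semiring.rawSemiring S.semiring)

    if-coefficient : ∀ b → (if b then S.1# else S.0#) 0 ≡ (if b then 1# else 0#)
    if-coefficient true  = ≡.refl
    if-coefficient false = ≡.refl

    A-coefficient : ∀ i j t k → (SM.adjacency G i j S.* t) k ≈ A i j * t k
    A-coefficient i j t k = trans (⊠-comm (SM.adjacency G i j) t k)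
      (trans (BF.*-constant t (BF.if-constant (adj i j)) k)
          (trans (*-comm _ _) (*-congʳ (reflexive (if-coefficient (adj i j))))))

    walks-series : ∀ c d → adj c d ≡ true → ∀ a b → adj a b ≡ true →
      walks c d a b S.≈ SM.identity a c S.* SM.identity b d S.+ X S.*
          (SR.sum (λ x → SM.adjacency G b x S.* walks c d b x) S.- walks c d b a)
    walks-series c d A-cd a b A-ab zero = sym
        (trans (+-cong (reflexive (≡.cong₂ _*_ (if-coefficient (does (a Fin.≟ c))) (if-coefficient (does (b Fin.≟ d)))))
      (X-⊠-zero (SR.sum (λ x → SM.adjacency G b x S.* walks c d b x) S.- walks c d b a))) (+-identityʳ _))
    walks-series c d A-cd a b A-ab (suc k) = sym (begin
      (SM.identity a c S.* SM.identity b d) (suc k) + (X S.* (s S.- walks c d b a)) (suc k)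
        ≈⟨ +-cong (trans (BF.*-constant (SM.identity a c) (BF.if-constant (does (b Fin.≟ d))) (suc k))
             (trans (*-congʳ (BF.if-constant (does (a Fin.≟ c)) k)) (zeroˡ _))) (X-⊠-suc (s S.- walks c d b a) k) ⟩
      0# + (s k - walks c d b a k)
        ≈⟨ +-identityˡ _ ⟩
      s k - walks c d b a k
        ≈⟨ +-congʳ (trans (reflexive (BF.sum-coefficient (λ x → SM.adjacency G b x S.* walks c d b x) k))
             (sum-cong-≋ {n} λ x → A-coefficient b x (walks c d b x) k)) ⟩
      sum (λ x → A b x * walks c d b x k) - walks c d b a k
        ≈⟨ walks-suc A-cd a b A-ab k ⟨
      walks c d a b (suc k) ∎)
      where
      s = SR.sum (λ x → SM.adjacency G b x S.* walks c d b x)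

    -- The constant term is 0 because `bass-formula` subtracts the number of arcs, that is, the
    -- walks without steps.
    walkSeries : ℕ → Carrier
    walkSeries zero    = 0#
    walkSeries (suc k) = ι (closedWalks (suc k))

    sum²-coefficient : ∀ (F : Fin n → Fin n → ℕ → Carrier) k → SG.sum² F k ≡ sum² (λ i j → F i j k)
    sum²-coefficient F k = ≡.trans (BF.sum-coefficient (λ i → SR.sum (F i)) k)
        (sum-cong-≗ {n} (λ i → BF.sum-coefficient (F i) k))

    walkSeries≈ : (SG.sum² (λ c d → SM.adjacency G c d S.* walks c d c d) S.- SG.sum² (SM.adjacency G)) S.≈ walkSeries
    walkSeries≈ k = trans (+-cong
        (trans (reflexive (sum²-coefficient (λ c d → SM.adjacency G c d S.* walks c d c d) k))
            (sum²-cong {n} {n} (λ c d → A-coefficient c d (walks c d c d) k)))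
        (-‿cong (reflexive (sum²-coefficient (SM.adjacency G) k))))
      (coefficient k)
      where
      coefficient : ∀ k → sum² (λ c d → A c d * walks c d c d k) - sum² (λ i j → SM.adjacency G i j k) ≈ walkSeries k
      coefficient zero    = x≈y⇒x-y≈0 (sum²-cong {n} {n} (λ c d → trans
        (*-congˡ (trans (*-cong (reflexive (identity-diagonal c)) (reflexive (identity-diagonal d))) (*-identityˡ _)))
        (trans (*-identityʳ _) (sym (reflexive (if-coefficient (adj c d)))))))
      coefficient (suc k) = trans (+-cong (sym (ι-closedWalks k))
          (trans (-‿cong (trans (sum²-cong {n} {n} (λ i j → BF.if-constant (adj i j) k))
            (trans (sum-cong-≋ {n} (λ _ → sum-replicate-zero n)) (sum-replicate-zero n)))) -0#≈0#))
        (+-identityʳ _)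

    bassFunction : ℕ → Carrier → Carrier
    bassFunction r u = (1# - u * u) ^ r * det (bass G u (λ i → valency G i - 1#))

    bassSeries : ℕ → ℕ → Carrier
    bassSeries r = BF.e SR.^ r S.* SM.det BF.M

    represents-if : ∀ b → Represents (λ _ → if b then 1# else 0#) (if b then S.1# else S.0#)
    represents-if true  = represents-constant 1#
    represents-if false = vanishing (λ _ → refl) (λ _ → refl)

    bassSeries-represents : ∀ r → Represents (bassFunction r) (bassSeries r)
    bassSeries-represents r = represents-*
      (represents-^ r (represents-+ (represents-constant 1#) (represents-neg (represents-* represents-X represents-X))))
      (represents-det λ i j → represents-+
        (represents-* (represents-+ (represents-constant 1#) (represents-* (represents-* represents-X represents-X)
            (represents-+ (represents-sum (λ j → represents-if (adj i j))) (represents-neg (represents-constant 1#)))))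
          (represents-if (does (i Fin.≟ j))))
        (represents-neg (represents-* represents-X (represents-if (adj i j)))))

    walks-bass : ∀ r → sum² A ≈ (1# + 1#) * (ι n + ι r) →
                 θ (bassSeries r) S.≈ S.- (walkSeries S.* bassSeries r)
    walks-bass r A≈ = S.trans (BF.bass-formula walks walks-series r A≈′)
      (S.-‿cong {_} {walkSeries S.* bassSeries r} (S.*-congʳ {bassSeries r} walkSeries≈))
      where
      constant≈ : ∀ {s t} → BF.IsConstant s → BF.IsConstant t → s 0 ≈ t 0 → s S.≈ t
      constant≈ cs ct e zero    = e
      constant≈ cs ct e (suc k) = trans (cs k) (sym (ct k))
      ·-coefficient : ∀ k → (k SR.× S.1#) 0 ≡ ι k
      ·-coefficient zero    = ≡.refl
      ·-coefficient (suc k) = ≡.cong (_+_ 1#) (·-coefficient k)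
      ·-constant : ∀ k → BF.IsConstant (k SR.× S.1#)
      ·-constant zero    i = refl
      ·-constant (suc k) i = trans (+-identityˡ _) (·-constant k i)
      A≈′ : SG.sum² (SM.adjacency G) S.≈ (S.1# S.+ S.1#) S.* ((n SR.× S.1#) S.+ (r SR.× S.1#))
      A≈′ = constant≈ (BF.sum-constant (λ i → BF.sum-constant (λ j → BF.if-constant (adj i j))))
        (λ k → trans (BF.*-constant {(n SR.× S.1#) S.+ (r SR.× S.1#)} (S.1# S.+ S.1#)
            (λ i → trans (+-cong (·-constant n i) (·-constant r i)) (+-identityʳ _)) (suc k))
          (trans (*-congʳ (+-identityʳ _)) (zeroˡ _)))
        (trans (reflexive (sum²-coefficient (SM.adjacency G) 0))
          (trans (sum²-cong {n} {n} (λ i j → reflexive (if-coefficient (adj i j))))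
            (trans A≈ (*-congˡ (sym (+-cong (reflexive (·-coefficient n)) (reflexive (·-coefficient r))))))))

    bassFunction-0 : ∀ r → bassFunction r 0# ≈ 1#
    bassFunction-0 r = trans (*-cong (trans
        (^-congˡ r (solve 0 (con (+ 1) :- con (+ 0) :* con (+ 0) := con (+ 1)) refl)) (1^ r))
        (trans (det-cong {n} entry) (det-identity n))) (*-identityˡ 1#)
      where
      entry : ∀ i j → bass G 0# (λ i → valency G i - 1#) i j ≈ identity i j
      entry i j = solve 3 (λ v e α → (con (+ 1) :+ con (+ 0) :* con (+ 0) :* v) :* e :- con (+ 0) :* α := e)
          refl (valency G i - 1#) (identity i j) (A i j)

    bassSeries-0 : ∀ r → bassSeries r 0 ≈ 1#
    bassSeries-0 r = trans (sym (represents-0 (bassSeries-represents r))) (bassFunction-0 r)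
      where
      represents-0 : ∀ {f s} → Represents f s → f 0# ≈ s 0
      represents-0 (vanishing f≈0 s≈0) = trans (f≈0 0#) (sym (s≈0 0))
      represents-0 (horner r f≈ s≈)    = trans (f≈ 0#) (trans (+-congˡ (zeroˡ _)) (+-identityʳ _))

  ⊠-vanish-below : ∀ s t n → (∀ k → k ≤ n → t k ≈ 0#) → (s ⊠ t) n ≈ 0#
  ⊠-vanish-below s t zero    t≈0 = trans (*-congˡ (t≈0 0 z≤n)) (zeroʳ _)
  ⊠-vanish-below s t (suc n) t≈0 = trans (+-cong (trans (*-congˡ (t≈0 (suc n) ℕ.≤-refl)) (zeroʳ _))
    (⊠-vanish-below (s ∘ suc) t n (λ k k≤n → t≈0 k (ℕ.m≤n⇒m≤1+n k≤n)))) (+-identityʳ _)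

  ⊠-cancel : ∀ {s t} → s 0 ≈ 1# → (∀ n → (s ⊠ t) n ≈ 0#) → ∀ n → t n ≈ 0#
  ⊠-cancel {s} {t} s₀≈1 st≈0 = <-rec _ step
    where
    step : ∀ n → (∀ {k} → k < n → t k ≈ 0#) → t n ≈ 0#
    step zero    rec = trans (sym (*-identityˡ _)) (trans (*-congʳ (sym s₀≈1)) (st≈0 0))
    step (suc n) rec = trans (sym (*-identityˡ _)) (trans (*-congʳ (sym s₀≈1)) (trans (sym (+-identityʳ _))
      (trans (+-congˡ (sym (⊠-vanish-below (s ∘ suc) t n (λ k k≤n → rec (s≤s k≤n))))) (st≈0 (suc n)))))

  -- Since N₀ = 0, the equation expresses n sₙ through earlier coefficients, and n is invertible in
  -- characteristic zero.
  θ-unique : ∀ {N s} → N 0 ≈ 0# → (∀ n → θ s n ≈ - (N ⊠ s) n) → s 0 ≈ 0# → ∀ n → s n ≈ 0#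
  θ-unique {N} {s} N₀≈0 θs≈ s₀≈0 = <-rec _ step
    where
    step : ∀ n → (∀ {k} → k < n → s k ≈ 0#) → s n ≈ 0#
    step zero    rec = s₀≈0
    step (suc n) rec = xy≈0⇒y≈0 (ιsuc≉0 n) (begin
      ι (suc n) * s (suc n)            ≈⟨ trans (×-assoc-* (suc n) 1# (s (suc n))) (×-congʳ (suc n) (*-identityˡ _)) ⟩
      θ s (suc n)                      ≈⟨ θs≈ (suc n) ⟩
      - (N 0 * s (suc n) + ((N ∘ suc) ⊠ s) n)
        ≈⟨ -‿cong (+-cong (trans (*-congʳ N₀≈0) (zeroˡ _)) (⊠-vanish-below (N ∘ suc) s n (λ k k≤n → rec (s≤s k≤n)))) ⟩
      - (0# + 0#)                      ≈⟨ solve 0 (:- (con (+ 0) :+ con (+ 0)) := con (+ 0)) refl ⟩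
      0#                               ∎)

  module _ (G G′ : Graph) (r r′ : ℕ)
    (size  : sum² (adjacency G)  ≈ (1# + 1#) * (ι (order G)  + ι r))
    (size′ : sum² (adjacency G′) ≈ (1# + 1#) * (ι (order G′) + ι r′)) where

    private
      f  = bassSeries G r
      f′ = bassSeries G′ r′
      N  = walkSeries G
      N′ = walkSeries G′
      module S = CommutativeRing seriesRing
      module SS = IntegerSolver seriesRing

    -- Forwards, both functions solve the same equation θ f = -N f with initial value 1. Backwards,
    -- one f satisfies the equation with both walk series, and a series with constant term 1 can be
    -- cancelled.
    zeta⇔bassFunction : (zeta G ≗ zeta G′) ⇔ (∀ u → bassFunction G r u ≈ bassFunction G′ r′ u)
    zeta⇔bassFunction = mk⇔ to from
      where
      open Equivalence (zeta⇔closedWalks G G′) renaming (to to walks-to; from to walks-from)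
      to : zeta G ≗ zeta G′ → ∀ u → bassFunction G r u ≈ bassFunction G′ r′ u
      to Z≗Z′ = represents-functional (bassSeries-represents G r) (bassSeries-represents G′ r′) f≈f′
        where
        N≈N′ : N′ S.≈ N
        N≈N′ zero    = refl
        N≈N′ (suc k) = reflexive (≡.cong ι (≡.sym (walks-to Z≗Z′ k)))
        f≈f′ : ∀ n → f n ≈ f′ n
        f≈f′ n = x-y≈0⇒x≈y (θ-unique {N} {f S.- f′} refl
          (S.trans (θ-+ f (S.- f′))
            (S.trans (S.+-cong {θ f} {S.- (N S.* f)} {θ (S.- f′)} {N S.* f′} (walks-bass G r size)
                (S.trans {θ (S.- f′)} {S.- θ f′} {N S.* f′} (neg f′) (λ k → trans (-‿cong (walks-bass G′ r′ size′ k))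
                  (trans (solve 1 (λ a → :- (:- a) := a) refl _) (⊠-cong {t = f′} N≈N′ (λ _ → refl) k)))))
              (SS.solve 3 (λ N f f′ → SS.:- (N SS.:* f) SS.:+ N SS.:* f′ SS.:= SS.:- (N SS.:* (f SS.:- f′))) S.refl N f f′)))
          (x≈y⇒x-y≈0 (trans (bassSeries-0 G r) (sym (bassSeries-0 G′ r′)))) n)
          where
          neg : ∀ s → θ (S.- s) S.≈ S.- θ s
          neg s k = begin
            k · (- s k)                           ≈⟨ solve 2 (λ a b → a := a :+ b :- b) refl _ (k · s k) ⟩
            k · (- s k) + k · s k - k · s k       ≈⟨ +-congʳ
                (trans (sym (·-distrib-+ k _ _)) (trans (×-congʳ k (-‿inverseˡ _)) (·-zeroʳ k))) ⟩
            0# - k · s k                          ≈⟨ +-identityˡ _ ⟩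
            - (k · s k)                           ∎
      from : (∀ u → bassFunction G r u ≈ bassFunction G′ r′ u) → zeta G ≗ zeta G′
      from e = walks-from λ k → ι-injective _ _ (x-y≈0⇒x≈y (⊠-cancel {f} {N S.- N′} (bassSeries-0 G r) f[N-N′]≈0 (suc k)))
        where
        f≈f′ : f S.≈ f′
        f≈f′ = represents-injective (bassSeries-represents G r) (bassSeries-represents G′ r′) e
        f[N-N′]≈0 : f S.* (N S.- N′) S.≈ S.0#
        f[N-N′]≈0 = S.trans (SS.solve 3 (λ f N N′ → f SS.:* (N SS.:- N′) SS.:= SS.:- (N′ SS.:* f) SS.:-
            (SS.:- (N SS.:* f))) S.refl f N N′)
          (λ k → x≈y⇒x-y≈0 (begin
            - (N′ ⊠ f) k     ≈⟨ -‿cong (⊠-cong {N′} (λ _ → refl) f≈f′ k) ⟩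
            - (N′ ⊠ f′) k    ≈⟨ walks-bass G′ r′ size′ k ⟨
            θ f′ k           ≈⟨ θ-cong f≈f′ k ⟨
            θ f k            ≈⟨ walks-bass G r size k ⟩
            - (N ⊠ f) k      ∎))

-- Counting in semi-regular bipartite graphs

#true #false : ∀ {n} → (Fin n → Bool) → ℕ
#true  {zero}  f = 0
#true  {suc n} f = (if f zero then 1 else 0) ℕ.+ #true (f ∘ suc)
#false f = #true (not ∘ f)

module _ where
  open ≡ using (refl; trans; cong; cong₂)

  #true-cong : ∀ {n} {f g : Fin n → Bool} → (∀ i → f i ≡ g i) → #true f ≡ #true g
  #true-cong {zero}  f≡g = refl
  #true-cong {suc n} f≡g = cong₂ (λ b r → (if b then 1 else 0) ℕ.+ r) (f≡g zero) (#true-cong (f≡g ∘ suc))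

  #true+#false : ∀ {n} (f : Fin n → Bool) → #true f ℕ.+ #false f ≡ n
  #true+#false {zero}  f = refl
  #true+#false {suc n} f with f zero
  ... | true  = cong suc (#true+#false (f ∘ suc))
  ... | false = trans (ℕ.+-suc _ _) (cong suc (#true+#false (f ∘ suc)))

  ∣∣≡#true : ∀ {n} (V : Subset n) → ∣ V ∣ ≡ #true (Vec.lookup V)
  ∣∣≡#true []          = refl
  ∣∣≡#true (true ∷ V)  = cong suc (∣∣≡#true V)
  ∣∣≡#true (false ∷ V) = ∣∣≡#true V

  #true-positive : ∀ {n} (f : Fin n → Bool) i → f i ≡ true → 1 ≤ #true f
  #true-positive f zero    e rewrite e = s≤s z≤n
  #true-positive f (suc i) e = ℕ.≤-trans (#true-positive (f ∘ suc) i e) (ℕ.m≤n+m _ _)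

  #true⇒∃ : ∀ {n} (f : Fin n → Bool) → 1 ≤ #true f → ∃[ i ] f i ≡ true
  #true⇒∃ {suc n} f p with f zero in e
  ... | true  = zero , e
  ... | false with i , e′ ← #true⇒∃ (f ∘ suc) p = suc i , e′

  degree≡#true : ∀ G v → Graph.degree G v ≡ #true (Graph.adj G v)
  degree≡#true G v = trans (∣∣≡#true (Graph.neighbours G v)) (#true-cong (Vec.lookup∘tabulate (Graph.adj G v)))

module SemiRegularGraph {G : Graph} {V₁ V₂ : Subset (order G)} {q₁ q₂ : ℕ} (semiRegular : IsSemiRegular G V₁ V₂ q₁ q₂) where
  open Graph G using (adj; nonempty; degree)
  open IsSemiRegular semiRegular
  open IsBipartition bipartition
  open ≡ using (refl; sym; trans; cong; cong₂; subst)

  side : Fin (order G) → Bool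
  side = Vec.lookup V₁

  side-true : ∀ {i} → side i ≡ true → i Subset.∈ V₁
  side-true {i} e = Vec.lookup⇒[]= i V₁ e

  true-side : ∀ {i} → i Subset.∈ V₁ → side i ≡ true
  true-side = Vec.[]=⇒lookup

  V₂-side : ∀ {i} → i Subset.∈ V₂ → side i ≡ false
  V₂-side {i} i∈V₂ with side i in e
  ... | true  = ⊥-elim (disjoint i (side-true e) i∈V₂)
  ... | false = refl

  side-false : ∀ {i} → side i ≡ false → i Subset.∈ V₂
  side-false {i} e with covers i
  ... | inj₂ i∈V₂ = i∈V₂
  ... | inj₁ i∈V₁ with () ← trans (sym e) (true-side i∈V₁)

  side-V₂ : ∀ i → Vec.lookup V₂ i ≡ not (side i)
  side-V₂ i with side i in e
  ... | false = Vec.[]=⇒lookup (side-false e)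
  ... | true with Vec.lookup V₂ i in e′
  ...   | false = refl
  ...   | true  = ⊥-elim (disjoint i (side-true e) (Vec.lookup⇒[]= i V₂ e′))

  adjacent-sides : ∀ {i j} → adj i j ≡ true → side i ≡ not (side j)
  adjacent-sides {i} {j} e with crossing i j (subst Bool.T (sym e) _)
  ... | inj₁ (i∈V₁ , j∈V₂) = trans (true-side i∈V₁) (cong not (sym (V₂-side j∈V₂)))
  ... | inj₂ (i∈V₂ , j∈V₁) = trans (V₂-side i∈V₂) (cong not (sym (true-side j∈V₁)))

  ∣V₁∣≡ : ∣ V₁ ∣ ≡ #true side
  ∣V₁∣≡ = ∣∣≡#true V₁

  ∣V₂∣≡ : ∣ V₂ ∣ ≡ #false side
  ∣V₂∣≡ = trans (∣∣≡#true V₂) (#true-cong side-V₂)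

  order≡ : ∣ V₁ ∣ ℕ.+ ∣ V₂ ∣ ≡ order G
  order≡ = trans (cong₂ ℕ._+_ ∣V₁∣≡ ∣V₂∣≡) (#true+#false side)

  degree≡ : ∀ i → degree i ≡ (if side i then q₁ else q₂)
  degree≡ i with side i in e
  ... | true  = degree₁ i (side-true e)
  ... | false = degree₂ i (side-false e)

  degree≥1 : ∀ i → 1 ≤ degree i
  degree≥1 i with side i in e
  ... | true  = subst (1 ≤_) (sym (degree₁ i (side-true e))) q₁≥1
  ... | false = subst (1 ≤_) (sym (degree₂ i (side-false e))) q₂≥1

  -- Some vertex exists; its degree is positive, so it has a neighbour, and the two lie on opposite
  -- sides.
  both-sides : 1 ≤ ∣ V₁ ∣ × 1 ≤ ∣ V₂ ∣
  both-sides = go (fromℕ< nonempty)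
    where
    positive : ∀ V k → k Subset.∈ V → 1 ≤ ∣ V ∣
    positive V k k∈V = subst (1 ≤_) (sym (∣∣≡#true V)) (#true-positive (Vec.lookup V) k (Vec.[]=⇒lookup k∈V))
    go : Fin (order G) → 1 ≤ ∣ V₁ ∣ × 1 ≤ ∣ V₂ ∣
    go i with j , Aij ← #true⇒∃ (adj i) (subst (1 ≤_) (degree≡#true G i) (degree≥1 i)) with crossing i j
        (subst Bool.T (sym Aij) _)
    ... | inj₁ (i∈V₁ , j∈V₂) = positive V₁ i i∈V₁ , positive V₂ j j∈V₂
    ... | inj₂ (i∈V₂ , j∈V₁) = positive V₁ j j∈V₁ , positive V₂ i i∈V₂

-- Determinants of weighted semi-regular bipartite graphs

module SemiRegularDeterminants {c ℓ} (R : CommutativeRing c ℓ) (isField : IsFieldOfCharacteristicZero R) where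
  open CommutativeRing R hiding (zero)
  open IntegerSolver R
  open PolynomialFunctions R isField
  open Determinants R
  open GraphMatrices R
  open Matrices R
  open import Algebra.Properties.Semiring.Sum semiring
  open import Algebra.Definitions.RawSemiring (Semiring.rawSemiring semiring) using (product; _^_)
  open import Relation.Binary.Reasoning.Setoid setoid
  private module Product = MonoidSum *-commutativeMonoid

  ι-#true : ∀ {n} (f : Fin n → Bool) → ι (#true f) ≈ sum (λ i → if f i then 1# else 0#)
  ι-#true {zero}  f = refl
  ι-#true {suc n} f with f zero
  ... | true  = +-congˡ (ι-#true (f ∘ suc))
  ... | false = trans (ι-#true (f ∘ suc)) (sym (+-identityˡ _))

  valency≈degree : ∀ G i → valency G i ≈ ι (Graph.degree G i)
  valency≈degree G i = sym (trans (reflexive (≡.cong ι (degree≡#true G i))) (ι-#true (Graph.adj G i)))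

  product-if : ∀ {n} (f : Fin n → Bool) x y → product (λ i → if f i then x else y) ≈ x ^ #true f * y ^ #false f
  product-if {zero}  f x y = sym (*-identityˡ 1#)
  product-if {suc n} f x y with f zero
  ... | true  = trans (*-congˡ (product-if (f ∘ suc) x y)) (sym (*-assoc _ _ _))
  ... | false = trans (*-congˡ (product-if (f ∘ suc) x y))
    (solve 3 (λ y a b → y :* (a :* b) := a :* (y :* b)) refl y _ _)

  ifᴾ : ∀ b {f g} → Polynomial f → Polynomial g → Polynomial (λ x → if b then f x else g x)
  ifᴾ true  P Q = P
  ifᴾ false P Q = Q

  bassᴾ : ∀ G p → Polynomial (λ u → det (bass G u p))
  bassᴾ G p = detᴾ {order G} λ i j → (constᴾ +ᴾ idᴾ *ᴾ idᴾ *ᴾ constᴾ) *ᴾ constᴾ +ᴾ (-ᴾ (idᴾ *ᴾ constᴾ))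

  bass-0 : ∀ G p → det (bass G 0# p) ≈ 1#
  bass-0 G p = trans (det-cong {order G} λ i j → solve 3 (λ v e α →
      (con (+ 1) :+ con (+ 0) :* con (+ 0) :* v) :* e :- con (+ 0) :* α := e) refl (p i) (identity i j) (adjacency G i j))
    (det-identity (order G))

  bass-cong : ∀ G u {p p′} → (∀ i → p i ≈ p′ i) → det (bass G u p) ≈ det (bass G u p′)
  bass-cong G u {p} {p′} p≈p′ = det-cong {order G} λ i j → +-congʳ (*-congʳ (+-congˡ (*-congˡ (p≈p′ i))))

  module _ {G : Graph} {V₁ V₂ : Subset (order G)} {q₁ q₂ : ℕ} (semiRegular : IsSemiRegular G V₁ V₂ q₁ q₂) where
    open SemiRegularGraph semiRegular
    private
      n = order G
      A = adjacency G

    onSides : Carrier → Carrier → Fin n → Carrier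
    onSides x y i = if side i then x else y

    adjacency-sides : ∀ i j x y → onSides x y i * A i j ≈ onSides y x j * A i j
    adjacency-sides i j x y with Graph.adj G i j in e
    ... | false = trans (zeroʳ _) (sym (zeroʳ _))
    ... | true rewrite adjacent-sides e with side j
    ...   | true  = refl
    ...   | false = refl

    valency-onSides : ∀ j → valency G j ≈ onSides (ι q₁) (ι q₂) j
    valency-onSides j = trans (valency≈degree G j) (trans (reflexive (≡.cong ι (degree≡ j))) (ι-if (side j)))
      where
      ι-if : ∀ b → ι (if b then q₁ else q₂) ≈ (if b then ι q₁ else ι q₂)
      ι-if true  = refl
      ι-if false = refl

    -- An edge exchanges the sides, so the weight can be taken at the fixed endpoint `j`, where it
    -- multiplies the valency. Vectors constant on the sides are thus preserved by the adjacency
    -- matrix.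
    sum-onSides-adjacency : ∀ x y j → sum (λ i → onSides x y i * A i j) ≈ onSides (y * ι q₁) (x * ι q₂) j
    sum-onSides-adjacency x y j = begin
      sum (λ i → onSides x y i * A i j)   ≈⟨ sum-cong-≋ {n}
          (λ i → trans (adjacency-sides i j x y) (*-congˡ (reflexive (adjacency-symmetric G i j)))) ⟩
      sum (λ i → onSides y x j * A j i)   ≈⟨ sym (*-distribˡ-sum (onSides y x j) (A j)) ⟩
      onSides y x j * valency G j         ≈⟨ *-congˡ (valency-onSides j) ⟩
      onSides y x j * onSides (ι q₁) (ι q₂) j   ≈⟨ combine (side j) ⟩
      onSides (y * ι q₁) (x * ι q₂) j     ∎
      where
      combine : ∀ b → (if b then y else x) * (if b then ι q₁ else ι q₂) ≈ (if b then y * ι q₁ else x * ι q₂)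
      combine true  = refl
      combine false = refl

    sum-onSides : ∀ x y → sum (onSides x y) ≈ ι ∣ V₁ ∣ * x + ι ∣ V₂ ∣ * y
    sum-onSides x y = begin
      sum (onSides x y)        ≈⟨ sum-cong-≋ {n} (λ i → split (side i)) ⟩
      sum (λ i → x * (if side i then 1# else 0#) + y * (if not (side i) then 1# else 0#))
        ≈⟨ trans (sum-linear x (λ i → if side i then 1# else 0#) (λ i → y * (if not (side i) then 1# else 0#)))
            (+-congˡ (sym (*-distribˡ-sum y (λ i → if not (side i) then 1# else 0#)))) ⟩
      x * sum (λ i → if side i then 1# else 0#) + y * sum (λ i → if not (side i) then 1# else 0#)
        ≈⟨ +-cong (trans (*-comm _ _) (*-congʳ (sym (trans (reflexive (≡.cong ι ∣V₁∣≡)) (ι-#true side)))))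
                  (trans (*-comm _ _) (*-congʳ (sym (trans (reflexive (≡.cong ι ∣V₂∣≡)) (ι-#true (not ∘ side)))))) ⟩
      ι ∣ V₁ ∣ * x + ι ∣ V₂ ∣ * y ∎
      where
      split : ∀ b → (if b then x else y) ≈ x * (if b then 1# else 0#) + y * (if not b then 1# else 0#)
      split true  = solve 2 (λ x y → x := x :* con (+ 1) :+ y :* con (+ 0)) refl x y
      split false = solve 2 (λ x y → y := x :* con (+ 0) :+ y :* con (+ 1)) refl x y

    -- Double counting of the edges, done in the field by exchanging two sums and pulled back to ℕ
    -- by injectivity of `ι`.
    edges≡ : ∣ V₁ ∣ ℕ.* q₁ ≡ ∣ V₂ ∣ ℕ.* q₂
    edges≡ = ι-injective _ _ (begin
      ι (∣ V₁ ∣ ℕ.* q₁)                        ≈⟨ ι-* ∣ V₁ ∣ q₁ ⟩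
      ι ∣ V₁ ∣ * ι q₁                          ≈⟨ solve 3
          (λ a b q → a :* q := a :* (con (+ 1) :* q) :+ b :* con (+ 0)) refl (ι ∣ V₁ ∣) (ι ∣ V₂ ∣) (ι q₁) ⟩
      ι ∣ V₁ ∣ * (1# * ι q₁) + ι ∣ V₂ ∣ * 0#   ≈⟨ sum-onSides (1# * ι q₁) 0# ⟨
      sum (onSides (1# * ι q₁) 0#)             ≈⟨ sum-cong-≋ {n}
          (λ j → trans (sum-onSides-adjacency 0# 1# j) (zero-if (side j))) ⟨
      sum (λ j → sum (λ i → onSides 0# 1# i * A i j))   ≈⟨ ∑-comm {n} {n} (λ j i → onSides 0# 1# i * A i j) ⟩
      sum (λ i → sum (λ j → onSides 0# 1# i * A i j))
        ≈⟨ sum-cong-≋ {n} (λ i → trans (sum-cong-≋ {n}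
            (λ j → trans (adjacency-sides i j 0# 1#) (*-congˡ (reflexive (adjacency-symmetric G i j)))))
            (trans (sum-onSides-adjacency 1# 0# i) (zero-if′ (side i)))) ⟩
      sum (onSides 0# (1# * ι q₂))             ≈⟨ sum-onSides 0# (1# * ι q₂) ⟩
      ι ∣ V₁ ∣ * 0# + ι ∣ V₂ ∣ * (1# * ι q₂)   ≈⟨ solve 3
          (λ a b q → a :* con (+ 0) :+ b :* (con (+ 1) :* q) := b :* q) refl (ι ∣ V₁ ∣) (ι ∣ V₂ ∣) (ι q₂) ⟩
      ι ∣ V₂ ∣ * ι q₂                          ≈⟨ ι-* ∣ V₂ ∣ q₂ ⟨
      ι (∣ V₂ ∣ ℕ.* q₂)                        ∎)
      where
      zero-if : ∀ b → (if b then 1# * ι q₁ else 0# * ι q₂) ≈ (if b then 1# * ι q₁ else 0#)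
      zero-if true  = refl
      zero-if false = zeroˡ _
      zero-if′ : ∀ b → (if b then 0# * ι q₁ else 1# * ι q₂) ≈ (if b then 0# else 1# * ι q₂)
      zero-if′ true  = zeroˡ _
      zero-if′ false = refl

    sideDet : Carrier → Carrier → Carrier → Carrier
    sideDet p₁ p₂ u = det (bass G u (onSides p₁ p₂))

    -- The determinant of the 2 × 2 quotient of `bass` by the bipartition, with diagonal 1 + u²p₁, 1
    -- + u²p₂ and off-diagonal entries -uq₁, -uq₂.
    sideDelta : Carrier → Carrier → Carrier → Carrier
    sideDelta p₁ p₂ u = (1# + u * u * p₁) * (1# + u * u * p₂) - u * u * (ι q₁ * ι q₂)

    -- Since the bipartition is equitable, a combination of the rows of
    -- bass u (onSides p₁ p₂) that is constant on the sides is a constant vector.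
    sideVector : Carrier → Carrier → Carrier → Fin n → Carrier
    sideVector p₁ p₂ u = onSides ((1# + u * u * p₂) + u * ι q₁) ((1# + u * u * p₁) + u * ι q₂)

    sideVector-bass : ∀ p₁ p₂ u j → sum (λ i → sideVector p₁ p₂ u i * bass G u (onSides p₁ p₂) i j) ≈ sideDelta p₁ p₂ u
    sideVector-bass p₁ p₂ u j = begin
      sum (λ i → a i * ((1# + u * u * p i) * identity i j - u * A i j))
        ≈⟨ sum-cong-≋ {n} (λ i → solve 6 (λ a u p e α z → a :* ((con (+ 1) :+ u :* u :* p) :* e :- u :* α) :=
            (:- u) :* (a :* α) :+ a :* (con (+ 1) :+ u :* u :* p) :* e) refl (a i) u (p i) (identity i j) (A i j) 0#) ⟩
      sum (λ i → (- u) * (a i * A i j) + a i * (1# + u * u * p i) * identity i j)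
        ≈⟨ trans (sum-linear (- u) (λ i → a i * A i j) (λ i → a i * (1# + u * u * p i) * identity i j))
             (+-cong (*-congˡ (sum-onSides-adjacency _ _ j)) (sum-identityʳ (λ i → a i * (1# + u * u * p i)) j)) ⟩
      (- u) * onSides (((1# + u * u * p₁) + u * ι q₂) * ι q₁) (((1# + u * u * p₂) + u * ι q₁) * ι q₂) j + a j *
          (1# + u * u * p j)
        ≈⟨ combine (side j) ⟩
      sideDelta p₁ p₂ u ∎
      where
      a = sideVector p₁ p₂ u
      p = onSides p₁ p₂
      combine : ∀ b → (- u) * (if b then ((1# + u * u * p₁) + u * ι q₂) * ι q₁ else ((1# + u * u * p₂) + u * ι q₁) * ι q₂)
        + (if b then (1# + u * u * p₂) + u * ι q₁ else (1# + u * u * p₁) + u * ι q₂) *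
            (1# + u * u * (if b then p₁ else p₂)) ≈ sideDelta p₁ p₂ u
      combine true  = solve 5 (λ u p₁ p₂ q₁ q₂ → (:- u) :* (((con (+ 1) :+ u :* u :* p₁) :+ u :* q₂) :* q₁) :+
          ((con (+ 1) :+ u :* u :* p₂) :+ u :* q₁) :* (con (+ 1) :+ u :* u :* p₁)
        := (con (+ 1) :+ u :* u :* p₁) :* (con (+ 1) :+ u :* u :* p₂) :- u :* u :* (q₁ :* q₂)) refl u p₁ p₂ (ι q₁) (ι q₂)
      combine false = solve 5 (λ u p₁ p₂ q₁ q₂ → (:- u) :* (((con (+ 1) :+ u :* u :* p₂) :+ u :* q₁) :* q₂) :+
          ((con (+ 1) :+ u :* u :* p₁) :+ u :* q₂) :* (con (+ 1) :+ u :* u :* p₂)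
        := (con (+ 1) :+ u :* u :* p₁) :* (con (+ 1) :+ u :* u :* p₂) :- u :* u :* (q₁ :* q₂)) refl u p₁ p₂ (ι q₁) (ι q₂)

    -- Sorted by parity in u: the odd part is 2u times the number of edges. It is the only source of
    -- odd powers in the determinant of a join.
    sum-sideVector : ∀ p₁ p₂ u → sum (sideVector p₁ p₂ u) ≈
      ι (order G) + u * u * (ι ∣ V₁ ∣ * p₂ + ι ∣ V₂ ∣ * p₁) + (1# + 1#) * u * ι (∣ V₁ ∣ ℕ.* q₁)
    sum-sideVector p₁ p₂ u = begin
      sum (sideVector p₁ p₂ u)      ≈⟨ sum-onSides _ _ ⟩
      n₁ * ((1# + u * u * p₂) + u * ι q₁) + n₂ * ((1# + u * u * p₁) + u * ι q₂)
        ≈⟨ solve 7 (λ n₁ n₂ u p₁ p₂ q₁ q₂ → n₁ :* ((con (+ 1) :+ u :* u :* p₂) :+ u :* q₁) :+ n₂ :*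
            ((con (+ 1) :+ u :* u :* p₁) :+ u :* q₂)
             := (n₁ :+ n₂) :+ u :* u :* (n₁ :* p₂ :+ n₂ :* p₁) :+ u :* (n₁ :* q₁ :+ n₂ :* q₂)) refl n₁ n₂ u p₁
                 p₂ (ι q₁) (ι q₂) ⟩
      (n₁ + n₂) + u * u * (n₁ * p₂ + n₂ * p₁) + u * (n₁ * ι q₁ + n₂ * ι q₂)
        ≈⟨ +-cong (+-congʳ (trans (sym (ι-+ ∣ V₁ ∣ ∣ V₂ ∣)) (reflexive (≡.cong ι order≡))))
             (*-congˡ (+-cong (sym (ι-* ∣ V₁ ∣ q₁)) (trans (sym (ι-* ∣ V₂ ∣ q₂)) (reflexive (≡.cong ι (≡.sym edges≡)))))) ⟩
      ι n + u * u * (n₁ * p₂ + n₂ * p₁) + u * (m + m)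
        ≈⟨ solve 3 (λ a u m → a :+ u :* (m :+ m) := a :+ (con (+ 1) :+ con (+ 1)) :* u :* m) refl _ u m ⟩
      _ ∎
      where
      n₁ = ι ∣ V₁ ∣
      n₂ = ι ∣ V₂ ∣
      m = ι (∣ V₁ ∣ ℕ.* q₁)

    -- Conjugation by the diagonal matrix that is -1 on V₁ and 1 on V₂ changes the sign of the
    -- adjacency matrix and fixes the diagonal.
    sideDet-even : ∀ p₁ p₂ u → sideDet p₁ p₂ (- u) ≈ sideDet p₁ p₂ u
    sideDet-even p₁ p₂ u = begin
      det (bass G (- u) (onSides p₁ p₂))   ≈⟨ det-cong {n} flip-signs ⟩
      det (λ i j → s i * bass G u (onSides p₁ p₂) i j * s j)   ≈⟨ det-scale s s (bass G u (onSides p₁ p₂)) ⟩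
      product s * product s * sideDet p₁ p₂ u   ≈⟨ *-congʳ (sym (Product.∑-distrib-+ s s)) ⟩
      product (λ i → s i * s i) * sideDet p₁ p₂ u
        ≈⟨ *-congʳ (trans (Product.sum-cong-≋ {n} (λ i → square (side i))) (Product.sum-replicate-zero n)) ⟩
      1# * sideDet p₁ p₂ u   ≈⟨ *-identityˡ _ ⟩
      sideDet p₁ p₂ u ∎
      where
      s = onSides (- 1#) 1#
      square : ∀ b → (if b then - 1# else 1#) * (if b then - 1# else 1#) ≈ 1#
      square true  = solve 0 (con -[1+ 0 ] :* con -[1+ 0 ] := con (+ 1)) refl
      square false = *-identityˡ 1#
      flip-signs : ∀ i j → bass G (- u) (onSides p₁ p₂) i j ≈ s i * bass G u (onSides p₁ p₂) i j * s j
      flip-signs i j = begin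
        (1# + (- u) * (- u) * p) * e - (- u) * A i j
          ≈⟨ solve 4 (λ u p e α → (con (+ 1) :+ (:- u) :* (:- u) :* p) :* e :- (:- u) :* α :=
              (con (+ 1) :+ u :* u :* p) :* e :- u :* (con -[1+ 0 ] :* α)) refl u p e (A i j) ⟩
        (1# + u * u * p) * e - u * ((- 1#) * A i j)
          ≈⟨ +-cong (*-congˡ diagonal) (-‿cong (*-congˡ offDiagonal)) ⟩
        (1# + u * u * p) * (s i * e * s j) - u * (s i * A i j * s j)
          ≈⟨ solve 6 (λ x s e t u α → x :* (s :* e :* t) :- u :* (s :* α :* t) := s :* (x :* e :- u :* α) :* t)
              refl (1# + u * u * p) (s i) e (s j) u (A i j) ⟩
        s i * ((1# + u * u * p) * e - u * A i j) * s j ∎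
        where
        p = onSides p₁ p₂ i
        e = identity i j
        diagonal : e ≈ s i * e * s j
        diagonal with i Fin.≟ j
        ... | yes ≡.refl = sym (trans (*-congʳ (*-identityʳ _)) (square (side i)))
        ... | no  _      = sym (trans (*-congʳ (zeroʳ _)) (zeroˡ _))
        offDiagonal : (- 1#) * A i j ≈ s i * A i j * s j
        offDiagonal with Graph.adj G i j in e
        ... | false = trans (zeroʳ _) (sym (trans (*-congʳ (zeroʳ _)) (zeroˡ _)))
        ... | true rewrite adjacent-sides e with side j
        ...   | true  = solve 0 (con -[1+ 0 ] :* con (+ 1) := con (+ 1) :* con (+ 1) :* con -[1+ 0 ]) refl
        ...   | false = solve 0 (con -[1+ 0 ] :* con (+ 1) := con -[1+ 0 ] :* con (+ 1) :* con (+ 1)) refl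

    -- The block matrix ((y , −B) , (−Bᵀ , 1)), where B is the biadjacency matrix.
    biadjacencyDet : Carrier → Carrier
    biadjacencyDet y = det (λ i j → onSides y 1# i * identity i j - A i j)

    biadjacencyDetᴾ : Polynomial biadjacencyDet
    biadjacencyDetᴾ = detᴾ {n} λ i j → ifᴾ (side i) idᴾ constᴾ *ᴾ constᴾ +ᴾ (-ᴾ constᴾ)

    -- Write sᵢ = 1 + u²pᵢ and scale the columns of V₁ by s₂. The result ((s₁s₂ , -uB) , (-us₂Bᵀ ,
    -- s₂)) is diag (u , s₂) · ((y , -B) , (-Bᵀ , 1)) · diag (u , 1), because y u² = s₁s₂.
    sideDet-biadjacency : ∀ p₁ p₂ u y → y * (u * u) ≈ (1# + u * u * p₁) * (1# + u * u * p₂) →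
      (1# + u * u * p₂) ^ ∣ V₁ ∣ * sideDet p₁ p₂ u ≈ (u ^ ∣ V₁ ∣ * u ^ ∣ V₁ ∣) * (1# + u * u * p₂) ^ ∣ V₂ ∣ *
          biadjacencyDet y
    sideDet-biadjacency p₁ p₂ u y yu² = begin
      s₂ ^ ∣ V₁ ∣ * sideDet p₁ p₂ u
        ≈⟨ *-congʳ (sym (trans (*-cong (Product.sum-replicate-zero n)
            (trans (product-sides s₂ 1#) (*-congˡ (1^ ∣ V₂ ∣)))) (trans (*-identityˡ _) (*-identityʳ _)))) ⟩
      product (λ (i : Fin n) → 1#) * product (onSides s₂ 1#) * sideDet p₁ p₂ u
        ≈⟨ sym (det-scale (λ _ → 1#) (onSides s₂ 1#) (bass G u (onSides p₁ p₂))) ⟩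
      det (λ i j → 1# * bass G u (onSides p₁ p₂) i j * onSides s₂ 1# j)
        ≈⟨ det-cong {n} entry ⟩
      det (λ i j → onSides u s₂ i * (onSides y 1# i * identity i j - A i j) * onSides u 1# j)
        ≈⟨ det-scale (onSides u s₂) (onSides u 1#) (λ i j → onSides y 1# i * identity i j - A i j) ⟩
      product (onSides u s₂) * product (onSides u 1#) * biadjacencyDet y
        ≈⟨ *-congʳ (*-cong (product-sides u s₂) (trans (product-sides u 1#) (*-congˡ (1^ ∣ V₂ ∣)))) ⟩
      (u ^ ∣ V₁ ∣ * s₂ ^ ∣ V₂ ∣) * (u ^ ∣ V₁ ∣ * 1#) * biadjacencyDet y
        ≈⟨ *-congʳ (solve 2 (λ a b → (a :* b) :* (a :* con (+ 1)) := (a :* a) :* b) refl (u ^ ∣ V₁ ∣) (s₂ ^ ∣ V₂ ∣)) ⟩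
      (u ^ ∣ V₁ ∣ * u ^ ∣ V₁ ∣) * s₂ ^ ∣ V₂ ∣ * biadjacencyDet y ∎
      where
      s₁ = 1# + u * u * p₁
      s₂ = 1# + u * u * p₂
      product-sides : ∀ x z → product (onSides x z) ≈ x ^ ∣ V₁ ∣ * z ^ ∣ V₂ ∣
      product-sides x z = trans (product-if side x z)
          (reflexive (≡.cong₂ (λ a b → x ^ a * z ^ b) (≡.sym ∣V₁∣≡) (≡.sym ∣V₂∣≡)))
      entry : ∀ i j → 1# * bass G u (onSides p₁ p₂) i j * onSides s₂ 1# j ≈ onSides u s₂ i *
          (onSides y 1# i * identity i j - A i j) * onSides u 1# j
      entry i j = begin
        1# * ((1# + u * u * onSides p₁ p₂ i) * identity i j - u * A i j) * onSides s₂ 1# j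
          ≈⟨ solve 5 (λ x e u α d → con (+ 1) :* (x :* e :- u :* α) :* d := x :* e :* d :- u :* α :* d) refl
              (1# + u * u * onSides p₁ p₂ i) (identity i j) u (A i j) (onSides s₂ 1# j) ⟩
        (1# + u * u * onSides p₁ p₂ i) * identity i j * onSides s₂ 1# j - u * A i j * onSides s₂ 1# j
          ≈⟨ +-cong diagonal (-‿cong offDiagonal) ⟩
        onSides u s₂ i * (onSides y 1# i * identity i j) * onSides u 1# j - onSides u s₂ i * A i j * onSides u 1# j
          ≈⟨ solve 4 (λ c x α d → c :* x :* d :- c :* α :* d := c :* (x :- α) :* d) refl (onSides u s₂ i)
              (onSides y 1# i * identity i j) (A i j) (onSides u 1# j) ⟩
        _ ∎
        where
        diagonal : (1# + u * u * onSides p₁ p₂ i) * identity i j * onSides s₂ 1# j ≈ onSides u s₂ i *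
            (onSides y 1# i * identity i j) * onSides u 1# j
        diagonal with i Fin.≟ j
        ... | no  _ = trans (trans (*-congʳ (zeroʳ _)) (zeroˡ _))
            (sym (trans (*-congʳ (trans (*-congˡ (zeroʳ _)) (zeroʳ _))) (zeroˡ _)))
        ... | yes ≡.refl with side i
        ...   | true  = trans (solve 2 (λ a b → a :* con (+ 1) :* b := a :* b) refl s₁ s₂)
                  (trans (sym yu²) (solve 2 (λ u y → y :* (u :* u) := u :* (y :* con (+ 1)) :* u) refl u y))
        ...   | false = solve 1 (λ s → s :* con (+ 1) :* con (+ 1) := s :* (con (+ 1) :* con (+ 1)) :* con (+ 1)) refl s₂
        offDiagonal : u * A i j * onSides s₂ 1# j ≈ onSides u s₂ i * A i j * onSides u 1# j
        offDiagonal with Graph.adj G i j in e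
        ... | false = trans (trans (*-congʳ (zeroʳ _)) (zeroˡ _)) (sym (trans (*-congʳ (zeroʳ _)) (zeroˡ _)))
        ... | true rewrite adjacent-sides e with side j
        ...   | true  = solve 2 (λ u s → u :* con (+ 1) :* s := s :* con (+ 1) :* u) refl u s₂
        ...   | false = refl

  ↑-elim : ∀ m {n p} {P : Fin (m ℕ.+ n) → Set p} → (∀ i → P (i ↑ˡ n)) → (∀ j → P (m ↑ʳ j)) → ∀ k → P k
  ↑-elim m {n} {P = P} l r k with splitAt m k in e
  ... | inj₁ i = ≡.subst P (Fin.splitAt⁻¹-↑ˡ e) (l i)
  ... | inj₂ j = ≡.subst P (Fin.splitAt⁻¹-↑ʳ e) (r j)

  -- The determinant of a join

  module _ (G₁ G₂ : Graph) where
    private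
      ν₁ = order G₁
      ν₂ = order G₂
      G  = G₁ ∨ G₂

    glue : ∀ {a} {B : Set a} → (Fin ν₁ → B) → (Fin ν₂ → B) → Fin (ν₁ ℕ.+ ν₂) → B
    glue f g = f Vector.++ g

    glue-ˡ : ∀ {a} {B : Set a} (f : Fin ν₁ → B) (g : Fin ν₂ → B) i → glue f g (i ↑ˡ ν₂) ≡ f i
    glue-ˡ f g i = ≡.cong [ f , g ]′ (Fin.splitAt-↑ˡ ν₁ i ν₂)

    glue-ʳ : ∀ {a} {B : Set a} (f : Fin ν₁ → B) (g : Fin ν₂ → B) j → glue f g (ν₁ ↑ʳ j) ≡ g j
    glue-ʳ f g j = ≡.cong [ f , g ]′ (Fin.splitAt-↑ʳ ν₁ ν₂ j)

    private
      join-adjacency : ∀ {x y s t} → splitAt ν₁ x ≡ s → splitAt ν₁ y ≡ t → adjacency G x y ≡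
          (if ⊎-adj G₁ G₂ s t then 1# else 0#)
      join-adjacency e e′ = ≡.cong₂ (λ s t → if ⊎-adj G₁ G₂ s t then 1# else 0#) e e′

    adjacency-ˡˡ : ∀ i j → adjacency G (i ↑ˡ ν₂) (j ↑ˡ ν₂) ≡ adjacency G₁ i j
    adjacency-ˡˡ i j = join-adjacency (Fin.splitAt-↑ˡ ν₁ i ν₂) (Fin.splitAt-↑ˡ ν₁ j ν₂)

    adjacency-ˡʳ : ∀ i j → adjacency G (i ↑ˡ ν₂) (ν₁ ↑ʳ j) ≡ 1#
    adjacency-ˡʳ i j = join-adjacency (Fin.splitAt-↑ˡ ν₁ i ν₂) (Fin.splitAt-↑ʳ ν₁ ν₂ j)

    adjacency-ʳˡ : ∀ i j → adjacency G (ν₁ ↑ʳ i) (j ↑ˡ ν₂) ≡ 1#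
    adjacency-ʳˡ i j = join-adjacency (Fin.splitAt-↑ʳ ν₁ ν₂ i) (Fin.splitAt-↑ˡ ν₁ j ν₂)

    adjacency-ʳʳ : ∀ i j → adjacency G (ν₁ ↑ʳ i) (ν₁ ↑ʳ j) ≡ adjacency G₂ i j
    adjacency-ʳʳ i j = join-adjacency (Fin.splitAt-↑ʳ ν₁ ν₂ i) (Fin.splitAt-↑ʳ ν₁ ν₂ j)

    private
      ↑ˡ≢↑ʳ : ∀ {i : Fin ν₁} {j : Fin ν₂} → i ↑ˡ ν₂ ≢ ν₁ ↑ʳ j
      ↑ˡ≢↑ʳ {i} {j} e with () ← ≡.trans (≡.sym (Fin.splitAt-↑ˡ ν₁ i ν₂))
          (≡.trans (≡.cong (splitAt ν₁) e) (Fin.splitAt-↑ʳ ν₁ ν₂ j))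

      identity-injective : ∀ {m n} (f : Fin m → Fin n) → (∀ {i j} → f i ≡ f j → i ≡ j) → ∀ i j → identity (f i)
          (f j) ≡ identity i j
      identity-injective f f-inj i j with i Fin.≟ j
      ... | yes ≡.refl = identity-diagonal (f i)
      ... | no  i≢j    = identity-offDiagonal (i≢j ∘ f-inj)

    valency-ˡ : ∀ i → valency G (i ↑ˡ ν₂) ≈ valency G₁ i + ι ν₂
    valency-ˡ i = trans (sum-split ν₁ (adjacency G (i ↑ˡ ν₂)))
      (+-cong (sum-cong-≋ {ν₁} (λ j → reflexive (adjacency-ˡˡ i j)))
              (trans (sum-cong-≋ {ν₂} (λ j → reflexive (adjacency-ˡʳ i j))) (sum-replicate ν₂)))

    valency-ʳ : ∀ j → valency G (ν₁ ↑ʳ j) ≈ ι ν₁ + valency G₂ j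
    valency-ʳ j = trans (sum-split ν₁ (adjacency G (ν₁ ↑ʳ j)))
      (+-cong (trans (sum-cong-≋ {ν₁} (λ i → reflexive (adjacency-ʳˡ j i))) (sum-replicate ν₁))
              (sum-cong-≋ {ν₂} (λ i → reflexive (adjacency-ʳʳ j i))))

    -- The two off-diagonal blocks −u of the join are rank-one matrices.
    join-det : ∀ u p₁ p₂ (a : Fin ν₁ → Carrier) (b : Fin ν₂ → Carrier) Δ₁ Δ₂ →
      (∀ j → sum (λ i → a i * bass G₁ u p₁ i j) ≈ Δ₁) → (∀ j → sum (λ i → b i * bass G₂ u p₂ i j) ≈ Δ₂) →
      Δ₁ * Δ₂ * det (bass G u (glue p₁ p₂)) ≈ (Δ₁ * Δ₂ - u * u * (sum a * sum b)) * (det (bass G₁ u p₁) * det (bass G₂ u p₂))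
    join-det u p₁ p₂ a b Δ₁ Δ₂ aM≈Δ₁ bM≈Δ₂ = begin
      Δ₁ * Δ₂ * det M
        ≈⟨ *-congˡ (det-cong {ν₁ ℕ.+ ν₂} (λ i j → solve 2 (λ m x → m := (m :- x) :+ x) refl (M i j) (k i * v j))) ⟩
      Δ₁ * Δ₂ * det (λ i j → N i j + k i * v j)
        ≈⟨ det-rank1 N k v z (Δ₁ * Δ₂) (↑-elim ν₁ columnˡ columnʳ) ⟩
      (Δ₁ * Δ₂ + sum (λ i → k i * z i)) * det N
        ≈⟨ *-cong (+-congˡ kz) detN ⟩
      (Δ₁ * Δ₂ - u * u * (sum a * sum b)) * (det (bass G₁ u p₁) * det (bass G₂ u p₂)) ∎
      where
      M N : Matrix (ν₁ ℕ.+ ν₂)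
      k v z : Fin (ν₁ ℕ.+ ν₂) → Carrier
      M = bass G u (glue p₁ p₂)
      -- Only the upper right block is treated as a perturbation k vᵀ. The lower left block stays in
      -- `N`, which is block triangular and has the product of the two determinants as its own.
      k = glue (λ _ → - u) (λ _ → 0#)
      v = glue (λ _ → 0#) (λ _ → 1#)
      -- Solves z N = Δ₁Δ₂ v: the part Δ₁ b gives Δ₁Δ₂ in the right columns and -uΔ₁ Σb in the left
      -- ones, which u (Σb) a cancels.
      z = glue (λ i → u * sum b * a i) (λ j → Δ₁ * b j)
      N i j = M i j - k i * v j

      N-ˡˡ : ∀ i j → N (i ↑ˡ ν₂) (j ↑ˡ ν₂) ≈ bass G₁ u p₁ i j
      N-ˡˡ i j = trans (+-cong (+-cong (*-cong (+-congˡ (*-congˡ (reflexive (glue-ˡ p₁ p₂ i))))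
          (reflexive (identity-injective (_↑ˡ ν₂) (Fin.↑ˡ-injective ν₂ _ _) i j)))
            (-‿cong (*-congˡ (reflexive (adjacency-ˡˡ i j)))))
                (-‿cong (*-congˡ (reflexive (glue-ˡ (λ _ → 0#) (λ _ → 1#) j)))))
        (solve 2 (λ m x → m :- x :* con (+ 0) := m) refl (bass G₁ u p₁ i j) (k (i ↑ˡ ν₂)))

      N-ˡʳ : ∀ i j → N (i ↑ˡ ν₂) (ν₁ ↑ʳ j) ≈ 0#
      N-ˡʳ i j = trans (+-cong (+-cong (*-congˡ (reflexive (identity-offDiagonal (↑ˡ≢↑ʳ {i} {j}))))
          (-‿cong (*-congˡ (reflexive (adjacency-ˡʳ i j)))))
            (-‿cong (*-cong (reflexive (glue-ˡ (λ _ → - u) (λ _ → 0#) i)) (reflexive (glue-ʳ (λ _ → 0#) (λ _ → 1#) j)))))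
        (solve 2 (λ x u → x :* con (+ 0) :- u :* con (+ 1) :- (:- u) :* con (+ 1) := con (+ 0)) refl
            (1# + u * u * glue p₁ p₂ (i ↑ˡ ν₂)) u)

      N-ʳˡ : ∀ i j → N (ν₁ ↑ʳ i) (j ↑ˡ ν₂) ≈ - u
      N-ʳˡ i j = trans (+-cong (+-cong (*-congˡ (reflexive (identity-offDiagonal (↑ˡ≢↑ʳ {j} {i} ∘ ≡.sym))))
          (-‿cong (*-congˡ (reflexive (adjacency-ʳˡ i j)))))
            (-‿cong (*-congʳ (reflexive (glue-ʳ (λ _ → - u) (λ _ → 0#) i)))))
        (solve 3 (λ x u y → x :* con (+ 0) :- u :* con (+ 1) :- con (+ 0) :* y := :- u) refl
            (1# + u * u * glue p₁ p₂ (ν₁ ↑ʳ i)) u (v (j ↑ˡ ν₂)))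

      N-ʳʳ : ∀ i j → N (ν₁ ↑ʳ i) (ν₁ ↑ʳ j) ≈ bass G₂ u p₂ i j
      N-ʳʳ i j = trans (+-cong (+-cong (*-cong (+-congˡ (*-congˡ (reflexive (glue-ʳ p₁ p₂ i))))
          (reflexive (identity-injective (ν₁ ↑ʳ_) (Fin.↑ʳ-injective ν₁ _ _) i j)))
            (-‿cong (*-congˡ (reflexive (adjacency-ʳʳ i j)))))
                (-‿cong (*-congʳ (reflexive (glue-ʳ (λ _ → - u) (λ _ → 0#) i)))))
        (solve 2 (λ m x → m :- con (+ 0) :* x := m) refl (bass G₂ u p₂ i j) (v (ν₁ ↑ʳ j)))

      detN : det N ≈ det (bass G₁ u p₁) * det (bass G₂ u p₂)
      detN = trans (det-blockTriangular ν₁ N N-ˡʳ) (*-cong (det-cong {ν₁} N-ˡˡ) (det-cong {ν₂} N-ʳʳ))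

      zN : ∀ y → sum (λ i → z i * N i y) ≈ sum (λ i → u * sum b * a i * N (i ↑ˡ ν₂) y) + sum (λ j → Δ₁ * b j * N (ν₁ ↑ʳ j) y)
      zN y = trans (sum-split ν₁ (λ i → z i * N i y))
        (+-cong (sum-cong-≋ {ν₁} (λ i → *-congʳ (reflexive (glue-ˡ (λ i → u * sum b * a i) (λ j → Δ₁ * b j) i))))
                (sum-cong-≋ {ν₂} (λ j → *-congʳ (reflexive (glue-ʳ (λ i → u * sum b * a i) (λ j → Δ₁ * b j) j)))))

      columnˡ : ∀ j → Δ₁ * Δ₂ * v (j ↑ˡ ν₂) ≈ sum (λ i → z i * N i (j ↑ˡ ν₂))
      columnˡ j = sym (begin
        sum (λ i → z i * N i (j ↑ˡ ν₂))
          ≈⟨ zN (j ↑ˡ ν₂) ⟩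
        sum (λ i → u * sum b * a i * N (i ↑ˡ ν₂) (j ↑ˡ ν₂)) + sum (λ i → Δ₁ * b i * N (ν₁ ↑ʳ i) (j ↑ˡ ν₂))
          ≈⟨ +-cong (trans (sum-cong-≋ {ν₁} (λ i → trans (*-congˡ (N-ˡˡ i j)) (*-assoc _ _ _)))
              (trans (sym (*-distribˡ-sum (u * sum b) (λ i → a i * bass G₁ u p₁ i j))) (*-congˡ (aM≈Δ₁ j))))
               (trans (sum-cong-≋ {ν₂} (λ i → trans (*-congˡ (N-ʳˡ i j))
                   (solve 3 (λ d b u → d :* b :* (:- u) := (:- (d :* u)) :* b) refl Δ₁ (b i) u)))
                   (sym (*-distribˡ-sum (- (Δ₁ * u)) b))) ⟩
        u * sum b * Δ₁ + (- (Δ₁ * u)) * sum b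
          ≈⟨ solve 4 (λ u s d e → u :* s :* d :+ (:- (d :* u)) :* s := d :* e :* con (+ 0)) refl u (sum b) Δ₁ Δ₂ ⟩
        Δ₁ * Δ₂ * 0#
          ≈⟨ *-congˡ (sym (reflexive (glue-ˡ (λ _ → 0#) (λ _ → 1#) j))) ⟩
        Δ₁ * Δ₂ * v (j ↑ˡ ν₂) ∎)

      columnʳ : ∀ j → Δ₁ * Δ₂ * v (ν₁ ↑ʳ j) ≈ sum (λ i → z i * N i (ν₁ ↑ʳ j))
      columnʳ j = sym (begin
        sum (λ i → z i * N i (ν₁ ↑ʳ j))
          ≈⟨ zN (ν₁ ↑ʳ j) ⟩
        sum (λ i → u * sum b * a i * N (i ↑ˡ ν₂) (ν₁ ↑ʳ j)) + sum (λ i → Δ₁ * b i * N (ν₁ ↑ʳ i) (ν₁ ↑ʳ j))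
          ≈⟨ +-cong (sum-zero {ν₁} (λ i → trans (*-congˡ (N-ˡʳ i j)) (zeroʳ _)))
               (trans (sum-cong-≋ {ν₂} (λ i → trans (*-congˡ (N-ʳʳ i j)) (*-assoc _ _ _)))
                   (trans (sym (*-distribˡ-sum Δ₁ (λ i → b i * bass G₂ u p₂ i j))) (*-congˡ (bM≈Δ₂ j)))) ⟩
        0# + Δ₁ * Δ₂
          ≈⟨ solve 1 (λ d → con (+ 0) :+ d := d :* con (+ 1)) refl (Δ₁ * Δ₂) ⟩
        Δ₁ * Δ₂ * 1#
          ≈⟨ *-congˡ (sym (reflexive (glue-ʳ (λ _ → 0#) (λ _ → 1#) j))) ⟩
        Δ₁ * Δ₂ * v (ν₁ ↑ʳ j) ∎)

      kz : sum (λ i → k i * z i) ≈ - (u * u * (sum a * sum b))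
      kz = begin
        sum (λ i → k i * z i)
          ≈⟨ sum-split ν₁ (λ i → k i * z i) ⟩
        sum (λ i → k (i ↑ˡ ν₂) * z (i ↑ˡ ν₂)) + sum (λ j → k (ν₁ ↑ʳ j) * z (ν₁ ↑ʳ j))
          ≈⟨ +-cong (sum-cong-≋ {ν₁} (λ i → trans
              (*-cong (reflexive (glue-ˡ (λ _ → - u) (λ _ → 0#) i))
              (reflexive (glue-ˡ (λ i → u * sum b * a i) (λ j → Δ₁ * b j) i)))
                 (solve 3 (λ u s a → (:- u) :* (u :* s :* a) := (:- (u :* u :* s)) :* a) refl u (sum b) (a i))))
               (sum-zero {ν₂} (λ j → trans (*-congʳ (reflexive (glue-ʳ (λ _ → - u) (λ _ → 0#) j))) (zeroˡ _))) ⟩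
        sum (λ i → (- (u * u * sum b)) * a i) + 0#
          ≈⟨ +-congʳ (sym (*-distribˡ-sum (- (u * u * sum b)) a)) ⟩
        (- (u * u * sum b)) * sum a + 0#
          ≈⟨ solve 3 (λ u s a → (:- (u :* u :* s)) :* a :+ con (+ 0) := :- (u :* u :* (a :* s))) refl u (sum b) (sum a) ⟩
        - (u * u * (sum a * sum b)) ∎

-- Separating even and odd parts

module Comparison {c ℓ} (R : CommutativeRing c ℓ) (isField : IsFieldOfCharacteristicZero R) where
  open CommutativeRing R hiding (zero)
  open IntegerSolver R
  open PolynomialFunctions R isField
  open import Relation.Binary.Reasoning.Setoid setoid

  -- J = (F / Δ) (Y − 2u³X), with F, Δ, X, Y even in u: the even and the odd part
  -- of J share the factor F / Δ, which therefore drops out of X / Y.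
  record Expansion (J : Carrier → Carrier) : Set (c ⊔ ℓ) where
    field
      F Δ ζ  : Carrier → Carrier
      τ ξ η  : Carrier
      Fᴾ     : Polynomial F
      Δᴾ     : Polynomial Δ
      ζᴾ     : Polynomial ζ
      F-even : ∀ u → F (- u) ≈ F u
      Δ-even : ∀ u → Δ (- u) ≈ Δ u
      ζ-even : ∀ u → ζ (- u) ≈ ζ u
      F-0    : F 0# ≈ 1#
      Δ-0    : Δ 0# ≈ 1#
      expand : ∀ u → Δ u * J u ≈
               F u * (1# + u * u * η + u * u * (u * u * ζ u) - (1# + 1#) * (u * u * u) * (τ + u * u * ξ))

    X Y : Carrier → Carrier
    X u = τ + u * u * ξ
    Y u = 1# + u * u * η + u * u * (u * u * ζ u)

    Xᴾ : Polynomial X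
    Xᴾ = constᴾ +ᴾ idᴾ *ᴾ idᴾ *ᴾ constᴾ

    Yᴾ : Polynomial Y
    Yᴾ = constᴾ +ᴾ idᴾ *ᴾ idᴾ *ᴾ constᴾ +ᴾ idᴾ *ᴾ idᴾ *ᴾ (idᴾ *ᴾ idᴾ *ᴾ ζᴾ)

    X-even : ∀ u → X (- u) ≈ X u
    X-even u = solve 3 (λ τ u ξ → τ :+ (:- u) :* (:- u) :* ξ := τ :+ u :* u :* ξ) refl τ u ξ

    Y-even : ∀ u → Y (- u) ≈ Y u
    Y-even u = trans (solve 3 (λ u η ζ → con (+ 1) :+ (:- u) :* (:- u) :* η :+ (:- u) :* (:- u) :* ((:- u) :* (:- u) :* ζ)
                 := con (+ 1) :+ u :* u :* η :+ u :* u :* (u :* u :* ζ)) refl u η (ζ (- u)))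
      (+-congˡ (*-congˡ (*-congˡ (ζ-even u))))

    X-0 : X 0# ≈ τ
    X-0 = solve 2 (λ τ ξ → τ :+ con (+ 0) :* con (+ 0) :* ξ := τ) refl τ ξ

  2≉0 : ¬ 1# + 1# ≈ 0#
  2≉0 2≈0 = ιsuc≉0 1 (trans (+-congˡ (+-identityʳ 1#)) 2≈0)

  double-injective : ∀ {x y} → (1# + 1#) * x ≈ (1# + 1#) * y → x ≈ y
  double-injective = *-cancelˡ-nonzero 2≉0

  module _ {J J′ P P′ : Carrier → Carrier} (E : Expansion J) (E′ : Expansion J′)
    (Pᴾ : Polynomial P) (P′ᴾ : Polynomial P′) (P-0 : P 0# ≈ 1#) (P′-0 : P′ 0# ≈ 1#)
    (P-even : ∀ u → P (- u) ≈ P u) (P′-even : ∀ u → P′ (- u) ≈ P′ u)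
    (PJ≈P′J′ : ∀ u → P u * J u ≈ P′ u * J′ u) where
    private
      module E  = Expansion E
      module E′ = Expansion E′

    -- The common factors of even and odd part after cross-multiplication with both Δ's. They are
    -- even and have value 1 at 0.
    L L′ : Carrier → Carrier
    L  u = P u * E.F u * E′.Δ u
    L′ u = P′ u * E′.F u * E.Δ u

    private
      Lᴾ : Polynomial L
      Lᴾ = Pᴾ *ᴾ E.Fᴾ *ᴾ E′.Δᴾ

      L′ᴾ : Polynomial L′
      L′ᴾ = P′ᴾ *ᴾ E′.Fᴾ *ᴾ E.Δᴾ

      L-0 : L 0# ≈ 1#
      L-0 = trans (*-cong (*-cong P-0 E.F-0) E′.Δ-0) (trans (*-identityʳ _) (*-identityʳ _))

      L′-0 : L′ 0# ≈ 1#
      L′-0 = trans (*-cong (*-cong P′-0 E′.F-0) E.Δ-0) (trans (*-identityʳ _) (*-identityʳ _))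

      t : Carrier → Carrier
      t u = (1# + 1#) * (u * u * u)

      combined : ∀ u → L u * (E.Y u - t u * E.X u) ≈ L′ u * (E′.Y u - t u * E′.X u)
      combined u = begin
        P u * E.F u * E′.Δ u * z            ≈⟨ solve 4 (λ p f d z → p :* f :* d :* z := d :* p :* (f :* z)) refl
            (P u) (E.F u) (E′.Δ u) z ⟩
        E′.Δ u * P u * (E.F u * z)          ≈⟨ *-congˡ (sym (E.expand u)) ⟩
        E′.Δ u * P u * (E.Δ u * J u)        ≈⟨ solve 4 (λ p e d j → d :* p :* (e :* j) := d :* e :* (p :* j))
            refl (P u) (E.Δ u) (E′.Δ u) (J u) ⟩
        E′.Δ u * E.Δ u * (P u * J u)        ≈⟨ *-congˡ (PJ≈P′J′ u) ⟩
        E′.Δ u * E.Δ u * (P′ u * J′ u)      ≈⟨ solve 4 (λ p e d j → d :* e :* (p :* j) := e :* p :* (d :* j))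
            refl (P′ u) (E.Δ u) (E′.Δ u) (J′ u) ⟩
        E.Δ u * P′ u * (E′.Δ u * J′ u)      ≈⟨ *-congˡ (E′.expand u) ⟩
        E.Δ u * P′ u * (E′.F u * z′)        ≈⟨ solve 4 (λ p f d z → d :* p :* (f :* z) := p :* f :* d :* z) refl
            (P′ u) (E′.F u) (E.Δ u) z′ ⟩
        P′ u * E′.F u * E.Δ u * z′          ∎
        where
        z  = E.Y u - t u * E.X u
        z′ = E′.Y u - t u * E′.X u

      reflected : ∀ u → L u * (E.Y u + t u * E.X u) ≈ L′ u * (E′.Y u + t u * E′.X u)
      reflected u = trans (sym (*-cong L-even (side E.Y-even E.X-even)))
        (trans (combined (- u)) (*-cong L′-even (side E′.Y-even E′.X-even)))
        where
        L-even : L (- u) ≈ L u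
        L-even = *-cong (*-cong (P-even u) (E.F-even u)) (E′.Δ-even u)
        L′-even : L′ (- u) ≈ L′ u
        L′-even = *-cong (*-cong (P′-even u) (E′.F-even u)) (E.Δ-even u)
        side : ∀ {X Y : Carrier → Carrier} → (∀ u → Y (- u) ≈ Y u) → (∀ u → X (- u) ≈ X u) → Y (- u) - t (- u) *
            X (- u) ≈ Y u + t u * X u
        side {X} {Y} Y-even X-even = trans (+-cong (Y-even u) (-‿cong (*-congˡ (X-even u))))
          (solve 3 (λ u x y → y :- (con (+ 1) :+ con (+ 1)) :* ((:- u) :* (:- u) :* (:- u)) :* x := y :+
              (con (+ 1) :+ con (+ 1)) :* (u :* u :* u) :* x) refl u (X u) (Y u))

    even-parts : ∀ u → L u * E.Y u ≈ L′ u * E′.Y u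
    even-parts u = double-injective (begin
      (1# + 1#) * (L u * E.Y u)     ≈⟨ solve 3
          (λ l y x → (con (+ 1) :+ con (+ 1)) :* (l :* y) := l :* (y :- x) :+ l :* (y :+ x)) refl (L u) (E.Y u)
          (t u * E.X u) ⟩
      _                             ≈⟨ +-cong (combined u) (reflected u) ⟩
      _                             ≈⟨ solve 3
          (λ l y x → (con (+ 1) :+ con (+ 1)) :* (l :* y) := l :* (y :- x) :+ l :* (y :+ x)) refl (L′ u)
          (E′.Y u) (t u * E′.X u) ⟨
      (1# + 1#) * (L′ u * E′.Y u)   ∎)

    -- The difference of the identities at -u and u carries the factor 2u³ (and another 2); it is
    -- cancelled for u ≠ 0, and the result extended to 0.
    odd-parts : ∀ u → L u * E.X u ≈ L′ u * E′.X u
    odd-parts = ≈-except (Lᴾ *ᴾ E.Xᴾ) (L′ᴾ *ᴾ E′.Xᴾ) 0# λ u u≉0 →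
      *-cancelˡ-nonzero (xy≉0 2≉0 (xy≉0 (xy≉0 u≉0 u≉0) u≉0)) (double-injective (begin
        (1# + 1#) * (t u * (L u * E.X u))
          ≈⟨ solve 4 (λ l y x t → (con (+ 1) :+ con (+ 1)) :* (t :* (l :* x)) := l :* (y :+ t :* x) :- l :*
              (y :- t :* x)) refl (L u) (E.Y u) (E.X u) (t u) ⟩
        _ ≈⟨ +-cong (reflected u) (-‿cong (combined u)) ⟩
        _ ≈⟨ solve 4 (λ l y x t → (con (+ 1) :+ con (+ 1)) :* (t :* (l :* x)) := l :* (y :+ t :* x) :- l :*
            (y :- t :* x)) refl (L′ u) (E′.Y u) (E′.X u) (t u) ⟨
        (1# + 1#) * (t u * (L′ u * E′.X u)) ∎))

    -- Evaluate the odd parts at 0, where `L` and `L′` are 1.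
    τ≈τ′ : E.τ ≈ E′.τ
    τ≈τ′ = begin
      E.τ                 ≈⟨ trans (sym (*-identityˡ _)) (*-cong (sym L-0) (sym E.X-0)) ⟩
      L 0# * E.X 0#       ≈⟨ odd-parts 0# ⟩
      L′ 0# * E′.X 0#     ≈⟨ trans (*-cong L′-0 E′.X-0) (*-identityˡ _) ⟩
      E′.τ                ∎

    private
      cross : ∀ u → E.X u * E′.Y u - E′.X u * E.Y u ≈ 0#
      cross = product-vanish (E.Xᴾ *ᴾ E′.Yᴾ +ᴾ (-ᴾ (E′.Xᴾ *ᴾ E.Yᴾ))) Lᴾ (λ e → 1≉0 (trans (sym L-0) e)) λ u → begin
        (E.X u * E′.Y u - E′.X u * E.Y u) * L u
          ≈⟨ solve 5 (λ x y x′ y′ l → (x :* y′ :- x′ :* y) :* l := l :* x :* y′ :- x′ :* (l :* y)) refl (E.X u)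
              (E.Y u) (E′.X u) (E′.Y u) (L u) ⟩
        L u * E.X u * E′.Y u - E′.X u * (L u * E.Y u)
          ≈⟨ +-cong (*-congʳ (odd-parts u)) (-‿cong (*-congˡ (even-parts u))) ⟩
        L′ u * E′.X u * E′.Y u - E′.X u * (L′ u * E′.Y u)
          ≈⟨ solve 3 (λ l x y → l :* x :* y :- x :* (l :* y) := con (+ 0)) refl (L′ u) (E′.X u) (E′.Y u) ⟩
        0# ∎

    -- The coefficient of u² in X Y′ = X′ Y.
    second-coefficient : E.τ * E′.η + E.ξ ≈ E.τ * E.η + E′.ξ
    second-coefficient = x-y≈0⇒x≈y (begin
      (E.τ * E′.η + E.ξ) - (E.τ * E.η + E′.ξ)
        ≈⟨ solve 2 (λ a r → a := a :+ con (+ 0) :* con (+ 0) :* r) refl _ (rest 0#) ⟩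
      (E.τ * E′.η + E.ξ) - (E.τ * E.η + E′.ξ) + 0# * 0# * rest 0#
        ≈⟨ vanish-except {λ u → κ + u * u * rest u} (constᴾ +ᴾ idᴾ *ᴾ idᴾ *ᴾ restᴾ) 0#
            (λ u u≉0 → xy≈0⇒y≈0 (xy≉0 u≉0 u≉0) (begin
             u * u * (κ + u * u * rest u)
               ≈⟨ solve 8 (λ u τ ξ ξ′ η η′ ζ ζ′ → let y = u :* u in
                    y :* ((τ :* η′ :+ ξ) :- (τ :* η :+ ξ′) :+ y :*
                        (τ :* ζ′ :+ ξ :* η′ :+ y :* (ξ :* ζ′) :- τ :* ζ :- ξ′ :* η :- y :* (ξ′ :* ζ)))
                    := (τ :+ y :* ξ) :* (con (+ 1) :+ y :* η′ :+ y :* (y :* ζ′)) :- (τ :+ y :* ξ′) :*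
                        (con (+ 1) :+ y :* η :+ y :* (y :* ζ)))
                    refl u E.τ E.ξ E′.ξ E.η E′.η (E.ζ u) (E′.ζ u) ⟩
             E.X u * E′.Y u - (E.τ + u * u * E′.ξ) * E.Y u
               ≈⟨ +-congˡ (-‿cong (*-congʳ (+-congʳ τ≈τ′))) ⟩
             E.X u * E′.Y u - E′.X u * E.Y u
               ≈⟨ cross u ⟩
             0# ∎)) 0# ⟩
      0# ∎)
      where
      -- With τ = τ′ one has X Y′ - X′ Y = u² (κ + u² `rest`), so κ is the value at 0 of the
      -- quotient by u².
      κ = (E.τ * E′.η + E.ξ) - (E.τ * E.η + E′.ξ)
      rest : Carrier → Carrier
      rest u = E.τ * E′.ζ u + E.ξ * E′.η + u * u * (E.ξ * E′.ζ u) - E.τ * E.ζ u - E′.ξ * E.η - u * u * (E′.ξ * E.ζ u)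
      restᴾ : Polynomial rest
      restᴾ = constᴾ *ᴾ E′.ζᴾ +ᴾ constᴾ *ᴾ constᴾ +ᴾ idᴾ *ᴾ idᴾ *ᴾ (constᴾ *ᴾ E′.ζᴾ) +ᴾ (-ᴾ (constᴾ *ᴾ E.ζᴾ)) +ᴾ
          (-ᴾ (constᴾ *ᴾ constᴾ)) +ᴾ (-ᴾ (idᴾ *ᴾ idᴾ *ᴾ (constᴾ *ᴾ E.ζᴾ)))

    -- Once P, Δ and X agree, the odd parts differ only in F. Since X(0) = τ ≠ 0, the remaining
    -- factor is nonzero at 0 and cancels.
    factor-equal : ¬ E.τ ≈ 0# → (∀ u → P u ≈ P′ u) → (∀ u → E.Δ u ≈ E′.Δ u) → E.ξ ≈ E′.ξ → ∀ u → E.F u ≈ E′.F u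
    factor-equal τ≉0 P≈ Δ≈ ξ≈ = product-cancelʳ E.Fᴾ E′.Fᴾ (Pᴾ *ᴾ E′.Δᴾ *ᴾ E.Xᴾ)
      (xy≉0 (xy≉0 (λ e → 1≉0 (trans (sym P-0) e)) (λ e → 1≉0 (trans (sym E′.Δ-0) e))) (λ e → τ≉0 (trans (sym E.X-0) e)))
      λ u → begin
        E.F u * (P u * E′.Δ u * E.X u)      ≈⟨ solve 4 (λ f p d x → f :* (p :* d :* x) := p :* f :* d :* x) refl
            (E.F u) (P u) (E′.Δ u) (E.X u) ⟩
        L u * E.X u                         ≈⟨ odd-parts u ⟩
        L′ u * E′.X u                       ≈⟨ *-cong (*-cong (*-congʳ (sym (P≈ u))) (Δ≈ u))
            (+-cong (sym τ≈τ′) (*-congˡ (sym ξ≈))) ⟩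
        P u * E′.F u * E′.Δ u * E.X u       ≈⟨ solve 4 (λ f p d x → p :* f :* d :* x := f :* (p :* d :* x)) refl
            (E′.F u) (P u) (E′.Δ u) (E.X u) ⟩
        E′.F u * (P u * E′.Δ u * E.X u)     ∎

-- The expansion for a join

module JoinExpansion {c ℓ} (R : CommutativeRing c ℓ) (isField : IsFieldOfCharacteristicZero R) where
  open CommutativeRing R hiding (zero)
  open IntegerSolver R
  open PolynomialFunctions R isField
  open Determinants R
  open GraphMatrices R
  open Matrices R
  open SemiRegularDeterminants R isField
  open Comparison R isField
  open import Algebra.Properties.Semiring.Sum semiring
  open import Relation.Binary.Reasoning.Setoid setoid

  module _ {G₁ V₁ V₂ q₁ q₂} (sr₁ : IsSemiRegular G₁ V₁ V₂ q₁ q₂) {G₂ V₃ V₄ q₃ q₄} (sr₂ : IsSemiRegular G₂ V₃ V₄ q₃ q₄) where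

    joinDet : (p₁ p₂ p₃ p₄ u : Carrier) → Carrier
    joinDet p₁ p₂ p₃ p₄ u = det (bass (G₁ ∨ G₂) u (glue G₁ G₂ (onSides sr₁ p₁ p₂) (onSides sr₂ p₃ p₄)))

    private
      ν₁ = ι (order G₁)
      ν₂ = ι (order G₂)
      m₁ = ι (∣ V₁ ∣ ℕ.* q₁)
      m₂ = ι (∣ V₃ ∣ ℕ.* q₃)

    joinExpansion : ∀ p₁ p₂ p₃ p₄ → Expansion (joinDet p₁ p₂ p₃ p₄)
    joinExpansion p₁ p₂ p₃ p₄ = record
      { F      = λ u → sideDet sr₁ p₁ p₂ u * sideDet sr₂ p₃ p₄ u
      ; Δ      = λ u → sideDelta sr₁ p₁ p₂ u * sideDelta sr₂ p₃ p₄ u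
      ; ζ      = ζ
      ; τ      = m₁ * ν₂ + m₂ * ν₁
      ; ξ      = m₁ * σ₂ + m₂ * σ₁
      ; η      = a₁ + a₂ - ν₁ * ν₂
      ; Fᴾ     = bassᴾ G₁ (onSides sr₁ p₁ p₂) *ᴾ bassᴾ G₂ (onSides sr₂ p₃ p₄)
      ; Δᴾ     = deltaᴾ p₁ p₂ (ι q₁ * ι q₂) *ᴾ deltaᴾ p₃ p₄ (ι q₃ * ι q₄)
      ; ζᴾ     = constᴾ +ᴾ idᴾ *ᴾ idᴾ *ᴾ constᴾ +ᴾ idᴾ *ᴾ idᴾ *ᴾ (idᴾ *ᴾ idᴾ *ᴾ constᴾ)
      ; F-even = λ u → *-cong (sideDet-even sr₁ p₁ p₂ u) (sideDet-even sr₂ p₃ p₄ u)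
      ; Δ-even = λ u → *-cong (delta-even p₁ p₂ (ι q₁ * ι q₂) u) (delta-even p₃ p₄ (ι q₃ * ι q₄) u)
      ; ζ-even = λ u → solve 4 (λ u x y z → x :+ (:- u) :* (:- u) :* y :+ (:- u) :* (:- u) :*
          ((:- u) :* (:- u) :* z) := x :+ u :* u :* y :+ u :* u :* (u :* u :* z)) refl u _ _ _
      ; F-0    = trans (*-cong (bass-0 G₁ _) (bass-0 G₂ _)) (*-identityˡ 1#)
      ; Δ-0    = trans (*-cong (delta-0 p₁ p₂ (ι q₁ * ι q₂)) (delta-0 p₃ p₄ (ι q₃ * ι q₄))) (*-identityˡ 1#)
      ; expand = expand
      }
      where
      -- Notation: Δᵢ = 1 + aᵢu² + bᵢu⁴, and the entries of the side vector of Gᵢ sum to νᵢ + σᵢu² +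
      -- 2mᵢu. Sorting Δ₁Δ₂ - u² · (product of the two sums) by parity gives τ, ξ, η and ζ.
      σ₁ = ι ∣ V₁ ∣ * p₂ + ι ∣ V₂ ∣ * p₁
      σ₂ = ι ∣ V₃ ∣ * p₄ + ι ∣ V₄ ∣ * p₃
      a₁ = p₁ + p₂ - ι q₁ * ι q₂
      a₂ = p₃ + p₄ - ι q₃ * ι q₄
      b₁ = p₁ * p₂
      b₂ = p₃ * p₄
      ζ : Carrier → Carrier
      ζ u = (b₁ + b₂ + a₁ * a₂ - (ν₁ * σ₂ + ν₂ * σ₁ + (1# + 1#) * (1# + 1#) * (m₁ * m₂))) + u * u *
          (a₁ * b₂ + a₂ * b₁ - σ₁ * σ₂) + u * u * (u * u * (b₁ * b₂))
      deltaᴾ : ∀ p q α → Polynomial (λ u → (1# + u * u * p) * (1# + u * u * q) - u * u * α)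
      deltaᴾ p q α = (constᴾ +ᴾ idᴾ *ᴾ idᴾ *ᴾ constᴾ) *ᴾ (constᴾ +ᴾ idᴾ *ᴾ idᴾ *ᴾ constᴾ) +ᴾ (-ᴾ (idᴾ *ᴾ idᴾ *ᴾ constᴾ))
      delta-even : ∀ p q α u → (1# + (- u) * (- u) * p) * (1# + (- u) * (- u) * q) - (- u) * (- u) * α ≈
          (1# + u * u * p) * (1# + u * u * q) - u * u * α
      delta-even = solve 4 (λ p q α u → (con (+ 1) :+ (:- u) :* (:- u) :* p) :*
          (con (+ 1) :+ (:- u) :* (:- u) :* q) :- (:- u) :* (:- u) :* α
        := (con (+ 1) :+ u :* u :* p) :* (con (+ 1) :+ u :* u :* q) :- u :* u :* α) refl
      delta-0 : ∀ p q α → (1# + 0# * 0# * p) * (1# + 0# * 0# * q) - 0# * 0# * α ≈ 1#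
      delta-0 = solve 3 (λ p q α → (con (+ 1) :+ con (+ 0) :* con (+ 0) :* p) :*
          (con (+ 1) :+ con (+ 0) :* con (+ 0) :* q) :- con (+ 0) :* con (+ 0) :* α := con (+ 1)) refl
      delta-expand : ∀ p q α u → (1# + u * u * p) * (1# + u * u * q) - u * u * α ≈ 1# + u * u * (p + q - α) + u
          * u * (u * u * (p * q))
      delta-expand = solve 4 (λ p q α u → (con (+ 1) :+ u :* u :* p) :* (con (+ 1) :+ u :* u :* q) :- u :* u :* α
        := con (+ 1) :+ u :* u :* (p :+ q :- α) :+ u :* u :* (u :* u :* (p :* q))) refl
      expand : ∀ u → sideDelta sr₁ p₁ p₂ u * sideDelta sr₂ p₃ p₄ u * joinDet p₁ p₂ p₃ p₄ u ≈
        sideDet sr₁ p₁ p₂ u * sideDet sr₂ p₃ p₄ u *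
            (1# + u * u * (a₁ + a₂ - ν₁ * ν₂) + u * u * (u * u * ζ u) - (1# + 1#) * (u * u * u) *
            (m₁ * ν₂ + m₂ * ν₁ + u * u * (m₁ * σ₂ + m₂ * σ₁)))
      expand u = trans (join-det G₁ G₂ u (onSides sr₁ p₁ p₂) (onSides sr₂ p₃ p₄) (sideVector sr₁ p₁ p₂ u)
          (sideVector sr₂ p₃ p₄ u) _ _
          (sideVector-bass sr₁ p₁ p₂ u) (sideVector-bass sr₂ p₃ p₄ u))
        (trans (*-comm _ _) (*-congˡ (begin
          sideDelta sr₁ p₁ p₂ u * sideDelta sr₂ p₃ p₄ u - u * u *
              (sum (sideVector sr₁ p₁ p₂ u) * sum (sideVector sr₂ p₃ p₄ u))
            ≈⟨ +-cong (*-cong (delta-expand p₁ p₂ (ι q₁ * ι q₂) u) (delta-expand p₃ p₄ (ι q₃ * ι q₄) u))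
                 (-‿cong (*-congˡ (*-cong (sum-sideVector sr₁ p₁ p₂ u) (sum-sideVector sr₂ p₃ p₄ u)))) ⟩
          (1# + u * u * a₁ + u * u * (u * u * b₁)) * (1# + u * u * a₂ + u * u * (u * u * b₂))
            - u * u * ((ν₁ + u * u * σ₁ + (1# + 1#) * u * m₁) * (ν₂ + u * u * σ₂ + (1# + 1#) * u * m₂))
            ≈⟨ solve 11 (λ u a₁ b₁ a₂ b₂ ν₁ σ₁ m₁ ν₂ σ₂ m₂ → let one = con (+ 1) ; two = one :+ one ; y = u :* u in
                 (one :+ y :* a₁ :+ y :* (y :* b₁)) :* (one :+ y :* a₂ :+ y :* (y :* b₂)) :- y :*
                     ((ν₁ :+ y :* σ₁ :+ two :* u :* m₁) :* (ν₂ :+ y :* σ₂ :+ two :* u :* m₂))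
                 := one :+ y :* (a₁ :+ a₂ :- ν₁ :* ν₂) :+ y :*
                     (y :* ((b₁ :+ b₂ :+ a₁ :* a₂ :- (ν₁ :* σ₂ :+ ν₂ :* σ₁ :+ two :* two :* (m₁ :* m₂))) :+ y :*
                     (a₁ :* b₂ :+ a₂ :* b₁ :- σ₁ :* σ₂) :+ y :* (y :* (b₁ :* b₂))))
                    :- two :* (u :* u :* u) :* (m₁ :* ν₂ :+ m₂ :* ν₁ :+ y :* (m₁ :* σ₂ :+ m₂ :* σ₁)))
                 refl u a₁ b₁ a₂ b₂ ν₁ σ₁ m₁ ν₂ σ₂ m₂ ⟩
          _ ∎)))

-- Arithmetic of the parameters

module _ where
  open ≡ using (refl; sym; trans; cong; cong₂; subst)

  -- With c = a + (k + 1) equal sums give b = d + (k + 1). Then equal products leave a (k + 1) = d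
  -- (k + 1), so a = d ≥ c, against a < c.
  no-smaller-part : ∀ {a b c d} → a ℕ.+ b ≡ c ℕ.+ d → a ℕ.* b ≡ c ℕ.* d → c ≤ d → ¬ a < c
  no-smaller-part {a} {b} {c} {d} sum≡ product≡ c≤d a<c with k , refl ← ℕ.m≤n⇒∃[o]m+o≡n a<c =
    ℕ.<⇒≱ a<c (ℕ.≤-trans c≤d (ℕ.≤-reflexive (sym (ℕ.*-cancelʳ-≡ a d (suc k) (ℕ.+-cancelˡ-≡ (a ℕ.* d) _ _ (begin
      a ℕ.* d ℕ.+ a ℕ.* suc k     ≡⟨ ℕ.*-distribˡ-+ a d (suc k) ⟨
      a ℕ.* (d ℕ.+ suc k)         ≡⟨ cong (a ℕ.*_) (trans (ℕ.+-comm d (suc k)) (sym b≡)) ⟩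
      a ℕ.* b                     ≡⟨ product≡ ⟩
      (suc a ℕ.+ k) ℕ.* d         ≡⟨ cong (ℕ._* d) (sym (ℕ.+-suc a k)) ⟩
      (a ℕ.+ suc k) ℕ.* d         ≡⟨ ℕ.*-distribʳ-+ d a (suc k) ⟩
      a ℕ.* d ℕ.+ suc k ℕ.* d     ≡⟨ cong (a ℕ.* d ℕ.+_) (ℕ.*-comm (suc k) d) ⟩
      a ℕ.* d ℕ.+ d ℕ.* suc k     ∎))))))
    where
    open ≡.≡-Reasoning
    b≡ : b ≡ suc k ℕ.+ d
    b≡ = ℕ.+-cancelˡ-≡ a _ _ (trans sum≡ (trans (cong (ℕ._+ d) (sym (ℕ.+-suc a k))) (ℕ.+-assoc a (suc k) d)))

  parts-unique : ∀ {a b c d} → a ≤ b → c ≤ d → a ℕ.+ b ≡ c ℕ.+ d → a ℕ.* b ≡ c ℕ.* d → a ≡ c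
  parts-unique a≤b c≤d sum≡ product≡ = ℕ.≤-antisym
    (ℕ.≮⇒≥ (no-smaller-part (sym sum≡) (sym product≡) a≤b)) (ℕ.≮⇒≥ (no-smaller-part sum≡ product≡ c≤d))

  m+m≡n+n⇒m≡n : ∀ {m n} → m ℕ.+ m ≡ n ℕ.+ n → m ≡ n
  m+m≡n+n⇒m≡n e = ℕ.≤-antisym (ℕ.≮⇒≥ λ n<m → ℕ.<-irrefl (sym e) (ℕ.+-mono-< n<m n<m))
                              (ℕ.≮⇒≥ λ m<n → ℕ.<-irrefl e (ℕ.+-mono-< m<n m<n))

  pos*pos : ∀ {a b} → 1 ≤ a → 1 ≤ b → 1 ≤ a ℕ.* b
  pos*pos (s≤s z≤n) (s≤s z≤n) = s≤s z≤n

  record Parameters : Set where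
    field
      n₁ n₂ q₁ q₂ : ℕ
      n₁≥1        : 1 ≤ n₁
      n₂≥1        : 1 ≤ n₂
      q₁≥1        : 1 ≤ q₁
      q₂≥1        : 1 ≤ q₂
      n₁≤n₂       : n₁ ≤ n₂
      edges       : n₁ ℕ.* q₁ ≡ n₂ ℕ.* q₂

    m ν β : ℕ
    m = n₁ ℕ.* q₁
    ν = n₁ ℕ.+ n₂
    β = q₁ ℕ.* q₂

    -- Multiply n₁q₁ = m by n₂q₂ = m. Hence m and β determine n₁n₂.
    m² : n₁ ℕ.* n₂ ℕ.* β ≡ m ℕ.* m
    m² = trans (interchange n₁ n₂ q₁ q₂) (cong (m ℕ.*_) (sym edges))
      where open import Algebra.Properties.CommutativeSemigroup ℕ.*-commutativeSemigroup using (interchange)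

    m≥1 : 1 ≤ m
    m≥1 = pos*pos n₁≥1 q₁≥1

    ν≤2m : ν ≤ m ℕ.+ m
    ν≤2m = ℕ.+-mono-≤ (ℕ.m≤m*n n₁ q₁ {{ℕ.>-nonZero q₁≥1}})
      (subst (n₂ ≤_) (sym edges) (ℕ.m≤m*n n₂ q₂ {{ℕ.>-nonZero q₂≥1}}))

    -- All degrees are positive, so n₂ ≤ m and 2n₂ ≤ 2m ≤ n₁ + n₂.
    balanced : m ℕ.+ m ≤ ν → n₁ ≡ n₂
    balanced 2m≤ν = ℕ.≤-antisym n₁≤n₂ (ℕ.+-cancelʳ-≤ n₂ n₂ n₁ (ℕ.≤-trans (ℕ.+-mono-≤ n₂≤m n₂≤m) 2m≤ν))
      where
      n₂≤m : n₂ ≤ m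
      n₂≤m = subst (n₂ ≤_) (sym edges) (ℕ.m≤m*n n₂ q₂ {{ℕ.>-nonZero q₂≥1}})

  module _ (A A′ : Parameters) where
    private
      module A = Parameters A
      module A′ = Parameters A′

    record Same : Set where
      field
        n₁≡ : A.n₁ ≡ A′.n₁
        n₂≡ : A.n₂ ≡ A′.n₂
        q₁≡ : A.q₁ ≡ A′.q₁
        q₂≡ : A.q₂ ≡ A′.q₂

    n₁⇒same : A.ν ≡ A′.ν → A.m ≡ A′.m → A.n₁ ≡ A′.n₁ → Same
    n₁⇒same ν≡ m≡ n₁≡ = record
      { n₁≡ = n₁≡
      ; n₂≡ = n₂≡
      ; q₁≡ = ℕ.*-cancelˡ-≡ A.q₁ A′.q₁ A.n₁ {{ℕ.>-nonZero A.n₁≥1}} (trans m≡ (cong (ℕ._* A′.q₁) (sym n₁≡)))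
      ; q₂≡ = ℕ.*-cancelˡ-≡ A.q₂ A′.q₂ A.n₂ {{ℕ.>-nonZero A.n₂≥1}}
          (trans (sym A.edges) (trans m≡ (trans A′.edges (cong (ℕ._* A′.q₂) (sym n₂≡)))))
      }
      where
      n₂≡ : A.n₂ ≡ A′.n₂
      n₂≡ = ℕ.+-cancelˡ-≡ A.n₁ _ _ (trans ν≡ (cong (ℕ._+ A′.n₂) (sym n₁≡)))

    -- The sum n₁ + n₂ = ν and the product n₁n₂ = m² / β are known; n₁ ≤ n₂ fixes the order, and the
    -- degrees are m / n₁ and m / n₂.
    β⇒same : A.ν ≡ A′.ν → A.m ≡ A′.m → A.β ≡ A′.β → Same
    β⇒same ν≡ m≡ β≡ = n₁⇒same ν≡ m≡ (parts-unique A.n₁≤n₂ A′.n₁≤n₂ ν≡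
      (ℕ.*-cancelʳ-≡ _ _ A.β {{ℕ.>-nonZero (pos*pos A.q₁≥1 A.q₂≥1)}}
          (trans A.m² (trans (cong₂ ℕ._*_ m≡ m≡) (trans (sym A′.m²) (cong (A′.n₁ ℕ.* A′.n₂ ℕ.*_) (sym β≡)))))))

    balanced⇒same : A.ν ≡ A′.ν → A.m ≡ A′.m → A.m ℕ.+ A.m ≤ A.ν → Same
    balanced⇒same ν≡ m≡ 2m≤ν = n₁⇒same ν≡ m≡ (m+m≡n+n⇒m≡n (trans (trans (cong (A.n₁ ℕ.+_) (A.balanced 2m≤ν)) ν≡)
      (cong (A′.n₁ ℕ.+_) (sym (A′.balanced (subst (λ k → k ℕ.+ k ≤ A′.ν) m≡ (subst (A.m ℕ.+ A.m ≤_) ν≡ 2m≤ν)))))))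

  -- Since 2m ≥ ν for both graphs, the bound ν ν′ ≤ m ν′ + m′ ν is attained only by
  -- perfect matchings.
  perfectMatching : ∀ (C A : Parameters) → let open Parameters in
                    ν C ℕ.* ν A ≡ m C ℕ.* ν A ℕ.+ m A ℕ.* ν C → m A ℕ.+ m A ≤ ν A
  perfectMatching C A e = ℕ.≮⇒≥ λ ν<2m → ℕ.<-irrefl (cong₂ ℕ._+_ e e) (begin-strict
    C.ν ℕ.* A.ν ℕ.+ C.ν ℕ.* A.ν                                        ≡⟨ cong (C.ν ℕ.* A.ν ℕ.+_) (ℕ.*-comm C.ν A.ν) ⟩
    C.ν ℕ.* A.ν ℕ.+ A.ν ℕ.* C.ν                                        <⟨ ℕ.+-mono-≤-< (ℕ.*-monoˡ-≤ A.ν C.ν≤2m)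
        (ℕ.*-monoˡ-< C.ν {{ℕ.>-nonZero C.ν≥1}} ν<2m) ⟩
    (C.m ℕ.+ C.m) ℕ.* A.ν ℕ.+ (A.m ℕ.+ A.m) ℕ.* C.ν                    ≡⟨ cong₂ ℕ._+_
        (ℕ.*-distribʳ-+ A.ν C.m C.m) (ℕ.*-distribʳ-+ C.ν A.m A.m) ⟩
    (C.m ℕ.* A.ν ℕ.+ C.m ℕ.* A.ν) ℕ.+ (A.m ℕ.* C.ν ℕ.+ A.m ℕ.* C.ν)    ≡⟨ interchange (C.m ℕ.* A.ν)
        (C.m ℕ.* A.ν) (A.m ℕ.* C.ν) (A.m ℕ.* C.ν) ⟩
    (C.m ℕ.* A.ν ℕ.+ A.m ℕ.* C.ν) ℕ.+ (C.m ℕ.* A.ν ℕ.+ A.m ℕ.* C.ν)    ∎)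
    where
    open ℕ.≤-Reasoning
    open import Algebra.Properties.CommutativeSemigroup ℕ.+-commutativeSemigroup using (interchange)
    module A = Parameters A
    module C where
      open Parameters C public
      ν≥1 : 1 ≤ ν
      ν≥1 = ℕ.≤-trans n₁≥1 (ℕ.m≤m+n n₁ n₂)

-- The second coefficient in terms of the parameters

module ParameterComparison {c ℓ} (R : CommutativeRing c ℓ) (isField : IsFieldOfCharacteristicZero R) where
  open CommutativeRing R hiding (zero)
  open IntegerSolver R
  open PolynomialFunctions R isField
  open import Relation.Binary.Reasoning.Setoid setoid

  -- This is m/q₁ + m/q₂ = ν with denominators cleared.
  degree-product : ∀ {n₁ n₂ q₁ q₂ m ν} → n₁ * q₁ ≈ m → n₂ * q₂ ≈ m → n₁ + n₂ ≈ ν → m * (q₁ + q₂) ≈ ν * (q₁ * q₂)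
  degree-product {n₁} {n₂} {q₁} {q₂} {m} {ν} e₁ e₂ e = begin
    m * (q₁ + q₂)                      ≈⟨ distribˡ m q₁ q₂ ⟩
    m * q₁ + m * q₂                    ≈⟨ +-cong (*-congʳ (sym e₂)) (*-congʳ (sym e₁)) ⟩
    n₂ * q₂ * q₁ + n₁ * q₁ * q₂        ≈⟨ solve 4
        (λ n₁ n₂ q₁ q₂ → n₂ :* q₂ :* q₁ :+ n₁ :* q₁ :* q₂ := (n₁ :+ n₂) :* (q₁ :* q₂)) refl n₁ n₂ q₁ q₂ ⟩
    (n₁ + n₂) * (q₁ * q₂)              ≈⟨ *-congʳ e ⟩
    ν * (q₁ * q₂)                      ∎

  -- The left side is (n₁² + n₂²) β, since m n₁q₂ = n₁² β and m n₂q₁ = n₂² β; moreover n₁n₂ β = m².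
  square-product : ∀ {n₁ n₂ q₁ q₂ m ν} → n₁ * q₁ ≈ m → n₂ * q₂ ≈ m → n₁ + n₂ ≈ ν →
                   m * (n₁ * q₂ + n₂ * q₁) ≈ ν * ν * (q₁ * q₂) - (1# + 1#) * (m * m)
  square-product {n₁} {n₂} {q₁} {q₂} {m} {ν} e₁ e₂ e = begin
    m * (n₁ * q₂ + n₂ * q₁)
      ≈⟨ solve 5 (λ m n₁ n₂ q₁ q₂ → m :* (n₁ :* q₂ :+ n₂ :* q₁) := m :* (n₁ :* q₂) :+ m :* (n₂ :* q₁)) refl m n₁ n₂ q₁ q₂ ⟩
    m * (n₁ * q₂) + m * (n₂ * q₁)
      ≈⟨ +-cong (*-congʳ (sym e₁)) (*-congʳ (sym e₂)) ⟩
    n₁ * q₁ * (n₁ * q₂) + n₂ * q₂ * (n₂ * q₁)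
      ≈⟨ solve 4 (λ n₁ n₂ q₁ q₂ → n₁ :* q₁ :* (n₁ :* q₂) :+ n₂ :* q₂ :* (n₂ :* q₁)
           := (n₁ :+ n₂) :* (n₁ :+ n₂) :* (q₁ :* q₂) :- (con (+ 1) :+ con (+ 1)) :* ((n₁ :* q₁) :* (n₂ :* q₂)))
               refl n₁ n₂ q₁ q₂ ⟩
    (n₁ + n₂) * (n₁ + n₂) * (q₁ * q₂) - (1# + 1#) * ((n₁ * q₁) * (n₂ * q₂))
      ≈⟨ +-cong (*-congʳ (*-cong e e)) (-‿cong (*-congˡ (*-cong e₁ e₂))) ⟩
    ν * ν * (q₁ * q₂) - (1# + 1#) * (m * m) ∎

  -- With m and ν already equal on both sides, `degree-product` and `square-product` turn the
  -- remaining unknowns into multiples of β = q₁q₂, so the hypothesis becomes linear in β. Here `c`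
  -- is the increase of degree - 1 caused by the join, and `a`, `s` collect what both sides share.
  second-coefficient-bass :
    ∀ {n₁ n₂ q₁ q₂ n₁′ n₂′ q₁′ q₂′ m ν μ k τ} c a s →
    n₁ * q₁ ≈ m → n₂ * q₂ ≈ m → n₁ + n₂ ≈ ν → n₁′ * q₁′ ≈ m → n₂′ * q₂′ ≈ m → n₁′ + n₂′ ≈ ν →
    τ ≈ μ * ν + m * k →
    τ * (a + (q₁′ + c + (q₂′ + c) - q₁′ * q₂′) - k * ν) + (μ * (n₁ * (q₂ + c) + n₂ * (q₁ + c)) + s) ≈
    τ * (a + (q₁ + c + (q₂ + c) - q₁ * q₂) - k * ν) + (μ * (n₁′ * (q₂′ + c) + n₂′ * (q₁′ + c)) + s) →
    (q₁′ * q₂′ - q₁ * q₂) * (m * (k * ν - τ)) ≈ 0#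
  second-coefficient-bass {n₁} {n₂} {q₁} {q₂} {n₁′} {n₂′} {q₁′} {q₂′} {m} {ν} {μ} {k} {τ} c a s e₁ e₂ e e₁′ e₂′
      e′ τ≈ H = begin
    (β′ - β) * (m * (k * ν - τ))
      ≈⟨ solve 6 (λ β′ β m k ν τ → (β′ :- β) :* (m :* (k :* ν :- τ)) := m :* k :* (ν :* (β′ :- β)) :- τ :*
          (m :* (β′ :- β))) refl β′ β m k ν τ ⟩
    m * k * (ν * (β′ - β)) - τ * (m * (β′ - β))
      -- `τ≈` replaces m k by τ - μν, after which all terms fit the two product formulas.
      ≈⟨ +-congʳ (*-congʳ (trans (solve 2 (λ x y → y := x :+ y :- x) refl (μ * ν) (m * k)) (+-congʳ (sym τ≈)))) ⟩
    (τ - μ * ν) * (ν * (β′ - β)) - τ * (m * (β′ - β))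
      ≈⟨ solve 6 (λ τ μ ν β′ β m → (τ :- μ :* ν) :* (ν :* (β′ :- β)) :- τ :* (m :* (β′ :- β))
           := τ :* (ν :* β′ :- ν :* β) :- μ :*
               ((ν :* ν :* β′ :- (con (+ 1) :+ con (+ 1)) :* (m :* m)) :-
               (ν :* ν :* β :- (con (+ 1) :+ con (+ 1)) :* (m :* m))) :- τ :* (m :* (β′ :- β))) refl τ μ ν β′ β m ⟩
    τ * (ν * β′ - ν * β) - μ * ((ν * ν * β′ - (1# + 1#) * (m * m)) - (ν * ν * β - (1# + 1#) * (m * m))) - τ * (m * (β′ - β))
      ≈⟨ +-congʳ (+-cong (*-congˡ (+-cong (sym (degree-product e₁′ e₂′ e′)) (-‿cong (sym (degree-product e₁ e₂ e)))))
           (-‿cong (*-congˡ (+-cong (sym (square-product e₁′ e₂′ e′)) (-‿cong (sym (square-product e₁ e₂ e))))))) ⟩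
    τ * (m * (q₁′ + q₂′) - m * (q₁ + q₂)) - μ * (m * (n₁′ * q₂′ + n₂′ * q₁′) - m * (n₁ * q₂ + n₂ * q₁)) - τ * (m * (β′ - β))
      ≈⟨ solve 9 (λ τ m κ′ κ μ σ′ σ β′ β → τ :* (m :* κ′ :- m :* κ) :- μ :* (m :* σ′ :- m :* σ) :- τ :* (m :* (β′ :- β))
           := m :* ((τ :* (κ′ :- β′) :+ μ :* σ) :- (τ :* (κ :- β) :+ μ :* σ′))) refl τ m (q₁′ + q₂′) (q₁ + q₂) μ
               (n₁′ * q₂′ + n₂′ * q₁′) (n₁ * q₂ + n₂ * q₁) β′ β ⟩
    m * ((τ * ((q₁′ + q₂′) - β′) + μ * (n₁ * q₂ + n₂ * q₁)) - (τ * ((q₁ + q₂) - β) + μ * (n₁′ * q₂′ + n₂′ * q₁′)))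
      ≈⟨ *-congˡ (x≈y⇒x-y≈0 reduced) ⟩
    m * 0#  ≈⟨ zeroʳ m ⟩
    0# ∎
    where
    β  = q₁ * q₂
    β′ = q₁′ * q₂′
    shape : ∀ q₁ q₂ n₁ n₂ τ′ → n₁ + n₂ ≈ ν → τ * τ′ + (μ * (n₁ * (q₂ + c) + n₂ * (q₁ + c)) + s) ≈ τ * τ′ +
        (μ * (n₁ * q₂ + n₂ * q₁ + ν * c) + s)
    shape q₁ q₂ n₁ n₂ τ′ e = +-congˡ (+-congʳ
        (*-congˡ (trans (solve 5 (λ n₁ n₂ q₁ q₂ c → n₁ :* (q₂ :+ c) :+ n₂ :* (q₁ :+ c) := n₁ :* q₂ :+ n₂ :* q₁
        :+ (n₁ :+ n₂) :* c) refl n₁ n₂ q₁ q₂ c)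
      (+-congˡ (*-congʳ e)))))
    reduced : τ * ((q₁′ + q₂′) - β′) + μ * (n₁ * q₂ + n₂ * q₁) ≈ τ * ((q₁ + q₂) - β) + μ * (n₁′ * q₂′ + n₂′ * q₁′)
    reduced = begin
      τ * ((q₁′ + q₂′) - β′) + μ * σ
        ≈⟨ isolate q₁′ q₂′ σ ⟩
      τ * (a + (q₁′ + c + (q₂′ + c) - β′) - k * ν) + (μ * (σ + ν * c) + s) - rest
        ≈⟨ +-congʳ (trans (sym (shape q₁ q₂ n₁ n₂ _ e)) (trans H (shape q₁′ q₂′ n₁′ n₂′ _ e′))) ⟩
      τ * (a + (q₁ + c + (q₂ + c) - β) - k * ν) + (μ * (σ′ + ν * c) + s) - rest
        ≈⟨ sym (isolate q₁ q₂ σ′) ⟩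
      τ * ((q₁ + q₂) - β) + μ * σ′ ∎
      where
      σ  = n₁ * q₂ + n₂ * q₁
      σ′ = n₁′ * q₂′ + n₂′ * q₁′
      rest = τ * (a + (c + c) - k * ν) + (μ * (ν * c) + s)
      isolate : ∀ x y σ → τ * ((x + y) - x * y) + μ * σ ≈ τ * (a + (x + c + (y + c) - x * y) - k * ν) +
          (μ * (σ + ν * c) + s) - rest
      isolate x y σ = solve 10 (λ τ x y μ σ a c k ν s → τ :* ((x :+ y) :- x :* y) :+ μ :* σ
        := τ :* (a :+ (x :+ c :+ (y :+ c) :- x :* y) :- k :* ν) :+ (μ :* (σ :+ ν :* c) :+ s) :-
            (τ :* (a :+ (c :+ c) :- k :* ν) :+ (μ :* (ν :* c) :+ s)))
        refl τ x y μ σ a c k ν s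

-- Changing the weights through the biadjacency determinant

module Transfer {c ℓ} (R : CommutativeRing c ℓ) (isField : IsFieldOfCharacteristicZero R) where
  open CommutativeRing R hiding (zero)
  open IntegerSolver R
  open PolynomialFunctions R isField
  open SemiRegularDeterminants R isField
  open Determinants R
  open GraphMatrices R
  open Matrices R
  open import Algebra.Properties.Semiring.Sum semiring
  open import Algebra.Definitions.RawSemiring (Semiring.rawSemiring semiring) using (_^_)
  open import Relation.Binary.Reasoning.Setoid setoid

  inverse-nonzero : ∀ {v u} → v * u ≈ 1# → ¬ u ≈ 0#
  inverse-nonzero vu≈1 u≈0 = 1≉0 (trans (sym vu≈1) (trans (*-congˡ u≈0) (zeroʳ _)))

  -- The arguments y for which sideDet at u = 1/v determines biadjacencyDet y.
  module Points (a b : ℕ) where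
    -- The offset a b + 1 makes every `v i` a positive integer exceeding a b, as `point-injective`
    -- requires.
    v : ℕ → Carrier
    v i = ι (suc (a ℕ.* b) ℕ.+ i)

    v⁻¹ : ∀ i → ∃[ u ] v i * u ≈ 1#
    v⁻¹ i = inverse (v i) (ιsuc≉0 (a ℕ.* b ℕ.+ i))

    u : ℕ → Carrier
    u i = proj₁ (v⁻¹ i)

    point : ℕ → Carrier
    point i = (v i * v i + ι a) * (v i * v i + ι b) * (u i * u i)

    point-u² : ∀ i → point i * (u i * u i) ≈ (1# + u i * u i * ι a) * (1# + u i * u i * ι b)
    point-u² i = trans (solve 4 (λ v u a b → (v :* v :+ a) :* (v :* v :+ b) :* (u :* u) :* (u :* u)
        := ((v :* u) :* (v :* u) :+ u :* u :* a) :* ((v :* u) :* (v :* u) :+ u :* u :* b)) refl (v i) (u i) (ι a) (ι b))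
      (*-cong (+-congʳ vu²) (+-congʳ vu²))
      where
      vu² : (v i * u i) * (v i * u i) ≈ 1#
      vu² = trans (*-cong (proj₂ (v⁻¹ i)) (proj₂ (v⁻¹ i))) (*-identityˡ 1#)

    side-nonzero : ∀ i → ¬ 1# + u i * u i * ι b ≈ 0#
    side-nonzero i e = ιsuc≉0 (pred ℕ.+ b) (begin
      ι (suc (pred ℕ.+ b))                  ≈⟨ ι-+ (suc pred) b ⟩
      ι (k ℕ.* k) + ι b                     ≈⟨ +-congʳ (ι-* k k) ⟩
      v i * v i + ι b                       ≈⟨ +-congˡ
          (sym (trans (*-congʳ (trans (*-cong (proj₂ (v⁻¹ i)) (proj₂ (v⁻¹ i))) (*-identityˡ 1#))) (*-identityˡ _))) ⟩
      v i * v i + (v i * u i) * (v i * u i) * ι b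
        ≈⟨ solve 3 (λ v u b → v :* v :+ (v :* u) :* (v :* u) :* b := v :* v :* (con (+ 1) :+ u :* u :* b)) refl
            (v i) (u i) (ι b) ⟩
      v i * v i * (1# + u i * u i * ι b)    ≈⟨ trans (*-congˡ e) (zeroʳ _) ⟩
      0#                                    ∎)
      where
      k = suc (a ℕ.* b) ℕ.+ i
      -- Chosen so that `suc pred` computes to `k ℕ.* k`, which makes the sum a visible successor.
      pred = (a ℕ.* b ℕ.+ i) ℕ.+ (a ℕ.* b ℕ.+ i) ℕ.* k

    -- In terms of V = v² the point is V + a + b + ab/V. For two values V and W the difference is (V
    -- - W)(VW - ab)/(VW), and VW > ab by the choice of `v`; finally v is positive, so V determines
    -- it.
    point-injective : ∀ i j → point i ≈ point j → i ≡ j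
    point-injective i j e = ℕ.+-cancelˡ-≡ (suc (a ℕ.* b)) i j (ι-injective _ _ (x-y≈0⇒x≈y
        (xy≈0⇒y≈0 sum≉0 (trans (solve 2 (λ v w → (v :+ w) :* (v :- w) := v :* v :- w :* w) refl (v i) (v j)) V-W≈0))))
      where
      V = v i * v i
      W = v j * v j
      sum≉0 : ¬ v i + v j ≈ 0#
      sum≉0 e = ιsuc≉0 ((a ℕ.* b ℕ.+ i) ℕ.+ (suc (a ℕ.* b) ℕ.+ j))
          (trans (ι-+ (suc (a ℕ.* b) ℕ.+ i) (suc (a ℕ.* b) ℕ.+ j)) e)
      eqV : W * ((V + ι a) * (V + ι b)) ≈ V * W * point i
      eqV = sym (trans (solve 5 (λ v w u x y → v :* v :* w :* (x :* y :* (u :* u)) := (v :* u) :* (v :* u) :*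
          (w :* (x :* y))) refl (v i) W (u i) (V + ι a) (V + ι b))
        (trans (*-congʳ (trans (*-cong (proj₂ (v⁻¹ i)) (proj₂ (v⁻¹ i))) (*-identityˡ 1#))) (*-identityˡ _)))
      eqW : V * ((W + ι a) * (W + ι b)) ≈ V * W * point j
      eqW = sym (trans (solve 5 (λ v w u x y → v :* (w :* w) :* (x :* y :* (u :* u)) := (w :* u) :* (w :* u) :*
          (v :* (x :* y))) refl V (v j) (u j) (W + ι a) (W + ι b))
        (trans (*-congʳ (trans (*-cong (proj₂ (v⁻¹ j)) (proj₂ (v⁻¹ j))) (*-identityˡ 1#))) (*-identityˡ _)))
      VW-ab≉0 : ¬ V * W - ι a * ι b ≈ 0#
      VW-ab≉0 e = ℕ.<-irrefl (≡.sym (ι-injective (k ℕ.* k ℕ.* (l ℕ.* l)) (a ℕ.* b) (begin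
        ι (k ℕ.* k ℕ.* (l ℕ.* l))     ≈⟨ trans (ι-* (k ℕ.* k) (l ℕ.* l)) (*-cong (ι-* k k) (ι-* l l)) ⟩
        V * W                         ≈⟨ x-y≈0⇒x≈y e ⟩
        ι a * ι b                     ≈⟨ ι-* a b ⟨
        ι (a ℕ.* b)                   ∎)))
        (ℕ.<-≤-trans (ℕ.≤-trans (ℕ.m≤m+n (suc (a ℕ.* b)) i) (ℕ.m≤m*n k k)) (ℕ.m≤m*n (k ℕ.* k) (l ℕ.* l)))
        where
        k = suc (a ℕ.* b) ℕ.+ i
        l = suc (a ℕ.* b) ℕ.+ j
      V-W≈0 : V - W ≈ 0#
      V-W≈0 = xy≈0⇒y≈0 VW-ab≉0 (begin
        (V * W - ι a * ι b) * (V - W)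
          ≈⟨ solve 4 (λ V W a b → (V :* W :- a :* b) :* (V :- W) := W :* ((V :+ a) :* (V :+ b)) :- V :*
              ((W :+ a) :* (W :+ b))) refl V W (ι a) (ι b) ⟩
        W * ((V + ι a) * (V + ι b)) - V * ((W + ι a) * (W + ι b))
          ≈⟨ x≈y⇒x-y≈0 (trans eqV (trans (*-congˡ e) (sym eqW))) ⟩
        0# ∎)

  module _ {H H′ : Graph} {V₃ V₄ V₃′ V₄′ q₃ q₄ q₃′ q₄′}
    (sr : IsSemiRegular H V₃ V₄ q₃ q₄) (sr′ : IsSemiRegular H′ V₃′ V₄′ q₃′ q₄′)
    (n₃≡ : ∣ V₃ ∣ ≡ ∣ V₃′ ∣) (n₄≡ : ∣ V₄ ∣ ≡ ∣ V₄′ ∣) where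

    -- With natural weights the factors in `sideDet-biadjacency` are nonzero at each u = 1/v, so
    -- equality is obtained at infinitely many y.
    biadjacencyDet-transfer : ∀ a b → (∀ u → sideDet sr (ι a) (ι b) u ≈ sideDet sr′ (ι a) (ι b) u) →
                              ∀ y → biadjacencyDet sr y ≈ biadjacencyDet sr′ y
    biadjacencyDet-transfer a b F≈F′ y = x-y≈0⇒x≈y (polynomial-vanish
      (biadjacencyDetᴾ sr +ᴾ (-ᴾ biadjacencyDetᴾ sr′)) point point-injective
      (λ i → x≈y⇒x-y≈0 (*-cancelˡ-nonzero (nonzero i) (begin
        coefficient (∣ V₃ ∣) (∣ V₄ ∣) i * biadjacencyDet sr (point i)      ≈⟨ sideDet-biadjacency sr (ι a) (ι b)
            (u i) (point i) (point-u² i) ⟨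
        (1# + u i * u i * ι b) ^ ∣ V₃ ∣ * sideDet sr (ι a) (ι b) (u i)
          ≈⟨ *-cong (reflexive (≡.cong ((1# + u i * u i * ι b) ^_) n₃≡)) (F≈F′ (u i)) ⟩
        (1# + u i * u i * ι b) ^ ∣ V₃′ ∣ * sideDet sr′ (ι a) (ι b) (u i)
          ≈⟨ sideDet-biadjacency sr′ (ι a) (ι b) (u i) (point i) (point-u² i) ⟩
        coefficient (∣ V₃′ ∣) (∣ V₄′ ∣) i * biadjacencyDet sr′ (point i)
          ≈⟨ *-congʳ (reflexive (≡.cong₂ (λ n n′ → coefficient n n′ i) n₃≡ n₄≡)) ⟨
        coefficient (∣ V₃ ∣) (∣ V₄ ∣) i * biadjacencyDet sr′ (point i)     ∎))) y)
      where
      open Points a b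
      coefficient : ℕ → ℕ → ℕ → Carrier
      coefficient n n′ i = (u i ^ n * u i ^ n) * (1# + u i * u i * ι b) ^ n′
      u≉0 : ∀ i → ¬ u i ≈ 0#
      u≉0 i = inverse-nonzero (proj₂ (v⁻¹ i))
      nonzero : ∀ i → ¬ coefficient (∣ V₃ ∣) (∣ V₄ ∣) i ≈ 0#
      nonzero i = xy≉0 (xy≉0 (^≉0 ∣ V₃ ∣ (u≉0 i)) (^≉0 ∣ V₃ ∣ (u≉0 i))) (^≉0 ∣ V₄ ∣ (side-nonzero i))

    -- For u ≠ 0 take y = (1 + u²p₃)(1 + u²p₄) / u². The power of 1 + u²p₄ on the left may vanish at
    -- some u, so it is cancelled as a polynomial with value 1 at 0.
    sideDet-transfer : (∀ y → biadjacencyDet sr y ≈ biadjacencyDet sr′ y) →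
                       ∀ p₃ p₄ u → sideDet sr p₃ p₄ u ≈ sideDet sr′ p₃ p₄ u
    sideDet-transfer Φ≈Φ′ p₃ p₄ = product-cancelʳ (bassᴾ H _) (bassᴾ H′ _) sᴾ s-0
      (≈-except (bassᴾ H _ *ᴾ sᴾ) (bassᴾ H′ _ *ᴾ sᴾ) 0# off-zero)
      where
      s : Carrier → Carrier
      s u = (1# + u * u * p₄) ^ ∣ V₃ ∣
      sᴾ : Polynomial s
      sᴾ = (constᴾ +ᴾ idᴾ *ᴾ idᴾ *ᴾ constᴾ) ^ᴾ ∣ V₃ ∣
      s-0 : ¬ s 0# ≈ 0#
      s-0 = ^≉0 ∣ V₃ ∣ (λ e → 1≉0 (trans (solve 1 (λ p → con (+ 1) := con (+ 1) :+ con (+ 0) :* con (+ 0) :* p) refl p₄) e))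
      off-zero : ∀ u → ¬ u ≈ 0# → sideDet sr p₃ p₄ u * s u ≈ sideDet sr′ p₃ p₄ u * s u
      off-zero u u≉0 with w , uw≈1 ← inverse u u≉0 = begin
        sideDet sr p₃ p₄ u * s u                          ≈⟨ *-comm _ _ ⟩
        s u * sideDet sr p₃ p₄ u                          ≈⟨ sideDet-biadjacency sr p₃ p₄ u y yu² ⟩
        (u ^ ∣ V₃ ∣ * u ^ ∣ V₃ ∣) * (1# + u * u * p₄) ^ ∣ V₄ ∣ * biadjacencyDet sr y
          ≈⟨ *-cong (reflexive (≡.cong₂ (λ n n′ → (u ^ n * u ^ n) * (1# + u * u * p₄) ^ n′) n₃≡ n₄≡)) (Φ≈Φ′ y) ⟩
        (u ^ ∣ V₃′ ∣ * u ^ ∣ V₃′ ∣) * (1# + u * u * p₄) ^ ∣ V₄′ ∣ * biadjacencyDet sr′ y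
          ≈⟨ sideDet-biadjacency sr′ p₃ p₄ u y yu² ⟨
        (1# + u * u * p₄) ^ ∣ V₃′ ∣ * sideDet sr′ p₃ p₄ u   ≈⟨ *-congʳ (reflexive (≡.cong ((1# + u * u * p₄) ^_) n₃≡)) ⟨
        s u * sideDet sr′ p₃ p₄ u                         ≈⟨ *-comm _ _ ⟩
        sideDet sr′ p₃ p₄ u * s u                         ∎
        where
        y = (1# + u * u * p₃) * (1# + u * u * p₄) * (w * w)
        yu² : y * (u * u) ≈ (1# + u * u * p₃) * (1# + u * u * p₄)
        yu² = trans (solve 3 (λ x w u → x :* (w :* w) :* (u :* u) := x :* ((u :* w) :* (u :* w))) refl _ w u)
          (trans (*-congˡ (trans (*-cong uw≈1 uw≈1) (*-identityˡ 1#))) (*-identityʳ _))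

-- Recovering the parameters from determinants of joins

module JoinDeterminants {c ℓ} (R : CommutativeRing c ℓ) (isField : IsFieldOfCharacteristicZero R) where
  open CommutativeRing R hiding (zero)
  open IntegerSolver R
  open PolynomialFunctions R isField
  open SemiRegularDeterminants R isField
  open Comparison R isField
  open JoinExpansion R isField
  open ParameterComparison R isField
  open Transfer R isField
  open Determinants R
  open GraphMatrices R
  open import Algebra.Properties.Semiring.Sum semiring
  open import Algebra.Properties.Semiring.Exp semiring using (^-congˡ)
  open import Algebra.Definitions.RawSemiring (Semiring.rawSemiring semiring) using (_^_)
  open import Relation.Binary.Reasoning.Setoid setoid

  parameters : ∀ {G V₁ V₂ q₁ q₂} → IsSemiRegular G V₁ V₂ q₁ q₂ → ∣ V₁ ∣ ≤ ∣ V₂ ∣ → Parameters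
  parameters {V₁ = V₁} {V₂} {q₁} {q₂} sr le = record
    { n₁ = ∣ V₁ ∣ ; n₂ = ∣ V₂ ∣ ; q₁ = q₁ ; q₂ = q₂
    ; n₁≥1 = proj₁ (SemiRegularGraph.both-sides sr) ; n₂≥1 = proj₂ (SemiRegularGraph.both-sides sr)
    ; q₁≥1 = IsSemiRegular.q₁≥1 sr ; q₂≥1 = IsSemiRegular.q₂≥1 sr
    ; n₁≤n₂ = le ; edges = edges≡ sr }

  module _ {G₁ V₁ V₂ q₁ q₂} (sr₁ : IsSemiRegular G₁ V₁ V₂ q₁ q₂) (le₁ : ∣ V₁ ∣ ≤ ∣ V₂ ∣) where
    private
      module C = Parameters (parameters sr₁ le₁)
      ν₁≡ : C.ν ≡ order G₁
      ν₁≡ = SemiRegularGraph.order≡ sr₁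
      ν₁≥1 : 1 ≤ order G₁
      ν₁≥1 = Graph.nonempty G₁

    joinDetᴾ : ∀ {H V₃ V₄ q₃ q₄} (sr : IsSemiRegular H V₃ V₄ q₃ q₄) p₁ p₂ p₃ p₄ → Polynomial (joinDet sr₁ sr p₁ p₂ p₃ p₄)
    joinDetᴾ {H} sr p₁ p₂ p₃ p₄ = bassᴾ (G₁ ∨ H) _

    module _ {H V₃ V₄ q₃ q₄} (sr : IsSemiRegular H V₃ V₄ q₃ q₄) (le : ∣ V₃ ∣ ≤ ∣ V₄ ∣)
             {H′ V₃′ V₄′ q₃′ q₄′} (sr′ : IsSemiRegular H′ V₃′ V₄′ q₃′ q₄′) (le′ : ∣ V₃′ ∣ ≤ ∣ V₄′ ∣) where
      private
        A  = parameters sr le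
        A′ = parameters sr′ le′
        module A  = Parameters A
        module A′ = Parameters A′
        ν  = order H
        ν′ = order H′
        ν≡ : A.ν ≡ ν
        ν≡ = SemiRegularGraph.order≡ sr
        ν′≡ : A′.ν ≡ ν′
        ν′≡ = SemiRegularGraph.order≡ sr′

        τ≉0 : ¬ ι C.m * ι ν + ι A.m * ι (order G₁) ≈ 0#
        τ≉0 e = ℕ.<-irrefl (≡.sym (characteristicZero _
            (trans (ι-+ (C.m ℕ.* ν) (A.m ℕ.* order G₁)) (trans (+-cong (ι-* C.m ν) (ι-* A.m (order G₁))) e))))
          (ℕ.≤-trans (pos*pos C.m≥1 (Graph.nonempty H)) (ℕ.m≤m+n _ _))

      module _ (same : Same A A′) where
        open Same same
        private
          ν≡ν′ : ν ≡ ν′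
          ν≡ν′ = ≡.trans (≡.sym ν≡) (≡.trans (≡.cong₂ ℕ._+_ n₁≡ n₂≡) ν′≡)

          delta≈ : ∀ p₃ p₄ u → sideDelta sr p₃ p₄ u ≈ sideDelta sr′ p₃ p₄ u
          delta≈ p₃ p₄ u = +-congˡ (-‿cong (*-congˡ (*-cong (reflexive (≡.cong ι q₁≡)) (reflexive (≡.cong ι q₂≡)))))

        -- `join-det` contains only Δ's, sums of side vectors and side determinants. The first two
        -- depend on the parameters and weights, the last on `biadjacencyDet` as well, so equality
        -- holds for all weights at once.
        join-transfer : (∀ y → biadjacencyDet sr y ≈ biadjacencyDet sr′ y) →
                        ∀ p₁ p₂ p₃ p₄ u → joinDet sr₁ sr p₁ p₂ p₃ p₄ u ≈ joinDet sr₁ sr′ p₁ p₂ p₃ p₄ u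
        join-transfer Φ≈Φ′ p₁ p₂ p₃ p₄ = product-cancelʳ (joinDetᴾ sr p₁ p₂ p₃ p₄) (joinDetᴾ sr′ p₁ p₂ p₃ p₄) E.Δᴾ
          (λ e → 1≉0 (trans (sym E.Δ-0) e)) λ u → trans (*-comm _ _) (trans (expandʲ sr u)
            (trans (*-cong (+-cong (*-congˡ (delta≈ p₃ p₄ u)) (-‿cong (*-congˡ (*-congˡ (w≈ u)))))
                (*-congˡ (sideDet-transfer sr sr′ n₁≡ n₂≡ Φ≈Φ′ p₃ p₄ u)))
              (trans (sym (expandʲ sr′ u)) (trans (*-congʳ (*-congˡ (sym (delta≈ p₃ p₄ u)))) (*-comm _ _)))))
          where
          module E = Expansion (joinExpansion sr₁ sr p₁ p₂ p₃ p₄)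
          expandʲ : ∀ {H V₃ V₄ q₃ q₄} (sr : IsSemiRegular H V₃ V₄ q₃ q₄) u →
            sideDelta sr₁ p₁ p₂ u * sideDelta sr p₃ p₄ u * joinDet sr₁ sr p₁ p₂ p₃ p₄ u ≈
            (sideDelta sr₁ p₁ p₂ u * sideDelta sr p₃ p₄ u - u * u *
                (sum (sideVector sr₁ p₁ p₂ u) * sum (sideVector sr p₃ p₄ u))) *
                (sideDet sr₁ p₁ p₂ u * sideDet sr p₃ p₄ u)
          expandʲ {H} sr u = join-det G₁ H u (onSides sr₁ p₁ p₂) (onSides sr p₃ p₄) (sideVector sr₁ p₁ p₂ u)
              (sideVector sr p₃ p₄ u) _ _
            (sideVector-bass sr₁ p₁ p₂ u) (sideVector-bass sr p₃ p₄ u)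
          w≈ : ∀ u → sum (sideVector sr p₃ p₄ u) ≈ sum (sideVector sr′ p₃ p₄ u)
          w≈ u = trans (sum-sideVector sr p₃ p₄ u) (trans
            (+-cong (+-cong (reflexive (≡.cong ι ν≡ν′))
                (*-congˡ (+-cong (*-congʳ (reflexive (≡.cong ι n₁≡))) (*-congʳ (reflexive (≡.cong ι n₂≡))))))
              (*-congˡ (reflexive (≡.cong₂ (λ n q → ι (n ℕ.* q)) n₁≡ q₁≡))))
            (sym (sum-sideVector sr′ p₃ p₄ u)))

        -- The converse direction for one choice of weights: `factor-equal` yields F₁F₂ = F₁F₂′, and
        -- F₁ cancels since it is 1 at 0.
        join-biadjacency : ∀ {P} → Polynomial P → P 0# ≈ 1# → (∀ u → P (- u) ≈ P u) → ∀ p₁ p₂ a b →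
          (∀ u → P u * joinDet sr₁ sr p₁ p₂ (ι a) (ι b) u ≈ P u * joinDet sr₁ sr′ p₁ p₂ (ι a) (ι b) u) →
          ∀ y → biadjacencyDet sr y ≈ biadjacencyDet sr′ y
        join-biadjacency Pᴾ P-0 P-even p₁ p₂ a b e = biadjacencyDet-transfer sr sr′ n₁≡ n₂≡ a b
          (product-cancelʳ (bassᴾ H _) (bassᴾ H′ _) (bassᴾ G₁ (onSides sr₁ p₁ p₂)) (λ z → 1≉0 (trans (sym (bass-0 G₁ _)) z))
            λ u → trans (*-comm _ _) (trans (F≈F′ u) (*-comm _ _)))
          where
          module E = Expansion (joinExpansion sr₁ sr p₁ p₂ (ι a) (ι b))
          F≈F′ : ∀ u → sideDet sr₁ p₁ p₂ u * sideDet sr (ι a) (ι b) u ≈ sideDet sr₁ p₁ p₂ u * sideDet sr′ (ι a) (ι b) u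
          F≈F′ = factor-equal (joinExpansion sr₁ sr p₁ p₂ (ι a) (ι b)) (joinExpansion sr₁ sr′ p₁ p₂ (ι a) (ι b))
            Pᴾ Pᴾ P-0 P-0 P-even P-even e τ≉0 (λ _ → refl) (λ u → *-congˡ (delta≈ (ι a) (ι b) u))
            (+-cong (*-congˡ (+-cong (*-congʳ (reflexive (≡.cong ι n₁≡))) (*-congʳ (reflexive (≡.cong ι n₂≡)))))
                    (*-congʳ (reflexive (≡.cong₂ (λ n q → ι (n ℕ.* q)) n₁≡ q₁≡))))

      private
        τ-ℕ : ι C.m * ι ν + ι A.m * ι (order G₁) ≈ ι C.m * ι ν′ + ι A′.m * ι (order G₁) →
              C.m ℕ.* ν ℕ.+ A.m ℕ.* order G₁ ≡ C.m ℕ.* ν′ ℕ.+ A′.m ℕ.* order G₁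
        τ-ℕ e = ι-injective _ _ (trans (cast A.m ν) (trans e (sym (cast A′.m ν′))))
          where
          cast : ∀ m ν → ι (C.m ℕ.* ν ℕ.+ m ℕ.* order G₁) ≈ ι C.m * ι ν + ι m * ι (order G₁)
          cast m ν = trans (ι-+ (C.m ℕ.* ν) (m ℕ.* order G₁)) (+-cong (ι-* C.m ν) (ι-* m (order G₁)))

        β-ℕ : ι q₃ * ι q₄ ≈ ι q₃′ * ι q₄′ → A.β ≡ A′.β
        β-ℕ e = ι-injective _ _ (trans (ι-* q₃ q₄) (trans e (sym (ι-* q₃′ q₄′))))

      module Spectral (ν≡ν′ : ν ≡ ν′)
        (J≈J′ : ∀ u → joinDet sr₁ sr 0# 0# 0# 0# u ≈ joinDet sr₁ sr′ 0# 0# 0# 0# u) where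
        private
          E  = joinExpansion sr₁ sr 0# 0# 0# 0#
          E′ = joinExpansion sr₁ sr′ 0# 0# 0# 0#
          P : Carrier → Carrier
          P _ = 1#
          PJ : ∀ u → P u * joinDet sr₁ sr 0# 0# 0# 0# u ≈ P u * joinDet sr₁ sr′ 0# 0# 0# 0# u
          PJ u = *-congˡ (J≈J′ u)
          τ  = ι C.m * ι ν + ι A.m * ι (order G₁)

        m≡ : A.m ≡ A′.m
        m≡ = ℕ.*-cancelʳ-≡ _ _ (order G₁) {{ℕ.>-nonZero ν₁≥1}} (ℕ.+-cancelˡ-≡ (C.m ℕ.* ν) _ _
          (≡.trans (τ-ℕ (τ≈τ′ E E′ constᴾ constᴾ refl refl (λ _ → refl) (λ _ → refl) PJ))
              (≡.cong (λ k → C.m ℕ.* k ℕ.+ A′.m ℕ.* order G₁) (≡.sym ν≡ν′))))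

        same : Same A A′
        -- All weights are 0, so ξ = ξ′ = 0 and η = -q₁q₂ - q₃q₄ - kν with k the order of G₁. The
        -- second coefficient therefore reduces to τ q₃q₄ = τ q₃′q₄′.
        same = β⇒same A A′ (≡.trans ν≡ (≡.trans ν≡ν′ (≡.sym ν′≡))) m≡ (β-ℕ (*-cancelˡ-nonzero τ≉0 (begin
          τ * (ι q₃ * ι q₄)
            ≈⟨ solve 11 (λ τ a b b′ n m₁ n₃ n₄ m₂ x y → let o = con (+ 0) in
                 τ :* b := (τ :* (o :+ o :- a :+ (o :+ o :- b′) :- n) :+
                     (m₁ :* (n₃ :* o :+ n₄ :* o) :+ m₂ :* (x :* o :+ y :* o))) :- τ :* (:- a :- b :- b′ :- n))
               refl τ (ι q₁ * ι q₂) (ι q₃ * ι q₄) (ι q₃′ * ι q₄′) (ι (order G₁) * ι ν′) (ι C.m) (ι ∣ V₃ ∣)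
                   (ι ∣ V₄ ∣) (ι A.m) (ι ∣ V₁ ∣) (ι ∣ V₂ ∣) ⟩
          _ ≈⟨ +-congʳ (trans (second-coefficient E E′ constᴾ constᴾ refl refl (λ _ → refl) (λ _ → refl) PJ)
                 (+-congʳ (*-congˡ (+-congˡ (-‿cong (*-congˡ (reflexive (≡.cong ι ν≡ν′)))))))) ⟩
          _ ≈⟨ solve 11 (λ τ a b b′ n m₁ n₃ n₄ m₂ x y → let o = con (+ 0) in
                 (τ :* (o :+ o :- a :+ (o :+ o :- b) :- n) :+
                     (m₁ :* (n₃ :* o :+ n₄ :* o) :+ m₂ :* (x :* o :+ y :* o))) :- τ :* (:- a :- b :- b′ :- n) :=
                     τ :* b′)
               refl τ (ι q₁ * ι q₂) (ι q₃ * ι q₄) (ι q₃′ * ι q₄′) (ι (order G₁) * ι ν′) (ι C.m) (ι ∣ V₃′ ∣)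
                   (ι ∣ V₄′ ∣) (ι A′.m) (ι ∣ V₁ ∣) (ι ∣ V₂ ∣) ⟩
          τ * (ι q₃′ * ι q₄′) ∎)))

        biadjacency≈ : ∀ y → biadjacencyDet sr y ≈ biadjacencyDet sr′ y
        biadjacency≈ = join-biadjacency same constᴾ refl (λ _ → refl) 0# 0# 0 0 PJ

      -- A vertex of degree q has degree q + n in the join, n being the order of the other graph, so
      -- its weight is q + (n - 1). Natural weights suit `join-biadjacency`, but they depend on ν
      -- and ν′, whose equality is still to be shown.
      module Zeta (r r′ : ℕ)
        (size  : order G₁ ℕ.+ ν  ℕ.+ r  ≡ C.m ℕ.+ A.m  ℕ.+ order G₁ ℕ.* ν)
        (size′ : order G₁ ℕ.+ ν′ ℕ.+ r′ ≡ C.m ℕ.+ A′.m ℕ.+ order G₁ ℕ.* ν′)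
        (size≡ : order G₁ ℕ.+ ν  ℕ.+ r ≡ order G₁ ℕ.+ ν′ ℕ.+ r′)
        (PJ≈P′J′ : ∀ u →
          (1# - u * u) ^ r * joinDet sr₁ sr (ι (q₁ ℕ.+ ℕ.pred ν)) (ι (q₂ ℕ.+ ℕ.pred ν))
              (ι (q₃ ℕ.+ ℕ.pred (order G₁))) (ι (q₄ ℕ.+ ℕ.pred (order G₁))) u ≈
          (1# - u * u) ^ r′ * joinDet sr₁ sr′ (ι (q₁ ℕ.+ ℕ.pred ν′)) (ι (q₂ ℕ.+ ℕ.pred ν′))
              (ι (q₃′ ℕ.+ ℕ.pred (order G₁))) (ι (q₄′ ℕ.+ ℕ.pred (order G₁))) u) where
        private
          c₁ = ι (ℕ.pred (order G₁))
          E  = joinExpansion sr₁ sr (ι (q₁ ℕ.+ ℕ.pred ν)) (ι (q₂ ℕ.+ ℕ.pred ν)) (ι (q₃ ℕ.+ ℕ.pred (order G₁)))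
              (ι (q₄ ℕ.+ ℕ.pred (order G₁)))
          E′ = joinExpansion sr₁ sr′ (ι (q₁ ℕ.+ ℕ.pred ν′)) (ι (q₂ ℕ.+ ℕ.pred ν′))
              (ι (q₃′ ℕ.+ ℕ.pred (order G₁))) (ι (q₄′ ℕ.+ ℕ.pred (order G₁)))
          P : ℕ → Carrier → Carrier
          P r u = (1# - u * u) ^ r
          Pᴾ : ∀ r → Polynomial (P r)
          Pᴾ r = (constᴾ +ᴾ (-ᴾ (idᴾ *ᴾ idᴾ))) ^ᴾ r
          P-0 : ∀ r → P r 0# ≈ 1#
          P-0 r = trans (^-congˡ r (solve 0 (con (+ 1) :- con (+ 0) :* con (+ 0) := con (+ 1)) refl)) (1^ r)
          P-even : ∀ r u → P r (- u) ≈ P r u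
          P-even r u = ^-congˡ r (solve 1 (λ u → con (+ 1) :- (:- u) :* (:- u) := con (+ 1) :- u :* u) refl u)
          k = ι (order G₁)
          τ  = ι C.m * ι ν  + ι A.m  * k

          τ≈ : τ ≈ ι C.m * ι ν′ + ι A′.m * k
          τ≈ = τ≈τ′ E E′ (Pᴾ r) (Pᴾ r′) (P-0 r) (P-0 r′) (P-even r) (P-even r′) PJ≈P′J′

        -- The numbers of edges and of triangles (τ) of the join are linear in ν and A.m,
        -- with determinant k² − C.m.
        ν≡ν′ : ν ≡ ν′
        ν≡ν′ = ι-injective _ _ (sym (x-y≈0⇒x≈y (xy≈0⇒y≈0 {k * k - ι C.m} dominant (begin
          (k * k - ι C.m) * (ι ν′ - ι ν)
            ≈⟨ solve 6 (λ k c n n′ a a′ → (k :* k :- c) :* (n′ :- n) := (c :* n :+ a :* k) :-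
                (c :* n′ :+ a′ :* k) :+ k :* ((c :+ a′ :+ k :* n′) :- (c :+ a :+ k :* n)))
               refl k (ι C.m) (ι ν) (ι ν′) (ι A.m) (ι A′.m) ⟩
          τ - (ι C.m * ι ν′ + ι A′.m * k) + k * ((ι C.m + ι A′.m + k * ι ν′) - (ι C.m + ι A.m + k * ι ν))
            ≈⟨ +-cong (x≈y⇒x-y≈0 τ≈) (*-congˡ (x≈y⇒x-y≈0
                (trans (sym (cast A′.m ν′)) (trans (reflexive (≡.cong ι edges≡edges)) (cast A.m ν))))) ⟩
          0# + k * 0#
            ≈⟨ solve 1 (λ k → con (+ 0) :+ k :* con (+ 0) := con (+ 0)) refl k ⟩
          0# ∎))))
          where
          cast : ∀ m ν → ι (C.m ℕ.+ m ℕ.+ order G₁ ℕ.* ν) ≈ ι C.m + ι m + k * ι ν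
          cast m ν = trans (ι-+ (C.m ℕ.+ m) (order G₁ ℕ.* ν)) (+-cong (ι-+ C.m m) (ι-* (order G₁) ν))
          edges≡edges : C.m ℕ.+ A′.m ℕ.+ order G₁ ℕ.* ν′ ≡ C.m ℕ.+ A.m ℕ.+ order G₁ ℕ.* ν
          edges≡edges = ≡.trans (≡.sym size′) (≡.trans (≡.sym size≡) size)
          q₁≤ν₁ : q₁ ≤ order G₁
          q₁≤ν₁ with i , e ← #true⇒∃ (SemiRegularGraph.side sr₁) (≡.subst (1 ≤_) (SemiRegularGraph.∣V₁∣≡ sr₁) C.n₁≥1) =
            ≡.subst (_≤ order G₁) (IsSemiRegular.degree₁ sr₁ i (SemiRegularGraph.side-true sr₁ e))
                (Subset.∣p∣≤n (Graph.neighbours G₁ i))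
          n₁<ν₁ : C.n₁ < order G₁
          n₁<ν₁ = ≡.subst (C.n₁ <_) ν₁≡ (ℕ.m<m+n C.n₁ C.n₂≥1)
          -- G₁ has n₁q₁ edges with n₁ < k and q₁ ≤ k, fewer than k².
          dominant : ¬ k * k - ι C.m ≈ 0#
          dominant e = ℕ.<-irrefl (≡.sym (ι-injective (order G₁ ℕ.* order G₁) C.m
              (trans (ι-* (order G₁) (order G₁)) (x-y≈0⇒x≈y e))))
            (ℕ.≤-<-trans (ℕ.*-monoʳ-≤ C.n₁ q₁≤ν₁) (ℕ.*-monoˡ-< (order G₁) {{ℕ.>-nonZero ν₁≥1}} n₁<ν₁))

        m≡ : A.m ≡ A′.m
        m≡ = ℕ.*-cancelʳ-≡ _ _ (order G₁) {{ℕ.>-nonZero ν₁≥1}} (ℕ.+-cancelˡ-≡ (C.m ℕ.* ν) _ _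
          (≡.trans (τ-ℕ τ≈) (≡.cong (λ n → C.m ℕ.* n ℕ.+ A′.m ℕ.* order G₁) (≡.sym ν≡ν′))))

        r≡r′ : r ≡ r′
        r≡r′ = ℕ.+-cancelˡ-≡ (order G₁ ℕ.+ ν) _ _ (≡.trans size≡ (≡.cong (λ n → order G₁ ℕ.+ n ℕ.+ r′) (≡.sym ν≡ν′)))

        private
          a₁ s : Carrier
          a₁ = ι (q₁ ℕ.+ ℕ.pred ν) + ι (q₂ ℕ.+ ℕ.pred ν) - ι q₁ * ι q₂
          s  = ι A.m * (ι ∣ V₁ ∣ * ι (q₂ ℕ.+ ℕ.pred ν) + ι ∣ V₂ ∣ * ι (q₁ ℕ.+ ℕ.pred ν))

          η≈ : ∀ q q′ n → n ≡ ν →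
               (ι (q₁ ℕ.+ ℕ.pred n) + ι (q₂ ℕ.+ ℕ.pred n) - ι q₁ * ι q₂) +
                   (ι (q ℕ.+ ℕ.pred (order G₁)) + ι (q′ ℕ.+ ℕ.pred (order G₁)) - ι q * ι q′) - k * ι n ≈
               a₁ + (ι q + c₁ + (ι q′ + c₁) - ι q * ι q′) - k * ι ν
          η≈ q q′ _ ≡.refl = +-congʳ (+-congˡ (+-congʳ (+-cong (ι-+ q _) (ι-+ q′ _))))

          ξ≈ : ∀ n₃ n₄ q q′ n m → n ≡ ν → m ≡ A.m →
               ι C.m * (ι n₃ * ι (q′ ℕ.+ ℕ.pred (order G₁)) + ι n₄ * ι (q ℕ.+ ℕ.pred (order G₁))) + ι m *
                   (ι ∣ V₁ ∣ * ι (q₂ ℕ.+ ℕ.pred n) + ι ∣ V₂ ∣ * ι (q₁ ℕ.+ ℕ.pred n)) ≈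
               ι C.m * (ι n₃ * (ι q′ + c₁) + ι n₄ * (ι q + c₁)) + s
          ξ≈ n₃ n₄ q q′ _ _ ≡.refl ≡.refl = +-congʳ (*-congˡ (+-cong (*-congˡ (ι-+ q′ _)) (*-congˡ (ι-+ q _))))

          ratio : (ι q₃′ * ι q₄′ - ι q₃ * ι q₄) * (ι A.m * (k * ι ν - τ)) ≈ 0#
          ratio = second-coefficient-bass {n₁ = ι ∣ V₃ ∣} {ι ∣ V₄ ∣} {ι q₃} {ι q₄} {ι ∣ V₃′ ∣} {ι ∣ V₄′ ∣}
              {ι q₃′} {ι q₄′} {ι A.m} {ι ν} {ι C.m} {k} {τ} c₁ a₁ s
            (sym (ι-* ∣ V₃ ∣ q₃)) (trans (sym (ι-* ∣ V₄ ∣ q₄)) (reflexive (≡.cong ι (≡.sym A.edges))))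
                (trans (sym (ι-+ ∣ V₃ ∣ ∣ V₄ ∣)) (reflexive (≡.cong ι ν≡)))
            (trans (sym (ι-* ∣ V₃′ ∣ q₃′)) (reflexive (≡.cong ι (≡.sym m≡))))
                (trans (sym (ι-* ∣ V₄′ ∣ q₄′)) (reflexive (≡.cong ι (≡.trans (≡.sym A′.edges) (≡.sym m≡)))))
            (trans (sym (ι-+ ∣ V₃′ ∣ ∣ V₄′ ∣)) (reflexive (≡.cong ι (≡.trans ν′≡ (≡.sym ν≡ν′)))))
            refl
            (trans (sym (+-cong (*-congˡ (η≈ q₃′ q₄′ ν′ (≡.sym ν≡ν′))) (ξ≈ (∣ V₃ ∣) (∣ V₄ ∣) q₃ q₄ ν A.m ≡.refl ≡.refl)))
              (trans (second-coefficient E E′ (Pᴾ r) (Pᴾ r′) (P-0 r) (P-0 r′) (P-even r) (P-even r′) PJ≈P′J′)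
                (+-cong (*-congˡ (η≈ q₃ q₄ ν ≡.refl)) (ξ≈ (∣ V₃′ ∣) (∣ V₄′ ∣) q₃′ q₄′ ν′ A′.m (≡.sym ν≡ν′) (≡.sym m≡)))))

        same : Same A A′
        same with 0#? (ι q₃′ * ι q₄′ - ι q₃ * ι q₄)
        ... | yes β≈ = β⇒same A A′ (≡.trans ν≡ (≡.trans ν≡ν′ (≡.sym ν′≡))) m≡ (β-ℕ (sym (x-y≈0⇒x≈y β≈)))
        -- If the products of degrees differ, then kν = τ. Every degree is at least 1, so this is
        -- the extreme case of perfect matchings, where n₃ = n₄ = ν/2 on both sides.
        ... | no β≉ = balanced⇒same A A′ (≡.trans ν≡ (≡.trans ν≡ν′ (≡.sym ν′≡))) m≡
            (perfectMatching (parameters sr₁ le₁) A matching)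
          where
          m≉0 : ¬ ι A.m ≈ 0#
          m≉0 e = ℕ.<-irrefl (≡.sym (characteristicZero A.m e)) A.m≥1
          matching : C.ν ℕ.* A.ν ≡ C.m ℕ.* A.ν ℕ.+ A.m ℕ.* C.ν
          matching = ≡.subst₂ (λ x y → x ℕ.* y ≡ C.m ℕ.* y ℕ.+ A.m ℕ.* x) (≡.sym ν₁≡) (≡.sym ν≡) (ι-injective _ _ (begin
            ι (order G₁ ℕ.* ν)                           ≈⟨ ι-* (order G₁) ν ⟩
            k * ι ν                                      ≈⟨ x-y≈0⇒x≈y (xy≈0⇒y≈0 m≉0 (xy≈0⇒y≈0 β≉ ratio)) ⟩
            ι C.m * ι ν + ι A.m * k                      ≈⟨ +-cong (ι-* C.m ν) (ι-* A.m (order G₁)) ⟨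
            ι (C.m ℕ.* ν) + ι (A.m ℕ.* order G₁)         ≈⟨ ι-+ (C.m ℕ.* ν) (A.m ℕ.* order G₁) ⟨
            ι (C.m ℕ.* ν ℕ.+ A.m ℕ.* order G₁)           ∎))

        biadjacency≈ : ∀ y → biadjacencyDet sr y ≈ biadjacencyDet sr′ y
        biadjacency≈ = join-biadjacency same (Pᴾ r) (P-0 r) (P-even r) (ι (q₁ ℕ.+ ℕ.pred ν))
            (ι (q₂ ℕ.+ ℕ.pred ν)) (q₃ ℕ.+ ℕ.pred (order G₁)) (q₄ ℕ.+ ℕ.pred (order G₁)) λ u → trans (PJ≈P′J′ u)
          (*-cong (reflexive (≡.cong (λ r → P r u) (≡.sym r≡r′))) (reflexive (rewritten u)))
          where
          open Same same
          J″ : ℕ → ℕ → ℕ → Carrier → Carrier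
          J″ n q q′ = joinDet sr₁ sr′ (ι (q₁ ℕ.+ ℕ.pred n)) (ι (q₂ ℕ.+ ℕ.pred n)) (ι (q ℕ.+ ℕ.pred (order G₁)))
              (ι (q′ ℕ.+ ℕ.pred (order G₁)))
          rewritten : ∀ u → J″ ν′ q₃′ q₄′ u ≡ J″ ν q₃ q₄ u
          rewritten u = ≡.trans (≡.cong (λ n → J″ n q₃′ q₄′ u) (≡.sym ν≡ν′))
              (≡.cong₂ (λ q q′ → J″ ν q q′ u) (≡.sym q₁≡) (≡.sym q₂≡))

-- Zeta functions and spectra of joins

module ZetaSpectrum {c ℓ} (R : CommutativeRing c ℓ) (isField : IsFieldOfCharacteristicZero R) where
  open CommutativeRing R hiding (zero)
  open IntegerSolver R
  open PolynomialFunctions R isField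
  open SemiRegularDeterminants R isField
  open JoinExpansion R isField
  open JoinDeterminants R isField
  open Transfer R isField using (inverse-nonzero)
  open WalkCounting R isField using (bassFunction; zeta⇔bassFunction)
  open Determinants R
  open GraphMatrices R
  open Matrices R
  open Permutation setoid using (_↭_)
  open import Algebra.Properties.Semiring.Sum semiring
  open import Algebra.Properties.Semiring.Exp semiring using (^-congˡ; ^-homo-*)
  open import Algebra.Properties.CommutativeSemiring.Exp commutativeSemiring using (^-distrib-*)
  open import Algebra.Definitions.RawSemiring (Semiring.rawSemiring semiring) using (_^_; product)
  open import Relation.Binary.Reasoning.Setoid setoid
  private module Product = MonoidSum *-commutativeMonoid

  inverse-^ : ∀ {x y} n → x * y ≈ 1# → x ^ n * y ^ n ≈ 1#
  inverse-^ {x} {y} n xy≈1 = trans (sym (^-distrib-* x y n)) (trans (^-congˡ n xy≈1) (1^ n))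

  ι-pred : ∀ {n} → 1 ≤ n → ι n ≈ 1# + ι (ℕ.pred n)
  ι-pred (s≤s _) = refl

  product-constant : ∀ n x → product (λ (_ : Fin n) → x) ≈ x ^ n
  product-constant n x = Product.sum-replicate n

  -- The reversal v²ⁿ det (`bass` G (1/v) p) as a polynomial in v, n the order of G. Its value at 0
  -- is the leading coefficient in degree 2n of the original.
  reversedBass : ∀ G → (Fin (order G) → Carrier) → Carrier → Carrier
  reversedBass G p v = det (λ i j → (v * v + p i) * identity i j - v * adjacency G i j)

  reversedBassᴾ : ∀ G p → Polynomial (reversedBass G p)
  reversedBassᴾ G p = detᴾ {order G} λ i j → (idᴾ *ᴾ idᴾ +ᴾ constᴾ) *ᴾ constᴾ +ᴾ (-ᴾ (idᴾ *ᴾ constᴾ))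

  reversedBass-0 : ∀ G p → reversedBass G p 0# ≈ product p
  reversedBass-0 G p = trans (det-cong {order G} λ i j → solve 3 (λ p e α →
    (con (+ 0) :* con (+ 0) :+ p) :* e :- con (+ 0) :* α := p :* e) refl (p i) (identity i j) (adjacency G i j))
        (det-diagonal p)

  reversedBass≈ : ∀ G p {v u} → v * u ≈ 1# → reversedBass G p v ≈ (v * v) ^ order G * det (bass G u p)
  reversedBass≈ G p {v} {u} vu≈1 = begin
    reversedBass G p v
      ≈⟨ det-cong {n} entry ⟩
    det (λ i j → v * bass G u p i j * v)
      ≈⟨ det-scale (λ _ → v) (λ _ → v) (bass G u p) ⟩
    product (λ (_ : Fin n) → v) * product (λ (_ : Fin n) → v) * det (bass G u p)
      ≈⟨ *-congʳ (trans (*-cong (product-constant n v) (product-constant n v)) (sym (^-distrib-* v v n))) ⟩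
    (v * v) ^ n * det (bass G u p) ∎
    where
    n = order G
    entry : ∀ i j → (v * v + p i) * identity i j - v * adjacency G i j ≈ v * bass G u p i j * v
    entry i j = sym (trans (solve 5 (λ v u p e α → v :* ((con (+ 1) :+ u :* u :* p) :* e :- u :* α) :* v
        := (v :* v :+ (v :* u) :* (v :* u) :* p) :* e :- (v :* u) :* v :* α) refl v u (p i) (identity i j) (adjacency G i j))
      (+-cong (*-congʳ (+-congˡ (trans (*-congʳ (trans (*-cong vu≈1 vu≈1) (*-identityˡ 1#))) (*-identityˡ _))))
              (-‿cong (*-congʳ (trans (*-congʳ vu≈1) (*-identityˡ v))))))

  charPoly≈ : ∀ G {x u} → x * u ≈ 1# → charPoly (adjacency G) x ≈ x ^ order G * det (bass G u (λ _ → 0#))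
  charPoly≈ G {x} {u} xu≈1 = begin
    charPoly (adjacency G) x
      ≈⟨ det-cong {n} entry ⟩
    det (λ i j → x * bass G u (λ _ → 0#) i j * 1#)
      ≈⟨ det-scale (λ _ → x) (λ _ → 1#) (bass G u (λ _ → 0#)) ⟩
    product (λ (_ : Fin n) → x) * product (λ (_ : Fin n) → 1#) * det (bass G u (λ _ → 0#))
      ≈⟨ *-congʳ (trans (*-cong (product-constant n x) (trans (product-constant n 1#) (1^ n))) (*-identityʳ _)) ⟩
    x ^ n * det (bass G u (λ _ → 0#)) ∎
    where
    n = order G
    entry : ∀ i j → x * identity i j - adjacency G i j ≈ x * bass G u (λ _ → 0#) i j * 1#
    entry i j = sym (trans (solve 4 (λ x u e α → x :* ((con (+ 1) :+ u :* u :* con (+ 0)) :* e :- u :* α) :* con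
        (+ 1) := x :* e :- (x :* u) :* α) refl x u (identity i j) (adjacency G i j))
      (+-congˡ (-‿cong (trans (*-congʳ xu≈1) (*-identityˡ _)))))

  charPolyᴾ : ∀ G → Polynomial (charPoly (adjacency G))
  charPolyᴾ G = detᴾ {order G} λ i j → idᴾ *ᴾ constᴾ +ᴾ (-ᴾ constᴾ)

  rootProduct reversedRootProduct : List Carrier → Carrier → Carrier
  rootProduct         λs x = foldr (λ α p → (x - α) * p) 1# λs
  reversedRootProduct λs u = foldr (λ α p → (1# - u * α) * p) 1# λs

  rootProductᴾ : ∀ λs → Polynomial (rootProduct λs)
  rootProductᴾ []       = constᴾ
  rootProductᴾ (α ∷ λs) = (idᴾ +ᴾ (-ᴾ constᴾ)) *ᴾ rootProductᴾ λs

  reversedRootProductᴾ : ∀ λs → Polynomial (reversedRootProduct λs)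
  reversedRootProductᴾ []       = constᴾ
  reversedRootProductᴾ (α ∷ λs) = (constᴾ +ᴾ (-ᴾ (idᴾ *ᴾ constᴾ))) *ᴾ reversedRootProductᴾ λs

  reversedRootProduct-0 : ∀ λs → reversedRootProduct λs 0# ≈ 1#
  reversedRootProduct-0 []       = refl
  reversedRootProduct-0 (α ∷ λs) = trans
      (*-cong (solve 1 (λ a → con (+ 1) :- con (+ 0) :* a := con (+ 1)) refl α) (reversedRootProduct-0 λs))
      (*-identityˡ 1#)

  rootProduct≈ : ∀ λs {x u} → x * u ≈ 1# → rootProduct λs x ≈ x ^ length λs * reversedRootProduct λs u
  rootProduct≈ []       xu≈1 = sym (*-identityˡ 1#)
  rootProduct≈ (α ∷ λs) {x} {u} xu≈1 = begin
    (x - α) * rootProduct λs x     ≈⟨ *-cong (+-congˡ (-‿cong (sym (trans (*-congʳ xu≈1) (*-identityˡ α)))))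
        (rootProduct≈ λs xu≈1) ⟩
    (x - x * u * α) * (x ^ length λs * reversedRootProduct λs u)
      ≈⟨ solve 5 (λ x u a p r → (x :- x :* u :* a) :* (p :* r) := x :* p :* ((con (+ 1) :- u :* a) :* r)) refl x
          u α (x ^ length λs) (reversedRootProduct λs u) ⟩
    x * x ^ length λs * ((1# - u * α) * reversedRootProduct λs u) ∎

  rootProduct-↭ : ∀ {αs βs} → αs ↭ βs → ∀ x → rootProduct αs x ≈ rootProduct βs x
  rootProduct-↭ (Homogeneous.refl αs≋βs)        x = pointwise αs≋βs
    where
    pointwise : ∀ {αs βs} → Pointwiseᴸ.Pointwise _≈_ αs βs → rootProduct αs x ≈ rootProduct βs x
    pointwise Pointwiseᴸ.[]         = refl
    pointwise (α≈β Pointwiseᴸ.∷ ps) = *-cong (+-congˡ (-‿cong α≈β)) (pointwise ps)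
  rootProduct-↭ (Homogeneous.prep α≈β p)        x = *-cong (+-congˡ (-‿cong α≈β)) (rootProduct-↭ p x)
  rootProduct-↭ (Homogeneous.swap α≈α′ β≈β′ p)  x = trans
    (*-cong (+-congˡ (-‿cong α≈α′)) (*-cong (+-congˡ (-‿cong β≈β′)) (rootProduct-↭ p x)))
    (solve 3 (λ a b r → a :* (b :* r) := b :* (a :* r)) refl _ _ _)
  rootProduct-↭ (Homogeneous.trans p p′)        x = trans (rootProduct-↭ p x) (rootProduct-↭ p′ x)

  -- A product vanishes only if a factor does; the decidable zero test finds which one.
  remove-root : ∀ α βs → rootProduct βs α ≈ 0# → ∃[ γs ] βs ↭ (α ∷ γs)
  remove-root α []       e = ⊥-elim (1≉0 e)
  remove-root α (β ∷ βs) e with 0#? (α - β)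
  ... | yes α≈β = βs , Homogeneous.prep (sym (x-y≈0⇒x≈y α≈β)) (Permutation.↭-refl setoid)
  ... | no  α≉β with γs , p ← remove-root α βs (xy≈0⇒y≈0 α≉β e) =
    β ∷ γs , Permutation.↭-trans setoid (Homogeneous.prep refl p) (Homogeneous.swap refl refl (Permutation.↭-refl setoid))

  -- The first root α of one product occurs among the roots of the other. Dividing both by x - α is
  -- possible for x ≠ α, and the quotients agree at α as well by `≈-except`.
  rootProduct-injective : ∀ αs βs → (∀ x → rootProduct αs x ≈ rootProduct βs x) → αs ↭ βs
  rootProduct-injective []       []       e = Permutation.↭-refl setoid
  rootProduct-injective []       (β ∷ βs) e = ⊥-elim (1≉0 (trans (e β) (trans (*-congʳ (-‿inverseʳ β)) (zeroˡ _))))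
  rootProduct-injective (α ∷ αs) βs       e
    with γs , p ← remove-root α βs (trans (sym (e α)) (trans (*-congʳ (-‿inverseʳ α)) (zeroˡ _))) =
    Permutation.↭-trans setoid (Homogeneous.prep refl
        (rootProduct-injective αs γs (≈-except (rootProductᴾ αs) (rootProductᴾ γs) α
      λ x x≉α → *-cancelˡ-nonzero (x≉α ∘ x-y≈0⇒x≈y) (trans (e x) (rootProduct-↭ p x))))) (Permutation.↭-sym setoid p)

  module _ (G : Graph) (λs : List Carrier) (spectrum : ∀ x → charPoly (adjacency G) x ≈ rootProduct λs x) where

    -- Reversing both expressions for the characteristic polynomial gives uˡ det (I - uA) = uⁿ ∏ (1
    -- - uα) for u ≠ 0, where l is the number of listed eigenvalues. Both polynomials are 1 at 0, so
    -- `order-unique` yields l = n as well.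
    spectrum-bass : length λs ≡ order G × (∀ u → det (bass G u (λ _ → 0#)) ≈ reversedRootProduct λs u)
    spectrum-bass = order-unique (bassᴾ G _) (reversedRootProductᴾ λs) (λ e → 1≉0 (trans (sym (bass-0 G _)) e))
      (λ e → 1≉0 (trans (sym (reversedRootProduct-0 λs)) e)) (length λs) (order G) compare
      where
      compare : ∀ u → ¬ u ≈ 0# → u ^ length λs * det (bass G u (λ _ → 0#)) ≈ u ^ order G * reversedRootProduct λs u
      compare u u≉0 with x , ux≈1 ← inverse u u≉0 = begin
        u ^ l * D                           ≈⟨ sym (trans (*-congʳ (inverse-^ n ux≈1)) (*-identityˡ _)) ⟩
        u ^ n * x ^ n * (u ^ l * D)         ≈⟨ solve 4 (λ a b c d → a :* b :* (c :* d) := a :* c :* (b :* d))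
            refl (u ^ n) (x ^ n) (u ^ l) D ⟩
        u ^ n * u ^ l * (x ^ n * D)         ≈⟨ *-congˡ
            (trans (sym (charPoly≈ G (trans (*-comm x u) ux≈1)))
            (trans (spectrum x) (rootProduct≈ λs (trans (*-comm x u) ux≈1)))) ⟩
        u ^ n * u ^ l * (x ^ l * S)         ≈⟨ solve 4 (λ a b c d → a :* b :* (c :* d) := b :* c :* (a :* d))
            refl (u ^ n) (u ^ l) (x ^ l) S ⟩
        u ^ l * x ^ l * (u ^ n * S)         ≈⟨ trans (*-congʳ (inverse-^ l ux≈1)) (*-identityˡ _) ⟩
        u ^ n * S                           ∎
        where
        n = order G
        l = length λs
        D = det (bass G u (λ _ → 0#))
        S = reversedRootProduct λs u

  ↭-length : ∀ {αs βs} → αs ↭ βs → length αs ≡ length βs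
  ↭-length = PermutationProperties.xs↭ys⇒|xs|≡|ys| setoid

  module _ {G₁ V₁ V₂ q₁ q₂} (sr₁ : IsSemiRegular G₁ V₁ V₂ q₁ q₂) (le₁ : ∣ V₁ ∣ ≤ ∣ V₂ ∣) where
    private
      ν₁ = order G₁
      m₁ = ∣ V₁ ∣ ℕ.* q₁

      order≥2 : ∀ {G V₁ V₂ q₁ q₂} → IsSemiRegular G V₁ V₂ q₁ q₂ → 2 ≤ order G
      order≥2 {G} sr = ≡.subst (2 ≤_) (SemiRegularGraph.order≡ sr)
        (ℕ.+-mono-≤ (proj₁ (SemiRegularGraph.both-sides sr)) (proj₂ (SemiRegularGraph.both-sides sr)))

      +≤* : ∀ {a b} → 2 ≤ a → 2 ≤ b → a ℕ.+ b ≤ a ℕ.* b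
      +≤* {suc (suc a)} {suc (suc b)} (s≤s (s≤s z≤n)) (s≤s (s≤s z≤n)) =
        ℕ.≤-trans (ℕ.≤-reflexive (ℕ.+-comm (2 ℕ.+ a) (2 ℕ.+ b))) (ℕ.+-monoʳ-≤ (2 ℕ.+ b)
          (ℕ.≤-trans (ℕ.≤-trans (ℕ.≤-reflexive (ℕ.+-comm 2 a))
              (ℕ.≤-trans (ℕ.+-monoˡ-≤ 2 (ℕ.m≤m*n a (2 ℕ.+ b))) (ℕ.≤-reflexive (ℕ.+-comm _ 2))))
            (ℕ.+-monoˡ-≤ (a ℕ.* (2 ℕ.+ b)) (ℕ.m≤m+n 2 b))))

    -- The exponent m − n in Bass's formula.
    excess : ∀ {H V₃ V₄ q₃ q₄} → IsSemiRegular H V₃ V₄ q₃ q₄ → ℕ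
    excess {H} {V₃} {q₃ = q₃} sr = (m₁ ℕ.+ ∣ V₃ ∣ ℕ.* q₃ ℕ.+ ν₁ ℕ.* order H) ℕ.∸ (ν₁ ℕ.+ order H)

    module _ {H V₃ V₄ q₃ q₄} (sr : IsSemiRegular H V₃ V₄ q₃ q₄) where
      private
        ν  = order H
        m  = ∣ V₃ ∣ ℕ.* q₃
        p₁ = ι (q₁ ℕ.+ ℕ.pred ν)
        p₂ = ι (q₂ ℕ.+ ℕ.pred ν)
        p₃ = ι (q₃ ℕ.+ ℕ.pred ν₁)
        p₄ = ι (q₄ ℕ.+ ℕ.pred ν₁)
        p  = glue G₁ H (onSides sr₁ p₁ p₂) (onSides sr p₃ p₄)

      -- The truncated difference is exact: both orders are at least 2, so their sum is at most
      -- their product.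
      excess≡ : ν₁ ℕ.+ ν ℕ.+ excess sr ≡ m₁ ℕ.+ m ℕ.+ ν₁ ℕ.* ν
      excess≡ = ℕ.m+[n∸m]≡n (ℕ.≤-trans (+≤* (order≥2 sr₁) (order≥2 sr)) (ℕ.m≤n+m _ (m₁ ℕ.+ m)))

      private
        degree-1 : ∀ {G V W a b} (s : IsSemiRegular G V W a b) {n} → 1 ≤ n → ∀ i →
                   valency G i + ι n - 1# ≈ onSides s (ι (a ℕ.+ ℕ.pred n)) (ι (b ℕ.+ ℕ.pred n)) i
        degree-1 {a = a} {b} s {n} 1≤n i = trans (+-congʳ (+-cong (valency-onSides s i) (ι-pred 1≤n)))
            (cases (SemiRegularGraph.side s i))
          where
          shift : ∀ q → ι q + (1# + ι (ℕ.pred n)) - 1# ≈ ι (q ℕ.+ ℕ.pred n)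
          shift q = trans (solve 2 (λ q n → q :+ (con (+ 1) :+ n) :- con (+ 1) := q :+ n) refl _ _) (sym (ι-+ q _))
          cases : ∀ t → (if t then ι a else ι b) + (1# + ι (ℕ.pred n)) - 1# ≈
              (if t then ι (a ℕ.+ ℕ.pred n) else ι (b ℕ.+ ℕ.pred n))
          cases true  = shift a
          cases false = shift b

      valency-1 : ∀ i → valency (G₁ ∨ H) i - 1# ≈ p i
      valency-1 = ↑-elim ν₁
        (λ i → trans (+-congʳ (valency-ˡ G₁ H i))
            (trans (degree-1 sr₁ (Graph.nonempty H) i)
            (sym (reflexive (glue-ˡ G₁ H (onSides sr₁ p₁ p₂) (onSides sr p₃ p₄) i)))))
        (λ j → trans (+-congʳ (trans (valency-ʳ G₁ H j) (+-comm _ _)))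
            (trans (degree-1 sr (Graph.nonempty G₁) j)
            (sym (reflexive (glue-ʳ G₁ H (onSides sr₁ p₁ p₂) (onSides sr p₃ p₄) j)))))

      bassFunction≈ : ∀ u → bassFunction (G₁ ∨ H) (excess sr) u ≈ (1# - u * u) ^ excess sr * joinDet sr₁ sr p₁ p₂ p₃ p₄ u
      bassFunction≈ u = *-congˡ (bass-cong (G₁ ∨ H) u valency-1)

      private
        sum-valency : ∀ {G V W a b} (s : IsSemiRegular G V W a b) → sum (valency G) ≈ (1# + 1#) * ι (∣ V ∣ ℕ.* a)
        sum-valency {G} {V} {W} {a} {b} s = begin
          sum (valency G)                        ≈⟨ sum-cong-≋ {order G} (valency-onSides s) ⟩
          sum (onSides s (ι a) (ι b))            ≈⟨ sum-onSides s (ι a) (ι b) ⟩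
          ι ∣ V ∣ * ι a + ι ∣ W ∣ * ι b          ≈⟨ +-cong (sym (ι-* ∣ V ∣ a))
              (trans (sym (ι-* ∣ W ∣ b)) (reflexive (≡.cong ι (≡.sym (edges≡ s))))) ⟩
          ι (∣ V ∣ ℕ.* a) + ι (∣ V ∣ ℕ.* a)      ≈⟨ solve 1 (λ a → a :+ a := (con (+ 1) :+ con (+ 1)) :* a) refl _ ⟩
          (1# + 1#) * ι (∣ V ∣ ℕ.* a)            ∎

      size : sum² (adjacency (G₁ ∨ H)) ≈ (1# + 1#) * (ι (order (G₁ ∨ H)) + ι (excess sr))
      size = begin
        sum (valency (G₁ ∨ H))
          ≈⟨ sum-split ν₁ (valency (G₁ ∨ H)) ⟩
        sum (λ i → valency (G₁ ∨ H) (i ↑ˡ ν)) + sum (λ j → valency (G₁ ∨ H) (ν₁ ↑ʳ j))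
          ≈⟨ +-cong (trans (sum-cong-≋ {ν₁} (valency-ˡ G₁ H)) (∑-distrib-+ (valency G₁) (λ _ → ι ν)))
                    (trans (sum-cong-≋ {ν} (valency-ʳ G₁ H)) (∑-distrib-+ (λ _ → ι ν₁) (valency H))) ⟩
        sum (valency G₁) + sum (λ (_ : Fin ν₁) → ι ν) + (sum (λ (_ : Fin ν) → ι ν₁) + sum (valency H))
          ≈⟨ +-cong (+-cong (sum-valency sr₁) (constant-sum ν₁ ν))
              (+-cong (trans (constant-sum ν ν₁) (*-comm _ _)) (sum-valency sr)) ⟩
        (1# + 1#) * ι m₁ + ι ν₁ * ι ν + (ι ν₁ * ι ν + (1# + 1#) * ι m)
          ≈⟨ solve 3 (λ a b c → (con (+ 1) :+ con (+ 1)) :* a :+ c :+ (c :+ (con (+ 1) :+ con (+ 1)) :* b) :=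
              (con (+ 1) :+ con (+ 1)) :* (a :+ b :+ c)) refl (ι m₁) (ι m) (ι ν₁ * ι ν) ⟩
        (1# + 1#) * (ι m₁ + ι m + ι ν₁ * ι ν)
          ≈⟨ *-congˡ (sym (trans (ι-+ (m₁ ℕ.+ m) (ν₁ ℕ.* ν)) (+-cong (ι-+ m₁ m) (ι-* ν₁ ν)))) ⟩
        (1# + 1#) * ι (m₁ ℕ.+ m ℕ.+ ν₁ ℕ.* ν)
          ≈⟨ *-congˡ (trans (reflexive (≡.cong ι (≡.sym excess≡))) (ι-+ (ν₁ ℕ.+ ν) (excess sr))) ⟩
        (1# + 1#) * (ι (ν₁ ℕ.+ ν) + ι (excess sr)) ∎
        where
        constant-sum : ∀ n k → sum (λ (_ : Fin n) → ι k) ≈ ι n * ι k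
        constant-sum n k = trans (sum-replicate n) (trans (sym (×-congʳ n (*-identityˡ _))) (sym (×-assoc-* n 1# (ι k))))
          where open import Algebra.Properties.Semiring.Mult semiring using (×-assoc-*; ×-congʳ)

      -- The reversal of `bassFunction` in degree 2(n + r), twice the number of edges of the join.
      reversed : Carrier → Carrier
      reversed v = (v * v - 1#) ^ excess sr * reversedBass (G₁ ∨ H) p v

      reversedᴾ : Polynomial reversed
      reversedᴾ = (idᴾ *ᴾ idᴾ +ᴾ (-ᴾ constᴾ)) ^ᴾ excess sr *ᴾ reversedBassᴾ (G₁ ∨ H) p

      -- The value is (-1)ʳ times the product of all weights. These are the degrees in the join
      -- minus 1, hence positive: `bassFunction` really attains its expected degree.
      reversed-0 : ¬ reversed 0# ≈ 0#
      reversed-0 = xy≉0 (^≉0 (excess sr) (λ e → 1≉0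
          (trans (solve 0 (con (+ 1) := :- (con (+ 0) :* con (+ 0) :- con (+ 1))) refl) (trans (-‿cong e) -0#≈0#))))
        (λ e → product≉0 p p≉0 (trans (sym (reversedBass-0 (G₁ ∨ H) p)) e))
        where
        open import Algebra.Properties.Ring ring using (-0#≈0#)
        product≉0 : ∀ {n} (f : Fin n → Carrier) → (∀ i → ¬ f i ≈ 0#) → ¬ product f ≈ 0#
        product≉0 {zero}  f f≉0 = 1≉0
        product≉0 {suc n} f f≉0 = xy≉0 (f≉0 zero) (product≉0 (f ∘ suc) (f≉0 ∘ suc))
        sides≉0 : ∀ {G V W a b} (s : IsSemiRegular G V W a b) k i → ¬ onSides s (ι (a ℕ.+ k)) (ι (b ℕ.+ k)) i ≈ 0#
        sides≉0 {a = a} {b} s k i e with SemiRegularGraph.side s i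
        ... | true  = ℕ.<-irrefl (≡.sym (characteristicZero _ e)) (ℕ.≤-trans (IsSemiRegular.q₁≥1 s) (ℕ.m≤m+n a k))
        ... | false = ℕ.<-irrefl (≡.sym (characteristicZero _ e)) (ℕ.≤-trans (IsSemiRegular.q₂≥1 s) (ℕ.m≤m+n b k))
        p≉0 : ∀ i → ¬ p i ≈ 0#
        p≉0 = ↑-elim ν₁
          (λ i e → sides≉0 sr₁ (ℕ.pred ν) i (trans
              (sym (reflexive (glue-ˡ G₁ H (onSides sr₁ p₁ p₂) (onSides sr p₃ p₄) i))) e))
          (λ j e → sides≉0 sr (ℕ.pred ν₁) j (trans
              (sym (reflexive (glue-ʳ G₁ H (onSides sr₁ p₁ p₂) (onSides sr p₃ p₄) j))) e))

      reversed≈ : ∀ {v u} → v * u ≈ 1# → reversed v ≈ (v * v) ^ (ν₁ ℕ.+ ν ℕ.+ excess sr) * bassFunction (G₁ ∨ H)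
          (excess sr) u
      reversed≈ {v} {u} vu≈1 = begin
        (v * v - 1#) ^ r * reversedBass (G₁ ∨ H) p v
          ≈⟨ *-cong (trans (^-congˡ r (sym v²-1)) (^-distrib-* (v * v) (1# - u * u) r)) (reversedBass≈ (G₁ ∨ H) p vu≈1) ⟩
        (v * v) ^ r * (1# - u * u) ^ r * ((v * v) ^ (ν₁ ℕ.+ ν) * det (bass (G₁ ∨ H) u p))
          ≈⟨ solve 4 (λ a b c d → a :* b :* (c :* d) := c :* a :* (b :* d)) refl ((v * v) ^ r)
              ((1# - u * u) ^ r) ((v * v) ^ (ν₁ ℕ.+ ν)) (det (bass (G₁ ∨ H) u p)) ⟩
        (v * v) ^ (ν₁ ℕ.+ ν) * (v * v) ^ r * ((1# - u * u) ^ r * det (bass (G₁ ∨ H) u p))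
          ≈⟨ *-cong (sym (^-homo-* (v * v) (ν₁ ℕ.+ ν) r)) (sym (bassFunction≈ u)) ⟩
        (v * v) ^ (ν₁ ℕ.+ ν ℕ.+ r) * bassFunction (G₁ ∨ H) r u ∎
        where
        r = excess sr
        v²-1 : v * v * (1# - u * u) ≈ v * v - 1#
        v²-1 = trans (solve 2 (λ v u → v :* v :* (con (+ 1) :- u :* u) := v :* v :- (v :* u) :* (v :* u)) refl v u)
          (+-congˡ (-‿cong (trans (*-cong vu≈1 vu≈1) (*-identityˡ 1#))))

      joinDet₀≈ : ∀ u → joinDet sr₁ sr 0# 0# 0# 0# u ≈ det (bass (G₁ ∨ H) u (λ _ → 0#))
      joinDet₀≈ u = bass-cong (G₁ ∨ H) u (↑-elim ν₁
        (λ i → trans (reflexive (glue-ˡ G₁ H (onSides sr₁ 0# 0#) (onSides sr 0# 0#) i)) (both (SemiRegularGraph.side sr₁ i)))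
        (λ j → trans (reflexive (glue-ʳ G₁ H (onSides sr₁ 0# 0#) (onSides sr 0# 0#) j)) (both (SemiRegularGraph.side sr j))))
        where
        both : ∀ b → (if b then 0# else 0#) ≈ 0#
        both true  = refl
        both false = refl

    module _ {H V₃ V₄ q₃ q₄} (sr : IsSemiRegular H V₃ V₄ q₃ q₄) (le : ∣ V₃ ∣ ≤ ∣ V₄ ∣)
             {H′ V₃′ V₄′ q₃′ q₄′} (sr′ : IsSemiRegular H′ V₃′ V₄′ q₃′ q₄′) (le′ : ∣ V₃′ ∣ ≤ ∣ V₄′ ∣)
             (spec spec′ : List Carrier)
             (S  : ∀ x → charPoly (adjacency (G₁ ∨ H))  x ≈ rootProduct spec  x)
             (S′ : ∀ x → charPoly (adjacency (G₁ ∨ H′)) x ≈ rootProduct spec′ x) where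
      private
        ν  = order H
        ν′ = order H′
        r  = excess sr
        r′ = excess sr′
        open Equivalence (zeta⇔bassFunction (G₁ ∨ H) (G₁ ∨ H′) r r′ (size sr) (size sr′)) renaming (to to zeta⇒bass; from to bass⇒zeta)

      -- `biadjacencyDet` is extracted with the weights degree - 1 and reinserted with all weights
      -- 0, which gives equal characteristic polynomials.
      zeta⇒spectrum : zeta (G₁ ∨ H) ≗ zeta (G₁ ∨ H′) → spec ↭ spec′
      zeta⇒spectrum Z≗Z′ = rootProduct-injective spec spec′ λ x → trans (sym (S x)) (trans (charPoly≈charPoly′ x) (S′ x))
        where
        f≈f′ : ∀ u → bassFunction (G₁ ∨ H) r u ≈ bassFunction (G₁ ∨ H′) r′ u
        f≈f′ = zeta⇒bass Z≗Z′
        a  = ν₁ ℕ.+ ν ℕ.+ r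
        a′ = ν₁ ℕ.+ ν′ ℕ.+ r′
        size≡ : a ≡ a′
        -- The reversals of one function in degrees 2a and 2a′ differ by the power of v needed to
        -- level the degrees. Both are nonzero at 0, so a = a′: the joins have equally many edges.
        size≡ = m+m≡n+n⇒m≡n (proj₁ (order-unique (reversedᴾ sr′) (reversedᴾ sr) (reversed-0 sr′) (reversed-0 sr)
            (a ℕ.+ a) (a′ ℕ.+ a′) compare))
          where
          square : ∀ v n → v ^ (n ℕ.+ n) ≈ (v * v) ^ n
          square v n = trans (^-homo-* v n n) (sym (^-distrib-* v v n))
          compare : ∀ v → ¬ v ≈ 0# → v ^ (a ℕ.+ a) * reversed sr′ v ≈ v ^ (a′ ℕ.+ a′) * reversed sr v
          compare v v≉0 with u , vu≈1 ← inverse v v≉0 = begin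
            v ^ (a ℕ.+ a) * reversed sr′ v
              ≈⟨ *-cong (square v a) (trans (reversed≈ sr′ vu≈1) (*-congˡ (sym (f≈f′ u)))) ⟩
            (v * v) ^ a * ((v * v) ^ a′ * bassFunction (G₁ ∨ H) r u)
              ≈⟨ solve 3 (λ x y z → x :* (y :* z) := y :* (x :* z)) refl ((v * v) ^ a) ((v * v) ^ a′)
                  (bassFunction (G₁ ∨ H) r u) ⟩
            (v * v) ^ a′ * ((v * v) ^ a * bassFunction (G₁ ∨ H) r u)
              ≈⟨ *-cong (square v a′) (reversed≈ sr vu≈1) ⟨
            v ^ (a′ ℕ.+ a′) * reversed sr v ∎
        module Z = Zeta sr₁ le₁ sr le sr′ le′ r r′ (excess≡ sr) (excess≡ sr′) size≡
          (λ u → trans (sym (bassFunction≈ sr u)) (trans (f≈f′ u) (bassFunction≈ sr′ u)))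
        charPoly≈charPoly′ : ∀ x → charPoly (adjacency (G₁ ∨ H)) x ≈ charPoly (adjacency (G₁ ∨ H′)) x
        charPoly≈charPoly′ = ≈-except (charPolyᴾ (G₁ ∨ H)) (charPolyᴾ (G₁ ∨ H′)) 0# off-zero
          where
          off-zero : ∀ x → ¬ x ≈ 0# → charPoly (adjacency (G₁ ∨ H)) x ≈ charPoly (adjacency (G₁ ∨ H′)) x
          off-zero x x≉0 with u , xu≈1 ← inverse x x≉0 = trans (charPoly≈ (G₁ ∨ H) xu≈1) (trans
            (*-cong (reflexive (≡.cong (λ n → x ^ (ν₁ ℕ.+ n)) Z.ν≡ν′))
              (trans (sym (joinDet₀≈ sr u)) (trans
                  (join-transfer sr₁ le₁ sr le sr′ le′ Z.same Z.biadjacency≈ 0# 0# 0# 0# u) (joinDet₀≈ sr′ u))))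
            (sym (charPoly≈ (G₁ ∨ H′) xu≈1)))

      -- The same passage in reverse: here the lengths of the spectra give the orders first, and the
      -- weights degree - 1 agree only once the parameters are known to coincide.
      spectrum⇒zeta : spec ↭ spec′ → zeta (G₁ ∨ H) ≗ zeta (G₁ ∨ H′)
      spectrum⇒zeta p = bass⇒zeta λ u → trans (bassFunction≈ sr u) (trans (step u) (sym (bassFunction≈ sr′ u)))
        where
        ν≡ν′ : ν ≡ ν′
        ν≡ν′ = ℕ.+-cancelˡ-≡ ν₁ _ _ (≡.trans (≡.sym (proj₁ (spectrum-bass (G₁ ∨ H) spec S)))
          (≡.trans (↭-length p) (proj₁ (spectrum-bass (G₁ ∨ H′) spec′ S′))))
        J≈J′ : ∀ u → joinDet sr₁ sr 0# 0# 0# 0# u ≈ joinDet sr₁ sr′ 0# 0# 0# 0# u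
        J≈J′ u = trans (joinDet₀≈ sr u) (trans (≈-except (bassᴾ (G₁ ∨ H) _) (bassᴾ (G₁ ∨ H′) _) 0# off-zero u)
            (sym (joinDet₀≈ sr′ u)))
          where
          off-zero : ∀ u → ¬ u ≈ 0# → det (bass (G₁ ∨ H) u (λ _ → 0#)) ≈ det (bass (G₁ ∨ H′) u (λ _ → 0#))
          off-zero u u≉0 with x , ux≈1 ← inverse u u≉0 = *-cancelˡ-nonzero (^≉0 (ν₁ ℕ.+ ν) (inverse-nonzero ux≈1)) (begin
            x ^ (ν₁ ℕ.+ ν) * det (bass (G₁ ∨ H) u (λ _ → 0#))     ≈⟨ charPoly≈ (G₁ ∨ H) (trans (*-comm x u) ux≈1) ⟨
            charPoly (adjacency (G₁ ∨ H)) x                       ≈⟨ trans (S x) (trans (rootProduct-↭ p x) (sym (S′ x))) ⟩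
            charPoly (adjacency (G₁ ∨ H′)) x                      ≈⟨ charPoly≈ (G₁ ∨ H′) (trans (*-comm x u) ux≈1) ⟩
            x ^ (ν₁ ℕ.+ ν′) * det (bass (G₁ ∨ H′) u (λ _ → 0#))   ≈⟨ *-congʳ
                (reflexive (≡.cong (λ n → x ^ (ν₁ ℕ.+ n)) ν≡ν′)) ⟨
            x ^ (ν₁ ℕ.+ ν) * det (bass (G₁ ∨ H′) u (λ _ → 0#))    ∎)
        module Sp = Spectral sr₁ le₁ sr le sr′ le′ ν≡ν′ J≈J′
        open Same Sp.same
        J : ∀ {H V₃ V₄ q₃ q₄} → IsSemiRegular H V₃ V₄ q₃ q₄ → ℕ → ℕ → ℕ → Carrier → Carrier
        J sr n q q′ = joinDet sr₁ sr (ι (q₁ ℕ.+ ℕ.pred n)) (ι (q₂ ℕ.+ ℕ.pred n)) (ι (q ℕ.+ ℕ.pred ν₁)) (ι (q′ ℕ.+ ℕ.pred ν₁))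
        r≡r′ : r ≡ r′
        r≡r′ = ≡.cong₂ (λ m n → (m₁ ℕ.+ m ℕ.+ ν₁ ℕ.* n) ℕ.∸ (ν₁ ℕ.+ n)) Sp.m≡ ν≡ν′
        step : ∀ u → (1# - u * u) ^ r * J sr ν q₃ q₄ u ≈ (1# - u * u) ^ r′ * J sr′ ν′ q₃′ q₄′ u
        step u = *-cong (reflexive (≡.cong ((1# - u * u) ^_) r≡r′))
          (trans (join-transfer sr₁ le₁ sr le sr′ le′ Sp.same Sp.biadjacency≈ _ _ _ _ u)
            (reflexive (≡.trans (≡.cong (λ n → J sr′ n q₃ q₄ u) ν≡ν′) (≡.cong₂ (λ q q′ → J sr′ ν′ q q′ u) q₁≡ q₂≡))))

      zeta⇔spectrum : (zeta (G₁ ∨ H) ≗ zeta (G₁ ∨ H′)) ⇔ (spec ↭ spec′)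
      zeta⇔spectrum = mk⇔ zeta⇒spectrum spectrum⇒zeta

theorem5p1 : ∀ {c ℓ₁ ℓ₂} (K : HeytingField c ℓ₁ ℓ₂) (let open Spectra K) →
    Decidable (HeytingField._#_ K) → CharacteristicZero →
    (G₁ G₂ G₂′ : Graph)
    (V₁ V₂ : Subset (order G₁)) (V₃ V₄ : Subset (order G₂)) (V₃′ V₄′ : Subset (order G₂′))
    (q₁ q₂ q₃ q₄ q₃′ q₄′ : ℕ) →
    IsSemiRegular G₁ V₁ V₂ q₁ q₂ → ∣ V₁ ∣ ≤ ∣ V₂ ∣ →
    IsSemiRegular G₂ V₃ V₄ q₃ q₄ → ∣ V₃ ∣ ≤ ∣ V₄ ∣ →
    IsSemiRegular G₂′ V₃′ V₄′ q₃′ q₄′ → ∣ V₃′ ∣ ≤ ∣ V₄′ ∣ →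
    (spec spec′ : List (HeytingField.Carrier K)) →
    IsSpectrum (G₁ ∨ G₂) spec → IsSpectrum (G₁ ∨ G₂′) spec′ →
    (zeta (G₁ ∨ G₂) ≗ zeta (G₁ ∨ G₂′)) ⇔ (spec ↭ spec′)
theorem5p1 K #? char0 G₁ G₂ G₂′ V₁ V₂ V₃ V₄ V₃′ V₄′ q₁ q₂ q₃ q₄ q₃′ q₄′ sr₁ le₁ sr₂ le₂ sr₂′ le₂′ spec spec′ S S′ =
  ZetaSpectrum.zeta⇔spectrum R isField sr₁ le₁ sr₂ le₂ sr₂′ le₂′ spec spec′ S S′
  where
  open HeytingField K
  R : CommutativeRing _ _
  R = Apartness.HeytingCommutativeRing.commutativeRing heytingCommutativeRing
  isField : IsFieldOfCharacteristicZero R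
  isField = record
    { inverse            = λ x x≉0 → inverse x (#? x 0#) x≉0
    ; 0#?                = λ x → zero? x (#? x 0#)
    ; characteristicZero = char0
    }
    where
    open import Algebra.Apartness.Properties.HeytingCommutativeRing heytingCommutativeRing using (x-0≈x)
    inverse : ∀ x → Dec (x # 0#) → ¬ x ≈ 0# → ∃[ y ] x * y ≈ 1#
    inverse x (yes x#0) x≉0 with y , _ , xy≈1 ← #⇒invertible x#0 = y , trans (*-congʳ (sym (x-0≈x x))) xy≈1
    inverse x (no ¬x#0) x≉0 = ⊥-elim (x≉0 (proj₁ (tight x 0#) ¬x#0))
    zero? : ∀ x → Dec (x # 0#) → Dec (x ≈ 0#)
    zero? x (yes x#0) = no λ x≈0 → proj₂ (tight x 0#) x≈0 x#0
    zero? x (no ¬x#0) = yes (proj₁ (tight x 0#) ¬x#0)
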